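{- Assume either $PFA^+$ or $MM$, and let $\delta$ be an inaccessible cardinal. Then there is a tower of ideals of height $\delta$ with critical point $\omega_2$ which is not presaturated; in fact, this tower fails to have the weak Chang property.
   Context: The base theory is ZFC. Forcing axioms. For a class $\Gamma$ of posets and an ordinal $\beta$, $FA^{+\beta}(\Gamma)$ says: for every $\mathbb P\in\Gamma$, every collection $\mathcal D$ of $\omega_1$ many dense subsets of $\mathbb P$, and every sequence $\langle\dot S_\xi:\xi<\beta\rangle$ of $\mathbb P$-names forced to be stationary subsets of $\omega_1$, there is a filter $F\subset\mathbb P$ meeting every $D\in\mathcal D$ such that for every $\xi<\beta$ the set $\{\alpha<\omega_1:\exists q\in F\ q\Vdash\check\alpha\in\dot S_\xi\}$ is stationary. $PFA^+$ is $FA^{+1}$(proper posets); $MM$ is $FA^{+0}$(posets preserving stationary subsets of $\omega_1$). Ideals. For a set $Z$, an ideal $I\subset\wp(Z)$ is always proper, countably complete, fine (for every $b\in\bigcup Z$, $\{M\in Z: b\notin M\}\in I$) and normal (if $S\notin I$ and $g$ is a function on $S$ with $g(M)\in M$ for all $M\in S$, then $g$ is constant on some $S'\subseteq S$ with $S'\notin I$). $I^+=\wp(Z)\setminus I$. The completeness of $I$ is the cardinal $\mu$ such that $I$ is closed under unions of fewer than $\mu$ of its members but not under unions of $\mu$ of its members. If $I\subset\wp(Z)$, $I'\subset\wp(Z')$ and $\bigcup Z\subseteq\bigcup Z'$, then $I$ is the canonical projection of $I'$ to $Z$ iff $I=\{A\subseteq Z:\{M'\in Z': M'\cap\bigcup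 Z\in A\}\in I'\}$. Towers. A tower of ideals of height $\delta$ is a sequence $\vec I=\langle I_\lambda\rangle$, indexed by the regular cardinals $\lambda$ with $\omega_2\le\lambda<\delta$, where $I_\lambda$ is an ideal on $Z_\lambda=\wp_{\omega_2}(H_\lambda)$ and, for $\lambda\le\lambda'$, $I_\lambda$ is the canonical projection of $I_{\lambda'}$ to $Z_\lambda$. If all $I_\lambda$ have the same completeness, it is called the critical point of $\vec I$. $\mathbb P_{\vec I}$ is the poset of pairs $(\lambda,S)$ with $S\in I_\lambda^+$, ordered by $(\lambda',S')\le(\lambda,S)$ iff $\lambda'\ge\lambda$ and $S'\subseteq\{M'\in Z_{\lambda'}: M'\cap H_\lambda\in S\}$. $\vec I$ is presaturated iff $\delta$ remains a regular cardinal in every generic extension of $V$ by $\mathbb P_{\vec I}$. Generic ultrapower. Let $G$ be $(V,\mathbb P_{\vec I})$-generic and $proj(G,\lambda)=\{S:(\lambda,S)\in G\}$. A (partial) function $f\in V$ from $V_\delta$ to $V$ has bounded support if for some $\lambda<\delta$, $f(x)$ depends only on $x\cap H_\lambda$. $ult(V,G)$ is the set of classes $[f]_G$ of functions $f\in V$ with bounded support, where $[f]_G=[g]_G$ (resp. $[f]_G\in[g]_G$) iff $\{M\in Z_\lambda: f(M)=g(M)\}$ (resp. $f(M)\in g(M)$) is in $proj(G,\lambda)$ for all sufficiently large $\lambda<\delta$. The wellfounded part of $ult(V,G)$ is identified with its transitive collapse. A tower of inaccessible height $\delta$ has the weak Chang property iff whenever $G$ is $(V,\mathbb P_{\vec I})$-generic,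 $\delta$ is an element of the wellfounded part of $ult(V,G)$ and $\delta$ is regular in $ult(V,G)$. -}

module Defs where

open import Level using (Level; _⊔_) renaming (suc to lsuc)
open import Data.Nat using (ℕ; zero; suc)
open import Data.Fin using (Fin)
open import Data.Vec using (Vec; []; _∷_; lookup)
open import Data.Product using (Σ; ∃; _×_; _,_)
open import Data.Sum using (_⊎_)
open import Data.Empty.Polymorphic using (⊥)
open import Relation.Nullary using (¬_)
open import Relation.Binary.PropositionalEquality using (_≡_)

-- An interpretation of the language of set theory with values in an arbitrary
-- type Ω of propositions.  The same set-theoretic notions are read in three
-- places: in V (Ω = Set ℓ), in the generic extensions of V (Ω = V → Set ℓ, a
-- proposition being the set of conditions forcing it), and in the generic
-- ultrapower, whose truth values are again those of the forcing language.
record Interpretation (d o : Level) : Set (lsuc (d ⊔ o)) where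
  infix  8 _∊_ _≐_
  infixr 6 _∧_
  infixr 5 _∨_
  infixr 4 _⇒_
  field
    D   : Set d
    Ω   : Set o
    _∊_ : D → D → Ω
    _≐_ : D → D → Ω
    ⟂   : Ω
    _∧_ : Ω → Ω → Ω
    _∨_ : Ω → Ω → Ω
    _⇒_ : Ω → Ω → Ω
    ∀̇   : (D → Ω) → Ω
    ∃̇   : (D → Ω) → Ω

module Vocabulary {d o : Level} (I : Interpretation d o) where
  open Interpretation I public

  infix  8 _⊑_ _∋⟨_,_⟩
  infixr 3 _⇔_

  ¬̇_ : Ω → Ω
  ¬̇ a = a ⇒ ⟂

  _⇔_ : Ω → Ω → Ω
  a ⇔ b = (a ⇒ b) ∧ (b ⇒ a)

  ∀∊ ∃∊ : D → (D → Ω) → Ω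
  ∀∊ A φ = ∀̇ λ x → x ∊ A ⇒ φ x
  ∃∊ A φ = ∃̇ λ x → x ∊ A ∧ φ x

  ∃! : (D → Ω) → Ω
  ∃! φ = ∃̇ λ x → φ x ∧ ∀̇ λ y → φ y ⇒ y ≐ x

  _⊑_ : D → D → Ω
  x ⊑ y = ∀∊ x λ z → z ∊ y

  IsEmpty : D → Ω
  IsEmpty x = ∀̇ λ z → ¬̇ (z ∊ x)

  IsUnorderedPair : D → D → D → Ω
  IsUnorderedPair z x y = ∀̇ λ w → w ∊ z ⇔ (w ≐ x ∨ w ≐ y)

  -- z = ⟨ x , y ⟩ = {{x},{x,y}}
  IsPair : D → D → D → Ω
  IsPair z x y = ∃̇ λ a → ∃̇ λ b →
    IsUnorderedPair a x x ∧ IsUnorderedPair b x y ∧ IsUnorderedPair z a b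

  _∋⟨_,_⟩ : D → D → D → Ω
  f ∋⟨ x , y ⟩ = ∃∊ f λ z → IsPair z x y

  IsUnion : D → D → Ω
  IsUnion U A = ∀̇ λ x → x ∊ U ⇔ (∃∊ A λ y → x ∊ y)

  IsPowerSet : D → D → Ω
  IsPowerSet P x = ∀̇ λ z → z ∊ P ⇔ z ⊑ x

  IsIntersection : D → D → D → Ω
  IsIntersection z x y = ∀̇ λ w → w ∊ z ⇔ (w ∊ x ∧ w ∊ y)

  -- s = x ∪ {x}
  IsSuccessor : D → D → Ω
  IsSuccessor s x = ∀̇ λ w → w ∊ s ⇔ (w ∊ x ∨ w ≐ x)

  IsPartialFunction : D → D → Ω
  IsPartialFunction f A =
    (∀∊ f λ z → ∃∊ A λ x → ∃̇ λ y → IsPair z x y) ∧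
    (∀̇ λ x → ∀̇ λ y → ∀̇ λ y' → f ∋⟨ x , y ⟩ ⇒ f ∋⟨ x , y' ⟩ ⇒ y ≐ y')

  IsFunctionOn : D → D → Ω
  IsFunctionOn f A = IsPartialFunction f A ∧ (∀∊ A λ x → ∃̇ λ y → f ∋⟨ x , y ⟩)

  IsFunction : D → D → D → Ω
  IsFunction f A B =
    IsFunctionOn f A ∧ (∀̇ λ x → ∀̇ λ y → f ∋⟨ x , y ⟩ ⇒ y ∊ B)

  IsInjective : D → Ω
  IsInjective f =
    ∀̇ λ x → ∀̇ λ x' → ∀̇ λ y → f ∋⟨ x , y ⟩ ⇒ f ∋⟨ x' , y ⟩ ⇒ x ≐ x'

  IsUnionOfRange : D → D → Ω
  IsUnionOfRange U f =
    ∀̇ λ x → x ∊ U ⇔ (∃̇ λ i → ∃̇ λ y → f ∋⟨ i , y ⟩ ∧ x ∊ y)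

  Transitive : D → Ω
  Transitive x = ∀∊ x λ y → y ⊑ x

  Ordinal : D → Ω
  Ordinal α = Transitive α ∧ ∀∊ α Transitive

  -- 0 is not a limit.
  LimitOrdinal : D → Ω
  LimitOrdinal α =
    Ordinal α ∧ (∃̇ λ β → β ∊ α) ∧ (∀∊ α λ β → ∃∊ α λ γ → β ∊ γ)

  Isω : D → Ω
  Isω w = LimitOrdinal w ∧ (∀∊ w λ n → ¬̇ LimitOrdinal n)

  -- |x| < κ, for a cardinal κ
  SizeBelow : D → D → Ω
  SizeBelow x κ = ∃∊ κ λ α → ∃̇ λ f → IsFunction f x α ∧ IsInjective f

  Cardinal : D → Ω
  Cardinal κ = Ordinal κ ∧ ¬̇ SizeBelow κ κ

  IsSuccessorCardinal : D → D → Ω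
  IsSuccessorCardinal μ κ =
    Cardinal μ ∧ κ ∊ μ ∧ (∀∊ μ λ ν → Cardinal ν ⇒ ν ⊑ κ)

  Isω₁ : D → Ω
  Isω₁ μ = ∃̇ λ κ → Isω κ ∧ IsSuccessorCardinal μ κ

  Isω₂ : D → Ω
  Isω₂ μ = ∃̇ λ κ → Isω₁ κ ∧ IsSuccessorCardinal μ κ

  Regular : D → Ω
  Regular κ =
    Cardinal κ ∧ LimitOrdinal κ ∧
    (∀∊ κ λ α → ∀̇ λ f → IsFunction f α κ ⇒
      ∃∊ κ λ β → ∀̇ λ x → ∀̇ λ y → f ∋⟨ x , y ⟩ ⇒ y ∊ β)

  Inaccessible : D → Ω
  Inaccessible δ =
    Regular δ ∧ ∃∊ δ Isω ∧
    (∀∊ δ λ α → ∀̇ λ P → IsPowerSet P α ⇒ SizeBelow P δ)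

  Club : D → D → Ω
  Club C κ =
    C ⊑ κ ∧
    (∀∊ κ λ α → ∃∊ C λ β → α ∊ β) ∧
    (∀∊ κ λ α → LimitOrdinal α ⇒
      (∀∊ α λ β → ∃∊ C λ γ → β ∊ γ ∧ γ ∊ α) ⇒ α ∊ C)

  Stationary : D → D → Ω
  Stationary S κ =
    S ⊑ κ ∧ (∀̇ λ C → Club C κ ⇒ ∃∊ S λ α → α ∊ C)

  Countable : D → Ω
  Countable x = ∃̇ λ w → Isω w ∧ ∃̇ λ f → IsFunction f x w ∧ IsInjective f

  Club-[_]^ω : D → D → Ω
  Club-[ X ]^ω C =
    (∀∊ C λ x → x ⊑ X ∧ Countable x) ∧
    (∀̇ λ x → x ⊑ X ⇒ Countable x ⇒ ∃∊ C λ y → x ⊑ y) ∧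
    (∀̇ λ w → ∀̇ λ s → Isω w ⇒ IsFunction s w C ⇒
      (∀̇ λ m → ∀̇ λ n → ∀̇ λ x → ∀̇ λ y →
        m ∊ n ⇒ s ∋⟨ m , x ⟩ ⇒ s ∋⟨ n , y ⟩ ⇒ x ⊑ y) ⇒
      ∀̇ λ U → IsUnionOfRange U s ⇒ U ∊ C)

  Stationary-[_]^ω : D → D → Ω
  Stationary-[ X ]^ω S =
    (∀∊ S λ x → x ⊑ X ∧ Countable x) ∧
    (∀̇ λ C → Club-[ X ]^ω C ⇒ ∃∊ S λ x → x ∊ C)

data Formula : ℕ → Set where
  mem eq       : ∀ {n} → Fin n → Fin n → Formula n
  false        : ∀ {n} → Formula n
  and or imp   : ∀ {n} → Formula n → Formula n → Formula n
  all ex       : ∀ {n} → Formula (suc n) → Formula n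

-- Tarskian semantics; equality is interpreted as identity.
tarski : ∀ {ℓ} (V : Set ℓ) → (V → V → Set ℓ) → Interpretation ℓ (lsuc ℓ)
tarski {ℓ} V _∈_ = record
  { D = V ; Ω = Set ℓ ; _∊_ = _∈_ ; _≐_ = _≡_ ; ⟂ = ⊥
  ; _∧_ = _×_ ; _∨_ = _⊎_ ; _⇒_ = λ A B → A → B
  ; ∀̇ = λ φ → ∀ x → φ x ; ∃̇ = λ φ → ∃ φ }

module _ {d o : Level} (I : Interpretation d o) where
  open Interpretation I

  ⟦_⟧ : ∀ {n} → Formula n → Vec D n → Ω
  ⟦ mem i j ⟧ ρ = lookup ρ i ∊ lookup ρ j
  ⟦ eq i j ⟧  ρ = lookup ρ i ≐ lookup ρ j
  ⟦ false ⟧   ρ = ⟂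
  ⟦ and φ ψ ⟧ ρ = ⟦ φ ⟧ ρ ∧ ⟦ ψ ⟧ ρ
  ⟦ or φ ψ ⟧  ρ = ⟦ φ ⟧ ρ ∨ ⟦ ψ ⟧ ρ
  ⟦ imp φ ψ ⟧ ρ = ⟦ φ ⟧ ρ ⇒ ⟦ ψ ⟧ ρ
  ⟦ all φ ⟧   ρ = ∀̇ λ x → ⟦ φ ⟧ (x ∷ ρ)
  ⟦ ex φ ⟧    ρ = ∃̇ λ x → ⟦ φ ⟧ (x ∷ ρ)

-- Models of first-order ZFC: the two schemes range over formulas (with
-- parameters), not over arbitrary Agda predicates.
record ZFCModel (ℓ : Level) : Set (lsuc ℓ) where
  field
    V   : Set ℓ
    _∈_ : V → V → Set ℓ

  interpretation : Interpretation ℓ (lsuc ℓ)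
  interpretation = tarski V _∈_

  open Vocabulary interpretation

  field
    extensionality : ∀ x y → (∀ z → z ∊ x ⇔ z ∊ y) → x ≡ y
    foundation     : ∀ x → (∃ λ y → y ∊ x) →
                     ∃∊ x λ y → ∀∊ x λ z → ¬̇ (z ∊ y)
    pairing        : ∀ x y → ∃ λ z → IsUnorderedPair z x y
    union          : ∀ A → ∃ λ U → IsUnion U A
    powerSet       : ∀ x → ∃ λ P → IsPowerSet P x
    infinity       : ∃ λ w → ∃∊ w IsEmpty ×
                     (∀∊ w λ x → ∃∊ w λ s → IsSuccessor s x)
    separation     : ∀ {n} (φ : Formula (suc n)) (ρ : Vec V n) A →
                     ∃ λ B → ∀ x → x ∊ B ⇔ (x ∊ A × ⟦ interpretation ⟧ φ (x ∷ ρ))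
    replacement    : ∀ {n} (φ : Formula (suc (suc n))) (ρ : Vec V n) A →
                     (∀∊ A λ x → ∃! λ y → ⟦ interpretation ⟧ φ (x ∷ y ∷ ρ)) →
                     ∃ λ B → ∀ y → y ∊ B ⇔
                       (∃∊ A λ x → ⟦ interpretation ⟧ φ (x ∷ y ∷ ρ))
    choice         : ∀ A → (∀∊ A λ x → ∃ λ y → y ∊ x) →
                     (∀ x x' z → x ∊ A → x' ∊ A → z ∊ x → z ∊ x' → x ≡ x') →
                     ∃ λ C → ∀∊ A λ x → ∃! λ y → y ∊ x × y ∊ C

module SetTheory {ℓ : Level} (M : ZFCModel ℓ) where
  open ZFCModel M using (V; interpretation)
  open Vocabulary interpretation public

  -- Posets are sets of V: a carrier P and a set Le of pairs ⟨ q , p ⟩, q ≤ p.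
  IsPoset : V → V → Set ℓ
  IsPoset P Le =
    (∃ λ p → p ∊ P) ×
    (∀∊ Le λ z → ∃∊ P λ q → ∃∊ P λ p → IsPair z q p) ×
    (∀∊ P λ p → Le ∋⟨ p , p ⟩) ×
    (∀ p q → Le ∋⟨ p , q ⟩ → Le ∋⟨ q , p ⟩ → p ≡ q) ×
    (∀ p q r → Le ∋⟨ p , q ⟩ → Le ∋⟨ q , r ⟩ → Le ∋⟨ p , r ⟩)

  module Forcing (P Le : V) where
    infix 8 _≼_

    _≼_ : V → V → Set ℓ
    q ≼ p = Le ∋⟨ q , p ⟩

    IsDense : V → Set ℓ
    IsDense A = A ⊑ P × (∀∊ P λ p → ∃∊ A λ q → q ≼ p)

    IsFilter : V → Set ℓ
    IsFilter F =
      F ⊑ P × (∃ λ p → p ∊ F) ×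
      (∀ p q → p ∊ F → p ≼ q → q ∊ F) ×
      (∀ p q → p ∊ F → q ∊ F → ∃∊ F λ r → r ≼ p × r ≼ q)

    -- A P-name is a set of pairs ⟨ σ , p ⟩ with σ a P-name and p ∈ P.
    ClosedSetOfNames : V → Set ℓ
    ClosedSetOfNames T =
      ∀∊ T λ τ → ∀∊ τ λ z → ∃∊ T λ σ → ∃∊ P λ p → IsPair z σ p

    IsName : V → Set ℓ
    IsName τ = ∃ λ T → ClosedSetOfNames T × τ ∊ T

    -- The relations p ⊩ σ = τ and p ⊩ σ ∈ τ are defined by simultaneous
    -- recursion on names:
    --   p ⊩ σ = τ  iff  for all π ∈ dom σ ∪ dom τ and q ≤ p,
    --                   q ⊩ π ∈ σ iff q ⊩ π ∈ τ;
    --   p ⊩ π ∈ τ  iff  densely many r ≤ p have r ⊩ π = ρ for some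
    --                   ⟨ ρ , s ⟩ ∈ τ with r ≤ s.
    -- Inside V the recursion is carried by a set E of triples
    -- ⟨ p , ⟨ σ , τ ⟩⟩ listing the forced equalities among the names in T.
    EqTriple : V → V → V → V → Set ℓ
    EqTriple E p σ τ = ∃ λ z → IsPair z σ τ × E ∋⟨ p , z ⟩

    module _ (eqForced : V → V → V → Set ℓ) where
      MemForced : V → V → V → Set ℓ
      MemForced p π τ =
        ∀ q → q ≼ p → ∃ λ r → r ≼ q ×
          ∃ λ ρ → ∃ λ s → τ ∋⟨ ρ , s ⟩ × r ≼ s × eqForced r π ρ

    IsEqTable : V → V → Set ℓ
    IsEqTable E T =
      ∀ p σ τ → p ∊ P → σ ∊ T → τ ∊ T →
        EqTriple E p σ τ ⇔
        (∀ π q → ((∃ λ s → σ ∋⟨ π , s ⟩) ⊎ (∃ λ s → τ ∋⟨ π , s ⟩)) → q ≼ p →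
          MemForced (EqTriple E) q π σ ⇔ MemForced (EqTriple E) q π τ)

    _⊩_≐_ : V → V → V → Set ℓ
    p ⊩ σ ≐ τ = ∃ λ T → ∃ λ E →
      ClosedSetOfNames T × σ ∊ T × τ ∊ T × IsEqTable E T × EqTriple E p σ τ

    -- The forcing relation for the language of the generic extension, whose
    -- variables range over P-names.
    extension : Interpretation ℓ (lsuc ℓ)
    extension = record
      { D   = V
      ; Ω   = V → Set ℓ
      ; _∊_ = λ σ τ p → MemForced _⊩_≐_ p σ τ
      ; _≐_ = λ σ τ p → p ⊩ σ ≐ τ
      ; ⟂   = λ p → ⊥
      ; _∧_ = λ φ ψ p → φ p × ψ p
      ; _∨_ = λ φ ψ p → ∀ q → q ≼ p → ∃ λ r → r ≼ q × (φ r ⊎ ψ r)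
      ; _⇒_ = λ φ ψ p → ∀ q → q ≼ p → φ q → ψ q
      ; ∀̇   = λ φ p → ∀ τ → IsName τ → φ τ p
      ; ∃̇   = λ φ p → ∀ q → q ≼ p → ∃ λ r → r ≼ q × ∃ λ τ → IsName τ × φ τ r
      }

    module Ext = Vocabulary extension

    Forced : Set (lsuc ℓ)
    Forced = V → Set ℓ

    -- φ holds in every generic extension of V by P.
    ⊩_ : Forced → Set ℓ
    ⊩ φ = ∀∊ P φ

    -- Quantification over (elements of) the ground model, and assertions
    -- about the ground model, inside the forcing language.
    ∀ᵛ ∃ᵛ : (V → Forced) → Forced
    ∀ᵛ φ p = ∀ x → φ x p
    ∃ᵛ φ p = ∀ q → q ≼ p → ∃ λ r → r ≼ q × ∃ λ x → φ x r

    ⌜_⌝ : Set ℓ → Forced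
    ⌜ A ⌝ p = A

    -- τ = x̌ = { ⟨ y̌ , p ⟩ : y ∈ x , p ∈ P }; no greatest condition is assumed.
    -- c is the function y ↦ y̌ on a transitive set containing x.
    IsCheckName : V → V → Set ℓ
    IsCheckName τ x = ∃ λ t → ∃ λ c →
      Transitive t × x ∊ t × IsFunctionOn c t ×
      (∀ y σ → c ∋⟨ y , σ ⟩ → ∀ z →
        z ∊ σ ⇔ (∃∊ y λ u → ∃ λ υ → ∃∊ P λ p → c ∋⟨ u , υ ⟩ × IsPair z υ p)) ×
      c ∋⟨ x , τ ⟩

    -- φ (x̌)
    check : V → (V → Forced) → Forced
    check x φ p = ∃ λ τ → IsCheckName τ x × φ τ p

    -- The canonical name { ⟨ p̌ , p ⟩ : p ∈ P } of the generic filter.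
    IsGenericName : V → Set ℓ
    IsGenericName Γ =
      ∀ z → z ∊ Γ ⇔ (∃∊ P λ p → ∃ λ τ → IsCheckName τ p × IsPair z τ p)

    _∊G : V → Forced
    (x ∊G) p = ∃ λ Γ → IsGenericName Γ × check x (λ τ → τ Ext.∊ Γ) p

  PreservesStationarySubsetsOfω₁ : V → V → Set ℓ
  PreservesStationarySubsetsOfω₁ P Le =
    ∀ ω₁ S → Isω₁ ω₁ → Stationary S ω₁ →
    ⊩ check S λ Š → check ω₁ λ ω̌₁ → Ext.Stationary Š ω̌₁
    where open Forcing P Le

  Proper : V → V → Set ℓ
  Proper P Le =
    ∀ μ S → Cardinal μ → ∃∊ μ Isω → Stationary-[ μ ]^ω S →
    ⊩ check S λ Š → check μ λ μ̌ → Ext.Stationary-[ μ̌ ]^ω Š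
    where open Forcing P Le

  -- FA^{+β}(𝒞); the ω₁ many dense sets and the β many names are given by
  -- functions 𝒟 and Ṡ in V with domains ω₁ and β.
  FA⁺ : V → (V → V → Set ℓ) → Set ℓ
  FA⁺ β 𝒞 =
    ∀ P Le ω₁ → IsPoset P Le → 𝒞 P Le → Isω₁ ω₁ →
    let open Forcing P Le in
    ∀ 𝒟 Ṡ →
    IsFunctionOn 𝒟 ω₁ → (∀ α A → 𝒟 ∋⟨ α , A ⟩ → IsDense A) →
    IsFunctionOn Ṡ β →
    (∀ ξ τ → Ṡ ∋⟨ ξ , τ ⟩ →
      IsName τ × ⊩ check ω₁ λ ω̌₁ → Ext.Stationary τ ω̌₁) →
    ∃ λ F → IsFilter F ×
      (∀ α A → 𝒟 ∋⟨ α , A ⟩ → ∃∊ F λ p → p ∊ A) ×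
      (∀ ξ τ → Ṡ ∋⟨ ξ , τ ⟩ →
        ∃ λ T →
          (∀ α → α ∊ T ⇔
            (α ∊ ω₁ × ∃∊ F λ q → check α (λ α̌ → α̌ Ext.∊ τ) q)) ×
          Stationary T ω₁)

  PFA⁺ : Set ℓ
  PFA⁺ = ∀ zero one → IsEmpty zero → IsSuccessor one zero → FA⁺ one Proper

  MM : Set ℓ
  MM = ∀ zero → IsEmpty zero → FA⁺ zero PreservesStationarySubsetsOfω₁

  record IsIdeal (J Z : V) : Set ℓ where
    field
      onZ              : ∀∊ J λ A → A ⊑ Z
      empty            : ∃∊ J IsEmpty
      downwardClosed   : ∀ A B → B ∊ J → A ⊑ B → A ∊ J
      proper           : ¬ (Z ∊ J)
      countablyComplete :
        ∀ w f U → Isω w → IsFunction f w J → IsUnionOfRange U f → U ∊ J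
      fine             :
        ∀ b → (∃∊ Z λ N → b ∊ N) →
        ∃∊ J λ A → ∀ N → N ∊ A ⇔ (N ∊ Z × ¬̇ (b ∊ N))
      normal           :
        ∀ S g → S ⊑ Z → ¬ (S ∊ J) → IsFunctionOn g S →
        (∀ N b → g ∋⟨ N , b ⟩ → b ∊ N) →
        ∃ λ S' → ∃ λ b → S' ⊑ S × ¬ (S' ∊ J) × (∀∊ S' λ N → g ∋⟨ N , b ⟩)

  IsCompleteness : V → V → Set ℓ
  IsCompleteness μ J =
    Cardinal μ ×
    (∀∊ μ λ α → ∀ f U → IsFunction f α J → IsUnionOfRange U f → U ∊ J) ×
    (∃ λ f → ∃ λ U → IsFunction f μ J × IsUnionOfRange U f × ¬ (U ∊ J))

  -- J on Z is the canonical projection of J' on Z'.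
  IsProjection : V → V → V → V → Set ℓ
  IsProjection J Z J' Z' =
    ∀ U → IsUnion U Z → ∀ A →
      A ∊ J ⇔
      (A ⊑ Z × ∃∊ J' λ B → ∀ N' →
        N' ∊ B ⇔ (N' ∊ Z' × ∃∊ A λ N → IsIntersection N N' U))

  -- H = H_λ, the sets whose transitive closure has size less than λ.
  IsH : V → V → Set ℓ
  IsH H lam =
    ∀ x → x ∊ H ⇔ (∃ λ t → Transitive t × x ⊑ t × SizeBelow t lam)

  -- Z = Z_λ, the set of N ⊆ H_λ with |N| < ω₂.
  IsZ : V → V → Set ℓ
  IsZ Z lam = ∃ λ H → ∃ λ ω₂ → IsH H lam × Isω₂ ω₂ ×
    (∀ N → N ∊ Z ⇔ (N ⊑ H × SizeBelow N ω₂))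

  -- W = V_δ; h is the sequence of the V_α, α < δ.
  IsVAt : V → V → Set ℓ
  IsVAt W δ = ∃ λ h →
    IsFunctionOn h δ ×
    (∀ α Y → h ∋⟨ α , Y ⟩ → ∀ x →
      x ∊ Y ⇔ (∃∊ α λ β → ∃ λ X → h ∋⟨ β , X ⟩ × x ⊑ X)) ×
    (∀ x → x ∊ W ⇔ (∃∊ δ λ β → ∃ λ X → h ∋⟨ β , X ⟩ × x ⊑ X))

  IsIndex : V → V → Set ℓ
  IsIndex δ lam = Regular lam × lam ∊ δ × (∃ λ ω₂ → Isω₂ ω₂ × ω₂ ⊑ lam)

  record IsTower (δ 𝓘 : V) : Set ℓ where
    field
      indexedByRegulars : ∃ λ R → (∀ lam → lam ∊ R ⇔ IsIndex δ lam) × IsFunctionOn 𝓘 R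
      ideals            : ∀ lam J Z → 𝓘 ∋⟨ lam , J ⟩ → IsZ Z lam → IsIdeal J Z
      projections       :
        ∀ lam lam' J J' Z Z' → 𝓘 ∋⟨ lam , J ⟩ → 𝓘 ∋⟨ lam' , J' ⟩ → lam ⊑ lam' →
        IsZ Z lam → IsZ Z' lam' → IsProjection J Z J' Z'

  HasCriticalPoint : V → V → Set ℓ
  HasCriticalPoint 𝓘 κ = ∀ lam J → 𝓘 ∋⟨ lam , J ⟩ → IsCompleteness κ J

  -- c = ⟨ λ , S ⟩ is a condition of the tower forcing.
  IsTowerCondition : V → V → V → V → Set ℓ
  IsTowerCondition 𝓘 c lam S =
    IsPair c lam S × (∃ λ J → ∃ λ Z →
      𝓘 ∋⟨ lam , J ⟩ × IsZ Z lam × S ⊑ Z × ¬ (S ∊ J))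

  record IsTowerPoset (𝓘 P Le : V) : Set ℓ where
    field
      carrier : ∀ c → c ∊ P ⇔ (∃ λ lam → ∃ λ S → IsTowerCondition 𝓘 c lam S)
      order   : ∀ z → z ∊ Le ⇔
        (∃ λ c' → ∃ λ c → ∃ λ lam' → ∃ λ S' → ∃ λ lam → ∃ λ S → ∃ λ H →
          IsPair z c' c ×
          IsTowerCondition 𝓘 c' lam' S' × IsTowerCondition 𝓘 c lam S ×
          lam ⊑ lam' × IsH H lam ×
          (∀∊ S' λ N' → ∃∊ S λ N → IsIntersection N N' H))

  Presaturated : V → V → Set ℓ
  Presaturated δ 𝓘 =
    ∀ P Le → IsTowerPoset 𝓘 P Le →
    let open Forcing P Le in ⊩ check δ λ δ̌ → Ext.Regular δ̌

  -- The generic ultrapower by the generic filter G ⊆ P, where (P , Le) is the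
  -- poset of a tower of height δ.  Its elements are represented by
  -- functions f ∈ V.
  module GenericUltrapower (δ P Le : V) where
    open Forcing P Le

    HasBoundedSupport : V → Set ℓ
    HasBoundedSupport f = ∃ λ W → IsVAt W δ × IsPartialFunction f W ×
      (∃ λ lam → ∃ λ H → IsIndex δ lam × IsH H lam ×
        (∀ x y → x ∊ W → y ∊ W → (∀∊ H λ u → u ∊ x ⇔ u ∊ y) →
          ∀ v → f ∋⟨ x , v ⟩ ⇔ f ∋⟨ y , v ⟩))

    -- { N ∈ Z_λ : Q N } ∈ proj(G , λ) for all sufficiently large λ < δ
    AlmostAll : (V → Set ℓ) → Forced
    AlmostAll Q = ∃ᵛ λ lam₀ → ⌜ lam₀ ∊ δ ⌝ Ext.∧
      (∀ᵛ λ lam → ⌜ IsIndex δ lam × lam₀ ⊑ lam ⌝ Ext.⇒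
        (∃ᵛ λ Z → ∃ᵛ λ S → ∃ᵛ λ c →
          ⌜ IsZ Z lam × (∀ N → N ∊ S ⇔ (N ∊ Z × Q N)) × IsPair c lam S ⌝ Ext.∧
          (c ∊G)))

    _≐ᵤ_ _∊ᵤ_ : V → V → Forced
    f ≐ᵤ g = AlmostAll λ N → ∃ λ v → f ∋⟨ N , v ⟩ × g ∋⟨ N , v ⟩
    f ∊ᵤ g = AlmostAll λ N → ∃ λ v → ∃ λ w → f ∋⟨ N , v ⟩ × g ∋⟨ N , w ⟩ × v ∊ w

    -- Since f may be partial, f ≐ᵤ f says that f is defined almost everywhere.
    InUlt : V → Forced
    InUlt f = ⌜ HasBoundedSupport f ⌝ Ext.∧ (f ≐ᵤ f)

    ultrapower : Interpretation ℓ (lsuc ℓ)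
    ultrapower = record
      { D   = V
      ; Ω   = Forced
      ; _∊_ = _∊ᵤ_
      ; _≐_ = _≐ᵤ_
      ; ⟂   = Ext.⟂
      ; _∧_ = Ext._∧_
      ; _∨_ = Ext._∨_
      ; _⇒_ = Ext._⇒_
      ; ∀̇   = λ φ → ∀ᵛ λ f → InUlt f Ext.⇒ φ f
      ; ∃̇   = λ φ → ∃ᵛ λ f → InUlt f Ext.∧ φ f
      }

    module Ult = Vocabulary ultrapower

    -- In V[G]: whenever c is defined at g, it is defined (on some
    -- representative of) every element of [g], and
    -- c(g) = { c(k) : [k] ∈ [g] }.  By ∈-induction on c(g), [g] is then in the
    -- wellfounded part and c(g) is its image under the transitive collapse.
    IsPartialCollapse : V → Forced
    IsPartialCollapse c =
      Ult.∀̇ λ g → check g λ ǧ → Ext.∀̇ λ x → c Ext.∋⟨ ǧ , x ⟩ Ext.⇒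
        ((Ult.∀̇ λ k → (k ∊ᵤ g) Ext.⇒
          (Ult.∃̇ λ k' → (k' ≐ᵤ k) Ext.∧
            (check k' λ ǩ' → Ext.∃̇ λ y → c Ext.∋⟨ ǩ' , y ⟩)))
        Ext.∧
        (Ext.∀̇ λ y → (y Ext.∊ x) Ext.⇔
          (Ult.∃̇ λ k → (k ∊ᵤ g) Ext.∧ (check k λ ǩ → c Ext.∋⟨ ǩ , y ⟩))))

    -- [f] is in the wellfounded part and its transitive collapse is α.
    CollapsesTo : V → V → Forced
    CollapsesTo f α =
      check f λ f̌ → check α λ α̌ →
      Ext.∃̇ λ c → IsPartialCollapse c Ext.∧ c Ext.∋⟨ f̌ , α̌ ⟩

  WeakChang : V → V → Set ℓ
  WeakChang δ 𝓘 =
    ∀ P Le → IsTowerPoset 𝓘 P Le →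
    let open Forcing P Le
        open GenericUltrapower δ P Le
    in ⊩ Ult.∃̇ λ f → CollapsesTo f δ Ext.∧ Ult.Regular f

{-# OPTIONS --safe #-}
-- Let W = V_δ.  There are U ∈ W and f : 𝒫(U) → ω₂ such that, for stationarily many N ⊆ W
-- of size ω₁, the order type of N ∩ δ is less than f(N ∩ U): N can be taken to be the set of
-- values of a set X of terms whose evaluation is coded by a subset x of U, and a König-type
-- argument makes the choice of X injective in x, so that f(X) can be read off x.  The tower
-- consists of the projections of the nonstationary ideal restricted to these N.
--
-- For α < δ the function g_α(N) = otp(N ∩ α) is almost everywhere less than
-- F(N) = f(N ∩ U) < ω₂.  Injections of the ordinals below ω₂ into ω₁ and normality thus give
-- an injection of δ into ω₁ in the generic extension, so the tower is not presaturated.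
--
-- Normality also shows that the elements of [g_α] are the [g_ζ] with ζ < α, so that [g_α] has
-- no image but α under the transitive collapse.  Suppose that [κ] collapses to δ.  It does not
-- have [F] as an element, since the image of [F] would be some γ < δ while [g_γ] ∈ [F].
-- Hence κ(N) ≤ F(N) < ω₂ almost everywhere.  If κ(N) ≤ ω₁, then ω₁ is the image of an element
-- of [g_ω₁]; otherwise [κ] has an injection into its element [g_ω₁] in the ultrapower.  In
-- either case [κ] is not a regular cardinal collapsing to δ.
module Submission where

open import Defs
open import Level using (lift; lower) renaming (suc to lsuc; zero to lzero)
open import Axiom.ExcludedMiddle using (ExcludedMiddle)
open import Data.Nat using (ℕ; zero; suc; _∸_)
open import Data.Fin using (Fin; zero; suc)
open import Data.Vec using (Vec; []; _∷_)
open import Data.Product using (∃; _×_; _,_; proj₁; proj₂)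
open import Data.Sum using (_⊎_; inj₁; inj₂; [_,_]′)
open import Data.Empty.Polymorphic using (⊥)
open import Relation.Nullary using (¬_; yes; no)
open import Relation.Binary.PropositionalEquality using (_≡_; refl; sym; trans; cong; subst)

-- The obstacle: f sees only N ∩ U for a fixed U of size below δ, while N has to be closed under an
-- arbitrary function on V_δ. Terms separate the two. They are elements of U, their values lie in
-- V_δ, and only two relations between terms matter for the order type of N ∩ δ: which term has
-- which value in U, and which terms have increasing ordinals below δ as values. Together these
-- relations are one subset x of U, so there are only as many cases as subsets of U. U is made of ω₁
-- levels, and every subset of a level is an element of U. A subset of U is therefore determined by
-- ω₁ elements of U, its traces on the levels. This is why sets X of size ω₁ are numerous enough to
-- represent all the codes x injectively. The forcing relation is given only by its recursive
-- definition inside the model. Names, pairs and the instances of Łoś's theorem are therefore worked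
-- out by hand, and statements about the generic filter are reduced to statements about families of
-- sets N modulo nonstationary families.

levelToIndex : (n k : ℕ) → Fin (suc n)
levelToIndex zero    _       = zero
levelToIndex (suc n) zero    = zero
levelToIndex (suc n) (suc k) = suc (levelToIndex n k)

-- In a context of n + 1 variables the variable of level i has index n - i. Well-scoped formulas
-- only use levels i ≤ n, so they reach neither the truncation nor the clause for the empty context.
atom : (∀ {n} → Fin n → Fin n → Formula n) → ℕ → ℕ → (n : ℕ) → Formula n
atom R i j zero    = false
atom R i j (suc n) = R (levelToIndex n (n ∸ i)) (levelToIndex n (n ∸ j))

-- The term model of the vocabulary: an element is a variable, given by its de
-- Bruijn level, and a proposition is a formula in a context of n variables.
-- Evaluated here, a notion of the vocabulary becomes a formula whose Tarskian
-- semantics is, by conversion, the notion itself; this is how instances of the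
-- schemes of separation and replacement are obtained.
syn : Interpretation lzero lzero
syn = record
  { D = ℕ ; Ω = (n : ℕ) → Formula n ; _∊_ = atom mem ; _≐_ = atom eq
  ; ⟂ = λ n → false
  ; _∧_ = λ φ ψ n → and (φ n) (ψ n)
  ; _∨_ = λ φ ψ n → or (φ n) (ψ n)
  ; _⇒_ = λ φ ψ n → imp (φ n) (ψ n)
  ; ∀̇ = λ φ n → all (φ n (suc n))
  ; ∃̇ = λ φ n → ex (φ n (suc n)) }

SynFormula : Set
SynFormula = (n : ℕ) → Formula n

-- Auxiliary notions over an arbitrary interpretation, read both in the model and as formulas.

module Notions₁ {d o} (I : Interpretation d o) where
  open Vocabulary I

  PairIn : D → (D → D → Ω) → Ω
  PairIn z R = ∃̇ λ x → ∃̇ λ y → IsPair z x y ∧ R x y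

  ProductElement : D → D → D → Ω
  ProductElement A B z = ∃∊ A λ x → ∃∊ B λ y → IsPair z x y

  Section : D → D → D → Ω
  Section A r F = ∃∊ A λ x → ∀̇ λ z → z ∊ F ⇔ (z ∊ r ∧ ∃̇ λ y → IsPair z x y)

module S  = Vocabulary syn
module S₁ = Notions₁ syn

module Notions₂ {d o} (I : Interpretation d o) where
  open Vocabulary I

  Comparable : D → D → Ω
  Comparable x y = x ∊ y ∨ x ≐ y ∨ y ∊ x

  module Recursion (F : D → D → D → Ω) (t E : D) where
    Values : D → D → D → Ω
    Values a y R = ∀̇ λ w → w ∊ R ⇔ (∃̇ λ u → E ∋⟨ u , y ⟩ ∧ a ∋⟨ u , w ⟩)

    -- The approximations of transfinite recursion. Their domains are closed under E-predecessors,
    -- so the recursion clause can be checked inside the approximation itself.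
    Attempt : D → Ω
    Attempt a =
      (∀∊ a λ z → ∃∊ t λ y → ∃̇ λ v → IsPair z y v) ∧
      (∀̇ λ y → ∀̇ λ v → ∀̇ λ v' → a ∋⟨ y , v ⟩ ⇒ a ∋⟨ y , v' ⟩ ⇒ v ≐ v') ∧
      (∀̇ λ y → ∀̇ λ v → a ∋⟨ y , v ⟩ ⇒
        (∀̇ λ u → E ∋⟨ u , y ⟩ ⇒ ∃̇ λ w → a ∋⟨ u , w ⟩) ∧
        (∃̇ λ R → Values a y R ∧ F y R v))

    Value : D → D → Ω
    Value u v = ∃̇ λ a → Attempt a ∧ a ∋⟨ u , v ⟩

module S₂ = Notions₂ syn

module Notions₃ {d o} (I : Interpretation d o) where
  open Vocabulary I
  open Notions₁ I
  open Notions₂ I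

  Inj : D → D → Ω
  Inj A B = ∃̇ λ f → IsFunction f A B ∧ IsInjective f

  collapseStep : D → D → D → Ω
  collapseStep y R v = v ≐ R

  hierarchyStep : D → D → D → D → Ω
  hierarchyStep B y R v = ∀̇ λ z → z ∊ v ⇔ (z ∊ B ∨ (∃∊ R λ s → z ⊑ s))

  IsMax : D → D → D → Ω
  IsMax m a b = ∀̇ λ x → x ∊ m ⇔ (x ∊ a ∨ x ∊ b)

  MaxLex : D → D → D → D → Ω
  MaxLex a b a' b' = ∃̇ λ m → ∃̇ λ m' → IsMax m a b ∧ IsMax m' a' b' ∧
    (m ∊ m' ∨ (m ≐ m' ∧ (a ∊ a' ∨ (a ≐ a' ∧ b ∊ b'))))

  Gödel : D → D → Ω
  Gödel z z' = PairIn z λ a b → PairIn z' λ a' b' → MaxLex a b a' b'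

  -- An injection f of ω into x ∪ {y} is turned into one into x: n is sent to f(n + 1), and f(0)
  -- takes the place of y.
  DropPoint : D → D → D → D → D → Ω
  DropPoint f y o n z = ∃̇ λ m → IsSuccessor m n ∧ ∃̇ λ z' → f ∋⟨ m , z' ⟩ ∧
    ((¬̇ (z' ≐ y) ∧ z ≐ z') ∨ (z' ≐ y ∧ f ∋⟨ o , z ⟩))

  -- Hilbert's hotel: the new point m goes to 0, the elements of ω move up by one, and the rest of m
  -- stays.
  Hotel : D → D → D → D → Ω
  Hotel w m x y = (x ≐ m ∧ IsEmpty y) ∨ (x ∊ w ∧ IsSuccessor y x) ∨ (x ∊ m ∧ ¬̇ (x ∊ w) ∧ y ≐ x)

  -- Quantifying over all sets Q of elements with P avoids naming the set of these elements, for
  -- which the formulas have no term.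
  NotInfinite : D → (D → Ω) → Ω
  NotInfinite w P = ∀̇ λ Q → (∀̇ λ z → z ∊ Q ⇒ P z) ⇒ ¬̇ (Inj w Q)

  -- The product `κ ⊗ κ` is an operation of the model and not a term of the formulas; an arbitrary
  -- set Q of pairs stands for it, so that induction on κ is possible.
  Squares : D → D → Ω
  Squares w κ = w ⊑ κ ⇒ ∀̇ λ Q → (∀̇ λ z → z ∊ Q ⇒ ProductElement κ κ z) ⇒ Inj Q κ

module S₃ = Notions₃ syn

module Notions₄ {d o} (I : Interpretation d o) where
  open Vocabulary I
  open Notions₃ I

  MaxOf : D → D → Ω
  MaxOf B μ = ∃∊ B λ z → ∃̇ λ a → ∃̇ λ b → IsPair z a b ∧ IsMax μ a b

  FirstWith : D → D → D → Ω
  FirstWith B μ a = ∃∊ B λ z → ∃̇ λ b → IsPair z a b ∧ IsMax μ a b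

  SecondWith : D → D → D → D → Ω
  SecondWith B μ a b = ∃∊ B λ z → IsPair z a b ∧ IsMax μ a b

  Diagonal : D → D → Ω
  Diagonal f x = ∃̇ λ y → f ∋⟨ y , x ⟩ ∧ ¬̇ (x ∊ y)

  InitialInjection : D → D → D → Ω
  InitialInjection β y e = ∃̇ λ s → IsSuccessor s y ∧ IsFunction e s β ∧ IsInjective e

  Spread : D → D → D → D → Ω
  Spread f i ξ z = ∃̇ λ x → ∃̇ λ y → ∃̇ λ e → ∃̇ λ v → f ∋⟨ x , y ⟩ ∧ i ∋⟨ y , e ⟩ ∧ e ∋⟨ ξ , v ⟩ ∧ IsPair z x v

  -- A function g on a set becomes a function on an ordinal along the injection i. Indices outside
  -- the range of i get the default value 0.
  TransferTo : D → D → D → D → Ω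
  TransferTo i g ξ y = (∃̇ λ a → i ∋⟨ a , ξ ⟩ ∧ g ∋⟨ a , y ⟩) ∨ ((¬̇ (∃̇ λ a → i ∋⟨ a , ξ ⟩)) ∧ IsEmpty y)

module S₄ = Notions₄ syn

module Notions₅ {d o} (I : Interpretation d o) where
  open Vocabulary I
  open Notions₁ I
  open Notions₃ I

  ImageOf : D → D → D → Ω
  ImageOf f x y = ∀̇ λ b → b ∊ y ⇔ (∃∊ x λ a → f ∋⟨ a , b ⟩)

  LevelContains : D → D → D → Ω
  LevelContains h u β = ∃̇ λ X → h ∋⟨ β , X ⟩ ∧ u ⊑ X

  LevelPowerBelow : D → D → D → Ω
  LevelPowerBelow h β ε = ∃̇ λ X → ∃̇ λ P → h ∋⟨ β , X ⟩ ∧ IsPowerSet P X ∧ Inj P ε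

  LevelInjection : D → D → D → D → Ω
  LevelInjection h Y β e = ∃̇ λ X → h ∋⟨ β , X ⟩ ∧ (∀∊ Y λ x → x ⊑ X ⇒ ∃̇ λ v → e ∋⟨ x , v ⟩) ∧ IsInjective e

  -- An element x of level α is coded by some β < α with x included in level β, together with its
  -- number there. Elements of the base carry the tag α, which differs from every such β.
  LevelCode : D → D → D → D → D → Ω
  LevelCode e α i x z = (∃̇ λ v → e ∋⟨ x , v ⟩ ∧ IsPair z α v) ∨
    (∃∊ α λ β → ∃̇ λ e' → ∃̇ λ v → i ∋⟨ β , e' ⟩ ∧ e' ∋⟨ x , v ⟩ ∧ IsPair z β v)

  SmallLevel : D → D → D → Ω
  SmallLevel h δ α = ∀̇ λ X → h ∋⟨ α , X ⟩ ⇒ SizeBelow X δ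

  ContainsOrdinal : D → D → Ω
  ContainsOrdinal h α = ∀̇ λ X → h ∋⟨ α , X ⟩ ⇒ α ⊑ X

  InSomeLevel : D → D → D → Ω
  InSomeLevel h δ x = ∃∊ δ λ β → ∃̇ λ X → h ∋⟨ β , X ⟩ ∧ x ⊑ X

  HereditarilyBelow : D → D → Ω
  HereditarilyBelow lam x = ∃̇ λ t → Transitive t ∧ x ⊑ t ∧ SizeBelow t lam

module S₅ = Notions₅ syn

module Notions₆ {d o} (I : Interpretation d o) where
  open Vocabulary I
  open Notions₁ I

  PairClosed : D → Ω
  PairClosed N = ∀∊ N λ x → ∀∊ N λ y → ∀̇ λ z → IsPair z x y ⇒ z ∊ N

  ClosedUnder : D → D → Ω
  ClosedUnder G N = ∀∊ N λ x → ∀̇ λ y → G ∋⟨ x , y ⟩ ⇒ y ∊ N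

  module Terms (Π e G c₀ c₁ c₂ : D) where
    Code : D → D → D → Ω
    Code i a b = ∃̇ λ z → IsPair z a b ∧ Π ∋⟨ z , i ⟩

    -- A term is a code of a pair whose first component, one of the tags `c₀`, `c₁`, `c₂`, tells by
    -- which rule it is formed.
    Rule : D → D → D → Ω
    Rule K x i =
      (∃̇ λ j → e ∋⟨ x , j ⟩ ∧ Code i c₀ j) ∨
      (∃̇ λ x₁ → ∃̇ λ x₂ → ∃̇ λ i₁ → ∃̇ λ i₂ → ∃̇ λ k →
        K ∋⟨ x₁ , i₁ ⟩ ∧ K ∋⟨ x₂ , i₂ ⟩ ∧ IsPair x x₁ x₂ ∧ Code k i₁ i₂ ∧ Code i c₁ k) ∨
      (∃̇ λ x₁ → ∃̇ λ i₁ → K ∋⟨ x₁ , i₁ ⟩ ∧ G ∋⟨ x₁ , x ⟩ ∧ Code i c₂ i₁)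

    RuleClosed : D → D → D → Ω
    RuleClosed W B K = ∀∊ W λ x → ∀∊ B λ i → Rule K x i ⇒ K ∋⟨ x , i ⟩

    -- Membership in the intersection of all rule-closed relations, that is, in the inductively
    -- defined one.
    Derivable : D → D → D → D → Ω
    Derivable W B 𝒦 z = ∀∊ 𝒦 λ K → RuleClosed W B K ⇒ z ∊ K

    UniqueValue : D → D → D → Ω
    UniqueValue K x i = ∀̇ λ x' → K ∋⟨ x' , i ⟩ ⇒ x' ≐ x

module S₆ = Notions₆ syn

module Notions₇ {d o} (I : Interpretation d o) where
  open Vocabulary I
  open Notions₁ I
  open Notions₃ I
  open Notions₆ I

  Traces : D → D → D → D → Ω
  Traces ω₁ k z X = ∀∊ ω₁ λ i → ∀̇ λ Y → k ∋⟨ i , Y ⟩ ⇒ ∀̇ λ t → IsIntersection t z Y ⇒ t ∊ X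

  InjectionInto : D → D → D → Ω
  InjectionInto B A f = IsFunction f A B ∧ IsInjective f

  -- g is the section at w of the union of those t ∈ X whose number under the injection `ê`(X) is in
  -- the range of w. The same w serves as selector and as place of the section, which is what the
  -- diagonal argument exploits. On U, the set g is determined by X and w.
  SectionCode : D → D → D → D → D → Ω
  SectionCode U ê X w g = ∀∊ U λ u → u ∊ g ⇔ (∃̇ λ e → ∃̇ λ t → ∃̇ λ i → ∃̇ λ j →
    ê ∋⟨ X , e ⟩ ∧ e ∋⟨ t , j ⟩ ∧ w ∋⟨ i , j ⟩ ∧ t ∋⟨ w , u ⟩)

  AvoidsSections : D → D → D → D → D → Ω
  AvoidsSections U ê R w g = ∀∊ R λ X → ¬̇ SectionCode U ê X w g

  Glue : D → D → D → Ω
  Glue γ w u = ∃̇ λ g → γ ∋⟨ w , g ⟩ ∧ u ∊ g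

  TraceCode : D → D → D → D → D → D → Ω
  TraceCode k z ê X i j = ∃̇ λ Y → ∃̇ λ t → ∃̇ λ e → k ∋⟨ i , Y ⟩ ∧ IsIntersection t z Y ∧ ê ∋⟨ X , e ⟩ ∧ e ∋⟨ t , j ⟩

  -- One set x carries two relations, told apart by the tag c. With tag ∅ it holds between a term
  -- and its value in U, with tag `one` between two terms whose values are increasing ordinals below
  -- δ.
  CodeRel : D → D → D → D → Ω
  CodeRel c x t u = ∃̇ λ z → ∃̇ λ z' → IsPair z t u ∧ IsPair z' c z ∧ z' ∊ x

  FunctionalCode : D → D → Ω
  FunctionalCode c x = ∀̇ λ t → ∀̇ λ u → ∀̇ λ u' → CodeRel c x t u ⇒ CodeRel c x t u' ⇒ u ≐ u'

  Good : D → D → D → D → D → Ω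
  Good U ω₁ c x X = X ⊑ U ∧ ω₁ ⊑ X ∧ Inj X ω₁ ∧ PairClosed X ∧ (∀∊ X λ t → ∀̇ λ u → CodeRel c x t u ⇒ u ∊ X)

  Before : D → D → D → Ω
  Before s x y = ∃̇ λ a → ∃̇ λ b → s ∋⟨ x , a ⟩ ∧ s ∋⟨ y , b ⟩ ∧ a ∊ b

  GoodOutside : D → D → D → D → D → D → D → Ω
  GoodOutside PU U ω₁ c x R X = X ∊ PU ∧ Good U ω₁ c x X ∧ ¬̇ (X ∊ R)

  selectionStep : D → D → D → D → D → D → D → D → Ω
  selectionStep PU U ω₁ c ch x R v = ∃̇ λ D' → (∀̇ λ X → X ∊ D' ⇔ GoodOutside PU U ω₁ c x R X) ∧ ch ∋⟨ D' , v ⟩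

  ChoiceFrom : D → D → Ω
  ChoiceFrom A X = (∃̇ λ Y → Y ∊ A) ⇒ X ∊ A

  IndexBelow : D → D → D → D → D → D → Ω
  IndexBelow E x c s X a = ∃̇ λ x' → E ∋⟨ x' , x ⟩ ∧ c ∋⟨ x' , X ⟩ ∧ s ∋⟨ x' , a ⟩

module S₇ = Notions₇ syn

module Notions₈ {d o} (I : Interpretation d o) where
  open Vocabulary I
  open Notions₁ I
  open Notions₃ I
  open Notions₆ I
  open Notions₇ I

  -- The coded relation on X is ranked by ordinals below γ. No set N occurs here, which is why a
  -- bound can be read off x and X alone.
  GoodBound : D → D → D → D → Ω
  GoodBound c x X γ = ∃̇ λ e → (∀̇ λ t → ∀̇ λ v → e ∋⟨ t , v ⟩ ⇒ v ∊ γ) ∧ (∀∊ X λ t → ∃̇ λ v → e ∋⟨ t , v ⟩) ∧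
    (∀∊ X λ t → ∀∊ X λ t' → CodeRel c x t t' ⇒ ∀̇ λ v → ∀̇ λ v' → e ∋⟨ t , v ⟩ ⇒ e ∋⟨ t' , v' ⟩ ⇒ v ∊ v')

  BoundOfCode : D → D → D → D → Ω
  BoundOfCode sel c X γ = ∃̇ λ x → sel ∋⟨ x , X ⟩ ∧ GoodBound c x X γ

  HasBound : D → D → D → D → Ω
  HasBound sel c θ X = ∃∊ θ λ γ → BoundOfCode sel c X γ

  -- The collapse has a value at every α < δ and not only at elements of N, because the functions
  -- g_α need the order type of N ∩ α also when α is outside N.
  CollapseOf : D → D → D → Ω
  CollapseOf δ N c =
    (∀̇ λ α → ∀̇ λ v → ∀̇ λ v' → c ∋⟨ α , v ⟩ ⇒ c ∋⟨ α , v' ⟩ ⇒ v ≐ v') ∧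
    (∀∊ δ λ α → ∃̇ λ v → c ∋⟨ α , v ⟩) ∧
    (∀̇ λ α → ∀̇ λ v → c ∋⟨ α , v ⟩ ⇒ α ∊ δ ∧
      ∀̇ λ w → w ∊ v ⇔ (∃̇ λ β → β ∊ N ∧ β ∊ α ∧ c ∋⟨ β , w ⟩))

  -- v is the order type of N ∩ α.
  Otp : D → D → D → D → Ω
  Otp δ N α v = ∃̇ λ c → CollapseOf δ N c ∧ c ∋⟨ α , v ⟩

  OtpAgree : D → D → D → D → Ω
  OtpAgree δ N N' α = (∀∊ α λ β → β ∊ N ⇔ β ∊ N') ⇒
    ∀̇ λ v → ∀̇ λ v' → Otp δ N α v ⇒ Otp δ N' α v' ⇒ v ≐ v'

  OtpOrdinal OtpIdentity : D → D → D → Ω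
  OtpOrdinal δ N α = ∀̇ λ v → Otp δ N α v ⇒ Ordinal v
  OtpIdentity δ N α = α ⊑ N ⇒ ∀̇ λ v → Otp δ N α v ⇒ v ≐ α

  -- The sets on which the ideals concentrate. From ω₁ ⊆ N, diagonal unions over ω₁ are plain
  -- unions; closure under pairs lets one unary function simulate many.
  Admissible : D → D → D → D → D → D → Ω
  Admissible δ ω₁ W U f N = N ⊑ W ∧ Inj N ω₁ ∧ ω₁ ⊑ N ∧ PairClosed N ∧
    (∃̇ λ X → ∃̇ λ γ → IsIntersection X N U ∧ f ∋⟨ X , γ ⟩ ∧
      (∀∊ N λ α → α ∊ δ ⇒ ∀̇ λ v → Otp δ N α v ⇒ v ∊ γ))

  CodeOf : D → D → D → D → D → D → Ω
  CodeOf U δ o c K z = ∃̇ λ q →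
    (IsPair z o q ∧ ∃̇ λ t → ∃̇ λ u → IsPair q t u ∧ K ∋⟨ u , t ⟩ ∧ u ∊ U) ∨
    (IsPair z c q ∧ ∃̇ λ t → ∃̇ λ t' → IsPair q t t' ∧ ∃̇ λ α → ∃̇ λ β → K ∋⟨ α , t ⟩ ∧ K ∋⟨ β , t' ⟩ ∧ α ∊ β ∧ β ∊ δ)

  RankOfTerm : D → D → D → D → D → Ω
  RankOfTerm K δ c t v = (∃̇ λ α → K ∋⟨ α , t ⟩ ∧ α ∊ δ ∧ c ∋⟨ α , v ⟩) ∨
    ((¬̇ (∃̇ λ α → K ∋⟨ α , t ⟩ ∧ α ∊ δ)) ∧ IsEmpty v)

  RankBelow : D → D → D → D → D → Ω
  RankBelow K X c e α = ∀∊ X λ t → K ∋⟨ α , t ⟩ ⇒ ∀̇ λ v → c ∋⟨ α , v ⟩ ⇒ ∀̇ λ v' → e ∋⟨ t , v' ⟩ ⇒ v ⊑ v'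

module S₈ = Notions₈ syn

module Notions₁₀ {d o} (I : Interpretation d o) where
  open Vocabulary I
  open Notions₃ I
  open Notions₆ I
  open Notions₈ I

  Trace : D → D → D → Ω
  Trace A H N = ∃∊ A λ M → IsIntersection M N H

  module Ideal (δ ω₁ W U f : D) where
    -- G witnesses that the family Y is nonstationary relative to the admissible sets: the sets
    -- closed under G form the club that avoids it.
    Kills : (D → Ω) → D → Ω
    Kills Y G = (∀∊ G λ z → ∃∊ W λ x → ∃∊ W λ y → IsPair z x y) ∧
      (∀̇ λ x → ∀̇ λ y → ∀̇ λ y' → G ∋⟨ x , y ⟩ ⇒ G ∋⟨ x , y' ⟩ ⇒ y ≐ y') ∧
      (∀̇ λ N → Admissible δ ω₁ W U f N ⇒ ClosedUnder G N ⇒ ¬̇ Y N)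

    Null : (D → Ω) → Ω
    Null Y = ∃̇ (Kills Y)

    IdealAt : D → D → Ω
    IdealAt lam J = ∃̇ λ H → ∃̇ λ Z → (∀̇ λ x → x ∊ H ⇔ (∃̇ λ t → Transitive t ∧ x ⊑ t ∧ SizeBelow t lam)) ∧
      (∃̇ λ ω₂ → Isω₂ ω₂ ∧ (∀̇ λ N → N ∊ Z ⇔ (N ⊑ H ∧ SizeBelow N ω₂))) ∧
      (∀̇ λ A → A ∊ J ⇔ (A ⊑ Z ∧ Null (Trace A H)))

  Index : D → D → Ω
  Index δ lam = Regular lam ∧ lam ∊ δ ∧ (∃̇ λ ω₂ → Isω₂ ω₂ ∧ ω₂ ⊑ lam)

  Tagged : D → D → D → D → D → Ω
  Tagged o c G G' z = ∃̇ λ q → ∃̇ λ y → IsPair z q y ∧ ((∃̇ λ x → IsPair q o x ∧ G ∋⟨ x , y ⟩) ∨ (∃̇ λ x → IsPair q c x ∧ G' ∋⟨ x , y ⟩))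

  Diagonally : D → D → D → Ω
  Diagonally g q y = ∃̇ λ b → ∃̇ λ x → ∃̇ λ G → IsPair q b x ∧ g ∋⟨ b , G ⟩ ∧ G ∋⟨ x , y ⟩

  Fibre : D → D → D → D → D → Ω
  Fibre S g H b N = ∃̇ λ M → M ∊ S ∧ g ∋⟨ M , b ⟩ ∧ IsIntersection M N H

  Member : D → D → D → D → D → Ω
  Member i F H j N = ∃̇ λ ξ → ∃̇ λ A → ∃̇ λ M → i ∋⟨ ξ , j ⟩ ∧ F ∋⟨ ξ , A ⟩ ∧ M ∊ A ∧ IsIntersection M N H

  Omitting : D → D → D → Ω
  Omitting Z b A = ∀̇ λ M → M ∊ A ⇔ (M ∊ Z ∧ ¬̇ (b ∊ M))

module S₁₀ = Notions₁₀ syn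

module Notions₁₁ {d o} (I : Interpretation d o) where
  open Vocabulary I
  open Notions₁ I

  closureStep : D → D → D → D → Ω
  closureStep a y R v = ∀̇ λ z → z ∊ v ⇔ (z ∊ a ∨ (∃∊ R λ s → ∃∊ s λ u → z ∊ u))

  productStep : D → D → D → D → Ω
  productStep P y R v = ∀̇ λ z → z ∊ v ⇔ (∃∊ R λ s → ∃∊ P λ p → IsPair z s p)

  module ForcingNotions (P Le : D) where
    infix 8 _≤_
    _≤_ : D → D → Ω
    q ≤ p = Le ∋⟨ q , p ⟩

    Triple : D → D → D → D → Ω
    Triple E p σ τ = ∃̇ λ z → IsPair z σ τ ∧ E ∋⟨ p , z ⟩

    MemBy : (D → D → D → Ω) → D → D → D → Ω
    MemBy e p π τ = ∀̇ λ q → q ≤ p ⇒ ∃̇ λ r → r ≤ q ∧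
      ∃̇ λ ρ → ∃̇ λ s → τ ∋⟨ ρ , s ⟩ ∧ r ≤ s ∧ e r π ρ

    Names : D → Ω
    Names T = ∀∊ T λ τ → ∀∊ τ λ z → ∃∊ T λ σ → ∃∊ P λ p → IsPair z σ p

    Sub : (D → D → D → Ω) → D → D → D → Ω
    Sub e p σ τ = ∀̇ λ π → ∀̇ λ s → σ ∋⟨ π , s ⟩ ⇒ ∀̇ λ q → q ≤ p ⇒ q ≤ s ⇒ MemBy e q π τ

    Bisimulation : D → D → Ω
    Bisimulation T X =
      (∀∊ X λ z → ∃∊ P λ p → ∃∊ T λ σ → ∃∊ T λ τ → ∃̇ λ y → IsPair y σ τ ∧ IsPair z p y) ∧
      (∀̇ λ p → ∀̇ λ σ → ∀̇ λ τ → Triple X p σ τ ⇒ Sub (Triple X) p σ τ ∧ Sub (Triple X) p τ σ)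

    Bisimilar : D → D → D → Ω
    Bisimilar p σ τ = ∃̇ λ T → Names T ∧ ∃̇ λ X → Bisimulation T X ∧ Triple X p σ τ

    TripleIn : (D → D → D → Ω) → D → Ω
    TripleIn R z = ∃̇ λ p → ∃̇ λ σ → ∃̇ λ τ → ∃̇ λ y → IsPair y σ τ ∧ IsPair z p y ∧ R p σ τ

    Either : D → D → D → Ω
    Either p σ τ = Bisimilar p σ τ ∨ Bisimilar p τ σ

    Above : D → D → D → Ω
    Above q σ τ = ∃̇ λ p → q ≤ p ∧ Bisimilar p σ τ

    Compose : D → D → D → Ω
    Compose p σ υ = ∃̇ λ τ → Bisimilar p σ τ ∧ Bisimilar p τ υ

    OrNew : D → D → D → D → D → D → Ω
    OrNew p₀ σ₀ τ₀ p σ τ = Bisimilar p σ τ ∨ (p ≐ p₀ ∧ σ ≐ σ₀ ∧ τ ≐ τ₀)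

    CheckName : D → D → Ω
    CheckName τ x = ∃̇ λ t → ∃̇ λ c →
      Transitive t ∧ x ∊ t ∧ IsFunctionOn c t ∧
      (∀̇ λ y → ∀̇ λ σ → c ∋⟨ y , σ ⟩ ⇒ ∀̇ λ z →
        z ∊ σ ⇔ (∃∊ y λ u → ∃̇ λ υ → ∃∊ P λ p → c ∋⟨ u , υ ⟩ ∧ IsPair z υ p)) ∧
      c ∋⟨ x , τ ⟩

    CheckAbsolute : D → Ω
    CheckAbsolute x = ∀̇ λ y → ∀̇ λ p → ∀̇ λ σ → ∀̇ λ τ → p ∊ P ⇒ CheckName σ x ⇒ CheckName τ y ⇒ Bisimilar p σ τ ⇒ x ≐ y

module S₁₁ = Notions₁₁ syn

module Notions₁₃ {d o} (I : Interpretation d o) where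
  open Vocabulary I
  open Notions₁₀ I
  open Notions₁₁ I

  -- The definitions of H_λ, Z_λ and of the tower forcing are fixed to the model. They are repeated
  -- here over an arbitrary interpretation so that they have formulas as well.
  IsHN : D → D → Ω
  IsHN H lam = ∀̇ λ x → x ∊ H ⇔ (∃̇ λ t → Transitive t ∧ x ⊑ t ∧ SizeBelow t lam)

  IsZN : D → D → Ω
  IsZN Z lam = ∃̇ λ H → ∃̇ λ ω₂ → IsHN H lam ∧ Isω₂ ω₂ ∧ (∀̇ λ N → N ∊ Z ⇔ (N ⊑ H ∧ SizeBelow N ω₂))

  Condition : D → D → D → D → Ω
  Condition 𝓘 c lam S = IsPair c lam S ∧ (∃̇ λ J → ∃̇ λ Z → 𝓘 ∋⟨ lam , J ⟩ ∧ IsZN Z lam ∧ S ⊑ Z ∧ ¬̇ (S ∊ J))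

  Order : D → D → Ω
  Order 𝓘 z = ∃̇ λ c' → ∃̇ λ c → ∃̇ λ lam' → ∃̇ λ S' → ∃̇ λ lam → ∃̇ λ S → ∃̇ λ H →
    IsPair z c' c ∧ Condition 𝓘 c' lam' S' ∧ Condition 𝓘 c lam S ∧ lam ⊑ lam' ∧ IsHN H lam ∧
    (∀∊ S' λ N' → ∃∊ S λ N → IsIntersection N N' H)

  InN : D → D → Ω
  InN s N = ∃̇ λ lam → ∃̇ λ S → ∃̇ λ H → IsPair s lam S ∧ IsHN H lam ∧ Trace S H N

  GenericPair : D → D → D → Ω
  GenericPair P Le z = ∃∊ P λ p → ∃̇ λ τ → ForcingNotions.CheckName P Le τ p ∧ IsPair z τ p

module S₁₃ = Notions₁₃ syn

module Notions₁₄ {d o} (I : Interpretation d o) where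
  open Vocabulary I
  open Notions₁ I
  open Notions₈ I
  open Notions₁₀ I
  open Notions₁₁ I
  open Notions₁₃ I

  -- The order type of N ∩ α is the i-th ordinal below f(N ∩ U).
  Position : D → D → D → D → D → D → D → Ω
  Position δ U f ê α i N = α ∊ N ∧ ∃̇ λ v → ∃̇ λ X → ∃̇ λ γ → ∃̇ λ e →
    Otp δ N α v ∧ IsIntersection X N U ∧ f ∋⟨ X , γ ⟩ ∧ ê ∋⟨ γ , e ⟩ ∧ e ∋⟨ v , i ⟩

  Colour : D → D → D → D → D → D → D → D → Ω
  Colour δ ω₁ W U f ê a s = ∃̇ λ α → ∃̇ λ i → IsPair a α i ∧
    (∀̇ λ N → Admissible δ ω₁ W U f N ⇒ InN s N ⇒ Position δ U f ê α i N)

  NameOfRelation : D → D → D → D → Ω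
  NameOfRelation P Le C z = ∃̇ λ a → ∃̇ λ s → C ∋⟨ a , s ⟩ ∧ ∃̇ λ τ → ForcingNotions.CheckName P Le τ a ∧ IsPair z τ s

module S₁₄ = Notions₁₄ syn

module Notions₁₅ {d o} (I : Interpretation d o) where
  open Vocabulary I

  HasValue : D → D → D → Ω
  HasValue f g M = ∃̇ λ v → f ∋⟨ M , v ⟩ ∧ g ∋⟨ M , v ⟩

  MemberValue : D → D → D → Ω
  MemberValue f g M = ∃̇ λ v → ∃̇ λ w → f ∋⟨ M , v ⟩ ∧ g ∋⟨ M , w ⟩ ∧ v ∊ w

  Chosen : D → D → D → D → Ω
  Chosen s H x v = ∃̇ λ M → IsIntersection M x H ∧ s ∋⟨ M , v ⟩

  OtherElement : D → D → D → D → D → Ω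
  OtherElement z x y M w = ∃̇ λ c → ∃̇ λ a → ∃̇ λ b → z ∋⟨ M , c ⟩ ∧ x ∋⟨ M , a ⟩ ∧ y ∋⟨ M , b ⟩ ∧
    w ∊ c ∧ ¬̇ (w ≐ a) ∧ ¬̇ (w ≐ b)

  UpairValue : D → D → D → D → Ω
  UpairValue x y M c = ∃̇ λ a → ∃̇ λ b → x ∋⟨ M , a ⟩ ∧ y ∋⟨ M , b ⟩ ∧ IsUnorderedPair c a b

  PairValue : D → D → D → D → Ω
  PairValue x y M c = ∃̇ λ a → ∃̇ λ b → x ∋⟨ M , a ⟩ ∧ y ∋⟨ M , b ⟩ ∧ IsPair c a b

module S₁₅ = Notions₁₅ syn

module Notions₁₆ {d o} (I : Interpretation d o) where
  open Vocabulary I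
  open Notions₈ I
  open Notions₁₀ I
  open Notions₁₁ I
  open Notions₁₃ I
  open Notions₁₄ I

  OtpBelow : D → D → D → Ω
  OtpBelow δ N α = ∀̇ λ v → Otp δ N α v ⇒ v ⊑ α

  BoundAt : D → D → D → D → Ω
  BoundAt U f x γ = ∃̇ λ X → IsIntersection X x U ∧ f ∋⟨ X , γ ⟩

  OtpValue : D → D → D → D → Ω
  OtpValue δ u ζ N = ∃̇ λ v → u ∋⟨ N , v ⟩ ∧ Otp δ N ζ v

  Supported : D → D → D → Ω
  Supported W H g = (∀∊ g λ z → ∃∊ W λ x → ∃̇ λ v → IsPair z x v) ∧
    (∀̇ λ x → ∀̇ λ v → ∀̇ λ v' → g ∋⟨ x , v ⟩ ⇒ g ∋⟨ x , v' ⟩ ⇒ v ≐ v') ∧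
    (∀∊ W λ x → ∀∊ W λ y → (∀∊ H λ u → u ∊ x ⇔ u ∊ y) ⇒ ∀̇ λ v → g ∋⟨ x , v ⟩ ⇒ g ∋⟨ y , v ⟩)

  ValueOf : D → D → D → D → D → Ω
  ValueOf δ W g N v = ∃̇ λ lam → ∃̇ λ H → Index δ lam ∧ IsHN H lam ∧ Supported W H g ∧ (∃̇ λ M → IsIntersection M N H ∧ g ∋⟨ M , v ⟩)

  -- The first-order form of `Rank`, needed to run the induction on η inside the model. Forced
  -- membership is expressed through bisimilarity of names, for which a formula is at hand.
  RankUnique : D → D → D → D → D → D → D → D → D → D → Ω
  RankUnique δ ω₁ W U f P Le p₀ c η = ∀̇ λ r → ∀̇ λ k → ∀̇ λ β → Le ∋⟨ r , p₀ ⟩ ⇒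
    (∃̇ λ lam → ∃̇ λ H → Index δ lam ∧ IsHN H lam ∧ Supported W H k) ⇒
    (∀̇ λ N → Admissible δ ω₁ W U f N ⇒ InN r N ⇒ ∃̇ λ v → ValueOf δ W k N v ∧ Otp δ N η v) ⇒
    (∀̇ λ z → ∀̇ λ τ → IsPair z k β ⇒ ForcingNotions.CheckName P Le τ z ⇒ ForcingNotions.MemBy P Le (ForcingNotions.Bisimilar P Le) r τ c) ⇒
    β ∊ δ ⇒ β ≐ η

  NonTransitive : D → D → D → Ω
  NonTransitive h M y = ∃̇ λ v → h ∋⟨ M , v ⟩ ∧ y ∊ v ∧ (∃∊ y λ z → ¬̇ (z ∊ v))

  NonTransitiveElement : D → D → D → Ω
  NonTransitiveElement h M y = ∃̇ λ v → h ∋⟨ M , v ⟩ ∧ y ∊ v ∧ (∃∊ y λ z → ∃∊ z λ t → ¬̇ (t ∊ y))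

  Escapes : D → D → D → D → Ω
  Escapes k h M z = ∃̇ λ y → ∃̇ λ v → k ∋⟨ M , y ⟩ ∧ h ∋⟨ M , v ⟩ ∧ z ∊ y ∧ ¬̇ (z ∊ v)

  InjectionValue : D → D → D → D → Ω
  InjectionValue ω₁ h M e = ∃̇ λ v → h ∋⟨ M , v ⟩ ∧ IsFunction e v ω₁ ∧ IsInjective e

  FirstValue SecondValue : D → D → D → Ω
  FirstValue z M a = ∃̇ λ c → z ∋⟨ M , c ⟩ ∧ ∃̇ λ b → IsPair c a b
  SecondValue z M b = ∃̇ λ c → z ∋⟨ M , c ⟩ ∧ ∃̇ λ a → IsPair c a b

  AppValue : D → D → D → D → Ω
  AppValue k x M b = ∃̇ λ e → ∃̇ λ a → k ∋⟨ M , e ⟩ ∧ x ∋⟨ M , a ⟩ ∧ e ∋⟨ a , b ⟩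

  ContainsValue : D → D → D → Ω
  ContainsValue a h M = ∃̇ λ v → h ∋⟨ M , v ⟩ ∧ a ∊ v

module S₁₆ = Notions₁₆ syn

module _ {ℓ} (em : ExcludedMiddle ℓ) (M : ZFCModel ℓ) where

  -- Basic set theory in the model: definable predicates, pairs, products and selections.

  module Sets where
    open ZFCModel M public
    open SetTheory M public
    open Notions₁ interpretation public

    ⟦_⟧ᵥ : ∀ {n} → Formula n → Vec V n → Set ℓ
    ⟦_⟧ᵥ = ⟦ interpretation ⟧

    dec : (P : Set ℓ) → P ⊎ ¬̇ P
    dec P with em {P}
    ... | yes p = inj₁ p
    ... | no ¬p = inj₂ λ p → lift (¬p p)

    ⊥-elim′ : ∀ {a} {A : Set a} → ⊥ {ℓ} → A
    ⊥-elim′ ()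

    dne : {P : Set ℓ} → ¬̇ ¬̇ P → P
    dne {P} h with dec P
    ... | inj₁ p = p
    ... | inj₂ n = ⊥-elim′ (h n)

    -- Separation and replacement accept formulas only, so a predicate that forms a set or carries
    -- an induction comes with a formula. Equivalence with the formula is enough; this admits
    -- predicates that mention operations of the model such as `_∩_`.
    record Defn (P : V → Set ℓ) : Set (lsuc ℓ) where
      field
        arity      : ℕ
        formula    : Formula (suc arity)
        parameters : Vec V arity
        sound      : ∀ x → ⟦ formula ⟧ᵥ (x ∷ parameters) → P x
        complete   : ∀ x → P x → ⟦ formula ⟧ᵥ (x ∷ parameters)
    open Defn

    -- In defₙ the parameters are the variables 0, …, n - 1 and the defined
    -- element is the variable n.
    abstract
      def : ∀ {n} (φ : Formula (suc n)) (ρ : Vec V n) → Defn (λ x → ⟦ φ ⟧ᵥ (x ∷ ρ))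
      def φ ρ = record { formula = φ ; parameters = ρ ; sound = λ _ z → z ; complete = λ _ z → z }

      def₀ : (Φ : SynFormula) → Defn (λ x → ⟦ Φ 1 ⟧ᵥ (x ∷ []))
      def₀ Φ = def (Φ 1) []
      def₁ : (a : V) (Φ : SynFormula) → Defn (λ x → ⟦ Φ 2 ⟧ᵥ (x ∷ a ∷ []))
      def₁ a Φ = def (Φ 2) (a ∷ [])
      def₂ : (a b : V) (Φ : SynFormula) → Defn (λ x → ⟦ Φ 3 ⟧ᵥ (x ∷ b ∷ a ∷ []))
      def₂ a b Φ = def (Φ 3) (b ∷ a ∷ [])
      def₃ : (a b c : V) (Φ : SynFormula) → Defn (λ x → ⟦ Φ 4 ⟧ᵥ (x ∷ c ∷ b ∷ a ∷ []))
      def₃ a b c Φ = def (Φ 4) (c ∷ b ∷ a ∷ [])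
      def₄ : (a b c d : V) (Φ : SynFormula) → Defn (λ x → ⟦ Φ 5 ⟧ᵥ (x ∷ d ∷ c ∷ b ∷ a ∷ []))
      def₄ a b c d Φ = def (Φ 5) (d ∷ c ∷ b ∷ a ∷ [])
      def₅ : (a b c d e : V) (Φ : SynFormula) → Defn (λ x → ⟦ Φ 6 ⟧ᵥ (x ∷ e ∷ d ∷ c ∷ b ∷ a ∷ []))
      def₅ a b c d e Φ = def (Φ 6) (e ∷ d ∷ c ∷ b ∷ a ∷ [])
      def₆ : (a b c d e f : V) (Φ : SynFormula) → Defn (λ x → ⟦ Φ 7 ⟧ᵥ (x ∷ f ∷ e ∷ d ∷ c ∷ b ∷ a ∷ []))
      def₆ a b c d e f Φ = def (Φ 7) (f ∷ e ∷ d ∷ c ∷ b ∷ a ∷ [])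
      def₇ : (a b c d e f g : V) (Φ : SynFormula) → Defn (λ x → ⟦ Φ 8 ⟧ᵥ (x ∷ g ∷ f ∷ e ∷ d ∷ c ∷ b ∷ a ∷ []))
      def₇ a b c d e f g Φ = def (Φ 8) (g ∷ f ∷ e ∷ d ∷ c ∷ b ∷ a ∷ [])
      def₈ : (a b c d e f g h : V) (Φ : SynFormula) → Defn (λ x → ⟦ Φ 9 ⟧ᵥ (x ∷ h ∷ g ∷ f ∷ e ∷ d ∷ c ∷ b ∷ a ∷ []))
      def₈ a b c d e f g h Φ = def (Φ 9) (h ∷ g ∷ f ∷ e ∷ d ∷ c ∷ b ∷ a ∷ [])

    def-¬ : ∀ {P} → Defn P → Defn (λ x → ¬̇ P x)
    def-¬ d = record { formula = imp (formula d) false ; parameters = parameters d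
                     ; sound = λ x n p → n (complete d x p) ; complete = λ x n p → n (sound d x p) }

    abstract
      sep : (A : V) {P : V → Set ℓ} → Defn P → V
      sep A d = proj₁ (separation (formula d) (parameters d) A)

      sep-i : ∀ {A P} (d : Defn P) {x} → x ∊ A → P x → x ∊ sep A d
      sep-i {A} d {x} a p = proj₂ (proj₂ (separation (formula d) (parameters d) A) x) (a , complete d x p)

      sep-e : ∀ {A P} (d : Defn P) {x} → x ∊ sep A d → x ∊ A × P x
      sep-e {A} d {x} m with proj₁ (proj₂ (separation (formula d) (parameters d) A) x) m
      ... | a , q = a , sound d x q

    sep-⊑ : ∀ {A P} (d : Defn P) → sep A d ⊑ A
    sep-⊑ d x m = proj₁ (sep-e d m)

    sep-P : ∀ {A P} (d : Defn P) {x} → x ∊ sep A d → P x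
    sep-P d m = proj₂ (sep-e d m)

    ext : ∀ {x y} → x ⊑ y → y ⊑ x → x ≡ y
    ext {x} {y} p q = extensionality x y λ z → p z , q z

    ⊑-refl : ∀ {x} → x ⊑ x
    ⊑-refl _ m = m

    ⊑-trans : ∀ {x y z} → x ⊑ y → y ⊑ z → x ⊑ z
    ⊑-trans p q w m = q w (p w m)

    abstract
      ∅ : V
      ∅ = sep (proj₁ infinity) (def₀ S.⟂)

      ∅-e : ∀ {a} {A : Set a} {x} → x ∊ ∅ → A
      ∅-e m = ⊥-elim′ (sep-P (def₀ S.⟂) m)

      upair : V → V → V
      upair x y = proj₁ (pairing x y)

      upair-spec : ∀ x y → IsUnorderedPair (upair x y) x y
      upair-spec x y = proj₂ (pairing x y)

      ⋃ : V → V
      ⋃ A = proj₁ (union A)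

      ⋃-spec : ∀ A → IsUnion (⋃ A) A
      ⋃-spec A = proj₂ (union A)

      𝒫 : V → V
      𝒫 A = proj₁ (powerSet A)

      𝒫-spec : ∀ A → IsPowerSet (𝒫 A) A
      𝒫-spec A = proj₂ (powerSet A)

    ∅-empty : IsEmpty ∅
    ∅-empty z m = ∅-e m

    empty-unique : ∀ {x} → IsEmpty x → x ≡ ∅
    empty-unique e = ext (λ z m → ⊥-elim′ (e z m)) (λ z m → ∅-e m)

    upair-e : ∀ {x y z} → z ∊ upair x y → z ≡ x ⊎ z ≡ y
    upair-e m = proj₁ (upair-spec _ _ _) m
    upair-l : ∀ {x y} → x ∊ upair x y
    upair-l = proj₂ (upair-spec _ _ _) (inj₁ refl)
    upair-r : ∀ {x y} → y ∊ upair x y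
    upair-r = proj₂ (upair-spec _ _ _) (inj₂ refl)

    sing : V → V
    sing x = upair x x
    sing-e : ∀ {x z} → z ∊ sing x → z ≡ x
    sing-e m = [ (λ e → e) , (λ e → e) ]′ (upair-e m)
    sing-i : ∀ {x} → x ∊ sing x
    sing-i = upair-l

    ⋃-i : ∀ {A x y} → x ∊ y → y ∊ A → x ∊ ⋃ A
    ⋃-i m n = proj₂ (⋃-spec _ _) (_ , n , m)
    ⋃-e : ∀ {A x} → x ∊ ⋃ A → ∃ λ y → y ∊ A × x ∊ y
    ⋃-e m = proj₁ (⋃-spec _ _) m

    𝒫-i : ∀ {A x} → x ⊑ A → x ∊ 𝒫 A
    𝒫-i s = proj₂ (𝒫-spec _ _) s
    𝒫-e : ∀ {A x} → x ∊ 𝒫 A → x ⊑ A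
    𝒫-e m = proj₁ (𝒫-spec _ _) m

    infixl 9 _∪_
    abstract
      _∪_ : V → V → V
      A ∪ B = ⋃ (upair A B)
      ∪-l : ∀ {A B x} → x ∊ A → x ∊ A ∪ B
      ∪-l m = ⋃-i m upair-l
      ∪-r : ∀ {A B x} → x ∊ B → x ∊ A ∪ B
      ∪-r m = ⋃-i m upair-r
      ∪-e : ∀ {A B x} → x ∊ A ∪ B → x ∊ A ⊎ x ∊ B
      ∪-e m with ⋃-e m
      ... | y , n , k with upair-e n
      ... | inj₁ refl = inj₁ k
      ... | inj₂ refl = inj₂ k

    upair-unique : ∀ {z x y} → IsUnorderedPair z x y → z ≡ upair x y
    upair-unique {z} {x} {y} h =
      extensionality z (upair x y) λ w →
        (λ m → proj₂ (upair-spec x y w) (proj₁ (h w) m)) ,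
        (λ m → proj₂ (h w) (proj₁ (upair-spec x y w) m))

    pr : V → V → V
    pr x y = upair (upair x x) (upair x y)

    pr-spec : ∀ {x y} → IsPair (pr x y) x y
    pr-spec {x} {y} = upair x x , upair x y , upair-spec x x , upair-spec x y , upair-spec _ _

    pr-unique : ∀ {z x y} → IsPair z x y → z ≡ pr x y
    pr-unique (a , b , p , q , r) with upair-unique p | upair-unique q
    ... | refl | refl = upair-unique r

    upair-injʳ : ∀ {x y z} → upair x y ≡ upair x z → y ≡ z
    upair-injʳ {x} {y} {z} e with upair-e (subst (y ∊_) e upair-r)
    ... | inj₂ p = p
    ... | inj₁ refl with upair-e (subst (z ∊_) (sym e) upair-r)
    ...   | inj₁ p = sym p
    ...   | inj₂ p = sym p

    pr-inj : ∀ {x y x' y'} → pr x y ≡ pr x' y' → x ≡ x' × y ≡ y'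
    pr-inj {x} {y} {x'} {y'} e = p , upair-injʳ (upair-injʳ (trans e (cong (λ t → pr t y') (sym p))))
      where
      p : x ≡ x'
      p with upair-e (subst (upair x x ∊_) e upair-l)
      ... | inj₁ q = sing-e (subst (x ∊_) q upair-l)
      ... | inj₂ q = sym (sing-e (subst (x' ∊_) (sym q) upair-l))

    pair-inj : ∀ {z x y x' y'} → IsPair z x y → IsPair z x' y' → x ≡ x' × y ≡ y'
    pair-inj p q = pr-inj (trans (sym (pr-unique p)) (pr-unique q))

    ∋-i : ∀ {f x y} → pr x y ∊ f → f ∋⟨ x , y ⟩
    ∋-i m = _ , m , pr-spec
    ∋-e : ∀ {f x y} → f ∋⟨ x , y ⟩ → pr x y ∊ f
    ∋-e (z , m , p) = subst (_∊ _) (pr-unique p) m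

    infixl 9 _⊗_
    abstract
      _⊗_ : V → V → V
      A ⊗ B = sep (𝒫 (𝒫 (A ∪ B))) (def₂ A B (S₁.ProductElement 0 1 2))

      ⊗-i : ∀ {A B x y} → x ∊ A → y ∊ B → pr x y ∊ A ⊗ B
      ⊗-i {A} {B} {x} {y} a b = sep-i (def₂ A B (S₁.ProductElement 0 1 2))
        (𝒫-i λ w m → 𝒫-i λ u k → [ (λ { refl → ∪-l (subst (_∊ A) (sym (sing-e k)) a) })
          , (λ { refl → [ (λ { refl → ∪-l a }) , (λ { refl → ∪-r b }) ]′ (upair-e k) }) ]′ (upair-e m))
        (x , a , y , b , pr-spec)

      ⊗-e : ∀ {A B z} → z ∊ A ⊗ B → ∃ λ x → ∃ λ y → x ∊ A × y ∊ B × z ≡ pr x y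
      ⊗-e {A} {B} m with sep-P (def₂ A B (S₁.ProductElement 0 1 2)) m
      ... | x , a , y , b , p = x , y , a , b , pr-unique p

    ⊗-e₂ : ∀ {A B x y} → pr x y ∊ A ⊗ B → x ∊ A × y ∊ B
    ⊗-e₂ m with ⊗-e m
    ... | x , y , a , b , e with pr-inj e
    ... | refl , refl = a , b

    RelDefn : (V → V → Set ℓ) → Set (lsuc ℓ)
    RelDefn R = Defn (λ z → PairIn z R)

    rel : (A B : V) {R : V → V → Set ℓ} → RelDefn R → V
    rel A B d = sep (A ⊗ B) d

    rel-i : ∀ {A B R} (d : RelDefn R) {x y} → x ∊ A → y ∊ B → R x y → rel A B d ∋⟨ x , y ⟩
    rel-i d a b r = ∋-i (sep-i d (⊗-i a b) (_ , _ , pr-spec , r))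

    rel-e : ∀ {A B R} (d : RelDefn R) {x y} → rel A B d ∋⟨ x , y ⟩ → x ∊ A × y ∊ B × R x y
    rel-e d f with sep-e d (∋-e f)
    ... | m , x' , y' , p , r with pair-inj p pr-spec
    ... | refl , refl = proj₁ (⊗-e₂ m) , proj₂ (⊗-e₂ m) , r

    rel-pair : ∀ {A B R} (d : RelDefn R) {z} → z ∊ rel A B d → ∃ λ x → ∃ λ y → z ≡ pr x y × x ∊ A × y ∊ B × R x y
    rel-pair d m with sep-e d m
    ... | k , x , y , p , r with pr-unique p
    ... | refl = x , y , refl , proj₁ (⊗-e₂ k) , proj₂ (⊗-e₂ k) , r

    Functional : V → Set ℓ
    Functional f = ∀ x y y' → f ∋⟨ x , y ⟩ → f ∋⟨ x , y' ⟩ → y ≡ y'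

    record Selection (f A B : V) (R : V → V → Set ℓ) : Set ℓ where
      field
        graph      : f ⊑ A ⊗ B
        functional : Functional f
        total      : ∀ {x} → x ∊ A → ∃ λ y → f ∋⟨ x , y ⟩
        holds      : ∀ {x y} → f ∋⟨ x , y ⟩ → R x y
      dom : ∀ {x y} → f ∋⟨ x , y ⟩ → x ∊ A
      dom m = proj₁ (⊗-e₂ (graph _ (∋-e m)))
      cod : ∀ {x y} → f ∋⟨ x , y ⟩ → y ∊ B
      cod m = proj₂ (⊗-e₂ (graph _ (∋-e m)))
      isFunctionOn : IsFunctionOn f A
      isFunctionOn = ((λ z m → let (x , y , a , b , e) = ⊗-e (graph z m) in x , a , y , subst (λ w → IsPair w x y) (sym e) pr-spec)
                     , functional) , λ x a → total a
      isFunction : IsFunction f A B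
      isFunction = isFunctionOn , λ x y m → cod m

    private
     -- The fibres of a relation over different points are disjoint sets of pairs. The choice axiom
     -- for disjoint families applies to them, and the chosen pairs form the graph of the selection.
     select′ : (A B : V) {R : V → V → Set ℓ} (d : RelDefn R) →
             (∀ {x} → x ∊ A → ∃ λ y → y ∊ B × R x y) → ∃ λ f → Selection f A B R
     select′ A B {R} d h = f , record
      { graph = λ z m → sep-⊑ d z (sep-⊑ dC z m)
      ; functional = λ x y y' m m' → proj₂ (pr-inj (fun x y y' m m'))
      ; total = λ {x} a → tot x a
      ; holds = λ m → proj₂ (proj₂ (rel-e d (_ , sep-⊑ dC _ (∋-e m) , pr-spec))) }
      where
      r = rel A B d
      dF : Defn (Section A r)
      dF = def₂ A r (S₁.Section 0 1 2)
      𝓕 = sep (𝒫 r) dF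
      d-sec : (x : V) → Defn (λ z → ∃ λ y → IsPair z x y)
      d-sec x = def₁ x (S.∃̇ λ y → S.IsPair 1 0 y)
      F : V → V
      F x = sep r (d-sec x)
      F∈ : ∀ {x} → x ∊ A → F x ∊ 𝓕
      F∈ {x} a = sep-i dF (𝒫-i (sep-⊑ (d-sec x))) (x , a , λ z → sep-e (d-sec x) , λ (m , p) → sep-i (d-sec x) m p)
      ch = choice 𝓕
        (λ Y m → let (x , a , e) = sep-P dF m
                     (y , b , r') = h a
                 in pr x y , proj₂ (e _) (∋-e (rel-i d a b r') , y , pr-spec))
        (λ Y Y' z m m' n n' → let (x , a , e) = sep-P dF m
                                  (x' , a' , e') = sep-P dF m'
                                  (k , y , p) = proj₁ (e z) n
                                  (k' , y' , p') = proj₁ (e' z) n'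
                                  q = proj₁ (pair-inj p p')
                              in extensionality Y Y' λ w →
                                   (λ u → let (i , j , t) = proj₁ (e w) u in proj₂ (e' w) (i , j , subst (λ v → IsPair w v j) q t))
                                 , (λ u → let (i , j , t) = proj₁ (e' w) u in proj₂ (e w) (i , j , subst (λ v → IsPair w v j) (sym q) t)))
      C = proj₁ ch
      dC = def₁ C (1 S.∊ 0)
      f = sep r dC
      inF : ∀ x y → f ∋⟨ x , y ⟩ → pr x y ∊ F x × pr x y ∊ C
      inF x y m = let (u , v) = sep-e dC (∋-e m) in sep-i (d-sec x) u (y , pr-spec) , v
      fun : ∀ x y y' → f ∋⟨ x , y ⟩ → f ∋⟨ x , y' ⟩ → pr x y ≡ pr x y'
      fun x y y' m m' = let a = proj₁ (rel-e d (_ , sep-⊑ dC _ (∋-e m) , pr-spec))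
                            (z , _ , u) = proj₂ ch (F x) (F∈ a)
                        in trans (u _ (inF x y m)) (sym (u _ (inF x y' m')))
      tot : ∀ x → x ∊ A → ∃ λ y → f ∋⟨ x , y ⟩
      tot x a = let (z , (m , c) , _) = proj₂ ch (F x) (F∈ a)
                    (k , y , p) = sep-e (d-sec x) m
                in y , z , sep-i dC k c , p

    abstract
      select : (A B : V) {R : V → V → Set ℓ} (d : RelDefn R) →
               (∀ {x} → x ∊ A → ∃ λ y → y ∊ B × R x y) → ∃ λ f → Selection f A B R
      select = select′

    minimal : (B : V) → (∃ λ x → x ∊ B) → ∃ λ m → m ∊ B × (∀ y → y ∊ m → y ∊ B → ⊥ {ℓ})
    minimal B ne with foundation B ne
    ... | m , mB , h = m , mB , λ y a b → h y b a

    -- The axiom of foundation speaks of sets, so the induction runs inside a set t: a minimal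
    -- counterexample in t is taken.
    foundation-ind : ∀ t {P} → Defn P → (∀ x → x ∊ t → (∀ y → y ∊ x → y ∊ t → P y) → P x) → ∀ {x} → x ∊ t → P x
    foundation-ind t {P} d step {x} xt = dne λ nx →
      let B = sep t (def-¬ d)
          (m , mB , h) = foundation B (x , sep-i (def-¬ d) xt nx)
          (mt , nm) = sep-e (def-¬ d) mB
      in nm (step m mt λ y ym yt → dne λ ny → h y (sep-i (def-¬ d) yt ny) ym)

  open Sets

  -- Ordinals, injections and recursion along well-founded relations.

  module Ordinals where
    open Notions₂ interpretation public

    ∉-refl : ∀ {x} → x ∊ x → ⊥ {ℓ}
    ∉-refl {x} m =
      let (y , k , h) = minimal (sing x) (x , sing-i)
      in h x (subst (x ∊_) (sym (sing-e k)) m) sing-i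

    ∈-asym : ∀ {x y} → x ∊ y → y ∊ x → ⊥ {ℓ}
    ∈-asym {x} {y} m n =
      let (z , k , h) = minimal (upair x y) (x , upair-l)
      in [ (λ e → h y (subst (y ∊_) (sym e) n) upair-r) , (λ e → h x (subst (x ∊_) (sym e) m) upair-l) ]′ (upair-e k)

    ord-elt : ∀ {α β} → Ordinal α → β ∊ α → Ordinal β
    ord-elt (t , h) m = h _ m , λ γ n → h γ (t _ m γ n)

    ord-trans : ∀ {α β γ} → Ordinal α → γ ∊ β → β ∊ α → γ ∊ α
    ord-trans (t , _) n m = t _ m _ n

    succ : V → V
    succ x = x ∪ sing x

    succ-i : ∀ {x} → x ∊ succ x
    succ-i = ∪-r sing-i

    succ-e : ∀ {x y} → y ∊ succ x → y ∊ x ⊎ y ≡ x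
    succ-e m = [ inj₁ , (λ k → inj₂ (sing-e k)) ]′ (∪-e m)

    succ-ord : ∀ {α} → Ordinal α → Ordinal (succ α)
    succ-ord {α} o@(t , h) =
      (λ β m γ n → [ (λ k → ∪-l (t β k γ n)) , (λ { refl → ∪-l n }) ]′ (succ-e m)) ,
      (λ β m → [ h β , (λ { refl → t }) ]′ (succ-e m))

    private
     -- Induction on the first ordinal and, inside it, on the second. If neither is equal to or an
     -- element of an element of the other, the induction hypotheses make each included in the
     -- other. The successors serve as the sets in which foundation is used.
     comparable′ : ∀ {α β} → Ordinal α → Ordinal β → Comparable α β
     comparable′ {α} {β} oα oβ = outer succ-i β succ-i
      where
      B = succ β
      A = succ α
      d₁ : Defn (λ x → ∀∊ B (Comparable x))
      d₁ = def₁ B (S.∀∊ 0 (S₂.Comparable 1))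
      d₂ : (x : V) → Defn (λ y → Comparable x y)
      d₂ x = def₁ x (S₂.Comparable 0 1)
      step : ∀ x y → Transitive x → Transitive y →
             (∀ x' → x' ∊ x → Comparable x' y) → (∀ y' → y' ∊ y → Comparable x y') → Comparable x y
      step x y tx ty h k with dec (∃ λ x' → x' ∊ x × (x' ≡ y ⊎ y ∊ x'))
      ... | inj₁ (x' , m , inj₁ refl) = inj₂ (inj₂ m)
      ... | inj₁ (x' , m , inj₂ n) = inj₂ (inj₂ (tx x' m y n))
      ... | inj₂ n with dec (∃ λ y' → y' ∊ y × (x ≡ y' ⊎ x ∊ y'))
      ...   | inj₁ (y' , m , inj₁ refl) = inj₁ m
      ...   | inj₁ (y' , m , inj₂ l) = inj₁ (ty y' m x l)
      ...   | inj₂ l = inj₂ (inj₁ (ext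
              (λ x' m → [ (λ r → r) , (λ r → ⊥-elim′ (n (x' , m , r))) ]′ (h x' m))
              (λ y' m → [ (λ r → ⊥-elim′ (l (y' , m , inj₂ r))) , [ (λ r → ⊥-elim′ (l (y' , m , inj₁ r))) , (λ r → r) ]′ ]′ (k y' m))))
      inner : ∀ x → x ∊ A → (∀ x' → x' ∊ x → x' ∊ A → ∀∊ B (Comparable x')) → ∀ {y} → y ∊ B → Comparable x y
      inner x mx h = foundation-ind B (d₂ x) λ y my k → step x y
        (proj₂ (succ-ord oα) x mx) (proj₂ (succ-ord oβ) y my)
        (λ x' m → h x' m (proj₁ (succ-ord oα) x mx x' m) y my)
        (λ y' m → k y' m (proj₁ (succ-ord oβ) y my y' m))
      outer : ∀ {x} → x ∊ A → ∀∊ B (Comparable x)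
      outer = foundation-ind A d₁ λ x mx h y my → inner x mx h my

    abstract
      comparable : ∀ {α β} → Ordinal α → Ordinal β → Comparable α β
      comparable = comparable′

    ord-cases : ∀ {α β} → Ordinal α → Ordinal β → α ⊑ β ⊎ β ∊ α
    ord-cases oα oβ with comparable oα oβ
    ... | inj₁ m = inj₁ (proj₁ oβ _ m)
    ... | inj₂ (inj₁ refl) = inj₁ ⊑-refl
    ... | inj₂ (inj₂ m) = inj₂ m

    ⊑-∊-trans : ∀ {α β γ} → Ordinal α → Ordinal γ → α ⊑ β → β ∊ γ → α ∊ γ
    ⊑-∊-trans {α} {β} oα oγ s m with ord-cases oγ oα
    ... | inj₂ k = k
    ... | inj₁ k = ⊥-elim′ (∉-refl (s β (k β m)))

    least : ∀ {P} → Defn P → ∀ {α} → Ordinal α → P α →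
            ∃ λ μ → Ordinal μ × P μ × (∀ β → β ∊ μ → ¬̇ P β) × μ ⊑ α
    least d {α} oα p =
      let B = sep (succ α) d
          (m , k , h) = minimal B (α , sep-i d succ-i p)
          (mα , pm) = sep-e d k
          oSα = succ-ord oα
      in m , ord-elt oSα mα , pm
         , (λ β n q → h β n (sep-i d (ord-trans oSα n mα) q))
         , [ proj₁ oα m , (λ e → subst (_⊑ α) (sym e) ⊑-refl) ]′ (succ-e mα)

    ord-ind : ∀ {P} → Defn P → (∀ α → Ordinal α → (∀ β → β ∊ α → P β) → P α) → ∀ {α} → Ordinal α → P α
    ord-ind d step oα = dne λ n →
      let (μ , oμ , nμ , h , _) = least (def-¬ d) oα n
      in nμ (step μ oμ λ β m → dne (h β m))

    ∪-ord : ∀ {α β} → Ordinal α → Ordinal β → Ordinal (α ∪ β)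
    ∪-ord (tα , hα) (tβ , hβ) =
      (λ x m y n → [ (λ k → ∪-l (tα x k y n)) , (λ k → ∪-r (tβ x k y n)) ]′ (∪-e m)) ,
      (λ x m → [ hα x , hβ x ]′ (∪-e m))

    infix 4 _≲_
    _≲_ : V → V → Set ℓ
    A ≲ B = ∃ λ f → IsFunction f A B × IsInjective f

    module Injection {A B} (i : A ≲ B) where
      f : V
      f = proj₁ i
      total : ∀ {x} → x ∊ A → ∃ λ y → f ∋⟨ x , y ⟩
      total a = proj₂ (proj₁ (proj₁ (proj₂ i))) _ a
      cod : ∀ {x y} → f ∋⟨ x , y ⟩ → y ∊ B
      cod m = proj₂ (proj₁ (proj₂ i)) _ _ m
      dom : ∀ {x y} → f ∋⟨ x , y ⟩ → x ∊ A
      dom {x} (z , m , p) =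
        let (x' , a , y' , p') = proj₁ (proj₁ (proj₁ (proj₁ (proj₂ i)))) z m
        in subst (_∊ A) (proj₁ (pair-inj p' p)) a
      functional : ∀ {x y y'} → f ∋⟨ x , y ⟩ → f ∋⟨ x , y' ⟩ → y ≡ y'
      functional m n = proj₂ (proj₁ (proj₁ (proj₁ (proj₂ i)))) _ _ _ m n
      injective : ∀ {x x' y} → f ∋⟨ x , y ⟩ → f ∋⟨ x' , y ⟩ → x ≡ x'
      injective m n = proj₂ (proj₂ i) _ _ _ m n

    ≲-rel : ∀ A B {R} → RelDefn R → (∀ {x} → x ∊ A → ∃ λ y → y ∊ B × R x y) →
            (∀ {x x' y} → x ∊ A → x' ∊ A → y ∊ B → R x y → R x' y → x ≡ x') → A ≲ B
    ≲-rel A B d h inj =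
      let (f , s) = select A B d h
          open Selection s
      in f , isFunction , λ x x' y m n → inj (dom m) (dom n) (cod m) (holds m) (holds n)

    ⊑→≲ : ∀ {A B} → A ⊑ B → A ≲ B
    ⊑→≲ {A} {B} s = ≲-rel A B {_≡_} (def₀ (S₁.PairIn 0 S._≐_)) (λ a → _ , s _ a , refl) (λ { _ _ _ refl refl → refl })

    ≲-refl : ∀ {A} → A ≲ A
    ≲-refl = ⊑→≲ ⊑-refl

    ≲-trans : ∀ {A B C} → A ≲ B → B ≲ C → A ≲ C
    ≲-trans {A} {B} {C} i j =
      ≲-rel A C {λ x z → ∃ λ y → I.f ∋⟨ x , y ⟩ × J.f ∋⟨ y , z ⟩}
        (def₂ I.f J.f (S₁.PairIn 2 λ x z → S.∃̇ λ y → (0 S.∋⟨ x , y ⟩) S.∧ (1 S.∋⟨ y , z ⟩)))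
        (λ a → let (y , m) = I.total a
                   (z , n) = J.total (I.cod m)
               in z , J.cod n , y , m , n)
        (λ { _ _ _ (y , m , n) (y' , m' , n') → I.injective (subst (λ v → I.f ∋⟨ _ , v ⟩) (J.injective n n') m) m' })
      where
      module I = Injection i
      module J = Injection j

    record Solution (F : V → V → V → Set ℓ) (t E c : V) : Set ℓ where
      open Recursion F t E using (Values)
      field
        total        : ∀ {y} → y ∊ t → ∃ λ v → c ∋⟨ y , v ⟩
        dom          : ∀ {y v} → c ∋⟨ y , v ⟩ → y ∊ t
        functional   : ∀ {y v v'} → c ∋⟨ y , v ⟩ → c ∋⟨ y , v' ⟩ → v ≡ v'
        equation     : ∀ {y v} → c ∋⟨ y , v ⟩ → ∃ λ R → Values c y R × F y R v
        isFunctionOn : IsFunctionOn c t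

    -- Recursion along a well-founded relation E on t: the value at y is determined by y
    -- and the set R of the values at the E-predecessors of y.
    module Recursion* (F : V → V → V → Set ℓ) (t E : V)
      {n : ℕ} (φ : Formula (suc (suc n))) (ρ : Vec V n)
      (φ→ : ∀ x y → ⟦ φ ⟧ᵥ (x ∷ y ∷ ρ) → Recursion.Value F t E x y)
      (→φ : ∀ x y → Recursion.Value F t E x y → ⟦ φ ⟧ᵥ (x ∷ y ∷ ρ))
      (dD : Defn (λ u → ∃ λ v → Recursion.Value F t E u v))
      (E⊑ : ∀ {u y} → E ∋⟨ u , y ⟩ → u ∊ t)
      (wf : ∀ B → B ⊑ t → (∃ λ x → x ∊ B) → ∃ λ m → m ∊ B × (∀ u → u ∊ B → ¬̇ (E ∋⟨ u , m ⟩)))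
      (F-total  : ∀ y R → y ∊ t → ∃ λ v → F y R v)
      (F-unique : ∀ {y R v v'} → F y R v → F y R v' → v ≡ v')
      where
      open Recursion F t E

      private
        wf-ind : ∀ {P} → Defn P → (∀ y → y ∊ t → (∀ u → E ∋⟨ u , y ⟩ → P u) → P y) → ∀ {y} → y ∊ t → P y
        wf-ind d step {y} yt = dne λ n →
          let B = sep t (def-¬ d)
              (m , mB , h) = wf B (sep-⊑ (def-¬ d)) (y , sep-i (def-¬ d) yt n)
              (mt , nm) = sep-e (def-¬ d) mB
          in nm (step m mt λ u e → dne λ nu → h u (sep-i (def-¬ d) (E⊑ e) nu) e)

        values-unique : ∀ {a a' y R R'} → (∀ u → E ∋⟨ u , y ⟩ → ∀ w → a ∋⟨ u , w ⟩ ⇔ a' ∋⟨ u , w ⟩) →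
                        Values a y R → Values a' y R' → R ≡ R'
        values-unique h v v' = ext
          (λ w m → let (u , e , k) = proj₁ (v w) m in proj₂ (v' w) (u , e , proj₁ (h u e w) k))
          (λ w m → let (u , e , k) = proj₁ (v' w) m in proj₂ (v w) (u , e , proj₂ (h u e w) k))

        att-dom : ∀ {a y v} → Attempt a → a ∋⟨ y , v ⟩ → y ∊ t
        att-dom A (z , m , p) = let (y , k , v , p') = proj₁ A z m in subst (_∊ t) (proj₁ (pair-inj p' p)) k

        agree : ∀ {a a'} → Attempt a → Attempt a' → ∀ {y} → y ∊ t → ∀ v v' → a ∋⟨ y , v ⟩ → a' ∋⟨ y , v' ⟩ → v ≡ v'
        agree {a} {a'} A A' = wf-ind
          (def₂ a a' (S.∀̇ λ v → S.∀̇ λ v' → (0 S.∋⟨ 2 , v ⟩) S.⇒ (1 S.∋⟨ 2 , v' ⟩) S.⇒ (v S.≐ v')))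
          λ y yt ih v v' m m' →
            let (c , R , V , f) = proj₂ (proj₂ A) y v m
                (c' , R' , V' , f') = proj₂ (proj₂ A') y v' m'
                e = values-unique (λ u e w →
                      (λ k → let (w' , k') = c' u e in subst (λ x → a' ∋⟨ u , x ⟩) (sym (ih u e w w' k k')) k') ,
                      (λ k → let (w' , k') = c u e in subst (λ x → a ∋⟨ u , x ⟩) (ih u e w' w k' k) k')) V V'
            in F-unique f (subst (λ r → F y r v') (sym e) f')

        value-unique : ∀ {y v v'} → Value y v → Value y v' → v ≡ v'
        value-unique (a , A , m) (a' , A' , m') = agree A A' (att-dom A m) _ _ m m'

        -- The predecessors of y and of every old point already lie in the domain of c, and y does
        -- not. The new pair therefore changes none of the sets of predecessor values.
        attempt-extension : ∀ {c y R v} → Attempt c → y ∊ t → (∀ u → E ∋⟨ u , y ⟩ → ∃ λ w → c ∋⟨ u , w ⟩) →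
          Values c y R → F y R v → (∀ w → ¬̇ (c ∋⟨ y , w ⟩)) → Value y v
        attempt-extension {c} {y} {R} {v} A yt hc V₀ f₀ n = a , att , ∋-i (∪-r sing-i)
          where
          a = c ∪ sing (pr y v)
          a-e : ∀ {u w} → a ∋⟨ u , w ⟩ → c ∋⟨ u , w ⟩ ⊎ (u ≡ y × w ≡ v)
          a-e m = [ (λ k → inj₁ (∋-i k)) , (λ k → inj₂ (pr-inj (sing-e k))) ]′ (∪-e (∋-e m))
          a-i : ∀ {u w} → c ∋⟨ u , w ⟩ → a ∋⟨ u , w ⟩
          a-i m = ∋-i (∪-l (∋-e m))
          no-y : ∀ {u w} {X : Set ℓ} → c ∋⟨ u , w ⟩ → u ≡ y → X
          no-y m e = ⊥-elim′ (n _ (subst (λ u → c ∋⟨ u , _ ⟩) e m))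
          transfer : ∀ {z R} → (∀ u → E ∋⟨ u , z ⟩ → ∃ λ w → c ∋⟨ u , w ⟩) → Values c z R → Values a z R
          transfer cl V w = (λ r → let (u , e , l) = proj₁ (V w) r in u , e , a-i l) ,
            (λ (u , e , l) → proj₂ (V w) (u , e , [ (λ k → k) , (λ (p , _) → no-y (proj₂ (cl u e)) p) ]′ (a-e l)))
          functional : ∀ y v v' → a ∋⟨ y , v ⟩ → a ∋⟨ y , v' ⟩ → v ≡ v'
          functional u w w' m m' =
            [ (λ k → [ (λ k' → proj₁ (proj₂ A) u w w' k k') , (λ (p , _) → no-y k p) ]′ (a-e m'))
            , (λ (p , q) → [ (λ k' → no-y k' p) , (λ (_ , q') → trans q (sym q')) ]′ (a-e m')) ]′ (a-e m)
          old : ∀ u w → c ∋⟨ u , w ⟩ → (∀ x → E ∋⟨ x , u ⟩ → ∃ λ w' → a ∋⟨ x , w' ⟩) × ∃ λ R → Values a u R × F u R w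
          old u w k = let (cl , R' , V , f) = proj₂ (proj₂ A) u w k
                      in (λ x e → let (w' , l) = cl x e in w' , a-i l) , R' , transfer cl V , f
          new : (∀ x → E ∋⟨ x , y ⟩ → ∃ λ w' → a ∋⟨ x , w' ⟩) × ∃ λ R → Values a y R × F y R v
          new = (λ x e → let (w' , l) = hc x e in w' , a-i l) , R , transfer hc V₀ , f₀
          att : Attempt a
          att = (λ z m → [ proj₁ A z , (λ k → y , yt , v , subst (λ z → IsPair z y v) (sym (sing-e k)) pr-spec) ]′ (∪-e m))
              , functional
              , (λ u w m → [ old u w , (λ { (refl , refl) → new }) ]′ (a-e m))

        dom′ : V
        dom′ = sep t dD

        -- Replacement collects the values, so that the union of all attempts is a set.
        image = replacement φ ρ dom′ λ y m →
          let (v , k) = sep-P dD m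
          in v , →φ y v k , λ v' k' → value-unique (φ→ y v' k') k

        B = proj₁ image

      module _ (dV : RelDefn Value) where
        private
          c = rel dom′ B dV

          c→ : ∀ {y v} → c ∋⟨ y , v ⟩ → Value y v
          c→ m = proj₂ (proj₂ (rel-e dV m))

          →c : ∀ {y v} → Value y v → c ∋⟨ y , v ⟩
          →c {y} {v} k@(a , A , m) =
            let yD = sep-i dD (att-dom A m) (v , k)
            in rel-i dV yD (proj₂ (proj₂ image v) (y , yD , →φ y v k)) k

          Rset : (a y : V) → ∃ λ R → Values a y R
          Rset a y = sep (⋃ (⋃ a)) dR , λ w →
            (λ m → sep-P dR m) ,
            (λ { (u , e , k) → sep-i dR (⋃-i (upair-r {u}) (⋃-i (upair-r {upair u u}) (∋-e k))) (u , e , k) })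
            where
            dR : Defn (λ w → ∃ λ u → E ∋⟨ u , y ⟩ × a ∋⟨ u , w ⟩)
            dR = def₃ a y E (S.∃̇ λ u → (2 S.∋⟨ u , 1 ⟩) S.∧ (0 S.∋⟨ u , 3 ⟩))

          c-step : ∀ {y v} → c ∋⟨ y , v ⟩ → (∀ u → E ∋⟨ u , y ⟩ → ∃ λ w → c ∋⟨ u , w ⟩) × ∃ λ R → Values c y R × F y R v
          c-step {y} {v} m =
            let (a , A , k) = c→ m
                (cl , R , V , f) = proj₂ (proj₂ A) y v k
            in (λ u e → let (w , l) = cl u e in w , →c (a , A , l)) ,
               R , (λ w → (λ r → let (u , e , l) = proj₁ (V w) r in u , e , →c (a , A , l)) ,
                          (λ { (u , e , l) → let (w' , l') = cl u e
                                             in proj₂ (V w) (u , e , subst (λ x → a ∋⟨ u , x ⟩) (value-unique (a , A , l') (c→ l)) l') })) , f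

          c-att : Attempt c
          c-att = (λ z m → let (y , v , e , yD , _) = rel-pair dV m
                           in y , sep-⊑ dD y yD , v , subst (λ z → IsPair z y v) (sym e) pr-spec)
                , (λ y v v' m m' → value-unique (c→ m) (c→ m'))
                , (λ y v m → c-step m)

          -- The union c of all attempts is itself an attempt. If it has no value at y, it extends
          -- to y, and the extension gives a value after all.
          extend′ : ∀ y → y ∊ t → (∀ u → E ∋⟨ u , y ⟩ → ∃ λ v → Value u v) → ¬̇ (∃ λ v → Value y v) → ∃ λ v → Value y v
          extend′ y yt h n =
            let (R , V) = Rset c y
                (v , f) = F-total y R yt
            in v , attempt-extension c-att yt (λ u e → let (w , k) = h u e in w , →c k) V f (λ w m → n (w , c→ m))

          extend : ∀ y → y ∊ t → (∀ u → E ∋⟨ u , y ⟩ → ∃ λ v → Value u v) → ∃ λ v → Value y v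
          extend y yt h = [ (λ p → p) , extend′ y yt h ]′ (dec (∃ λ v → Value y v))

          everywhere : ∀ {y} → y ∊ t → ∃ λ v → Value y v
          everywhere = wf-ind dD extend

        private
         solution′ : ∃ (Solution F t E)
         solution′ = c , record
          { total = λ yt → let (v , k) = everywhere yt in v , →c k
          ; dom = λ m → att-dom c-att m
          ; functional = λ m m' → proj₁ (proj₂ c-att) _ _ _ m m'
          ; equation = λ m → proj₂ (c-step m)
          ; isFunctionOn = (proj₁ c-att , proj₁ (proj₂ c-att)) , λ y yt → let (v , k) = everywhere yt in v , →c k }

        abstract
          solution : ∃ (Solution F t E)
          solution = solution′

  open Ordinals

  -- Collapses, cumulative hierarchies, ω and finiteness.

  module Cardinals where
    open Notions₃ interpretation public

    record WellFounded (t E : V) : Set (lsuc ℓ) where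
      field
        field⊑ : ∀ {u y} → E ∋⟨ u , y ⟩ → u ∊ t
        wf : ∀ B → B ⊑ t → (∃ λ x → x ∊ B) → ∃ λ m → m ∊ B × (∀ u → u ∊ B → ¬̇ (E ∋⟨ u , m ⟩))
      wf-ind : ∀ {P} → Defn P → (∀ y → y ∊ t → (∀ u → E ∋⟨ u , y ⟩ → P u) → P y) → ∀ {y} → y ∊ t → P y
      wf-ind d step {y} yt = dne λ n →
        let B = sep t (def-¬ d)
            (m , mB , h) = wf B (sep-⊑ (def-¬ d)) (y , sep-i (def-¬ d) yt n)
            (mt , nm) = sep-e (def-¬ d) mB
        in nm (step m mt λ u e → dne λ nu → h u (sep-i (def-¬ d) (field⊑ e) nu) e)

    record Collapse (t E c : V) : Set ℓ where
      field
        total      : ∀ {y} → y ∊ t → ∃ λ v → c ∋⟨ y , v ⟩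
        dom        : ∀ {y v} → c ∋⟨ y , v ⟩ → y ∊ t
        functional : ∀ {y v v'} → c ∋⟨ y , v ⟩ → c ∋⟨ y , v' ⟩ → v ≡ v'
        values     : ∀ {y v} → c ∋⟨ y , v ⟩ → ∀ w → w ∊ v ⇔ (∃ λ u → E ∋⟨ u , y ⟩ × c ∋⟨ u , w ⟩)

    module _ {t E : V} (W : WellFounded t E) where
      open WellFounded W
      private
        module SR = S₂.Recursion S₃.collapseStep 0 1

      private
       collapse′ : ∃ λ c → Collapse t E c
       collapse′ =
        let (c , s) = Recursion*.solution collapseStep t E (SR.Value 3 2 4) (E ∷ t ∷ [])
                        (λ _ _ k → k) (λ _ _ k → k) (def₂ t E (S.∃̇ λ v → SR.Value 2 v)) field⊑ wf
                        (λ y R _ → R , refl) (λ { refl refl → refl })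
                        (def₂ t E (S₁.PairIn 2 SR.Value))
            open Solution s
        in c , record { total = total ; dom = dom ; functional = functional
                      ; values = λ m → let (R , V , e) = equation m in subst (λ r → ∀ w → w ∊ r ⇔ _) (sym e) V }

      abstract
        collapse : ∃ λ c → Collapse t E c
        collapse = collapse′

      module _ {c : V} (C : Collapse t E c) where
        open Collapse C

        collapse-mono : ∀ {u y v w} → E ∋⟨ u , y ⟩ → c ∋⟨ u , w ⟩ → c ∋⟨ y , v ⟩ → w ∊ v
        collapse-mono e m n = proj₂ (values n _) (_ , e , m)

        collapse-ord : (∀ {x y z} → E ∋⟨ x , y ⟩ → E ∋⟨ y , z ⟩ → E ∋⟨ x , z ⟩) → ∀ {y v} → c ∋⟨ y , v ⟩ → Ordinal v
        collapse-ord tr {y} {v} m = wf-ind (def₁ c (S.∀̇ λ v → (0 S.∋⟨ 1 , v ⟩) S.⇒ S.Ordinal v)) step (dom m) v m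
          where
          step : ∀ y → y ∊ t → (∀ u → E ∋⟨ u , y ⟩ → ∀ v → c ∋⟨ u , v ⟩ → Ordinal v) → ∀ v → c ∋⟨ y , v ⟩ → Ordinal v
          step y _ ih v m =
            (λ w k x l → let (u , e , p) = proj₁ (values m w) k
                             (u' , e' , p') = proj₁ (values p x) l
                         in proj₂ (values m x) (u' , tr e' e , p')) ,
            (λ w k → let (u , e , p) = proj₁ (values m w) k in proj₁ (ih u e w p))

        collapse-inj : (∀ {x y} → x ∊ t → y ∊ t → E ∋⟨ x , y ⟩ ⊎ x ≡ y ⊎ E ∋⟨ y , x ⟩) →
                       ∀ {x y v} → c ∋⟨ x , v ⟩ → c ∋⟨ y , v ⟩ → x ≡ y
        collapse-inj tot m n with tot (dom m) (dom n)
        ... | inj₁ e = ⊥-elim′ (∉-refl (collapse-mono e m n))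
        ... | inj₂ (inj₁ p) = p
        ... | inj₂ (inj₂ e) = ⊥-elim′ (∉-refl (collapse-mono e n m))

    abstract
      memDefn : (N : V) → RelDefn (λ x y → x ∊ N × x ∊ y)
      memDefn N = def₁ N (S₁.PairIn 1 λ x y → (x S.∊ 0) S.∧ (x S.∊ y))

    -- Only elements of N count as predecessors. With N = t this is membership on t; on t = δ its
    -- collapse gives the order types of the sets N ∩ α.
    memRel : V → V → V
    memRel N t = rel t t (memDefn N)

    mem-wf : ∀ N t → WellFounded t (memRel N t)
    mem-wf N t = record
      { field⊑ = λ e → proj₁ (rel-e (memDefn N) e)
      ; wf = λ B s ne → let (m , k , h) = minimal B ne
                        in m , k , λ u l e → h u (proj₂ (proj₂ (proj₂ (rel-e (memDefn N) e)))) l }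

    -- The hierarchy X₀ ⊆ X₁ ⊆ … with X_α = B ∪ ⋃ { 𝒫(X_β) : β < α }.
    record Hierarchy (B θ h : V) : Set ℓ where
      field
        total        : ∀ {α} → α ∊ θ → ∃ λ X → h ∋⟨ α , X ⟩
        dom          : ∀ {α X} → h ∋⟨ α , X ⟩ → α ∊ θ
        functional   : ∀ {α X Y} → h ∋⟨ α , X ⟩ → h ∋⟨ α , Y ⟩ → X ≡ Y
        isFunctionOn : IsFunctionOn h θ
        level        : ∀ {α Y} → h ∋⟨ α , Y ⟩ → ∀ x → x ∊ Y ⇔ (x ∊ B ⊎ ∃∊ α λ β → ∃ λ X → h ∋⟨ β , X ⟩ × x ⊑ X)

    private
     hierarchy′ : ∀ B θ → Ordinal θ → ∃ λ h → Hierarchy B θ h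
     hierarchy′ B θ oθ = pack (Recursion*.solution (hierarchyStep B) θ E (SR.Value 4 3 5) (B ∷ E ∷ θ ∷ [])
         (λ _ _ k → k) (λ _ _ k → k) (def₃ θ E B (S.∃̇ λ v → SR.Value 3 v)) field⊑ wf
         step (λ p q → ext (λ z m → proj₂ (q z) (proj₁ (p z) m)) (λ z m → proj₂ (p z) (proj₁ (q z) m)))
         (def₃ θ E B (S₁.PairIn 3 SR.Value)))
      where
      E = memRel θ θ
      open WellFounded (mem-wf θ θ)
      module SR = S₂.Recursion (S₃.hierarchyStep 2) 0 1
      toHierarchy : ∀ {h} → Solution (hierarchyStep B) θ E h → Hierarchy B θ h
      toHierarchy {h} s = record
        { total = total ; dom = dom ; functional = functional ; isFunctionOn = isFunctionOn
        ; level = λ m x → (λ k → fwd (equation m) x k) , bwd m (equation m) x }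
        where
        open Solution s
        Equation : V → V → Set ℓ
        Equation α Y = ∃ λ R → Recursion.Values (hierarchyStep B) θ E h α R × hierarchyStep B α R Y
        Element : V → V → Set ℓ
        Element α x = x ∊ B ⊎ ∃∊ α λ β → ∃ λ X → h ∋⟨ β , X ⟩ × x ⊑ X
        fwd : ∀ {α Y} → Equation α Y → ∀ x → x ∊ Y → Element α x
        fwd (R , V , e) x k = [ inj₁ , (λ (X , r , l) → let (β , b , p) = proj₁ (V X) r in inj₂ (β , proj₂ (proj₂ (proj₂ (rel-e (memDefn θ) b))) , X , p , l)) ]′ (proj₁ (e x) k)
        bwd : ∀ {α Y} → h ∋⟨ α , Y ⟩ → Equation α Y → ∀ x → Element α x → x ∊ Y
        bwd m (R , V , e) x k = proj₂ (e x) ([ inj₁ , (λ (β , b , X , p , l) → inj₂ (X , proj₂ (V X) (β , rel-i (memDefn θ) (ord-trans oθ b (dom m)) (dom m) (ord-trans oθ b (dom m) , b) , p) , l)) ]′ k)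
      pack : (∃ λ h → Solution (hierarchyStep B) θ E h) → ∃ λ h → Hierarchy B θ h
      pack (h , s) = h , toHierarchy s
      step : ∀ y R → y ∊ θ → ∃ λ v → hierarchyStep B y R v
      step y R _ = B ∪ sep (𝒫 (⋃ R)) dR , λ z →
        (λ m → [ inj₁ , (λ k → inj₂ (sep-P dR k)) ]′ (∪-e m)) ,
        [ ∪-l , (λ (s , r , k) → ∪-r (sep-i dR (𝒫-i λ x l → ⋃-i (k x l) r) (s , r , k))) ]′
        where
        dR : Defn (λ z → ∃∊ R λ s → z ⊑ s)
        dR = def₁ R (S.∃∊ 0 λ s → 1 S.⊑ s)

    abstract
      hierarchy : ∀ B θ → Ordinal θ → ∃ λ h → Hierarchy B θ h
      hierarchy = hierarchy′

    ⊗-mono : ∀ {A B A' B'} → A ≲ A' → B ≲ B' → A ⊗ B ≲ A' ⊗ B'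
    ⊗-mono {A} {B} {A'} {B'} i j =
      ≲-rel (A ⊗ B) (A' ⊗ B') {λ z z' → PairIn z λ a b → PairIn z' λ a' b' → I.f ∋⟨ a , a' ⟩ × J.f ∋⟨ b , b' ⟩}
        (def₂ I.f J.f (S₁.PairIn 2 λ z z' → S₁.PairIn z λ a b → S₁.PairIn z' λ a' b' → (0 S.∋⟨ a , a' ⟩) S.∧ (1 S.∋⟨ b , b' ⟩)))
        (λ m → let (a , b , p , q , e) = ⊗-e m
                   (a' , k) = I.total p
                   (b' , l) = J.total q
               in pr a' b' , ⊗-i (I.cod k) (J.cod l) , a , b , subst (λ z → IsPair z a b) (sym e) pr-spec , a' , b' , pr-spec , k , l)
        (λ _ _ _ (a , b , p , a' , b' , q , k , l) (c , d , p' , c' , d' , q' , k' , l') →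
          let (e , e') = pair-inj q q'
          in trans (pr-unique p) (trans (cong-pr (I.injective k (subst (λ v → I.f ∋⟨ c , v ⟩) (sym e) k'))
                                                 (J.injective l (subst (λ v → J.f ∋⟨ d , v ⟩) (sym e') l'))) (sym (pr-unique p'))))
      where
      module I = Injection i
      module J = Injection j
      cong-pr : ∀ {x y x' y'} → x ≡ x' → y ≡ y' → pr x y ≡ pr x' y'
      cong-pr refl refl = refl

    ≲-diagonal : ∀ A → A ≲ A ⊗ A
    ≲-diagonal A = ≲-rel A (A ⊗ A) {λ x z → IsPair z x x} (def₀ (S₁.PairIn 0 λ x z → S.IsPair z x x))
      (λ a → _ , ⊗-i a a , pr-spec) (λ _ _ _ p q → proj₁ (pair-inj p q))

    succ-spec : ∀ x → IsSuccessor (succ x) x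
    succ-spec x w = succ-e , [ ∪-l , (λ { refl → succ-i }) ]′

    succ-unique : ∀ {s x} → IsSuccessor s x → s ≡ succ x
    succ-unique {s} {x} h = ext (λ w m → proj₂ (succ-spec x w) (proj₁ (h w) m)) (λ w m → proj₂ (h w) (proj₁ (succ-spec x w) m))

    succ-inj : ∀ {x y} → succ x ≡ succ y → x ≡ y
    succ-inj {x} {y} e = [ (λ m → [ (λ n → ⊥-elim′ (∈-asym m n)) , sym ]′ (succ-e (subst (y ∊_) (sym e) succ-i))) , (λ p → p) ]′ (succ-e (subst (x ∊_) e succ-i))

    succ-∊ : ∀ {α β γ} → Ordinal γ → Ordinal β → α ∊ β → β ∊ γ → succ α ∊ γ
    succ-∊ oγ oβ m n = ⊑-∊-trans (succ-ord (ord-elt oβ m)) oγ (λ x k → [ (λ l → ord-trans oβ l m) , (λ { refl → m }) ]′ (succ-e k)) n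

    module Omega {w : V} (isω : Isω w) where
      oω : Ordinal w
      oω = proj₁ (proj₁ isω)

      ω-succ : ∀ {n} → n ∊ w → succ n ∊ w
      ω-succ m = let (γ , g , k) = proj₂ (proj₂ (proj₁ isω)) _ m in succ-∊ oω (ord-elt oω g) k g

      ω-zero : ∅ ∊ w
      ω-zero = let (n , m) = proj₁ (proj₂ (proj₁ isω))
               in ⊑-∊-trans ((λ x k → ∅-e k) , (λ x k → ∅-e k)) oω (λ x k → ∅-e k) m

      -- A nonempty element n of ω is not a limit, so some β ∈ n has no element of n above it, and
      -- then n is the successor of β.
      ω-cases : ∀ {n} → n ∊ w → n ≡ ∅ ⊎ ∃ λ m → m ∊ n × n ≡ succ m
      ω-cases {n} nw = [ (λ ne → inj₂ (dne λ k → proj₂ isω n nw (on , ne , λ β b → dne λ l →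
          k (β , b , ext (λ x c → [ (λ d → ∪-l d) , [ (λ { refl → succ-i }) , (λ d → ⊥-elim′ (l (x , c , d))) ]′ ]′ (comparable (ord-elt on c) (ord-elt on b)))
                         (λ x c → [ (λ d → ord-trans on d b) , (λ { refl → b }) ]′ (succ-e c)))))) ,
        (λ e → inj₁ (empty-unique λ x m → e (x , m))) ]′ (dec (∃ λ m → m ∊ n))
        where on = ord-elt oω nw

      ω-ind : ∀ {P} → Defn P → P ∅ → (∀ n → n ∊ w → P n → P (succ n)) → ∀ {n} → n ∊ w → P n
      ω-ind {P} d z s = foundation-ind w d λ n m ih →
        [ (λ e → subst P (sym e) z) , (λ (k , l , e) → subst P (sym e) (s k (ord-trans oω l m) (ih k l (ord-trans oω l m)))) ]′ (ω-cases m)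

      -- Dedekind finiteness, chosen because adding a point is then a shift of an injective
      -- sequence. Products follow by adding a row, and a row by adding its points.
      Finite : V → Set ℓ
      Finite x = ¬̇ (w ≲ x)

      finite-⊑ : ∀ {x y} → x ⊑ y → Finite y → Finite x
      finite-⊑ s f i = f (≲-trans i (⊑→≲ s))

      finite-insert : ∀ {x y} → Finite x → Finite (x ∪ sing y)
      finite-insert {x} {y} fin i = fin (≲-rel w x {DropPoint f y ∅}
        (def₃ f y ∅ (S₁.PairIn 3 (S₃.DropPoint 0 1 2))) tot inj)
        where
        open Injection i
        new : ∀ {n z} → f ∋⟨ n , z ⟩ → ¬̇ (z ≡ y) → z ∊ x
        new m n = [ (λ k → k) , (λ k → ⊥-elim′ (n (sing-e k))) ]′ (∪-e (cod m))
        nonzero : ∀ {m n} → IsSuccessor m n → m ≡ ∅ → ⊥ {ℓ}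
        nonzero s refl = ∅-e (proj₂ (s _) (inj₂ refl))
        tot : ∀ {n} → n ∊ w → ∃ λ z → z ∊ x × DropPoint f y ∅ n z
        tot {n} nw =
          let (z' , p) = total (ω-succ nw)
              (z₀ , q) = total ω-zero
          in [ (λ e → z₀ , new q (λ e' → nonzero (succ-spec n) (injective p (subst (λ v → f ∋⟨ ∅ , v ⟩) (trans e' (sym e)) q)))
                      , succ n , succ-spec n , z' , p , inj₂ (e , q))
             , (λ ne → z' , new p ne , succ n , succ-spec n , z' , p , inj₁ (ne , refl)) ]′ (dec (z' ≡ y))
        done : ∀ {m n m' n'} → IsSuccessor m n → IsSuccessor m' n' → m ≡ m' → n ≡ n'
        done s s' refl = succ-inj (trans (sym (succ-unique s)) (succ-unique s'))
        inj : ∀ {n n' z} → n ∊ w → n' ∊ w → z ∊ x → DropPoint f y ∅ n z → DropPoint f y ∅ n' z → n ≡ n'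
        inj _ _ _ (m , s , _ , p , inj₁ (_ , refl)) (m' , s' , _ , p' , inj₁ (_ , refl)) = done s s' (injective p p')
        inj _ _ _ (m , s , _ , p , inj₁ (_ , refl)) (m' , s' , _ , p' , inj₂ (_ , q)) = ⊥-elim′ (nonzero s (injective p q))
        inj _ _ _ (m , s , _ , p , inj₂ (_ , q)) (m' , s' , _ , p' , inj₁ (_ , refl)) = ⊥-elim′ (nonzero s' (injective p' q))
        inj _ _ _ (m , s , _ , p , inj₂ (refl , q)) (m' , s' , _ , p' , inj₂ (refl , q')) = done s s' (injective p p')

      finite-∅ : Finite ∅
      finite-∅ i = let (y , m) = Injection.total i ω-zero in ∅-e (Injection.cod i m)

      finite-row : ∀ x y → Finite x → ∀ {m} → m ∊ w → NotInfinite w (λ z → z ∊ x ⊎ (∃∊ m λ k → IsPair z y k))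
      finite-row x y fin = ω-ind
        (def₃ w x y (S₃.NotInfinite 0 λ z → (z S.∊ 1) S.∨ (S.∃∊ 3 λ k → S.IsPair z 2 k)))
        (λ Q h → finite-⊑ (λ z m → [ (λ k → k) , (λ (k , l , _) → ∅-e l) ]′ (h z m)) fin)
        (λ n nw ih Q h →
          let d = def₃ x y n ((3 S.∊ 0) S.∨ (S.∃∊ 2 λ k → S.IsPair 3 1 k))
              Q' = sep Q {λ z → z ∊ x ⊎ (∃∊ n λ k → IsPair z y k)} d
          in finite-⊑ {Q} {Q' ∪ sing (pr y n)}
               (λ z m → [ (λ k → ∪-l (sep-i d m (inj₁ k)))
                        , (λ (k , l , p) → [ (λ l' → ∪-l (sep-i d m (inj₂ (k , l' , p))))
                                           , (λ e → ∪-r (subst (_∊ sing (pr y n)) (sym (trans (pr-unique p) (cong (pr y) e))) sing-i)) ]′ (succ-e l)) ]′ (h z m))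
               (finite-insert (ih Q' (λ z m → sep-P d m))))

      finite-product : ∀ {m} → m ∊ w → ∀ {n} → n ∊ w → NotInfinite w (ProductElement n m)
      finite-product {m} mw = ω-ind
        (def₂ w m (S₃.NotInfinite 0 (S₁.ProductElement 2 1)))
        (λ Q h → finite-⊑ (λ z k → let (_ , l , _) = h z k in ∅-e l) finite-∅)
        (λ n nw ih Q h →
          let d = def₂ n m (S₁.ProductElement 0 1 2)
              Q' = sep Q {ProductElement n m} d
          in finite-row Q' n (ih Q' (λ z k → sep-P d k)) mw Q
               (λ z k → let (a , p , b , q , r) = h z k in
                 [ (λ p' → inj₁ (sep-i d k (a , p' , b , q , r))) , (λ e → inj₂ (b , q , subst (λ a → IsPair z a b) e r)) ]′ (succ-e p)))

      finite-⊗ : ∀ {n m} → n ∊ w → m ∊ w → Finite (n ⊗ m)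
      finite-⊗ nw mw = finite-product mw nw _ λ z k → let (a , b , p , q , e) = ⊗-e k in a , p , b , q , subst (λ z → IsPair z a b) (sym e) pr-spec

      finite-n : ∀ {n} → n ∊ w → Finite n
      finite-n nw i = finite-⊗ nw nw (≲-trans i (≲-diagonal _))

      hotel : ∀ {m} → Ordinal m → w ⊑ m → succ m ≲ m
      hotel {m} om s = ≲-rel (succ m) m {Hotel w m} (def₂ w m (S₁.PairIn 2 (S₃.Hotel 0 1))) tot
        (λ _ _ _ h h' → inj h h')
        where
        tot : ∀ {x} → x ∊ succ m → ∃ λ y → y ∊ m × Hotel w m x y
        tot {x} k = [ (λ xm → [ (λ xw → succ x , s _ (ω-succ xw) , inj₂ (inj₁ (xw , succ-spec x)))
                              , (λ nw → x , xm , inj₂ (inj₂ (xm , nw , refl))) ]′ (dec (x ∊ w)))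
                    , (λ e → ∅ , s _ ω-zero , inj₁ (e , ∅-empty)) ]′ (succ-e k)
        inj : ∀ {x x' y} → Hotel w m x y → Hotel w m x' y → x ≡ x'
        inj (inj₁ (refl , _)) (inj₁ (refl , _)) = refl
        inj (inj₁ (refl , e)) (inj₂ (inj₁ (xw , k))) = ⊥-elim′ (e _ (proj₂ (k _) (inj₂ refl)))
        inj (inj₁ (refl , e)) (inj₂ (inj₂ (xm , nw , refl))) = ⊥-elim′ (nw (subst (_∊ w) (sym (empty-unique e)) ω-zero))
        inj (inj₂ (inj₁ (xw , k))) (inj₁ (refl , e)) = ⊥-elim′ (e _ (proj₂ (k _) (inj₂ refl)))
        inj (inj₂ (inj₁ (xw , k))) (inj₂ (inj₁ (xw' , k'))) = succ-inj (trans (sym (succ-unique k)) (succ-unique k'))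
        inj (inj₂ (inj₁ (xw , k))) (inj₂ (inj₂ (xm , nw , refl))) = ⊥-elim′ (nw (subst (_∊ w) (sym (succ-unique k)) (ω-succ xw)))
        inj (inj₂ (inj₂ (xm , nw , refl))) (inj₁ (refl , e)) = ⊥-elim′ (nw (subst (_∊ w) (sym (empty-unique e)) ω-zero))
        inj (inj₂ (inj₂ (xm , nw , refl))) (inj₂ (inj₁ (xw , k))) = ⊥-elim′ (nw (subst (_∊ w) (sym (succ-unique k)) (ω-succ xw)))
        inj (inj₂ (inj₂ (_ , _ , refl))) (inj₂ (inj₂ (_ , _ , refl))) = refl

  open Cardinals

  -- Squares of infinite ordinals, Cantor's theorem, successor cardinals and regularity.

  module Hessenberg where
    open Notions₄ interpretation public

    max-unique : ∀ {m a b} → IsMax m a b → m ≡ a ∪ b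
    max-unique h = ext (λ x k → [ ∪-l , ∪-r ]′ (proj₁ (h x) k)) (λ x k → proj₂ (h x) (∪-e k))

    max-spec : ∀ {a b} → IsMax (a ∪ b) a b
    max-spec x = ∪-e , [ ∪-l , ∪-r ]′

    Lex : V → V → V → V → Set ℓ
    Lex a b a' b' = a ∪ b ∊ a' ∪ b' ⊎ (a ∪ b ≡ a' ∪ b' × (a ∊ a' ⊎ (a ≡ a' × b ∊ b')))

    abstract
      gödelDefn : RelDefn Gödel
      gödelDefn = def₀ (S₁.PairIn 0 S₃.Gödel)

    module GödelOrder {κ : V} (oκ : Ordinal κ) where
      t E : V
      t = κ ⊗ κ
      E = rel t t gödelDefn

      E-i : ∀ {a b a' b'} → a ∊ κ → b ∊ κ → a' ∊ κ → b' ∊ κ → Lex a b a' b' → E ∋⟨ pr a b , pr a' b' ⟩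
      E-i p q p' q' l = rel-i gödelDefn (⊗-i p q) (⊗-i p' q')
        (_ , _ , pr-spec , _ , _ , pr-spec , _ , _ , max-spec , max-spec , l)

      E-e : ∀ {a b a' b'} → E ∋⟨ pr a b , pr a' b' ⟩ → Lex a b a' b'
      E-e m = unpack (proj₂ (proj₂ (rel-e gödelDefn m))) {refl} {refl}
        where
        match : ∀ {a b a' b' c d c' d' m m'} → a ≡ c × b ≡ d → a' ≡ c' × b' ≡ d' → m ≡ a ∪ b → m' ≡ a' ∪ b' →
                m ∊ m' ⊎ (m ≡ m' × (a ∊ a' ⊎ (a ≡ a' × b ∊ b'))) → Lex c d c' d'
        match (refl , refl) (refl , refl) refl refl l = l
        unpack : ∀ {z z' c d c' d'} → Gödel z z' → {e : z ≡ pr c d} {e' : z' ≡ pr c' d'} → Lex c d c' d'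
        unpack (a , b , p , a' , b' , p' , m₁ , m₂ , h₁ , h₂ , l) {e} {e'} =
          match (pr-inj (trans (sym (pr-unique p)) e)) (pr-inj (trans (sym (pr-unique p')) e')) (max-unique h₁) (max-unique h₂) l

      E-dom : ∀ {u z} → E ∋⟨ u , z ⟩ → ∃ λ a → ∃ λ b → a ∊ κ × b ∊ κ × u ≡ pr a b
      E-dom m = ⊗-e (proj₁ (rel-e gödelDefn m))
      E-cod : ∀ {u z} → E ∋⟨ u , z ⟩ → ∃ λ a → ∃ λ b → a ∊ κ × b ∊ κ × z ≡ pr a b
      E-cod m = ⊗-e (proj₁ (proj₂ (rel-e gödelDefn m)))

      oel : ∀ {a} → a ∊ κ → Ordinal a
      oel = ord-elt oκ

      lex-trans : ∀ {a b c d e f} → Ordinal e → Ordinal f → Lex a b c d → Lex c d e f → Lex a b e f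
      lex-trans oe of (inj₁ m) (inj₁ n) = inj₁ (ord-trans (∪-ord oe of) m n)
      lex-trans oe of (inj₁ m) (inj₂ (p , _)) = inj₁ (subst (_ ∊_) p m)
      lex-trans oe of (inj₂ (p , _)) (inj₁ n) = inj₁ (subst (_∊ _) (sym p) n)
      lex-trans oe of (inj₂ (p , inj₁ x)) (inj₂ (q , inj₁ y)) = inj₂ (trans p q , inj₁ (ord-trans oe x y))
      lex-trans oe of (inj₂ (p , inj₁ x)) (inj₂ (q , inj₂ (refl , _))) = inj₂ (trans p q , inj₁ x)
      lex-trans oe of (inj₂ (p , inj₂ (refl , _))) (inj₂ (q , inj₁ y)) = inj₂ (trans p q , inj₁ y)
      lex-trans oe of (inj₂ (p , inj₂ (refl , x))) (inj₂ (q , inj₂ (refl , y))) = inj₂ (trans p q , inj₂ (refl , ord-trans of x y))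

      E-trans : ∀ {x y z} → E ∋⟨ x , y ⟩ → E ∋⟨ y , z ⟩ → E ∋⟨ x , z ⟩
      E-trans m n =
        let (a , b , p , q , e) = E-dom m
            (c , d , _ , _ , e') = E-cod m
            (f , g , p' , q' , e'') = E-cod n
        in step e e' e'' p q p' q' m n
        where
        step : ∀ {x y z a b c d f g} → x ≡ pr a b → y ≡ pr c d → z ≡ pr f g → a ∊ κ → b ∊ κ → f ∊ κ → g ∊ κ →
               E ∋⟨ x , y ⟩ → E ∋⟨ y , z ⟩ → E ∋⟨ x , z ⟩
        step refl refl refl p q p' q' m n = E-i p q p' q' (lex-trans (oel p') (oel q') (E-e m) (E-e n))

      E-total : ∀ {x y} → x ∊ t → y ∊ t → E ∋⟨ x , y ⟩ ⊎ x ≡ y ⊎ E ∋⟨ y , x ⟩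
      E-total m n with ⊗-e m | ⊗-e n
      ... | a , b , p , q , refl | c , d , p' , q' , refl with comparable (∪-ord (oel p) (oel q)) (∪-ord (oel p') (oel q'))
      ... | inj₁ k = inj₁ (E-i p q p' q' (inj₁ k))
      ... | inj₂ (inj₂ k) = inj₂ (inj₂ (E-i p' q' p q (inj₁ k)))
      ... | inj₂ (inj₁ e) with comparable (oel p) (oel p')
      ...   | inj₁ k = inj₁ (E-i p q p' q' (inj₂ (e , inj₁ k)))
      ...   | inj₂ (inj₂ k) = inj₂ (inj₂ (E-i p' q' p q (inj₂ (sym e , inj₁ k))))
      ...   | inj₂ (inj₁ refl) with comparable (oel q) (oel q')
      ...     | inj₁ k = inj₁ (E-i p q p' q' (inj₂ (e , inj₂ (refl , k))))
      ...     | inj₂ (inj₁ refl) = inj₂ (inj₁ refl)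
      ...     | inj₂ (inj₂ k) = inj₂ (inj₂ (E-i p' q' p q (inj₂ (sym e , inj₂ (refl , k)))))

      E-wf : WellFounded t E
      E-wf = record
        { field⊑ = λ m → proj₁ (rel-e gödelDefn m)
        ; wf = λ B s (z , zB) →
            let (a , b , p , q , e) = ⊗-e (s z zB)
                zp = λ {x} → subst (λ z → IsPair z a b) (sym e) pr-spec
                (μ , oμ , P₁ , l₁ , _) = least {MaxOf B} (def₁ B (S₄.MaxOf 0 1)) (∪-ord (oel p) (oel q)) (z , zB , a , b , zp {z} , max-spec)
            in minimize B s μ P₁ l₁ }
        where
        minimize : ∀ B → B ⊑ t → ∀ μ → MaxOf B μ → (∀ ν → ν ∊ μ → ¬̇ MaxOf B ν) → ∃ λ m → m ∊ B × (∀ u → u ∊ B → ¬̇ (E ∋⟨ u , m ⟩))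
        minimize B s μ (z , zB , a , b , p , x) l₁ =
          let oa = λ {a} {b} {z} (p : IsPair z a b) (zB : z ∊ B) → ⊗-e₂ (subst (_∊ t) (pr-unique p) (s z zB))
              (a₀ , _ , (z₀ , z₀B , b₀ , p₀ , x₀) , l₂ , _) = least {FirstWith B μ} (def₂ B μ (S₄.FirstWith 0 1 2)) (oel (proj₁ (oa p zB))) (z , zB , b , p , x)
              (b₁ , _ , (z₁ , z₁B , p₁ , x₁) , l₃ , _) = least {SecondWith B μ a₀} (def₃ B μ a₀ (S₄.SecondWith 0 1 2 3)) (oel (proj₂ (oa p₀ z₀B))) (z₀ , z₀B , p₀ , x₀)
          in z₁ , z₁B , λ u uB e → contra B μ a₀ b₁ z₁ p₁ x₁ l₁ l₂ l₃ u uB e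
          where
          contra : ∀ B μ a b z → IsPair z a b → IsMax μ a b → (∀ ν → ν ∊ μ → ¬̇ MaxOf B ν) → (∀ c → c ∊ a → ¬̇ FirstWith B μ c) →
                   (∀ d → d ∊ b → ¬̇ SecondWith B μ a d) → ∀ u → u ∊ B → ¬̇ (E ∋⟨ u , z ⟩)
          contra B μ a b z p x l₁ l₂ l₃ u uB e =
            let (c , d , cκ , dκ , ue) = E-dom e
                up = subst (λ u → IsPair u c d) (sym ue) pr-spec
                μe = max-unique x
                lex = E-e (subst (λ u → E ∋⟨ u , pr a b ⟩) ue (subst (λ z → E ∋⟨ u , z ⟩) (pr-unique p) e))
                atμ = λ (q : c ∪ d ≡ a ∪ b) → subst (λ m → IsMax m c d) (trans q (sym μe)) max-spec
            in [ (λ k → l₁ _ (subst (c ∪ d ∊_) (sym μe) k) (u , uB , c , d , up , max-spec))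
               , (λ (q , r) → [ (λ k → l₂ c k (u , uB , d , up , atμ q))
                              , (λ (c≡a , k) → l₃ d k (u , uB , subst (λ c → IsPair u c d) c≡a up , subst (λ c → IsMax μ c d) c≡a (atμ q))) ]′ r) ]′ lex

      o : V
      o = proj₁ (collapse E-wf)
      oC : Collapse t E o
      oC = proj₂ (collapse E-wf)

      -- In Gödel's order every predecessor of (a, b) has both coordinates at most m = max(a, b).
      -- The initial segment of order type γ thus lies in the square of m + 1.
      below : ∀ {z γ} → o ∋⟨ z , γ ⟩ → ∃ λ m → m ∊ κ × γ ≲ succ m ⊗ succ m
      below {z} {γ} h with ⊗-e (Collapse.dom oC h)
      ... | a , b , p , q , refl = a ∪ b , mκ ,
        ≲-rel γ (succ (a ∪ b) ⊗ succ (a ∪ b)) {λ ξ u → o ∋⟨ u , ξ ⟩} (def₁ o (S₁.PairIn 1 λ ξ u → 0 S.∋⟨ u , ξ ⟩))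
          (λ ξγ → let (u , e , k) = proj₁ (Collapse.values oC h _) ξγ in u , inside u e , k)
          (λ _ _ _ k l → Collapse.functional oC k l)
        where
        mκ : a ∪ b ∊ κ
        mκ = [ (λ s → subst (_∊ κ) (ext (λ x → ∪-r) (λ x k → [ s x , (λ l → l) ]′ (∪-e k))) q)
             , (λ k → subst (_∊ κ) (ext (λ x → ∪-l) (λ x l → [ (λ l → l) , (λ l → ord-trans (oel p) l k) ]′ (∪-e l))) p) ]′ (ord-cases (oel p) (oel q))
        om : Ordinal (a ∪ b)
        om = oel mκ
        inside′ : ∀ {c d} → c ∊ κ → d ∊ κ → E ∋⟨ pr c d , pr a b ⟩ → pr c d ∊ succ (a ∪ b) ⊗ succ (a ∪ b)
        inside′ {c} {d} cκ dκ e = ⊗-i (le (oel cκ) λ x → ∪-l) (le (oel dκ) λ x → ∪-r)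
          where
          m≤ : c ∪ d ⊑ a ∪ b
          m≤ = [ (λ k → proj₁ om _ k) , (λ (q , _) → subst (_⊑ (a ∪ b)) (sym q) ⊑-refl) ]′ (E-e e)
          le : ∀ {x} → Ordinal x → x ⊑ c ∪ d → x ∊ succ (a ∪ b)
          le ox s = ⊑-∊-trans ox (succ-ord om) (⊑-trans s m≤) succ-i
        inside : ∀ u → E ∋⟨ u , pr a b ⟩ → u ∊ succ (a ∪ b) ⊗ succ (a ∪ b)
        inside u e = let (c , d , cκ , dκ , q) = E-dom e
                     in subst (_∊ succ (a ∪ b) ⊗ succ (a ∪ b)) (sym q) (inside′ cκ dκ (subst (λ u → E ∋⟨ u , pr a b ⟩) q e))

    module _ {w : V} (isω : Isω w) where
      open Omega isω

      infinite-below : ∀ {κ β} → Ordinal β → w ⊑ κ → κ ≲ β → w ⊑ β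
      infinite-below oβ s i = [ (λ k → k) , (λ k → ⊥-elim′ (finite-n k (≲-trans (⊑→≲ s) i))) ]′ (ord-cases oω oβ)

      -- By induction on κ. If κ injects into a smaller ordinal β, the hypothesis at β suffices.
      -- Otherwise every proper initial segment of Gödel's order lies in the square of some m + 1 <
      -- κ, into which κ does not inject; its order type is then below κ, and the order isomorphism
      -- maps the whole square into κ.
      hessenberg : ∀ {κ} → Ordinal κ → w ⊑ κ → κ ⊗ κ ≲ κ
      hessenberg oκ s = ord-ind {Squares w} (def₁ w (S₃.Squares 0 1)) step oκ s _ λ z k →
        let (a , b , p , q , e) = ⊗-e k in a , p , b , q , subst (λ z → IsPair z a b) (sym e) pr-spec
        where
        square : ∀ {β} → Squares w β → w ⊑ β → β ⊗ β ≲ β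
        square h s = h s _ λ z k → let (a , b , p , q , e) = ⊗-e k in a , p , b , q , subst (λ z → IsPair z a b) (sym e) pr-spec
        step : ∀ κ → Ordinal κ → (∀ β → β ∊ κ → Squares w β) → Squares w κ
        step κ oκ ih s Q hQ = ≲-trans (⊑→≲ Q⊑) ([ small , large ]′ (dec (∃ λ β → β ∊ κ × κ ≲ β)))
          where
          open GödelOrder oκ
          Q⊑ : Q ⊑ κ ⊗ κ
          Q⊑ z k = let (a , p , b , q , e) = hQ z k in subst (_∊ κ ⊗ κ) (sym (pr-unique e)) (⊗-i p q)
          small : (∃ λ β → β ∊ κ × κ ≲ β) → κ ⊗ κ ≲ κ
          small (β , k , i) = ≲-trans (⊗-mono i i) (≲-trans (square (ih β k) (infinite-below (oel k) s i)) (⊑→≲ (proj₁ oκ β k)))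
          large : ¬̇ (∃ λ β → β ∊ κ × κ ≲ β) → κ ⊗ κ ≲ κ
          large n = ≲-rel (κ ⊗ κ) κ {λ z γ → o ∋⟨ z , γ ⟩} (def₁ o (S₁.PairIn 1 λ z γ → 0 S.∋⟨ z , γ ⟩))
            (λ {z} zt → let (γ , h) = Collapse.total oC zt in γ , value∈κ h , h)
            (λ _ _ _ h h' → collapse-inj E-wf oC E-total h h')
            where
            succ-closed : ∀ {m} → m ∊ κ → succ m ∊ κ
            succ-closed {m} k = [ (λ l → [ (λ sm → ⊥-elim′ (n (m , k , ≲-trans (⊑→≲ l) (hotel (oel k) sm))))
                                         , (λ mw → ⊥-elim′ (∉-refl (l _ (s _ (ω-succ mw))))) ]′ (ord-cases oω (oel k)))
                                , (λ l → l) ]′ (ord-cases oκ (succ-ord (oel k)))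
            value∈κ : ∀ {z γ} → o ∋⟨ z , γ ⟩ → γ ∊ κ
            value∈κ {z} {γ} h = [ (λ l → ⊥-elim′ (absurd′ (≲-trans (⊑→≲ l) (proj₂ (proj₂ (below h)))))) , (λ l → l) ]′ (ord-cases oκ (collapse-ord E-wf oC E-trans h))
              where
              m = proj₁ (below h)
              mκ = proj₁ (proj₂ (below h))
              absurd′ : κ ≲ succ m ⊗ succ m → ⊥ {ℓ}
              absurd′ i = [ (λ sm → n (succ m , succ-closed mκ , ≲-trans i (square (ih _ (succ-closed mκ)) sm)))
                          , (λ mw → finite-⊗ mw mw (≲-trans (⊑→≲ s) i)) ]′ (ord-cases oω (oel (succ-closed mκ)))

    fun-⊑ : ∀ {f A B} → IsFunction f A B → f ⊑ A ⊗ B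
    fun-⊑ {f} {A} {B} h z m =
      let (x , a , y , p) = proj₁ (proj₁ (proj₁ h)) z m
      in subst (_∊ A ⊗ B) (sym (pr-unique p)) (⊗-i a (proj₂ h x y (z , m , p)))

    cantor : ∀ {A} → ¬̇ (𝒫 A ≲ A)
    cantor {A} i = out inn
      where
      open Injection i
      dΔ : Defn (Diagonal f)
      dΔ = def₁ f (S₄.Diagonal 0 1)
      Δ = sep A dΔ
      Δ∈ : Δ ∊ 𝒫 A
      Δ∈ = 𝒫-i (sep-⊑ dΔ)
      x = proj₁ (total Δ∈)
      fx : f ∋⟨ Δ , x ⟩
      fx = proj₂ (total Δ∈)
      out : ¬̇ (x ∊ Δ)
      out m = let (y , p , q) = sep-P dΔ m in q (subst (x ∊_) (injective fx p) m)
      inn : x ∊ Δ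
      inn = sep-i dΔ (cod fx) (Δ , fx , out)

    -- μ is the least ordinal that does not inject into β. The ordinal β need not be a cardinal, so
    -- this also gives the cardinal above max(β, ω₂) for any β.
    record SuccessorOf (β μ : V) : Set ℓ where
      field
        ordinal : Ordinal μ
        larger  : ¬̇ (μ ≲ β)
        below   : ∀ {α} → α ∊ μ → α ≲ β

      cardinal : Cardinal μ
      cardinal = ordinal , λ (α , m , i) → larger (≲-trans i (below m))

      β∊ : Ordinal β → β ∊ μ
      β∊ oβ = [ (λ s → ⊥-elim′ (larger (⊑→≲ s))) , (λ k → k) ]′ (ord-cases ordinal oβ)

      isSuccessorCardinal : Cardinal β → IsSuccessorCardinal μ β
      isSuccessorCardinal (oβ , _) = cardinal , β∊ oβ , λ ν m (oν , c) →
        [ (λ s → s) , (λ k → ⊥-elim′ (c (β , k , below m))) ]′ (ord-cases oν oβ)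

      small→∊ : ∀ {α} → Ordinal α → α ≲ β → α ∊ μ
      small→∊ oα i = [ (λ s → ⊥-elim′ (larger (≲-trans (⊑→≲ s) i))) , (λ k → k) ]′ (ord-cases ordinal oα)

      module _ {w} (isω : Isω w) (oβ : Ordinal β) (inf : w ⊑ β) where
        open Omega isω

        succ-closed : ∀ {α} → α ∊ μ → succ α ∊ μ
        succ-closed {α} m = small→∊ (succ-ord oα)
          ([ (λ s → ≲-trans (hotel oα s) (below m)) , (λ k → ⊑→≲ (proj₁ oβ _ (inf _ (ω-succ k)))) ]′ (ord-cases oω oα))
          where oα = ord-elt ordinal m

        regular : Regular μ
        regular = cardinal , (ordinal , (β , β∊ oβ) , λ α m → succ α , succ-closed m , succ-i) , λ α m f h → bound m h
          where
          bound : ∀ {α f} → α ∊ μ → IsFunction f α μ → ∃ λ γ → γ ∊ μ × ∀ x y → f ∋⟨ x , y ⟩ → y ∊ γ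
          bound {α} {f} αμ hf = dne λ n → small n (select μ (𝒫 (μ ⊗ β)) dI λ m → initial m (below (succ-closed m)))
            where
            dI : RelDefn (InitialInjection β)
            dI = def₁ β (S₁.PairIn 1 (S₄.InitialInjection 0))
            initial : ∀ {y} → y ∊ μ → succ y ≲ β → ∃ λ e → e ∊ 𝒫 (μ ⊗ β) × InitialInjection β y e
            initial {y} m (e , h , j) = e , 𝒫-i (λ z k → let (a , b , p , q , r) = ⊗-e (fun-⊑ h z k)
                                                         in subst (_∊ μ ⊗ β) (sym r) (⊗-i (ord-trans ordinal p (succ-closed m)) q))
                                      , succ y , succ-spec y , h , j
            -- If f is unbounded, each ξ ∈ μ is at most some value y = f(x), so ξ ∈ y + 1. It is
            -- coded by x and its number under a chosen injection of y + 1 into β. The codes form a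
            -- set of size |β|, which is too small for μ.
            unbounded : ∀ i → Selection i μ (𝒫 (μ ⊗ β)) (InitialInjection β) →
                        ¬̇ (∃ λ γ → γ ∊ μ × ∀ x y → f ∋⟨ x , y ⟩ → y ∊ γ) → μ ≲ α ⊗ β
            unbounded i sel n = ≲-rel μ (α ⊗ β) {Spread f i} (def₂ f i (S₁.PairIn 2 (S₄.Spread 0 1)))
              (λ {ξ} m → dne λ k → n (ξ , m , λ x y p → at m p (total (proj₂ hf x y p)) k))
              (λ { _ _ _ (x , y , e , v , p , q , r , t) (x' , y' , e' , v' , p' , q' , r' , t') → same p q r t p' q' r' t' })
              where
              open Selection sel
              at : ∀ {ξ x y} → ξ ∊ μ → f ∋⟨ x , y ⟩ → (∃ λ e → i ∋⟨ y , e ⟩) → ¬̇ (∃ λ z → z ∊ α ⊗ β × Spread f i ξ z) → y ∊ ξ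
              at {ξ} {x} {y} m p (e , q) k = initial′ (holds q)
                where
                oy : Ordinal y
                oy = ord-elt ordinal (proj₂ hf x y p)
                initial′ : InitialInjection β y e → y ∊ ξ
                initial′ (s , hs , he , _) = [ (λ l → ⊥-elim′ (k (hit (proj₂ (proj₁ he) ξ (subst (ξ ∊_) (sym (succ-unique hs)) (⊑-∊-trans (ord-elt ordinal m) (succ-ord oy) l succ-i))))))
                                             , (λ l → l) ]′ (ord-cases (ord-elt ordinal m) oy)
                  where
                  hit : (∃ λ v → e ∋⟨ ξ , v ⟩) → ∃ λ z → z ∊ α ⊗ β × Spread f i ξ z
                  hit (v , r) = pr x v , ⊗-i (proj₁ (⊗-e₂ (fun-⊑ hf _ (∋-e p)))) (proj₂ he ξ v r) , x , y , e , v , p , q , r , pr-spec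
              same : ∀ {ξ ξ' z x y e v x' y' e' v'} → f ∋⟨ x , y ⟩ → i ∋⟨ y , e ⟩ → e ∋⟨ ξ , v ⟩ → IsPair z x v →
                     f ∋⟨ x' , y' ⟩ → i ∋⟨ y' , e' ⟩ → e' ∋⟨ ξ' , v' ⟩ → IsPair z x' v' → ξ ≡ ξ'
              same {x = x} {y} {y' = y'} p q r t p' q' r' t' with pair-inj t t'
              ... | refl , refl with proj₂ (proj₁ (proj₁ hf)) x y y' p p'
              ... | refl with functional _ _ _ q q'
              ... | refl = let (s , _ , _ , j) = holds q in j _ _ _ r r'
            small : ¬̇ (∃ λ γ → γ ∊ μ × ∀ x y → f ∋⟨ x , y ⟩ → y ∊ γ) → ¬̇ (∃ λ i → Selection i μ (𝒫 (μ ⊗ β)) (InitialInjection β))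
            small n (i , sel) = larger (≲-trans (unbounded i sel n) (≲-trans (⊗-mono (below αμ) ≲-refl) (hessenberg isω oβ inf)))

    module Bounding {lam : V} (reg : Regular lam) where
      oλ : Ordinal lam
      oλ = proj₁ (proj₁ reg)

      limit : ∀ {α} → α ∊ lam → succ α ∊ lam
      limit m = let (γ , g , k) = proj₂ (proj₂ (proj₁ (proj₂ reg))) _ m in succ-∊ oλ (ord-elt oλ g) k g

      zero∊ : ∅ ∊ lam
      zero∊ = let (n , m) = proj₁ (proj₂ (proj₁ (proj₂ reg)))
              in ⊑-∊-trans ((λ x k → ∅-e k) , (λ x k → ∅-e k)) oλ (λ x k → ∅-e k) m

      -- Regularity is stated for functions on ordinals. A set A of size below λ is moved to an
      -- ordinal along its injection, after a value has been chosen for each of its elements.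
      bounding : ∀ {A R} → SizeBelow A lam → RelDefn R → (∀ {a} → a ∊ A → ∃ λ β → β ∊ lam × R a β) →
                 ∃ λ γ → γ ∊ lam × ∀ {a} → a ∊ A → ∃ λ β → β ∊ γ × R a β
      bounding {A} {R} (α , αλ , i) d h = first (select A lam d h)
        where
        open Injection i using (f; total; cod; dom; injective)
        Res : Set ℓ
        Res = ∃ λ γ → γ ∊ lam × ∀ {a} → a ∊ A → ∃ λ β → β ∊ γ × R a β
        module _ {g : V} (sg : Selection g A lam R) where
          Inverse : V → Set ℓ
          Inverse ξ = ∃ λ a → f ∋⟨ a , ξ ⟩
          tot : ∀ {ξ} → Inverse ξ ⊎ ¬̇ Inverse ξ → ∃ λ y → y ∊ lam × TransferTo f g ξ y
          tot (inj₁ (a , k)) = let (y , q) = Selection.total sg (dom k) in y , Selection.cod sg q , inj₁ (a , k , q)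
          tot (inj₂ n) = ∅ , zero∊ , inj₂ (n , ∅-empty)
          conclude : ∀ {a ξ y} → f ∋⟨ a , ξ ⟩ → TransferTo f g ξ y → R a y
          conclude p (inj₁ (a' , p' , q)) = subst (λ a → R a _) (injective p' p) (Selection.holds sg q)
          conclude p (inj₂ (n , _)) = ⊥-elim′ (n (_ , p))
          bound : ∀ {k γ} → Selection k α lam (TransferTo f g) → γ ∊ lam → (∀ x y → k ∋⟨ x , y ⟩ → y ∊ γ) → Res
          bound {k} {γ} sf γλ b = γ , γλ , λ aA → value (total aA)
            where
            value : ∀ {a} → (∃ λ ξ → f ∋⟨ a , ξ ⟩) → ∃ λ β → β ∊ γ × R a β
            value (ξ , p) = let (y , q) = Selection.total sf (cod p) in y , b ξ y q , conclude p (Selection.holds sf q)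
          second : (∃ λ k → Selection k α lam (TransferTo f g)) → Res
          second (k , sf) = let (γ , γλ , b) = proj₂ (proj₂ reg) α αλ k (Selection.isFunction sf) in bound sf γλ b
        first : (∃ λ g → Selection g A lam R) → Res
        first (g , sg) = second sg (select α lam {TransferTo f g} (def₂ f g (S₁.PairIn 2 (S₄.TransferTo 0 1))) λ {ξ} _ → tot sg (dec (Inverse sg ξ)))

    ω-unique : ∀ {w w'} → Isω w → Isω w' → w ≡ w'
    ω-unique (l , h) (l' , h') = [ (λ m → ⊥-elim′ (h' _ m l)) , [ (λ e → e) , (λ m → ⊥-elim′ (h _ m l')) ]′ ]′ (comparable (proj₁ l) (proj₁ l'))

    successor-unique : ∀ {μ μ' κ} → IsSuccessorCardinal μ κ → IsSuccessorCardinal μ' κ → μ ≡ μ'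
    successor-unique (c , k , h) (c' , k' , h') =
      [ (λ m → ⊥-elim′ (∉-refl (h' _ m c _ k))) , [ (λ e → e) , (λ m → ⊥-elim′ (∉-refl (h _ m c' _ k'))) ]′ ]′ (comparable (proj₁ c) (proj₁ c'))

    ω₁-unique : ∀ {μ μ'} → Isω₁ μ → Isω₁ μ' → μ ≡ μ'
    ω₁-unique (w , h , s) (w' , h' , s') with ω-unique h h'
    ... | refl = successor-unique s s'

    ω₂-unique : ∀ {μ μ'} → Isω₂ μ → Isω₂ μ' → μ ≡ μ'
    ω₂-unique (w , h , s) (w' , h' , s') with ω₁-unique h h'
    ... | refl = successor-unique s s'

  open Hessenberg

  -- The cardinals below an inaccessible.

  module Levels where
    open Notions₅ interpretation public

    𝒫-mono : ∀ {A B} → A ≲ B → 𝒫 A ≲ 𝒫 B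
    𝒫-mono {A} {B} i = ≲-rel (𝒫 A) (𝒫 B) {ImageOf f} (def₁ f (S₁.PairIn 1 (S₅.ImageOf 0)))
      (λ {x} xA → image x , 𝒫-i (sep-⊑ (dI x)) , λ b → sep-P (dI x) , λ (a , m , k) → sep-i (dI x) (cod k) (a , m , k))
      (λ p q _ h h' → ext (incl p h h') (incl q h' h))
      where
      open Injection i
      dI : ∀ x → Defn (λ b → ∃∊ x λ a → f ∋⟨ a , b ⟩)
      dI x = def₂ f x (S.∃∊ 1 λ a → 0 S.∋⟨ a , 2 ⟩)
      image : V → V
      image x = sep B (dI x)
      incl : ∀ {x x' y} → x ∊ 𝒫 A → ImageOf f x y → ImageOf f x' y → x ⊑ x'
      incl p h h' a m = let (b , k) = total (𝒫-e p a m)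
                            (a' , m' , k') = proj₁ (h' b) (proj₂ (h b) (a , m , k))
                        in subst (_∊ _) (injective k' k) m'

    sizeBelow-trans : ∀ {A B κ} → A ≲ B → SizeBelow B κ → SizeBelow A κ
    sizeBelow-trans i (α , m , j) = α , m , ≲-trans i j

    record Frame (δ : V) : Set ℓ where
      field
        regδ  : Regular δ
        w ω₁ ω₂ : V
        isω   : Isω w
        w∈δ   : w ∊ δ
        succ₁ : SuccessorOf w ω₁
        ω₁∈δ  : ω₁ ∊ δ
        isω₁  : Isω₁ ω₁
        succ₂ : SuccessorOf ω₁ ω₂
        ω₂∈δ  : ω₂ ∊ δ
        isω₂  : Isω₂ ω₂
        successorBelow : ∀ {β} → β ∊ δ → ∃ λ μ → μ ∊ δ × SuccessorOf β μ
        𝒫-small : ∀ {A} → SizeBelow A δ → SizeBelow (𝒫 A) δ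
        h     : V
        hier  : Hierarchy ∅ δ h

    frame : ∀ {δ} → Inaccessible δ → Frame δ
    frame {δ} (reg , (w , wδ , isω) , strong) = record
      { regδ = reg ; w = w ; ω₁ = proj₁ s₁ ; ω₂ = proj₁ s₂ ; isω = isω ; w∈δ = wδ
      ; succ₁ = proj₂ (proj₂ s₁) ; ω₁∈δ = proj₁ (proj₂ s₁) ; isω₁ = i₁
      ; succ₂ = proj₂ (proj₂ s₂) ; ω₂∈δ = proj₁ (proj₂ s₂)
      ; isω₂ = proj₁ s₁ , i₁ , SuccessorOf.isSuccessorCardinal (proj₂ (proj₂ s₂)) (SuccessorOf.cardinal (proj₂ (proj₂ s₁)))
      ; successorBelow = successor ; 𝒫-small = power
      ; h = proj₁ (hierarchy ∅ δ oδ) ; hier = proj₂ (hierarchy ∅ δ oδ) }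
      where
      open Omega isω using (oω; finite-n)
      oδ : Ordinal δ
      oδ = proj₁ (proj₁ reg)
      power : ∀ {A} → SizeBelow A δ → SizeBelow (𝒫 A) δ
      power (α , m , i) = sizeBelow-trans (𝒫-mono i) (strong α m (𝒫 α) (𝒫-spec α))
      -- The least ordinal that does not inject into β is below δ: since δ is a strong limit, 𝒫(β)
      -- injects into some γ < δ, and by Cantor's theorem this γ does not inject into β.
      successor : ∀ {β} → β ∊ δ → ∃ λ μ → μ ∊ δ × SuccessorOf β μ
      successor {β} m =
        let (μ , oμ , big , min , _) = least {λ α → ¬̇ (α ≲ β)} (def₁ β (S.¬̇ (S₃.Inj 1 0))) oδ (λ i → proj₂ (proj₁ reg) (β , m , i))
            (γ , g , i) = power (β , m , ≲-refl)
        in μ , [ (λ s → ⊥-elim′ (min γ (s γ g) λ j → cantor (≲-trans i j))) , (λ k → k) ]′ (ord-cases oδ oμ)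
             , record { ordinal = oμ ; larger = big ; below = λ {α} k → dne (min α k) }
      s₁ = successor wδ
      s₂ = successor (proj₁ (proj₂ s₁))
      i₁ : Isω₁ (proj₁ s₁)
      i₁ = w , isω , SuccessorOf.isSuccessorCardinal (proj₂ (proj₂ s₁)) (oω , λ (n , m , i) → finite-n m i)

  open Levels

  -- Terms and their values.

  module Evaluation where
    open Notions₆ interpretation public

    record TermBase (B Π c₀ c₁ c₂ : V) : Set ℓ where
      field
        Π-total : ∀ {i j} → i ∊ B → j ∊ B → ∃ λ k → k ∊ B × Π ∋⟨ pr i j , k ⟩
        Π-functional : ∀ {z k k'} → Π ∋⟨ z , k ⟩ → Π ∋⟨ z , k' ⟩ → k ≡ k'
        Π-injective : ∀ {z z' k} → Π ∋⟨ z , k ⟩ → Π ∋⟨ z' , k ⟩ → z ≡ z'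
        c₀∊ : c₀ ∊ B
        c₁∊ : c₁ ∊ B
        c₂∊ : c₂ ∊ B
        c₀≢c₁ : c₀ ≡ c₁ → ⊥ {ℓ}
        c₀≢c₂ : c₀ ≡ c₂ → ⊥ {ℓ}
        c₁≢c₂ : c₁ ≡ c₂ → ⊥ {ℓ}

    -- The relation "the term i has the value x", for terms built from the leaves
    -- e by pairing and by applying G.
    record Eval (W B Π e G c₀ c₁ c₂ K : V) : Set ℓ where
      open Terms Π e G c₀ c₁ c₂
      field
        graph   : K ⊑ W ⊗ B
        leaf    : ∀ {x j} → x ∊ W → j ∊ B → e ∋⟨ x , j ⟩ → ∀ {i} → Code i c₀ j → K ∋⟨ x , i ⟩
        node    : ∀ {x y i j k l} → K ∋⟨ x , i ⟩ → K ∋⟨ y , j ⟩ → Code k i j → Code l c₁ k → K ∋⟨ pr x y , l ⟩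
        apply   : ∀ {x y i j} → K ∋⟨ x , i ⟩ → G ∋⟨ x , y ⟩ → Code j c₂ i → K ∋⟨ y , j ⟩
        unique  : ∀ {x y i} → K ∋⟨ x , i ⟩ → K ∋⟨ y , i ⟩ → x ≡ y
      K-dom : ∀ {x i} → K ∋⟨ x , i ⟩ → x ∊ W
      K-dom m = proj₁ (⊗-e₂ (graph _ (∋-e m)))
      K-cod : ∀ {x i} → K ∋⟨ x , i ⟩ → i ∊ B
      K-cod m = proj₂ (⊗-e₂ (graph _ (∋-e m)))

    module MakeEval {W B Π e G c₀ c₁ c₂ : V} (tb : TermBase B Π c₀ c₁ c₂)
      (W-pair : ∀ {x y} → x ∊ W → y ∊ W → pr x y ∊ W)
      (e-inj : ∀ {x x' j} → e ∋⟨ x , j ⟩ → e ∋⟨ x' , j ⟩ → x ≡ x')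
      (G⊑ : G ⊑ W ⊗ W) (G-fun : Functional G)
      where
      open TermBase tb
      open Terms Π e G c₀ c₁ c₂

      code-∊ : ∀ {i a b} → a ∊ B → b ∊ B → Code i a b → i ∊ B
      code-∊ a b (z , p , m) = let (k , kB , n) = Π-total a b
                               in subst (_∊ B) (Π-functional (subst (λ z → Π ∋⟨ z , k ⟩) (sym (pr-unique p)) n) m) kB

      code-inj : ∀ {i a b a' b'} → Code i a b → Code i a' b' → a ≡ a' × b ≡ b'
      code-inj (z , p , m) (z' , p' , m') = pair-inj p (subst (λ z → IsPair z _ _) (Π-injective m' m) p')

      private
        𝒦 : V
        𝒦 = 𝒫 (W ⊗ B)

        abstract
          derivable : Defn (Derivable W B 𝒦)
          derivable = def (S₆.Terms.Derivable 0 1 2 3 4 5 6 7 8 9 10) (𝒦 ∷ B ∷ W ∷ c₂ ∷ c₁ ∷ c₀ ∷ G ∷ e ∷ Π ∷ [])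

          ruleDefn : ∀ K → RelDefn (Rule K)
          ruleDefn K = def₇ Π e G c₀ c₁ c₂ K (S₁.PairIn 7 (S₆.Terms.Rule 0 1 2 3 4 5 6))

          uniqueDefn : ∀ K → RelDefn (UniqueValue K)
          uniqueDefn K = def₇ Π e G c₀ c₁ c₂ K (S₁.PairIn 7 (S₆.Terms.UniqueValue 0 1 2 3 4 5 6))

        K : V
        K = sep (W ⊗ B) derivable

        K⊑ : K ⊑ W ⊗ B
        K⊑ = sep-⊑ derivable

        least-K : ∀ {K'} → K' ⊑ W ⊗ B → RuleClosed W B K' → K ⊑ K'
        least-K s c z m = sep-P derivable m _ (𝒫-i s) c

        rule-mono : ∀ {K K' x i} → K ⊑ K' → Rule K x i → Rule K' x i
        rule-mono s (inj₁ r) = inj₁ r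
        rule-mono s (inj₂ (inj₁ (x , y , i , j , k , m , n , r))) = inj₂ (inj₁ (x , y , i , j , k , ∋-i (s _ (∋-e m)) , ∋-i (s _ (∋-e n)) , r))
        rule-mono s (inj₂ (inj₂ (x , i , m , r))) = inj₂ (inj₂ (x , i , ∋-i (s _ (∋-e m)) , r))

        K-closed : RuleClosed W B K
        K-closed x xW i iB r = ∋-i (sep-i derivable (⊗-i xW iB) λ K' k c →
          ∋-e (c x xW i iB (rule-mono (λ z m → least-K (𝒫-e k) c z m) r)))

        -- Inversion from leastness: the part of K obtained by a rule applied inside K is closed
        -- under the rules, hence is all of K.
        K-rule : ∀ {x i} → K ∋⟨ x , i ⟩ → Rule K x i
        K-rule {x} {i} m = proj₂ (proj₂ (rel-e (ruleDefn K) (∋-i (sep-i (ruleDefn K) (K⊑ _ (∋-e m))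
          (sep-P (ruleDefn K) (least-K {sep K (ruleDefn K)} (⊑-trans (sep-⊑ (ruleDefn K)) K⊑)
            (λ x xW i iB r → let r' = rule-mono (sep-⊑ (ruleDefn K)) r
                             in ∋-i (sep-i (ruleDefn K) (∋-e (K-closed x xW i iB r')) (x , i , pr-spec , r'))) _ (∋-e m)))))))

        K₂ : V
        K₂ = sep K (uniqueDefn K)

        K₂-e : ∀ {x i} → K₂ ∋⟨ x , i ⟩ → UniqueValue K x i
        K₂-e {x} {i} m = read (sep-P (uniqueDefn K) (∋-e m))
          where
          match : ∀ {x' i'} → x' ≡ x × i' ≡ i → UniqueValue K x' i' → UniqueValue K x i
          match (refl , refl) u = u
          read : PairIn (pr x i) (UniqueValue K) → UniqueValue K x i
          read (x' , i' , p , u) = match (pair-inj p pr-spec) u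

        -- `K₂` is the part of K where the term has only one value. Tags are distinct and the coding
        -- is injective, so two derivations for one term end in the same rule with the same
        -- subterms. This makes `K₂` rule-closed and thus equal to K.
        determined : ∀ {x x' i} → Rule K₂ x i → Rule K x' i → x' ≡ x
        determined (inj₁ (j , p , q)) (inj₁ (j' , p' , q')) =
          e-inj p' (subst (λ j → e ∋⟨ _ , j ⟩) (proj₂ (code-inj q q')) p)
        determined (inj₁ (j , p , q)) (inj₂ (inj₁ (_ , _ , _ , _ , _ , _ , _ , _ , _ , q'))) = ⊥-elim′ (c₀≢c₁ (proj₁ (code-inj q q')))
        determined (inj₁ (j , p , q)) (inj₂ (inj₂ (_ , _ , _ , _ , q'))) = ⊥-elim′ (c₀≢c₂ (proj₁ (code-inj q q')))
        determined (inj₂ (inj₁ (_ , _ , _ , _ , _ , _ , _ , _ , _ , q))) (inj₁ (_ , _ , q')) = ⊥-elim′ (c₀≢c₁ (proj₁ (code-inj q' q)))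
        determined (inj₂ (inj₁ (x , y , i , j , k , m , n , p , q , r))) (inj₂ (inj₁ (x' , y' , i' , j' , k' , m' , n' , p' , q' , r'))) =
          match (proj₂ (code-inj r r')) q q' m n m' n' p p'
          where
          match₂ : ∀ {x y i j x' y' i' j' u u'} → i ≡ i' × j ≡ j' → K₂ ∋⟨ x , i ⟩ → K₂ ∋⟨ y , j ⟩ → K ∋⟨ x' , i' ⟩ → K ∋⟨ y' , j' ⟩ →
                   IsPair u x y → IsPair u' x' y' → u' ≡ u
          match₂ (refl , refl) m n m' n' p p' = combine (K₂-e m _ m') (K₂-e n _ n') p p'
            where
            combine : ∀ {x y x' y' u u'} → x' ≡ x → y' ≡ y → IsPair u x y → IsPair u' x' y' → u' ≡ u
            combine refl refl p p' = trans (pr-unique p') (sym (pr-unique p))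
          match : ∀ {x y i j k x' y' i' j' k' u u'} → k ≡ k' → Code k i j → Code k' i' j' → K₂ ∋⟨ x , i ⟩ → K₂ ∋⟨ y , j ⟩ → K ∋⟨ x' , i' ⟩ → K ∋⟨ y' , j' ⟩ →
                   IsPair u x y → IsPair u' x' y' → u' ≡ u
          match refl q q' = match₂ (code-inj q q')
        determined (inj₂ (inj₁ (_ , _ , _ , _ , _ , _ , _ , _ , _ , q))) (inj₂ (inj₂ (_ , _ , _ , _ , q'))) = ⊥-elim′ (c₁≢c₂ (proj₁ (code-inj q q')))
        determined (inj₂ (inj₂ (_ , _ , _ , _ , q))) (inj₁ (_ , _ , q')) = ⊥-elim′ (c₀≢c₂ (proj₁ (code-inj q' q)))
        determined (inj₂ (inj₂ (_ , _ , _ , _ , q))) (inj₂ (inj₁ (_ , _ , _ , _ , _ , _ , _ , _ , _ , q'))) = ⊥-elim′ (c₁≢c₂ (proj₁ (code-inj q' q)))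
        determined (inj₂ (inj₂ (x , i , m , g , q))) (inj₂ (inj₂ (x' , i' , m' , g' , q'))) = match (proj₂ (code-inj q q')) m m' g g'
          where
          match₁ : ∀ {x x' u u'} → x' ≡ x → G ∋⟨ x , u ⟩ → G ∋⟨ x' , u' ⟩ → u' ≡ u
          match₁ refl g g' = G-fun _ _ _ g' g
          match : ∀ {x i x' i' u u'} → i ≡ i' → K₂ ∋⟨ x , i ⟩ → K ∋⟨ x' , i' ⟩ → G ∋⟨ x , u ⟩ → G ∋⟨ x' , u' ⟩ → u' ≡ u
          match refl m m' = match₁ (K₂-e m _ m')

        K-unique : ∀ {x y i} → K ∋⟨ x , i ⟩ → K ∋⟨ y , i ⟩ → x ≡ y
        K-unique {x} {y} {i} m n = sym (K₂-e (∋-i (least-K {K₂} (⊑-trans (sep-⊑ (uniqueDefn K)) K⊑) closed _ (∋-e m))) y n)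
          where
          closed : RuleClosed W B K₂
          closed x xW i iB r = ∋-i (sep-i (uniqueDefn K) (∋-e (K-closed x xW i iB (rule-mono (sep-⊑ (uniqueDefn K)) r)))
            (x , i , pr-spec , λ x' m' → determined r (K-rule m')))

      abstract
        eval : ∃ λ K → Eval W B Π e G c₀ c₁ c₂ K
        eval = K , record
          { graph = K⊑
          ; leaf = λ {x} {j} xW jB p c → K-closed x xW _ (code-∊ c₀∊ jB c) (inj₁ (j , p , c))
          ; node = λ {x} {y} {i} {j} {k} m n c c' → K-closed _ (W-pair (dom m) (dom n)) _ (code-∊ c₁∊ (code-∊ (cod m) (cod n) c) c')
              (inj₂ (inj₁ (x , y , i , j , k , m , n , pr-spec , c , c')))
          ; apply = λ {x} {y} {i} m g c → K-closed _ (proj₂ (⊗-e₂ (G⊑ _ (∋-e g)))) _ (code-∊ c₂∊ (cod m) c) (inj₂ (inj₂ (x , i , m , g , c)))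
          ; unique = K-unique }
          where
          dom : ∀ {x i} → K ∋⟨ x , i ⟩ → x ∊ W
          dom m = proj₁ (⊗-e₂ (K⊑ _ (∋-e m)))
          cod : ∀ {x i} → K ∋⟨ x , i ⟩ → i ∊ B
          cod m = proj₂ (⊗-e₂ (K⊑ _ (∋-e m)))

  open Evaluation

  open Notions₇ interpretation public

  -- Order types of the sets N ∩ α.

  module Bounded where
    open Notions₈ interpretation public

    module OrderTypes {δ : V} (oδ : Ordinal δ) where
      collapse-exists : ∀ N → ∃ λ c → CollapseOf δ N c
      collapse-exists N = convert (collapse (mem-wf N δ))
        where
        convert : (∃ λ c → Collapse δ (memRel N δ) c) → ∃ λ c → CollapseOf δ N c
        convert (c , C) = c , (λ _ _ _ → functional) , (λ _ → total) , λ α v m → dom m , λ x →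
          (λ k → let (β , e , p) = proj₁ (values m x) k
                     (_ , _ , q , r) = rel-e (memDefn N) e
                 in β , q , r , p) ,
          (λ (β , q , r , p) → proj₂ (values m x) (β , rel-i (memDefn N) (ord-trans oδ r (dom m)) (dom m) (q , r) , p))
          where
          open Collapse C

      otp-exists : ∀ N {α} → α ∊ δ → ∃ λ v → Otp δ N α v
      otp-exists N {α} a = find (collapse-exists N)
        where
        find : (∃ λ c → CollapseOf δ N c) → ∃ λ v → Otp δ N α v
        find (c , C) = let (v , m) = proj₁ (proj₂ C) α a in v , c , C , m

      otp-dom : ∀ {N α v} → Otp δ N α v → α ∊ δ
      otp-dom (c , C , m) = proj₁ (proj₂ (proj₂ C) _ _ m)

      private
        members : ∀ {N α v} → Otp δ N α v → ∀ {x} → x ∊ v → ∃ λ β → β ∊ N × β ∊ α × Otp δ N β x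
        members (c , C , m) {x} k = let (β , p , q , r) = proj₁ (proj₂ (proj₂ (proj₂ C) _ _ m) x) k in β , p , q , c , C , r

        back : ∀ {N α v β} → Otp δ N α v → β ∊ N → β ∊ α → ∃ λ x → x ∊ v × Otp δ N β x
        back {α = α} {v} {β} (c , C , m) p q =
          let (x , r) = proj₁ (proj₂ C) β (ord-trans oδ q (proj₁ (proj₂ (proj₂ C) α v m)))
          in x , proj₂ (proj₂ (proj₂ (proj₂ C) α v m) x) (β , p , q , r) , c , C , r

        agree-step : ∀ N N' α → α ∊ δ → (∀ β → β ∊ α → β ∊ δ → OtpAgree δ N N' β) → OtpAgree δ N N' α
        agree-step N N' α a ih same v v' o o' = ext (λ x → half₁ (members o)) (λ x → half₂ (members o'))
          where
          restrict : ∀ {β} → β ∊ α → ∀ γ → γ ∊ β → γ ∊ N ⇔ γ ∊ N'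
          restrict b γ g = same γ (ord-trans (ord-elt oδ a) g b)
          half₁ : ∀ {x} → (x ∊ v → ∃ λ β → β ∊ N × β ∊ α × Otp δ N β x) → x ∊ v → x ∊ v'
          half₁ f m = let (β , p , q , r) = f m
                          (x' , k , r') = back o' (proj₁ (same β q) p) q
                      in subst (_∊ v') (sym (ih β q (ord-trans oδ q a) (restrict q) _ x' r r')) k
          half₂ : ∀ {x} → (x ∊ v' → ∃ λ β → β ∊ N' × β ∊ α × Otp δ N' β x) → x ∊ v' → x ∊ v
          half₂ f m = let (β , p , q , r) = f m
                          (x' , k , r') = back o (proj₂ (same β q) p) q
                      in subst (_∊ v) (ih β q (ord-trans oδ q a) (restrict q) x' _ r' r) k

      -- The order type depends on N ∩ α alone. This is the source of the bounded support of the
      -- functions g_α.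
      otp-agree : ∀ {N N' α v v'} → (∀ β → β ∊ α → β ∊ N ⇔ β ∊ N') → Otp δ N α v → Otp δ N' α v' → v ≡ v'
      otp-agree {N} {N'} s o o' = foundation-ind δ {OtpAgree δ N N'} (def₃ δ N N' (S₈.OtpAgree 0 1 2 3)) (agree-step N N') (otp-dom o) s _ _ o o'

      otp-unique : ∀ {N α v v'} → Otp δ N α v → Otp δ N α v' → v ≡ v'
      otp-unique = otp-agree λ β _ → (λ k → k) , (λ k → k)

      otp-members : ∀ {N α v} → Otp δ N α v → ∀ {x} → x ∊ v → ∃ λ β → β ∊ N × β ∊ α × Otp δ N β x
      otp-members = members

      otp-mono : ∀ {N α β v x} → Otp δ N α v → β ∊ N → β ∊ α → Otp δ N β x → x ∊ v
      otp-mono o p q r = let (x , k , r') = back o p q in subst (_∊ _) (otp-unique r' r) k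

      otp-transfer : ∀ {N N' α v} → (∀ β → β ∊ α → β ∊ N ⇔ β ∊ N') → Otp δ N α v → Otp δ N' α v
      otp-transfer {N' = N'} s o = let (v' , o') = otp-exists N' (otp-dom o) in subst (Otp δ N' _) (sym (otp-agree s o o')) o'

      otp-ordinal : ∀ {N α v} → Otp δ N α v → Ordinal v
      otp-ordinal {N} o = foundation-ind δ {OtpOrdinal δ N} (def₂ δ N (S₈.OtpOrdinal 0 1 2)) step (otp-dom o) _ o
        where
        step : ∀ α → α ∊ δ → (∀ β → β ∊ α → β ∊ δ → OtpOrdinal δ N β) → OtpOrdinal δ N α
        step α a ih v o =
          (λ x m y n → let (β , p , q , r) = members o m
                           (γ , p' , q' , r') = members r n
                       in otp-mono o p' (ord-trans (ord-elt oδ a) q' q) r') ,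
          (λ x m → let (β , p , q , r) = members o m in proj₁ (ih β q (ord-trans oδ q a) x r))

      otp-identity : ∀ {N α v} → α ⊑ N → Otp δ N α v → v ≡ α
      otp-identity {N} s o = foundation-ind δ {OtpIdentity δ N} (def₂ δ N (S₈.OtpIdentity 0 1 2)) step (otp-dom o) s _ o
        where
        step : ∀ α → α ∊ δ → (∀ β → β ∊ α → β ∊ δ → OtpIdentity δ N β) → OtpIdentity δ N α
        step α a ih s v o = ext
          (λ x m → let (β , p , q , r) = members o m
                   in subst (_∊ α) (sym (ih β q (ord-trans oδ q a) (⊑-trans (proj₁ (ord-elt oδ a) β q) s) x r)) q)
          (λ β q → let (x , k , r) = back o (s β q) q
                   in subst (_∊ v) (ih β q (ord-trans oδ q a) (⊑-trans (proj₁ (ord-elt oδ a) β q) s) x r) k)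

  open Bounded

  -- Intersections and traces.

  module Towers where
    open Notions₁₀ interpretation public

    infixl 9 _∩_
    abstract
      _∩_ : V → V → V
      x ∩ y = sep x (def₁ y (1 S.∊ 0))
      ∩-i : ∀ {x y z} → z ∊ x → z ∊ y → z ∊ x ∩ y
      ∩-i a b = sep-i (def₁ _ (1 S.∊ 0)) a b
      ∩-e : ∀ {x y z} → z ∊ x ∩ y → z ∊ x × z ∊ y
      ∩-e = sep-e (def₁ _ (1 S.∊ 0))

    ∩-spec : ∀ {x y} → IsIntersection (x ∩ y) x y
    ∩-spec z = ∩-e , λ (a , b) → ∩-i a b

    ∩-unique : ∀ {z x y} → IsIntersection z x y → z ≡ x ∩ y
    ∩-unique h = ext (λ u m → let (a , b) = proj₁ (h u) m in ∩-i a b) (λ u m → proj₂ (h u) (∩-e m))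

    trace-e : ∀ {A H N} → Trace A H N → N ∩ H ∊ A
    trace-e (M , m , p) = subst (_∊ _) (∩-unique p) m

    trace-i : ∀ {A H N} → N ∩ H ∊ A → Trace A H N
    trace-i m = _ , m , ∩-spec

    ∩-absorb : ∀ {N H H'} → H ⊑ H' → (N ∩ H') ∩ H ≡ N ∩ H
    ∩-absorb s = ext (λ x m → let (a , b) = ∩-e m in ∩-i (proj₁ (∩-e a)) b) (λ x m → let (a , b) = ∩-e m in ∩-i (∩-i a (s x b)) b)

  open Towers

  -- Transitive closures and forced equality of names.

  module ForcingNames where
    open Notions₁₁ interpretation public

    module _ {w : V} (isω : Isω w) where
      open Omega isω

      -- Stage n consists of the elements of a and the elements of elements of earlier stages. The
      -- union over ω, with a itself added, is transitive.
      transitive-closure : ∀ a → ∃ λ t → Transitive t × a ∊ t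
      transitive-closure a = finish (Recursion*.solution (closureStep a) w E (SR.Value 4 3 5) (a ∷ E ∷ w ∷ [])
          (λ _ _ k → k) (λ _ _ k → k) (def₃ w E a (S.∃̇ λ v → SR.Value 3 v)) (WellFounded.field⊑ (mem-wf w w)) (WellFounded.wf (mem-wf w w))
          (λ y R _ → a ∪ ⋃ (⋃ R) , λ z →
            (λ m → [ inj₁ , (λ k → let (u , k' , l) = ⋃-e k ; (s , k'' , l') = ⋃-e k' in inj₂ (s , k'' , u , l' , l)) ]′ (∪-e m)) ,
            [ ∪-l , (λ (s , m , u , m' , l) → ∪-r (⋃-i l (⋃-i m' m))) ]′)
          (λ p q → ext (λ z m → proj₂ (q z) (proj₁ (p z) m)) (λ z m → proj₂ (p z) (proj₁ (q z) m)))
          (def₃ w E a (S₁.PairIn 3 SR.Value)))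
        where
        E : V
        E = memRel w w
        module SR = S₂.Recursion (S₁₁.closureStep 2) 0 1
        finish : (∃ λ c → Solution (closureStep a) w E c) → ∃ λ t → Transitive t × a ∊ t
        finish (c , sol) = t , tr , ∪-r sing-i
          where
          open Solution sol
          dt : Defn (λ z → ∃ λ n → ∃ λ v → c ∋⟨ n , v ⟩ × z ∊ v)
          dt = def₁ c (S.∃̇ λ n → S.∃̇ λ v → (0 S.∋⟨ n , v ⟩) S.∧ (1 S.∊ v))
          union-c : V
          union-c = sep (⋃ (⋃ (⋃ c))) dt
          u-i : ∀ {n v z} → c ∋⟨ n , v ⟩ → z ∊ v → z ∊ union-c
          u-i {n} {v} p m = sep-i dt (⋃-i m (⋃-i (upair-r {n} {v}) (⋃-i upair-r (∋-e p)))) (n , v , p , m)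
          t : V
          t = union-c ∪ sing a
          tr : Transitive t
          tr x m z k = ∪-l ([ (λ l → step (sep-P dt l)) , (λ e → base (subst (z ∊_) (sing-e e) k)) ]′ (∪-e m))
            where
            base : z ∊ a → z ∊ union-c
            base k = let (v , p) = total ω-zero
                         (R , _ , h) = equation p
                     in u-i p (proj₂ (h z) (inj₁ k))
            step : (∃ λ n → ∃ λ v → c ∋⟨ n , v ⟩ × x ∊ v) → z ∊ union-c
            step (n , v , p , l) = go (total (ω-succ (dom p)))
              where
              go : (∃ λ v' → c ∋⟨ succ n , v' ⟩) → z ∊ union-c
              go (v' , q) = let (R , V , h) = equation q
                            in u-i q (proj₂ (h z) (inj₂ (v , proj₂ (V v) (n , rel-i (memDefn w) (dom p) (ω-succ (dom p)) (dom p , succ-i) , p) , x , l , k)))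

    module Names {w : V} (isω : Isω w) (P Le : V)
      (≼-refl  : ∀ {p} → p ∊ P → Le ∋⟨ p , p ⟩)
      (≼-trans : ∀ {p q r} → Le ∋⟨ p , q ⟩ → Le ∋⟨ q , r ⟩ → Le ∋⟨ p , r ⟩)
      (≼-dom   : ∀ {p q} → Le ∋⟨ p , q ⟩ → p ∊ P)
      (≼-cod   : ∀ {p q} → Le ∋⟨ p , q ⟩ → q ∊ P)
      where
      open Forcing P Le public
      open ForcingNotions P Le public using (Triple; MemBy; Sub; Bisimulation; Bisimilar; TripleIn; Either; Above; Compose; OrNew; CheckAbsolute)

      ≼r : ∀ {p q} → q ≼ p → q ≼ q
      ≼r m = ≼-refl (≼-dom m)

      triple-i : ∀ {E p σ τ} → pr p (pr σ τ) ∊ E → Triple E p σ τ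
      triple-i m = _ , pr-spec , ∋-i m

      triple-e : ∀ {E p σ τ} → Triple E p σ τ → pr p (pr σ τ) ∊ E
      triple-e (z , p , m) = subst (λ z → pr _ z ∊ _) (pr-unique p) (∋-e m)

      triple-in : ∀ {R p σ τ} → TripleIn R (pr p (pr σ τ)) → R p σ τ
      triple-in {R} (p' , σ' , τ' , y , a , b , r) = match (pair-inj b pr-spec) a r
        where
        match₂ : ∀ {σ' τ' σ τ p} → σ' ≡ σ × τ' ≡ τ → R p σ' τ' → R p σ τ
        match₂ (refl , refl) r = r
        match : ∀ {p' y p σ τ σ' τ'} → p' ≡ p × y ≡ pr σ τ → IsPair y σ' τ' → R p' σ' τ' → R p σ τ
        match (refl , refl) a r = match₂ (pair-inj a pr-spec) r

      bisim-dom : ∀ {T X p σ τ} → Bisimulation T X → Triple X p σ τ → p ∊ P × σ ∊ T × τ ∊ T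
      bisim-dom {T} {X} B t = let (p , a , σ , b , τ , c , y , e , e') = proj₁ B _ (triple-e t) in match (pair-inj e' pr-spec) e a b c
        where
        match₂ : ∀ {σ' τ' σ τ} → σ' ≡ σ × τ' ≡ τ → σ' ∊ T → τ' ∊ T → σ ∊ T × τ ∊ T
        match₂ (refl , refl) b c = b , c
        match : ∀ {p' y p σ τ σ' τ'} → p' ≡ p × y ≡ pr σ τ → IsPair y σ' τ' → p' ∊ P → σ' ∊ T → τ' ∊ T → p ∊ P × σ ∊ T × τ ∊ T
        match (refl , refl) e a b c = a , match₂ (pair-inj e pr-spec) b c

      memBy-mono : ∀ {e e' : V → V → V → Set ℓ} {p π τ} → (∀ r ρ s → τ ∋⟨ ρ , s ⟩ → e r π ρ → e' r π ρ) → MemBy e p π τ → MemBy e' p π τ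
      memBy-mono h m q l = let (r , a , ρ , s , b , c , x) = m q l in r , a , ρ , s , b , c , h r ρ s b x

      private
        names-∪ : ∀ {T T'} → ClosedSetOfNames T → ClosedSetOfNames T' → ClosedSetOfNames (T ∪ T')
        names-∪ h h' τ m z k = [ (λ l → let (σ , a , b) = h τ l z k in σ , ∪-l a , b) , (λ l → let (σ , a , b) = h' τ l z k in σ , ∪-r a , b) ]′ (∪-e m)

        element : ∀ {T τ π s} → ClosedSetOfNames T → τ ∊ T → τ ∋⟨ π , s ⟩ → π ∊ T × s ∊ P
        element {T} h m p = let (σ , a , q , b , e) = h _ m _ (∋-e p) in match (pair-inj e pr-spec) a b
          where
          match : ∀ {σ q π s} → σ ≡ π × q ≡ s → σ ∊ T → q ∊ P → π ∊ T × s ∊ P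
          match (refl , refl) a b = a , b

      names-∪′ : ∀ {T T'} → ClosedSetOfNames T → ClosedSetOfNames T' → ClosedSetOfNames (T ∪ T')
      names-∪′ = names-∪

      name-element : ∀ {τ π s} → IsName τ → τ ∋⟨ π , s ⟩ → IsName π × s ∊ P
      name-element (T , h , m) p = let (a , b) = element h m p in (T , h , a) , b

      infix 8 _⊩_≈_
      -- Forced equality as bisimilarity. A table of forced equalities must be exact, while a
      -- bisimulation need only pass a one-step test, so that symmetry, transitivity and locality
      -- follow by exhibiting one. The two relations agree by `≈→≐` and `≐→≈`.
      _⊩_≈_ : V → V → V → Set ℓ
      p ⊩ σ ≈ τ = Bisimilar p σ τ

      ≈-names : ∀ {p σ τ} → p ⊩ σ ≈ τ → p ∊ P × IsName σ × IsName τ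
      ≈-names (T , h , X , B , t) = let (a , b , c) = bisim-dom B t in a , (T , h , b) , (T , h , c)

      ≈-sub : ∀ {p σ τ} → p ⊩ σ ≈ τ → Sub _⊩_≈_ p σ τ
      ≈-sub (T , h , X , B , t) π s m q l k = memBy-mono {Triple X} {_⊩_≈_} (λ r ρ s _ x → T , h , X , B , x) (proj₁ (proj₂ B _ _ _ t) π s m q l k)

      private
        module SF = S₁₁.ForcingNotions 0 1

      -- The triples of a definable R over T form a set. The one-step test stays inside T because
      -- elements of names of T are in T, so this set is a bisimulation.
      coinduction : ∀ {T} {R : V → V → V → Set ℓ} → ClosedSetOfNames T → Defn (TripleIn R) →
        (∀ {p σ τ} → p ∊ P → σ ∊ T → τ ∊ T → R p σ τ → Sub R p σ τ × Sub R p τ σ) →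
        ∀ {p σ τ} → p ∊ P → σ ∊ T → τ ∊ T → R p σ τ → p ⊩ σ ≈ τ
      coinduction {T} {R} h d step a b c r = T , h , X , (shape , λ p σ τ t → sub (X-e t)) , X-i a b c r
        where
        X : V
        X = sep (P ⊗ (T ⊗ T)) d
        X-i : ∀ {p σ τ} → p ∊ P → σ ∊ T → τ ∊ T → R p σ τ → Triple X p σ τ
        X-i a b c r = triple-i (sep-i d (⊗-i a (⊗-i b c)) (_ , _ , _ , _ , pr-spec , pr-spec , r))
        X-e : ∀ {p σ τ} → Triple X p σ τ → p ∊ P × σ ∊ T × τ ∊ T × R p σ τ
        X-e t = let m = sep-e d (triple-e t)
                    (a , b) = ⊗-e₂ (proj₁ m)
                    (c , e) = ⊗-e₂ b
                in a , c , e , triple-in {R} (proj₂ m)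
        shape : ∀∊ X λ z → ∃∊ P λ p → ∃∊ T λ σ → ∃∊ T λ τ → ∃ λ y → IsPair y σ τ × IsPair z p y
        shape z m = let (p , y , a , b , e) = ⊗-e (sep-⊑ d z m)
                        (σ , τ , c , c' , e') = ⊗-e b
                    in p , a , σ , c , τ , c' , y , subst (λ y → IsPair y σ τ) (sym e') pr-spec , subst (λ z → IsPair z p y) (sym e) pr-spec
        restrict : ∀ {p σ τ} → σ ∊ T → τ ∊ T → Sub R p σ τ → Sub (Triple X) p σ τ
        restrict b c sb π s m q l k q' l' =
          let (r , n , ρ , s' , m' , n' , x) = sb π s m q l k q' l'
          in r , n , ρ , s' , m' , n' , X-i (≼-dom n) (proj₁ (element h b m)) (proj₁ (element h c m')) x
        sub : ∀ {p σ τ} → p ∊ P × σ ∊ T × τ ∊ T × R p σ τ → Sub (Triple X) p σ τ × Sub (Triple X) p τ σ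
        sub (a , b , c , r) = restrict b c (proj₁ (step a b c r)) , restrict c b (proj₂ (step a b c r))

      sub-mono : ∀ {e e' : V → V → V → Set ℓ} {p σ τ} → (∀ {r π ρ} → r ∊ P → e r π ρ → e' r π ρ) → Sub e p σ τ → Sub e' p σ τ
      sub-mono h sb π s m q l k q' l' = let (r , n , ρ , s' , m' , n' , x) = sb π s m q l k q' l' in r , n , ρ , s' , m' , n' , h (≼-dom n) x

      sub-≼ : ∀ {e : V → V → V → Set ℓ} {p q σ τ} → q ≼ p → Sub e p σ τ → Sub e q σ τ
      sub-≼ l sb π s m r k = sb π s m r (≼-trans k l)

      ≈-sub′ : ∀ {p σ τ} → p ⊩ σ ≈ τ → Sub _⊩_≈_ p τ σ
      ≈-sub′ (T , h , X , B , t) = sub-mono {Triple X} {_⊩_≈_} (λ _ x → T , h , X , B , x) (proj₂ (proj₂ B _ _ _ t))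

      sub-refl : ∀ {e : V → V → V → Set ℓ} {p σ} → (∀ {r π s} → r ∊ P → σ ∋⟨ π , s ⟩ → e r π π) → Sub e p σ σ
      sub-refl h π s m q l k q' l' = q' , ≼r l' , π , s , m , ≼-trans l' k , h (≼-dom l') m

      ≈-refl : ∀ {p σ} → p ∊ P → IsName σ → p ⊩ σ ≈ σ
      ≈-refl a (T , h , m) = coinduction {T} {λ p σ τ → σ ≡ τ} h (def₂ P Le (SF.TripleIn (λ p σ τ → σ S.≐ τ) 2))
        (λ { _ _ _ refl → sub-refl (λ _ _ → refl) , sub-refl (λ _ _ → refl) }) a m m refl

      ≈-sym : ∀ {p σ τ} → p ⊩ σ ≈ τ → p ⊩ τ ≈ σ
      ≈-sym (T , h , X , B , t) = let (a , b , c) = bisim-dom B t in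
        coinduction {T} {Either} h (def₂ P Le (SF.TripleIn SF.Either 2))
          (λ { _ _ _ (inj₁ x) → sub-mono (λ _ → inj₁) (≈-sub x) , sub-mono (λ _ → inj₁) (≈-sub′ x)
             ; _ _ _ (inj₂ x) → sub-mono (λ _ → inj₁) (≈-sub′ x) , sub-mono (λ _ → inj₁) (≈-sub x) })
          a c b (inj₂ (T , h , X , B , t))

      ≈-mono : ∀ {p q σ τ} → q ≼ p → p ⊩ σ ≈ τ → q ⊩ σ ≈ τ
      ≈-mono l (T , h , X , B , t) = let (a , b , c) = bisim-dom B t in
        coinduction {T} {Above} h (def₂ P Le (SF.TripleIn SF.Above 2))
          (λ { _ _ _ (p , l , x) → sub-mono (λ r y → _ , ≼-refl r , y) (sub-≼ l (≈-sub x)) , sub-mono (λ r y → _ , ≼-refl r , y) (sub-≼ l (≈-sub′ x)) })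
          (≼-dom l) b c (_ , l , T , h , X , B , t)

      ≈-trans : ∀ {p σ τ υ} → p ⊩ σ ≈ τ → p ⊩ τ ≈ υ → p ⊩ σ ≈ υ
      ≈-trans {p} {σ} {τ} {υ} x@(T , h , X , B , t) y@(T' , h' , X' , B' , t') =
        coinduction {T ∪ T'} {Compose} (names-∪ h h') (def₂ P Le (SF.TripleIn SF.Compose 2))
          (λ { _ _ _ (τ , x , y) → compose (≈-sub x) (≈-sub y) , compose (≈-sub′ y) (≈-sub′ x) })
          (proj₁ (bisim-dom B t)) (∪-l (proj₁ (proj₂ (bisim-dom B t)))) (∪-r (proj₂ (proj₂ (bisim-dom B' t')))) (_ , x , y)
        where
        compose : ∀ {p σ τ υ} → Sub _⊩_≈_ p σ τ → Sub _⊩_≈_ p τ υ → Sub Compose p σ υ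
        compose f g π s m q l k q' l' =
          let (r , n , ρ , s' , m' , n' , x) = f π s m q l k q' l'
              (r' , o , ρ' , s'' , m'' , o' , y) = g ρ s' m' r (≼-trans n (≼-trans l' l)) n' r (≼r n)
          in r' , ≼-trans o n , ρ' , s'' , m'' , o' , ρ , ≈-mono o x , y

      -- Bisimilarity with the single triple (p, σ, τ) added still passes the one-step test; this is
      -- what `OrNew` describes.
      ≈-intro : ∀ {p σ τ} → p ∊ P → IsName σ → IsName τ → Sub _⊩_≈_ p σ τ → Sub _⊩_≈_ p τ σ → p ⊩ σ ≈ τ
      ≈-intro {p} {σ} {τ} a (T , h , m) (T' , h' , m') f g =
        coinduction {T ∪ T'} {OrNew p σ τ} (names-∪ h h') (def₅ P Le p σ τ (SF.TripleIn (SF.OrNew 2 3 4) 5))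
          (λ { _ _ _ (inj₁ x) → sub-mono (λ _ → inj₁) (≈-sub x) , sub-mono (λ _ → inj₁) (≈-sub′ x)
             ; _ _ _ (inj₂ (refl , refl , refl)) → sub-mono (λ _ → inj₁) f , sub-mono (λ _ → inj₁) g })
          a (∪-l m) (∪-r m') (inj₂ (refl , refl , refl))

      ≈-local : ∀ {p σ τ} → p ∊ P → IsName σ → IsName τ → (∀ q → q ≼ p → ∃ λ r → r ≼ q × r ⊩ σ ≈ τ) → p ⊩ σ ≈ τ
      ≈-local {p} {σ} {τ} a n n' h = ≈-intro a n n'
        (λ π s m q l k q' l' → let (r , o , x) = h q' (≼-trans l' l)
                                   (r' , o' , ρ , s' , y) = ≈-sub x π s m r (≼r o) (≼-trans o (≼-trans l' k)) r (≼r o)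
                               in r' , ≼-trans o' o , ρ , s' , y)
        (λ π s m q l k q' l' → let (r , o , x) = h q' (≼-trans l' l)
                                   (r' , o' , ρ , s' , y) = ≈-sub′ x π s m r (≼r o) (≼-trans o (≼-trans l' k)) r (≼r o)
                               in r' , ≼-trans o' o , ρ , s' , y)

      private
        tableDefn : Defn (TripleIn _⊩_≈_)
        tableDefn = def₂ P Le (SF.TripleIn SF.Bisimilar 2)

      -- All bisimilar triples over T form an exact table. For the direction that introduces a
      -- triple, the table condition is applied to the elements of σ and τ, which are forced into
      -- their own name.
      ≈→≐ : ∀ {p σ τ} → p ⊩ σ ≈ τ → p ⊩ σ ≐ τ
      ≈→≐ {p₀} {σ₀} {τ₀} x₀@(T , h , X , B , t) = T , E , h , b₀ , c₀ , table , E-i a₀ b₀ c₀ x₀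
        where
        a₀ = proj₁ (bisim-dom B t)
        b₀ = proj₁ (proj₂ (bisim-dom B t))
        c₀ = proj₂ (proj₂ (bisim-dom B t))
        E : V
        E = sep (P ⊗ (T ⊗ T)) tableDefn
        E-i : ∀ {p σ τ} → p ∊ P → σ ∊ T → τ ∊ T → p ⊩ σ ≈ τ → Triple E p σ τ
        E-i a b c r = triple-i (sep-i tableDefn (⊗-i a (⊗-i b c)) (_ , _ , _ , _ , pr-spec , pr-spec , r))
        E-e : ∀ {p σ τ} → Triple E p σ τ → p ⊩ σ ≈ τ
        E-e t = triple-in {_⊩_≈_} (proj₂ (sep-e tableDefn (triple-e t)))
        name : ∀ {σ} → σ ∊ T → IsName σ
        name m = T , h , m
        transport : ∀ {p σ τ q π} → σ ∊ T → τ ∊ T → π ∊ T → p ⊩ σ ≈ τ → q ≼ p → MemForced (Triple E) q π σ → MemForced (Triple E) q π τ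
        transport b c d x l mm q' l' =
          let (r , n , ρ , s , m , n' , y) = mm q' l'
              (r' , o , ρ' , s' , m' , o' , z) = ≈-sub x ρ s m r (≼-trans n (≼-trans l' l)) n' r (≼r n)
          in r' , ≼-trans o n , ρ' , s' , m' , o' , E-i (≼-dom o) d (proj₁ (element h c m')) (≈-trans (≈-mono o (E-e y)) z)
        table : IsEqTable E T
        table p σ τ a b c = (λ t π q d l → let dT = [ (λ (s , m) → proj₁ (element h b m)) , (λ (s , m) → proj₁ (element h c m)) ]′ d
                                            in transport b c dT (E-e t) l , transport c b dT (≈-sym (E-e t)) l)
                          , (λ hyp → E-i a b c (≈-intro a (name b) (name c)
                              (λ π s m q l k → memBy-mono {Triple E} {_⊩_≈_} (λ _ _ _ _ → E-e) (proj₁ (hyp π q (inj₁ (s , m)) l) (self b m k)))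
                              (λ π s m q l k → memBy-mono {Triple E} {_⊩_≈_} (λ _ _ _ _ → E-e) (proj₂ (hyp π q (inj₂ (s , m)) l) (self c m k)))))
          where
          self : ∀ {σ π s q} → σ ∊ T → σ ∋⟨ π , s ⟩ → q ≼ s → MemForced (Triple E) q π σ
          self b m k q' l' = q' , ≼r l' , _ , _ , m , ≼-trans l' k , E-i (≼-dom l') (proj₁ (element h b m)) (proj₁ (element h b m)) (≈-refl (≼-dom l') (name (proj₁ (element h b m))))

      -- The triples of a table form a bisimulation. The table contains all reflexive triples, so an
      -- element of σ is forced into σ, and its condition carries this over to τ.
      ≐→≈ : ∀ {p σ τ} → p ∊ P → p ⊩ σ ≐ τ → p ⊩ σ ≈ τ
      ≐→≈ a (T , E , h , b , c , table , t) = coinduction {T} {Triple E} h (def₃ P Le E (SF.TripleIn (SF.Triple 2) 3))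
        (λ a b c t → sub a b c t , sub′ a b c t) a b c t
        where
        self : ∀ {p σ} → p ∊ P → σ ∊ T → Triple E p σ σ
        self a b = proj₂ (table _ _ _ a b b) (λ π q _ _ → (λ m → m) , (λ m → m))
        self-mem : ∀ {σ π s q} → σ ∊ T → σ ∋⟨ π , s ⟩ → q ≼ s → MemForced (Triple E) q π σ
        self-mem b m k q' l' = q' , ≼r l' , _ , _ , m , ≼-trans l' k , self (≼-dom l') (proj₁ (element h b m))
        sub : ∀ {p σ τ} → p ∊ P → σ ∊ T → τ ∊ T → Triple E p σ τ → Sub (Triple E) p σ τ
        sub a b c t π s m q l k = proj₁ (proj₁ (table _ _ _ a b c) t π q (inj₁ (s , m)) l) (self-mem b m k)
        sub′ : ∀ {p σ τ} → p ∊ P → σ ∊ T → τ ∊ T → Triple E p σ τ → Sub (Triple E) p τ σ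
        sub′ a b c t π s m q l k = proj₂ (proj₁ (table _ _ _ a b c) t π q (inj₂ (s , m)) l) (self-mem c m k)

  open ForcingNames

  -- Check names, forced membership and names of pairs.

  module CheckNames where
    module Check {w : V} (isω : Isω w) (P Le : V)
      (≼-refl  : ∀ {p} → p ∊ P → Le ∋⟨ p , p ⟩)
      (≼-trans : ∀ {p q r} → Le ∋⟨ p , q ⟩ → Le ∋⟨ q , r ⟩ → Le ∋⟨ p , r ⟩)
      (≼-dom   : ∀ {p q} → Le ∋⟨ p , q ⟩ → p ∊ P)
      (≼-cod   : ∀ {p q} → Le ∋⟨ p , q ⟩ → q ∊ P)
      where
      open Names isω P Le ≼-refl ≼-trans ≼-dom ≼-cod public

      private
        check-exists : ∀ x → ∃ λ τ → IsCheckName τ x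
        check-exists x = start (transitive-closure isω x)
          where
          module SR = S₂.Recursion (S₁₁.productStep 2) 0 1
          finish : ∀ {t c} → Transitive t → x ∊ t → Solution (productStep P) t (memRel t t) c → ∃ λ τ → IsCheckName τ x
          finish {t} {c} tr xt sol = let (τ , m) = total xt in τ , t , c , tr , xt , isFunctionOn , spec , m
            where
            open Solution sol
            spec : ∀ y σ → c ∋⟨ y , σ ⟩ → ∀ z → z ∊ σ ⇔ (∃∊ y λ u → ∃ λ υ → ∃∊ P λ p → c ∋⟨ u , υ ⟩ × IsPair z υ p)
            spec y σ m z = (λ k → fwd (equation m) k) , bwd (equation m)
              where
              fwd : (∃ λ R → Recursion.Values (productStep P) t (memRel t t) c y R × productStep P y R σ) → z ∊ σ → ∃∊ y λ u → ∃ λ υ → ∃∊ P λ p → c ∋⟨ u , υ ⟩ × IsPair z υ p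
              fwd (R , V , h) k = let (s , sR , p , pP , e) = proj₁ (h z) k
                                      (u , l , n) = proj₁ (V s) sR
                                  in u , proj₂ (proj₂ (proj₂ (rel-e (memDefn t) l))) , s , p , pP , n , e
              bwd : (∃ λ R → Recursion.Values (productStep P) t (memRel t t) c y R × productStep P y R σ) → (∃∊ y λ u → ∃ λ υ → ∃∊ P λ p → c ∋⟨ u , υ ⟩ × IsPair z υ p) → z ∊ σ
              bwd (R , V , h) (u , uy , υ , p , pP , n , e) =
                proj₂ (h z) (υ , proj₂ (V υ) (u , rel-i (memDefn t) (dom n) (dom m) (dom n , uy) , n) , p , pP , e)
          start : (∃ λ t → Transitive t × x ∊ t) → ∃ λ τ → IsCheckName τ x
          start (t , tr , xt) = go (Recursion*.solution (productStep P) t E (SR.Value 4 3 5) (P ∷ E ∷ t ∷ [])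
              (λ _ _ k → k) (λ _ _ k → k) (def₃ t E P (S.∃̇ λ v → SR.Value 3 v)) (WellFounded.field⊑ (mem-wf t t)) (WellFounded.wf (mem-wf t t))
              (λ y R _ → R ⊗ P , λ z → (λ m → let (s , p , a , b , e) = ⊗-e m in s , a , p , b , subst (λ z → IsPair z s p) (sym e) pr-spec)
                                     , λ (s , a , p , b , e) → subst (_∊ R ⊗ P) (sym (pr-unique e)) (⊗-i a b))
              (λ p q → ext (λ z m → proj₂ (q z) (proj₁ (p z) m)) (λ z m → proj₂ (p z) (proj₁ (q z) m)))
              (def₃ t E P (S₁.PairIn 3 SR.Value)))
            where
            E : V
            E = memRel t t
            go : (∃ λ c → Solution (productStep P) t E c) → ∃ λ τ → IsCheckName τ x
            go (c , sol) = finish tr xt sol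

      abstract
        infix 20 ˇ_
        ˇ_ : V → V
        ˇ x = proj₁ (check-exists x)

        ˇ-spec : ∀ x → IsCheckName (ˇ x) x
        ˇ-spec x = proj₂ (check-exists x)

      ˇ-unique₂ : ∀ {x τ τ'} → IsCheckName τ x → IsCheckName τ' x → τ ≡ τ'
      ˇ-unique₂ {x} {τ} {τ'} (t , c , tr , xt , fn , h , m) (t' , c' , tr' , xt' , fn' , h' , m') =
        foundation-ind t (def₂ c c' (S.∀̇ λ σ → S.∀̇ λ σ' → (0 S.∋⟨ 2 , σ ⟩) S.⇒ (1 S.∋⟨ 2 , σ' ⟩) S.⇒ (σ S.≐ σ'))) step xt _ _ m m'
        where
        dom : ∀ {c t y v} → IsFunctionOn c t → c ∋⟨ y , v ⟩ → y ∊ t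
        dom {t = t} fn (z , m , p) = let (y' , a , _ , p') = proj₁ (proj₁ fn) z m in subst (_∊ t) (proj₁ (pair-inj p' p)) a
        step : ∀ y → y ∊ t → (∀ u → u ∊ y → u ∊ t → ∀ σ σ' → c ∋⟨ u , σ ⟩ → c' ∋⟨ u , σ' ⟩ → σ ≡ σ') → ∀ σ σ' → c ∋⟨ y , σ ⟩ → c' ∋⟨ y , σ' ⟩ → σ ≡ σ'
        step y yt ih σ σ' m m' = ext
          (λ z k → let (u , uy , υ , p , pP , n , e) = proj₁ (h y σ m z) k
                       (υ' , n') = proj₂ fn' u (tr' y (dom fn' m') u uy)
                   in proj₂ (h' y σ' m' z) (u , uy , υ , p , pP , subst (λ υ → c' ∋⟨ u , υ ⟩) (sym (ih u uy (dom fn n) υ υ' n n')) n' , e))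
          (λ z k → let (u , uy , υ , p , pP , n , e) = proj₁ (h' y σ' m' z) k
                       (υ' , n') = proj₂ fn u (tr y yt u uy)
                   in proj₂ (h y σ m z) (u , uy , υ , p , pP , subst (λ υ → c ∋⟨ u , υ ⟩) (ih u uy (dom fn n') υ' υ n' n) n' , e))

      ˇ-unique : ∀ {x τ} → IsCheckName τ x → τ ≡ ˇ x
      ˇ-unique h = ˇ-unique₂ h (ˇ-spec _)

      ˇ-element : ∀ {x z} → z ∊ ˇ x → ∃ λ u → ∃ λ p → u ∊ x × p ∊ P × z ≡ pr (ˇ u) p
      ˇ-element {x} {z} m = go (ˇ-spec x) m
        where
        go : ∀ {τ} → IsCheckName τ x → z ∊ τ → ∃ λ u → ∃ λ p → u ∊ x × p ∊ P × z ≡ pr (ˇ u) p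
        go (t , c , tr , xt , fn , h , n) k =
          let (u , ux , υ , p , pP , n' , e) = proj₁ (h _ _ n z) k
          in u , p , ux , pP , trans (pr-unique e) (cong (λ υ → pr υ p) (ˇ-unique (t , c , tr , tr x xt u ux , fn , h , n')))

      ˇ-member : ∀ {x u p} → u ∊ x → p ∊ P → ˇ x ∋⟨ ˇ u , p ⟩
      ˇ-member {x} {u} {p} ux pP = go (ˇ-spec x)
        where
        go : ∀ {τ} → IsCheckName τ x → τ ∋⟨ ˇ u , p ⟩
        go (t , c , tr , xt , fn , h , n) =
          let (υ , n') = proj₂ fn u (tr x xt u ux)
          in pr υ p , proj₂ (h _ _ n _) (u , ux , υ , p , pP , n' , pr-spec) , subst (λ υ' → IsPair (pr υ p) υ' p) (ˇ-unique (t , c , tr , tr x xt u ux , fn , h , n')) pr-spec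

      ˇ-member-e : ∀ {x ρ s} → ˇ x ∋⟨ ρ , s ⟩ → ∃ λ u → u ∊ x × ρ ≡ ˇ u
      ˇ-member-e m = let (u , p , ux , _ , e) = ˇ-element (∋-e m) in u , ux , proj₁ (pr-inj e)

      ˇ-name : ∀ x → IsName (ˇ x)
      ˇ-name x = go (ˇ-spec x)
        where
        go : ∀ {τ} → IsCheckName τ x → IsName τ
        go {τ} (t , c , tr , xt , fn , h , n) = T , closed , T-i n
          where
          dT : Defn (λ σ → ∃ λ y → c ∋⟨ y , σ ⟩)
          dT = def₁ c (S.∃̇ λ y → 0 S.∋⟨ y , 1 ⟩)
          T : V
          T = sep (⋃ (⋃ c)) dT
          T-i : ∀ {y σ} → c ∋⟨ y , σ ⟩ → σ ∊ T
          T-i {y} {σ} m = sep-i dT (⋃-i (upair-r {y} {σ}) (⋃-i upair-r (∋-e m))) (y , m)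
          closed : ClosedSetOfNames T
          closed σ m z k = let (y , n) = sep-P dT m
                               (u , _ , υ , p , pP , n' , e) = proj₁ (h y σ n z) k
                           in υ , T-i n' , p , pP , e

      check→ : ∀ {x φ p} → check x φ p → φ (ˇ x) p
      check→ {φ = φ} {p} (τ , h , m) = subst (λ τ → φ τ p) (ˇ-unique h) m

      check← : ∀ {x} {φ : V → Forced} {p} → φ (ˇ x) p → check x φ p
      check← {x} m = ˇ x , ˇ-spec x , m

      subset-name : ∀ {σ τ} → σ ⊑ τ → IsName τ → IsName σ
      subset-name {σ} {τ} s (T , h , m) = T ∪ sing σ , closed , ∪-r sing-i
        where
        Item : V → Set ℓ
        Item z = ∃∊ (T ∪ sing σ) λ π → ∃∊ P λ p → IsPair z π p
        old : ∀ {z} → (∃∊ T λ π → ∃∊ P λ p → IsPair z π p) → Item z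
        old (π , a , b) = π , ∪-l a , b
        closed : ∀∊ (T ∪ sing σ) λ υ → ∀∊ υ Item
        closed υ k z l = [ (λ k' → old (h υ k' z l)) , (λ k' → old (h τ m z (s z (subst (z ∊_) (sing-e k') l)))) ]′ (∪-e k)

      infix 8 _⊩_∈_
      _⊩_∈_ : V → V → V → Set ℓ
      p ⊩ π ∈ τ = (π Ext.∊ τ) p

      ∈-elim : ∀ {p π τ} → p ⊩ π ∈ τ → ∀ q → q ≼ p → ∃ λ r → r ≼ q × ∃ λ ρ → ∃ λ s → τ ∋⟨ ρ , s ⟩ × r ≼ s × r ⊩ π ≈ ρ
      ∈-elim m q l = let (r , n , ρ , s , a , b , e) = m q l in r , n , ρ , s , a , b , ≐→≈ (≼-dom n) e

      ∈-from : ∀ {p π τ} → (∀ q → q ≼ p → ∃ λ r → r ≼ q × ∃ λ ρ → ∃ λ s → τ ∋⟨ ρ , s ⟩ × r ≼ s × r ⊩ π ≈ ρ) → p ⊩ π ∈ τ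
      ∈-from h q l = let (r , n , ρ , s , a , b , e) = h q l in r , n , ρ , s , a , b , ≈→≐ e

      ∈-intro : ∀ {p π τ s} → IsName τ → τ ∋⟨ π , s ⟩ → p ≼ s → p ⊩ π ∈ τ
      ∈-intro n m l = ∈-from λ q k → q , ≼r k , _ , _ , m , ≼-trans k l , ≈-refl (≼-dom k) (proj₁ (name-element n m))

      ∈-mono : ∀ {p q π τ} → q ≼ p → p ⊩ π ∈ τ → q ⊩ π ∈ τ
      ∈-mono l m r k = m r (≼-trans k l)

      ∈-local : ∀ {p π τ} → (∀ q → q ≼ p → ∃ λ r → r ≼ q × r ⊩ π ∈ τ) → p ⊩ π ∈ τ
      ∈-local h q l = let (r , n , m) = h q l
                          (r' , n' , x) = m r (≼r n)
                      in r' , ≼-trans n' n , x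

      ∈-congˡ : ∀ {p π π' τ} → p ⊩ π ≈ π' → p ⊩ π ∈ τ → p ⊩ π' ∈ τ
      ∈-congˡ e m = ∈-from λ q l → let (r , n , ρ , s , a , b , x) = ∈-elim m q l
                                   in r , n , ρ , s , a , b , ≈-trans (≈-sym (≈-mono (≼-trans n l) e)) x

      ∈-congʳ : ∀ {p π τ τ'} → p ⊩ τ ≈ τ' → p ⊩ π ∈ τ → p ⊩ π ∈ τ'
      ∈-congʳ e m = ∈-from λ q l →
        let (r , n , ρ , s , a , b , x) = ∈-elim m q l
            (r' , n' , ρ' , s' , a' , b' , y) = ≈-sub e ρ s a r (≼-trans n l) b r (≼r n)
        in r' , ≼-trans n' n , ρ' , s' , a' , b' , ≈-trans (≈-mono n' x) y

      ≈-ext : ∀ {p σ τ} → p ∊ P → IsName σ → IsName τ →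
              (∀ π q → IsName π → q ≼ p → q ⊩ π ∈ σ → q ⊩ π ∈ τ) → (∀ π q → IsName π → q ≼ p → q ⊩ π ∈ τ → q ⊩ π ∈ σ) → p ⊩ σ ≈ τ
      ≈-ext a n n' f g = ≈-intro a n n'
        (λ π s m q l k → ∈-elim (f π q (proj₁ (name-element n m)) l (∈-intro n m k)))
        (λ π s m q l k → ∈-elim (g π q (proj₁ (name-element n' m)) l (∈-intro n' m k)))

      ˇ∈-i : ∀ {x y p} → p ∊ P → x ∊ y → p ⊩ ˇ x ∈ ˇ y
      ˇ∈-i {y = y} a m = ∈-intro (ˇ-name y) (ˇ-member m a) (≼-refl a)

      ∈ˇ-e : ∀ {τ y p} → p ⊩ τ ∈ ˇ y → ∀ q → q ≼ p → ∃ λ r → r ≼ q × ∃ λ u → u ∊ y × r ⊩ τ ≈ ˇ u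
      ∈ˇ-e m q l = let (r , n , ρ , s , a , b , e) = ∈-elim m q l
                       (u , uy , e') = ˇ-member-e a
                   in r , n , u , uy , subst (r ⊩ _ ≈_) e' e

      -- Induction on x. An element z of x is forced into the check name of y, so some stronger
      -- condition makes it equal to an element u of y, and z = u by induction; the other inclusion
      -- is symmetric.
      ˇ-injective : ∀ {x y p} → p ⊩ ˇ x ≈ ˇ y → x ≡ y
      ˇ-injective {x} {y} {p} e = start (transitive-closure isω x)
        where
        step : ∀ {t} → Transitive t → ∀ x → x ∊ t → (∀ u → u ∊ x → u ∊ t → CheckAbsolute u) → CheckAbsolute x
        step tr x xt ih y p σ τ pP hσ hτ e = go (ˇ-unique hσ) (ˇ-unique hτ) e
          where
          go : ∀ {σ τ} → σ ≡ ˇ x → τ ≡ ˇ y → p ⊩ σ ≈ τ → x ≡ y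
          go refl refl e = ext
            (λ z m → let (r , n , u , uy , e') = ∈ˇ-e (∈-congʳ e (ˇ∈-i pP m)) p (≼-refl pP)
                     in subst (_∊ y) (sym (ih z m (tr x xt z m) u r (ˇ z) (ˇ u) (≼-dom n) (ˇ-spec z) (ˇ-spec u) e')) uy)
            (λ z m → let (r , n , u , ux , e') = ∈ˇ-e (∈-congʳ (≈-sym e) (ˇ∈-i pP m)) p (≼-refl pP)
                     in subst (_∊ x) (ih u ux (tr x xt u ux) z r (ˇ u) (ˇ z) (≼-dom n) (ˇ-spec u) (ˇ-spec z) (≈-sym e')) ux)
        start : (∃ λ t → Transitive t × x ∊ t) → x ≡ y
        start (t , tr , xt) = foundation-ind t {CheckAbsolute} (def₂ P Le (S₁₁.ForcingNotions.CheckAbsolute 0 1 2)) (step tr) xt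
          y p (ˇ x) (ˇ y) (proj₁ (≈-names e)) (ˇ-spec x) (ˇ-spec y) e

      -- Names of unordered and ordered pairs. Every condition is attached to each member, as there
      -- is no greatest condition to use.
      up pn : V → V → V
      up σ τ = upair σ τ ⊗ P
      pn σ τ = up (up σ σ) (up σ τ)

      up-name : ∀ {σ τ} → IsName σ → IsName τ → IsName (up σ τ)
      up-name {σ} {τ} (T , h , m) (T' , h' , m') = T ∪ T' ∪ sing (up σ τ) , closed , ∪-r sing-i
        where
        closed : ClosedSetOfNames (T ∪ T' ∪ sing (up σ τ))
        closed υ k z l = [ (λ k' → let (π , a , b) = names-∪′ h h' υ k' z l in π , ∪-l a , b)
                         , (λ k' → let (π , s , a , b , e) = ⊗-e (subst (z ∊_) (sing-e k') l)
                                   in π , [ (λ q → subst (_∊ _) (sym q) (∪-l (∪-l m))) , (λ q → subst (_∊ _) (sym q) (∪-l (∪-r m'))) ]′ (upair-e a)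
                                      , s , b , subst (λ z → IsPair z π s) (sym e) pr-spec) ]′ (∪-e k)

      pn-name : ∀ {σ τ} → IsName σ → IsName τ → IsName (pn σ τ)
      pn-name n n' = up-name (up-name n n) (up-name n n')

      up-∈ : ∀ {p π σ τ} → p ⊩ π ≈ σ ⊎ p ⊩ π ≈ τ → p ⊩ π ∈ up σ τ
      up-∈ (inj₁ e) = ∈-from λ q l → q , ≼r l , _ , q , ∋-i (⊗-i upair-l (≼-dom l)) , ≼r l , ≈-mono l e
      up-∈ (inj₂ e) = ∈-from λ q l → q , ≼r l , _ , q , ∋-i (⊗-i upair-r (≼-dom l)) , ≼r l , ≈-mono l e

      up-e : ∀ {p π σ τ} → p ⊩ π ∈ up σ τ → ∀ q → q ≼ p → ∃ λ r → r ≼ q × (r ⊩ π ≈ σ ⊎ r ⊩ π ≈ τ)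
      up-e m q l = let (r , n , ρ , s , a , b , e) = ∈-elim m q l
                   in r , n , [ (λ x → inj₁ (subst (r ⊩ _ ≈_) x e)) , (λ x → inj₂ (subst (r ⊩ _ ≈_) x e)) ]′ (upair-e (proj₁ (⊗-e₂ (∋-e a))))

      up-cong : ∀ {p σ τ σ' τ'} → p ⊩ σ ≈ σ' → p ⊩ τ ≈ τ' → p ⊩ up σ τ ≈ up σ' τ'
      up-cong e e' = ≈-ext (proj₁ (≈-names e)) (up-name (proj₁ (proj₂ (≈-names e))) (proj₁ (proj₂ (≈-names e')))) (up-name (proj₂ (proj₂ (≈-names e))) (proj₂ (proj₂ (≈-names e'))))
        (λ π q _ l m → go l e e' m) (λ π q _ l m → go l (≈-sym e) (≈-sym e') m)
        where
        go : ∀ {p q π σ τ σ' τ'} → q ≼ p → p ⊩ σ ≈ σ' → p ⊩ τ ≈ τ' → q ⊩ π ∈ up σ τ → q ⊩ π ∈ up σ' τ'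
        go l e e' m = ∈-local λ q' l' → let (r , n , d) = up-e m q' l'
                                            k = ≼-trans n (≼-trans l' l)
                                        in r , n , up-∈ ([ (λ x → inj₁ (≈-trans x (≈-mono k e))) , (λ x → inj₂ (≈-trans x (≈-mono k e'))) ]′ d)

      pn-cong : ∀ {p σ τ σ' τ'} → p ⊩ σ ≈ σ' → p ⊩ τ ≈ τ' → p ⊩ pn σ τ ≈ pn σ' τ'
      pn-cong e e' = up-cong (up-cong e e) (up-cong e e')

      UP-unique : ∀ {p z x y} → p ∊ P → IsName z → IsName x → IsName y → Ext.IsUnorderedPair z x y p → p ⊩ z ≈ up x y
      UP-unique a n n' n'' h = ≈-ext a n (up-name n' n'')
        (λ π q nπ l m → ∈-local λ q' l' → let (r , k , d) = proj₁ (h π nπ) q l m q' l'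
                                          in r , k , up-∈ ([ (λ e → inj₁ (≐→≈ (≼-dom k) e)) , (λ e → inj₂ (≐→≈ (≼-dom k) e)) ]′ d))
        (λ π q nπ l m → proj₂ (h π nπ) q l λ q' l' → let (r , k , d) = up-e m q' l'
                                                     in r , k , [ (λ e → inj₁ (≈→≐ e)) , (λ e → inj₂ (≈→≐ e)) ]′ d)

      UP-intro : ∀ {p z x y} → p ⊩ z ≈ up x y → Ext.IsUnorderedPair z x y p
      UP-intro e π nπ =
        (λ q l m q' l' → let (r , k , d) = up-e (∈-congʳ (≈-mono l e) m) q' l' in r , k , [ (λ e → inj₁ (≈→≐ e)) , (λ e → inj₂ (≈→≐ e)) ]′ d) ,
        (λ q l d → ∈-congʳ (≈-sym (≈-mono l e)) (∈-local λ q' l' → let (r , k , d') = d q' l'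
                                                                  in r , k , up-∈ ([ (λ e → inj₁ (≐→≈ (≼-dom k) e)) , (λ e → inj₂ (≐→≈ (≼-dom k) e)) ]′ d')))

      pair→pn : ∀ {p z x y} → p ∊ P → IsName z → IsName x → IsName y → Ext.IsPair z x y p → p ⊩ z ≈ pn x y
      pair→pn a n nx ny h = ≈-local a n (pn-name nx ny) λ q l →
        let (r , k , A , nA , h') = h q l
            (r' , k' , B , nB , u₁ , u₂ , u₃) = h' r (≼r k)
            c = ≼-dom k'
        in r' , ≼-trans k' k , ≈-trans (UP-unique c n nA nB u₃) (up-cong (UP-unique c nA nx nx u₁) (UP-unique c nB nx ny u₂))

      pn→pair : ∀ {p z x y} → IsName x → IsName y → p ⊩ z ≈ pn x y → Ext.IsPair z x y p
      pn→pair {x = x} {y} nx ny e q l = q , ≼r l , up x x , up-name nx nx , λ q' l' → q' , ≼r l' , up x y , up-name nx ny ,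
        UP-intro (≈-refl (≼-dom l') (up-name nx nx)) , UP-intro (≈-refl (≼-dom l') (up-name nx ny)) , UP-intro (≈-mono (≼-trans l' l) e)

      ∋→pn : ∀ {p F x y} → IsName x → IsName y → (F Ext.∋⟨ x , y ⟩) p → p ⊩ pn x y ∈ F
      ∋→pn nx ny h = ∈-local λ q l → let (r , k , z , nz , m , e) = h q l
                                     in r , k , ∈-congˡ (pair→pn (≼-dom k) nz nx ny e) m

      pn→∋ : ∀ {p F x y} → IsName x → IsName y → p ⊩ pn x y ∈ F → (F Ext.∋⟨ x , y ⟩) p
      pn→∋ {x = x} {y} nx ny m q l = q , ≼r l , pn x y , pn-name nx ny , ∈-mono l m , pn→pair nx ny (≈-refl (≼-dom l) (pn-name nx ny))

      pn-injective : ∀ {p x y x' y'} → p ∊ P → IsName x → IsName y → IsName x' → IsName y' → p ⊩ pn x y ≈ pn x' y' → p ⊩ x ≈ x' × p ⊩ y ≈ y'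
      pn-injective {p} {x} {y} {x'} {y'} a nx ny nx' ny' e = fst≈ , snd≈
        where
        eqˡ : ∀ {p u a b} → p ∊ P → IsName u → IsName a → IsName b → p ⊩ up u u ≈ up a b → p ⊩ u ≈ a
        eqˡ a nu na nb e = ≈-local a nu na λ q l →
          let (r , k , d) = up-e (∈-congʳ (≈-sym e) (up-∈ (inj₁ (≈-refl a na)))) q l
          in r , k , [ ≈-sym , ≈-sym ]′ d
        eqʳ : ∀ {p u a b} → p ∊ P → IsName u → IsName a → IsName b → p ⊩ up u u ≈ up a b → p ⊩ u ≈ b
        eqʳ a nu na nb e = ≈-local a nu nb λ q l →
          let (r , k , d) = up-e (∈-congʳ (≈-sym e) (up-∈ (inj₂ (≈-refl a nb)))) q l
          in r , k , [ ≈-sym , ≈-sym ]′ d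
        fst≈ : p ⊩ x ≈ x'
        fst≈ = ≈-local a nx nx' λ q l →
          let (r , k , d) = up-e (∈-congʳ e (up-∈ (inj₁ (≈-refl a (up-name nx nx))))) q l
          in r , k , [ (λ t → eqˡ (≼-dom k) nx nx' nx' t) , (λ t → eqˡ (≼-dom k) nx nx' ny' t) ]′ d
        half : ∀ {p x y x' y'} → p ∊ P → IsName x → IsName y → IsName x' → IsName y' → p ⊩ pn x y ≈ pn x' y' → ∀ q → q ≼ p → ∃ λ r → r ≼ q × (r ⊩ y ≈ x' ⊎ r ⊩ y ≈ y')
        half {p} {x} {y} {x'} {y'} a nx ny nx' ny' e q l = go (up-e (∈-congʳ e (up-∈ (inj₂ (≈-refl a (up-name nx ny))))) q l)
          where
          Res : Set ℓ
          Res = ∃ λ r → r ≼ q × (r ⊩ y ≈ x' ⊎ r ⊩ y ≈ y')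
          go₂ : ∀ {r} → r ≼ q → (∃ λ r' → r' ≼ r × (r' ⊩ y ≈ x' ⊎ r' ⊩ y ≈ y')) → Res
          go₂ k (r' , k' , d') = r' , ≼-trans k' k , d'
          go : (∃ λ r → r ≼ q × (r ⊩ up x y ≈ up x' x' ⊎ r ⊩ up x y ≈ up x' y')) → Res
          go (r , k , inj₁ t) = r , k , inj₁ (≈-sym (eqʳ (≼-dom k) nx' nx ny (≈-sym t)))
          go (r , k , inj₂ t) = go₂ k (up-e (∈-congʳ t (up-∈ (inj₂ (≈-refl (≼-dom k) ny)))) r (≼r k))
        snd≈ : p ⊩ y ≈ y'
        snd≈ = ≈-local a ny ny' λ q l → go q l (half a nx ny nx' ny' e q l)
          where
          decide : ∀ {r} → r ≼ p → r ⊩ y ≈ x' ⊎ r ⊩ y ≈ y' → r ⊩ y' ≈ x ⊎ r ⊩ y' ≈ y → r ⊩ y ≈ y'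
          decide m (inj₂ t) _ = t
          decide m (inj₁ t) (inj₂ t') = ≈-sym t'
          decide m (inj₁ t) (inj₁ t') = ≈-trans t (≈-trans (≈-sym (≈-mono m fst≈)) (≈-sym t'))
          lower≈ : ∀ {r r'} → r' ≼ r → r ⊩ y ≈ x' ⊎ r ⊩ y ≈ y' → r' ⊩ y ≈ x' ⊎ r' ⊩ y ≈ y'
          lower≈ k = [ (λ t → inj₁ (≈-mono k t)) , (λ t → inj₂ (≈-mono k t)) ]′
          go₂ : ∀ q r → q ≼ p → r ≼ q → r ⊩ y ≈ x' ⊎ r ⊩ y ≈ y' → (∃ λ r' → r' ≼ r × (r' ⊩ y' ≈ x ⊎ r' ⊩ y' ≈ y)) → ∃ λ r → r ≼ q × r ⊩ y ≈ y'
          go₂ q r l k d (r' , k' , d') = r' , ≼-trans k' k , decide (≼-trans (≼-trans k' k) l) (lower≈ k' d) d'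
          go : ∀ q → q ≼ p → (∃ λ r → r ≼ q × (r ⊩ y ≈ x' ⊎ r ⊩ y ≈ y')) → ∃ λ r → r ≼ q × r ⊩ y ≈ y'
          go q l (r , k , d) = go₂ q r l k d (half a nx' ny' nx ny (≈-sym e) r (≼-trans k l))

      -- An identity of names and not merely a forced one, since both sides attach all of P to the
      -- same members.
      ˇ-upair : ∀ x y → ˇ (upair x y) ≡ up (ˇ x) (ˇ y)
      ˇ-upair x y = ext (λ z m → fwd (ˇ-element m)) (λ z m → bwd (⊗-e m))
        where
        fwd : ∀ {z} → (∃ λ u → ∃ λ p → u ∊ upair x y × p ∊ P × z ≡ pr (ˇ u) p) → z ∊ up (ˇ x) (ˇ y)
        fwd (u , p , a , b , refl) = ⊗-i ([ (λ { refl → upair-l }) , (λ { refl → upair-r }) ]′ (upair-e a)) b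
        bwd : ∀ {z} → (∃ λ u → ∃ λ p → u ∊ upair (ˇ x) (ˇ y) × p ∊ P × z ≡ pr u p) → z ∊ ˇ (upair x y)
        bwd (u , p , a , b , refl) = [ (λ { refl → ∋-e (ˇ-member upair-l b) }) , (λ { refl → ∋-e (ˇ-member upair-r b) }) ]′ (upair-e a)

      ˇ-pair : ∀ x y → ˇ (pr x y) ≡ pn (ˇ x) (ˇ y)
      ˇ-pair x y = trans (ˇ-upair (upair x x) (upair x y)) (trans (cong (λ a → up a (ˇ (upair x y))) (ˇ-upair x x)) (cong (up (up (ˇ x) (ˇ x))) (ˇ-upair x y)))

  open CheckNames

  open Notions₁₃ interpretation public

  open Notions₁₄ interpretation public

  open Notions₁₅ interpretation public

  open Notions₁₆ interpretation public

  -- V_δ and the sets H_λ and Z_λ.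

  module _ {δ : V} (fr : Frame δ) where
    module FrameProperties where
      open Frame fr public
      open Omega isω public
      open Bounding regδ public using () renaming (oλ to oδ; limit to limitδ; zero∊ to zero∈δ)
      open Hierarchy hier public using () renaming (total to h-total; dom to h-dom; functional to h-functional; level to h-level)

      o₁ : Ordinal ω₁
      o₁ = SuccessorOf.ordinal succ₁
      o₂ : Ordinal ω₂
      o₂ = SuccessorOf.ordinal succ₂
      w∈ω₁ : w ∊ ω₁
      w∈ω₁ = SuccessorOf.β∊ succ₁ oω
      w⊑ω₁ : w ⊑ ω₁
      w⊑ω₁ = proj₁ o₁ w w∈ω₁
      ω₁∈ω₂ : ω₁ ∊ ω₂
      ω₁∈ω₂ = SuccessorOf.β∊ succ₂ o₁

      max∊ : ∀ {θ α β} → Ordinal θ → α ∊ θ → β ∊ θ → α ∪ β ∊ θ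
      max∊ oθ a b = [ (λ s → subst (_∊ _) (ext (λ x → ∪-r) (λ x k → [ s x , (λ l → l) ]′ (∪-e k))) b)
                    , (λ k → subst (_∊ _) (ext (λ x → ∪-l) (λ x l → [ (λ l → l) , (λ l → ord-trans (ord-elt oθ a) l k) ]′ (∪-e l))) a)
                    ]′ (ord-cases (ord-elt oθ a) (ord-elt oθ b))

      ⊗-small : ∀ {α β} → α ∊ δ → β ∊ δ → SizeBelow (α ⊗ β) δ
      ⊗-small {α} {β} a b = η , m , ≲-trans (⊗-mono (⊑→≲ λ x k → ∪-l (∪-l k)) (⊑→≲ λ x k → ∪-l (∪-r k)))
                                            (hessenberg isω (ord-elt oδ m) (λ x → ∪-r))
        where
        η = α ∪ β ∪ w
        m : η ∊ δ
        m = max∊ oδ (max∊ oδ a b) w∈δ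

      module HierarchyProperties {B θ k : V} (oθ : Ordinal θ) (K : Hierarchy B θ k) where
        open Hierarchy K

        level-mono : ∀ {α β X Y} → α ⊑ β → k ∋⟨ α , X ⟩ → k ∋⟨ β , Y ⟩ → X ⊑ Y
        level-mono s p q x m = proj₂ (level q x) ([ inj₁ , (λ (γ , g , r) → inj₂ (γ , s γ g , r)) ]′ (proj₁ (level p x) m))

        level-subset : ∀ {α β X Y x} → β ∊ α → k ∋⟨ β , X ⟩ → k ∋⟨ α , Y ⟩ → x ⊑ X → x ∊ Y
        level-subset m p q s = proj₂ (level q _) (inj₂ (_ , m , _ , p , s))

        level-transitive : (∀ x → x ∊ B → x ⊑ B) → ∀ {α X} → k ∋⟨ α , X ⟩ → Transitive X
        level-transitive tB p x m y n = [ (λ b → proj₂ (level p y) (inj₁ (tB x b y n)))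
          , (λ (β , b , Y , q , s) → level-mono (proj₁ (ord-elt oθ (dom p)) β b) q p y (s y n)) ]′ (proj₁ (level p x) m)

        module _ (sB : SizeBelow B δ) (θδ : θ ⊑ δ) where
          private
            -- By induction the levels below α have power sets of size below δ, and regularity of δ
            -- bounds these sizes by one γ. An element of Y is then coded by a level and a number,
            -- with base elements numbered separately.
            small′ : ∀ α → α ∊ θ → (∀ β → β ∊ α → β ∊ θ → SmallLevel k δ β) → SmallLevel k δ α
            small′ α m ih Y p =
              step₁ (Bounding.bounding regδ {α} {LevelPowerBelow k} (α , θδ α m , ≲-refl) dP bound) sB
              where
              dP : RelDefn (LevelPowerBelow k)
              dP = def₁ k (S₁.PairIn 1 (S₅.LevelPowerBelow 0))
              dL : RelDefn (LevelInjection k Y)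
              dL = def₂ k Y (S₁.PairIn 2 (S₅.LevelInjection 0 1))
              dC : ∀ {β₀} (i₀ : B ≲ β₀) ι → RelDefn (LevelCode (proj₁ i₀) α ι)
              dC i₀ ι = def₃ (proj₁ i₀) α ι (S₁.PairIn 3 (S₅.LevelCode 0 1 2))
              pick : ∀ {β X P γ η} → k ∋⟨ β , X ⟩ → IsPowerSet P X → P ≲ γ → γ ⊑ η → ∃ λ e → e ∊ 𝒫 (Y ⊗ η) × LevelInjection k Y β e
              pick {X = X} {P} {η = η} q isP i s =
                let dE : RelDefn (λ x v → proj₁ i ∋⟨ x , v ⟩)
                    dE = def₁ (proj₁ i) (S₁.PairIn 1 λ x v → 0 S.∋⟨ x , v ⟩)
                in rel Y η dE , 𝒫-i (sep-⊑ dE) , X , q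
                   , (λ x y l → let (v , r) = Injection.total i (proj₂ (isP x) l) in v , rel-i dE y (s v (Injection.cod i r)) r)
                   , λ x x' y a b → Injection.injective i (proj₂ (proj₂ (rel-e dE a))) (proj₂ (proj₂ (rel-e dE b)))
              inside : ∀ {i₀ η ι} → Selection ι α (𝒫 (Y ⊗ η)) (LevelInjection k Y) → ∀ {x β X} → x ∊ Y → β ∊ α → k ∋⟨ β , X ⟩ → x ⊑ X →
                       ∃ λ z → z ∊ succ α ⊗ η × LevelCode i₀ α ι x z
              inside sel {x} {β} y b q s =
                let (e , r) = Selection.total sel b
                    (X' , q' , t , _) = Selection.holds sel r
                    (v , u) = t x y (subst (x ⊑_) (functional q q') s)
                in pr β v , ⊗-i (∪-l b) (proj₂ (⊗-e₂ (𝒫-e (Selection.cod sel r) _ (∋-e u)))) , inj₂ (β , b , e , v , r , u , pr-spec)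
              same : ∀ {β₀ η ι} (i₀ : B ≲ β₀) → Selection ι α (𝒫 (Y ⊗ η)) (LevelInjection k Y) →
                     ∀ {x x' z} → LevelCode (proj₁ i₀) α ι x z → LevelCode (proj₁ i₀) α ι x' z → x ≡ x'
              same i₀ sel (inj₁ (v , r , p)) (inj₁ (v' , r' , p')) =
                Injection.injective i₀ r (subst (λ v → proj₁ i₀ ∋⟨ _ , v ⟩) (sym (proj₂ (pair-inj p p'))) r')
              same i₀ sel (inj₁ (v , r , p)) (inj₂ (β , b , _ , _ , _ , _ , p')) = ⊥-elim′ (∉-refl (subst (_∊ α) (sym (proj₁ (pair-inj p p'))) b))
              same i₀ sel (inj₂ (β , b , _ , _ , _ , _ , p')) (inj₁ (v , r , p)) = ⊥-elim′ (∉-refl (subst (_∊ α) (sym (proj₁ (pair-inj p p'))) b))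
              same i₀ sel (inj₂ (β , b , e , v , r , u , p)) (inj₂ (β' , b' , e' , v' , r' , u' , p')) = same₂ sel (pair-inj p p') r u r' u'
                where
                same₂ : ∀ {η ι x x' β β' e e' v v'} → Selection ι α (𝒫 (Y ⊗ η)) (LevelInjection k Y) → β ≡ β' × v ≡ v' → ι ∋⟨ β , e ⟩ → e ∋⟨ x , v ⟩ →
                        ι ∋⟨ β' , e' ⟩ → e' ∋⟨ x' , v' ⟩ → x ≡ x'
                same₂ sel (refl , refl) r u r' u' =
                  let (_ , _ , _ , j) = Selection.holds sel r
                  in j _ _ _ u (subst (λ e → e ∋⟨ _ , _ ⟩) (Selection.functional sel _ _ _ r' r) u')
              step₂ : ∀ {γ β₀} → γ ∊ δ → β₀ ∊ δ → (i₀ : B ≲ β₀) →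
                      (∃ λ ι → Selection ι α (𝒫 (Y ⊗ (γ ∪ β₀))) (LevelInjection k Y)) → SizeBelow Y δ
              step₂ {γ} {β₀} g b₀ i₀ (ι , sel) = sizeBelow-trans
                (≲-rel Y (succ α ⊗ (γ ∪ β₀)) {LevelCode (proj₁ i₀) α ι} (dC i₀ ι)
                  (λ {x} y → [ (λ b → let (v , r) = Injection.total i₀ b
                                      in pr α v , ⊗-i succ-i (∪-r (Injection.cod i₀ r)) , inj₁ (v , r , pr-spec))
                             , (λ (β , b , X , q , s) → inside {i₀ = proj₁ i₀} sel y b q s) ]′ (proj₁ (level p x) y))
                  (λ _ _ _ l l' → same i₀ sel l l'))
                (⊗-small (limitδ (θδ α m)) (max∊ oδ g b₀))
              step₁ : (∃ λ γ → γ ∊ δ × ∀ {β} → β ∊ α → ∃ λ ε → ε ∊ γ × LevelPowerBelow k β ε) → SizeBelow B δ → SizeBelow Y δ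
              step₁ (γ , g , c) (β₀ , b₀ , i₀) = step₂ g b₀ i₀ (select α (𝒫 (Y ⊗ (γ ∪ β₀))) {LevelInjection k Y} dL λ b →
                let (ε , e , X , P , q , isP , i) = c b
                in pick q isP (≲-trans i (⊑→≲ (proj₁ (ord-elt oδ g) ε e))) (λ x → ∪-l))
              bound : ∀ {β} → β ∊ α → ∃ λ ε → ε ∊ δ × LevelPowerBelow k β ε
              bound {β} b = let (X , q) = total (ord-trans oθ b m)
                                (ε , e , i) = 𝒫-small (ih β b (ord-trans oθ b m) X q)
                            in ε , e , X , 𝒫 X , q , 𝒫-spec X , i

          level-small : ∀ {α X} → k ∋⟨ α , X ⟩ → SizeBelow X δ
          level-small p = foundation-ind θ {SmallLevel k δ} (def₂ k δ (S₅.SmallLevel 0 1 2)) small′ (dom p) _ p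

      private
        module HP = HierarchyProperties oδ hier

      abstract
        W : V
        W = sep (𝒫 (⋃ (⋃ (⋃ h)))) {InSomeLevel h δ} (def₂ h δ (S₅.InSomeLevel 0 1 2))

        W-e : ∀ {x} → x ∊ W → InSomeLevel h δ x
        W-e = sep-P (def₂ h δ (S₅.InSomeLevel 0 1 2))

        W-i : ∀ {x} → InSomeLevel h δ x → x ∊ W
        W-i (β , b , X , p , s) = sep-i (def₂ h δ (S₅.InSomeLevel 0 1 2))
          (𝒫-i λ y m → ⋃-i (s y m) (⋃-i (upair-r {β} {X}) (⋃-i upair-r (∋-e p)))) (β , b , X , p , s)

      isVAt : IsVAt W δ
      isVAt = h , Hierarchy.isFunctionOn hier ,
        (λ α Y p x → (λ m → [ (λ k → ∅-e k) , (λ k → k) ]′ (proj₁ (h-level p x) m)) , (λ k → proj₂ (h-level p x) (inj₂ k))) ,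
        (λ x → W-e , W-i)

      VAt-unique : ∀ {W'} → IsVAt W' δ → W' ≡ W
      VAt-unique {W'} (h' , f' , e' , s') = ext (λ x m → let (β , b , X , p , s) = proj₁ (s' x) m in W-i (β , b , X , subst (λ z → h ∋⟨ β , z ⟩) (same (h-cod b) p) (h-spec b) , s))
                                               (λ x m → let (β , b , X , p , s) = W-e m
                                                            (X' , p') = proj₂ f' β b
                                                        in proj₂ (s' x) (β , b , X' , p' , subst (x ⊑_) (same p p') s))
        where
        h-cod : ∀ {β} (b : β ∊ δ) → h ∋⟨ β , proj₁ (h-total b) ⟩
        h-cod b = proj₂ (h-total b)
        h-spec : ∀ {β} (b : β ∊ δ) → h ∋⟨ β , proj₁ (h-total b) ⟩
        h-spec b = proj₂ (h-total b)
        step : ∀ β → β ∊ δ → (∀ γ → γ ∊ β → γ ∊ δ → ∀ X X' → h ∋⟨ γ , X ⟩ → h' ∋⟨ γ , X' ⟩ → X ≡ X') → ∀ X X' → h ∋⟨ β , X ⟩ → h' ∋⟨ β , X' ⟩ → X ≡ X'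
        step β b ih X X' p p' = ext
          (λ x m → [ (λ k → ∅-e k) , (λ (γ , g , Y , q , s) →
              let gδ = ord-trans oδ g b
                  (Y' , q') = proj₂ f' γ gδ
              in proj₂ (e' β X' p' x) (γ , g , Y' , q' , subst (x ⊑_) (ih γ g gδ Y Y' q q') s)) ]′ (proj₁ (h-level p x) m))
          (λ x m → let (γ , g , Y' , q' , s) = proj₁ (e' β X' p' x) m
                       gδ = ord-trans oδ g b
                       (Y , q) = h-total gδ
                   in proj₂ (h-level p x) (inj₂ (γ , g , Y , q , subst (x ⊑_) (sym (ih γ g gδ Y Y' q q')) s)))
        same : ∀ {β X X'} → h ∋⟨ β , X ⟩ → h' ∋⟨ β , X' ⟩ → X ≡ X'
        same p p' = foundation-ind δ (def₂ h h' (S.∀̇ λ X → S.∀̇ λ X' → (0 S.∋⟨ 2 , X ⟩) S.⇒ (1 S.∋⟨ 2 , X' ⟩) S.⇒ (X S.≐ X'))) step (h-dom p) _ _ p p'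

      W-⊑ : ∀ {x y} → y ∊ W → x ⊑ y → x ∊ W
      W-⊑ m s = let (β , b , X , p , t) = W-e m in W-i (β , b , X , p , ⊑-trans s t)

      common-level : ∀ {x y} → x ∊ W → y ∊ W → ∃ λ γ → ∃ λ Z → h ∋⟨ γ , Z ⟩ × x ⊑ Z × y ⊑ Z
      common-level m n =
        let (α , a , X , p , s) = W-e m
            (β , b , Y , q , t) = W-e n
            (Z , r) = h-total (max∊ oδ a b)
        in α ∪ β , Z , r , ⊑-trans s (HP.level-mono (λ x → ∪-l) p r) , ⊑-trans t (HP.level-mono (λ x → ∪-r) q r)

      W-upair : ∀ {x y} → x ∊ W → y ∊ W → upair x y ∊ W
      W-upair m n =
        let (γ , Z , r , s , t) = common-level m n
            (Y , q) = h-total (limitδ (h-dom r))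
        in W-i (succ γ , h-dom q , Y , q , λ z k → [ (λ e → subst (_∊ Y) (sym e) (HP.level-subset succ-i r q s))
                                                   , (λ e → subst (_∊ Y) (sym e) (HP.level-subset succ-i r q t)) ]′ (upair-e k))

      W-pr : ∀ {x y} → x ∊ W → y ∊ W → pr x y ∊ W
      W-pr m n = W-upair (W-upair m m) (W-upair m n)

      W-𝒫 : ∀ {x} → x ∊ W → 𝒫 x ∊ W
      W-𝒫 m = let (α , a , X , p , s) = W-e m
                  (Y , q) = h-total (limitδ a)
              in W-i (succ α , h-dom q , Y , q , λ z k → HP.level-subset succ-i p q (⊑-trans (𝒫-e k) s))

      W-∪ : ∀ {x y} → x ∊ W → y ∊ W → x ∪ y ∊ W
      W-∪ m n = let (γ , Z , r , s , t) = common-level m n in W-i (γ , h-dom r , Z , r , λ z k → [ s z , t z ]′ (∪-e k))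

      W-⊗ : ∀ {A B} → A ∊ W → B ∊ W → A ⊗ B ∊ W
      W-⊗ {A} {B} m n = W-⊑ (W-𝒫 (W-𝒫 (W-∪ m n))) λ z k →
        let (x , y , a , b , e) = ⊗-e k
        in 𝒫-i λ u l → 𝒫-i λ v i → [ (λ e₁ → ∪-l (subst (_∊ A) (sym (sing-e (subst (v ∊_) e₁ i))) a))
          , (λ e₂ → [ (λ q → ∪-l (subst (_∊ A) (sym q) a)) , (λ q → ∪-r (subst (_∊ B) (sym q) b)) ]′ (upair-e (subst (v ∊_) e₂ i))) ]′ (upair-e (subst (u ∊_) e l))

      level-ordinal : ∀ {α X} → h ∋⟨ α , X ⟩ → α ⊑ X
      level-ordinal p = foundation-ind δ {ContainsOrdinal h} (def₁ h (S₅.ContainsOrdinal 0 1))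
        (λ α a ih X p β b → let (Y , q) = h-total (ord-trans oδ b a) in HP.level-subset b q p (ih β b (ord-trans oδ b a) Y q)) (h-dom p) _ p

      W-ordinal : ∀ {α} → α ∊ δ → α ∊ W
      W-ordinal a = let (X , p) = h-total a in W-i (_ , a , X , p , level-ordinal p)

      abstract
        -- Cut out of V_δ so that it is a set for every `lam`. For an index it is the true H_λ,
        -- because the sets hereditarily smaller than λ have rank below δ.
        H : V → V
        H lam = sep W {HereditarilyBelow lam} (def₁ lam (S₅.HereditarilyBelow 0 1))

        H-e : ∀ {lam x} → x ∊ H lam → x ∊ W × HereditarilyBelow lam x
        H-e = sep-e (def₁ _ (S₅.HereditarilyBelow 0 1))

        H-i′ : ∀ {lam x} → x ∊ W → HereditarilyBelow lam x → x ∊ H lam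
        H-i′ = sep-i (def₁ _ (S₅.HereditarilyBelow 0 1))

        Z : V → V
        Z lam = sep (𝒫 (H lam)) (def₁ ω₂ (S.SizeBelow 1 0))

        Z-i : ∀ {lam N} → N ⊑ H lam → SizeBelow N ω₂ → N ∊ Z lam
        Z-i s = sep-i (def₁ ω₂ (S.SizeBelow 1 0)) (𝒫-i s)

        Z-e : ∀ {lam N} → N ∊ Z lam → N ⊑ H lam × SizeBelow N ω₂
        Z-e m = let (a , b) = sep-e (def₁ ω₂ (S.SizeBelow 1 0)) m in 𝒫-e a , b

      -- Fewer than λ elements of y enter the hierarchy before λ. By regularity they enter before
      -- one γ < λ, so y itself enters before λ.
      small-transitive : ∀ {lam t X} → Regular lam → h ∋⟨ lam , X ⟩ → Transitive t → SizeBelow t lam → t ⊑ X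
      small-transitive {lam} {t} {X} reg p tr sb y m = foundation-ind t {λ y → y ∊ X} (def₁ X (1 S.∊ 0)) step m
        where
        dR : RelDefn (LevelContains h)
        dR = def₁ h (S₁.PairIn 1 (S₅.LevelContains 0))
        step : ∀ y → y ∊ t → (∀ u → u ∊ y → u ∊ t → u ∊ X) → y ∊ X
        step y yt ih =
          let (γ , g , b) = Bounding.bounding reg {y} {LevelContains h} (sizeBelow-trans (⊑→≲ (tr y yt)) sb) dR
                              λ {u} uy → [ (λ k → ∅-e k) , (λ k → k) ]′ (proj₁ (h-level p u) (ih u uy (tr y yt u uy)))
              (Y , q) = h-total (ord-trans oδ g (h-dom p))
          in HP.level-subset g q p λ u uy → let (β , bγ , Z , r , s) = b uy in HP.level-subset bγ r q s

      H-i : ∀ {lam x} → Regular lam → lam ∊ δ → HereditarilyBelow lam x → x ∊ H lam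
      H-i reg m hb@(t , tr , s , sb) =
        let (X , p) = h-total m
        in H-i′ (W-i (_ , m , X , p , ⊑-trans s (small-transitive reg p tr sb))) hb

      H-spec : ∀ {lam} → IsIndex δ lam → IsH (H lam) lam
      H-spec (reg , m , _) x = (λ k → proj₂ (H-e k)) , H-i reg m

      H-unique : ∀ {lam H'} → IsIndex δ lam → IsH H' lam → H' ≡ H lam
      H-unique i h' = ext (λ x k → proj₂ (H-spec i x) (proj₁ (h' x) k)) (λ x k → proj₂ (h' x) (proj₁ (H-spec i x) k))

      Z-spec : ∀ {lam} → IsIndex δ lam → IsZ (Z lam) lam
      Z-spec i = H _ , ω₂ , H-spec i , isω₂ , λ N → Z-e , λ (a , b) → Z-i a b

      Z-unique : ∀ {lam Z'} → IsIndex δ lam → IsZ Z' lam → Z' ≡ Z lam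
      Z-unique {lam} {Z'} i (H' , ω₂' , h' , o' , e) = same (H-unique i h') (ω₂-unique o' isω₂)
        where
        same : H' ≡ H lam → ω₂' ≡ ω₂ → Z' ≡ Z lam
        same refl refl = ext (λ N k → let (a , b) = proj₁ (e N) k in Z-i a b) (λ N k → proj₂ (e N) (Z-e k))

      H⊑W : ∀ {lam} → H lam ⊑ W
      H⊑W x m = proj₁ (H-e m)

      H-∈W : ∀ {lam} → IsIndex δ lam → H lam ∊ W
      H-∈W (reg , m , _) = let (X , p) = h-total m
                           in W-⊑ (W-𝒫 (W-i (_ , m , X , p , ⊑-refl))) λ x k →
                                let (t , tr , s , sb) = proj₂ (H-e k) in 𝒫-i (⊑-trans s (small-transitive reg p tr sb))

      H-mono : ∀ {lam lam'} → lam ⊑ lam' → H lam ⊑ H lam'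
      H-mono s x m = let (a , (t , tr , u , (α , k , i))) = H-e m in H-i′ a (t , tr , u , (α , s α k , i))

      H-ordinal : ∀ {lam α} → lam ∊ δ → α ∊ lam → α ∊ H lam
      H-ordinal m a = H-i′ (W-ordinal (ord-trans oδ a m)) (_ , proj₁ (ord-elt (ord-elt oδ m) a) , ⊑-refl , (_ , a , ≲-refl))

      H-sing : ∀ {lam x} → x ∊ H lam → sing x ∊ Z lam
      H-sing {lam} {x} m = Z-i (λ y k → subst (_∊ H lam) (sym (sing-e k)) m)
        (w , ord-trans o₂ w∈ω₁ ω₁∈ω₂ , ≲-rel (sing x) w {λ _ y → IsEmpty y} (def₀ (S₁.PairIn 0 λ _ y → S.IsEmpty y))
          (λ _ → ∅ , ω-zero , ∅-empty) (λ p q _ _ _ → trans (sing-e p) (sym (sing-e q))))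

      index-ω₂ : ∀ {lam} → IsIndex δ lam → ω₂ ⊑ lam
      index-ω₂ (_ , _ , (ω₂' , i , s)) = subst (_⊑ _) (ω₂-unique i isω₂) s

      -- Successor cardinals are regular, so the one above max(β, ω₂) is an index of the tower.
      index-above : ∀ {β} → β ∊ δ → ∃ λ lam → IsIndex δ lam × β ∊ lam × SuccessorOf (β ∪ ω₂) lam
      index-above {β} b =
        let m = max∊ oδ b ω₂∈δ
            om = ord-elt oδ m
            (lam , l , s) = successorBelow m
            olam = SuccessorOf.ordinal s
            mlam = SuccessorOf.β∊ s om
        in lam , (SuccessorOf.regular s isω om (λ x k → ∪-r (proj₁ o₂ _ ω₁∈ω₂ x (w⊑ω₁ x k))) , l , ω₂ , isω₂ , λ x k → proj₁ olam _ mlam x (∪-r k))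
           , ⊑-∊-trans (ord-elt oδ b) olam (λ x → ∪-l) mlam , s

    open FrameProperties

    -- Closures of size ω₁.

    module Hulls where
      one two : V
      one = succ ∅
      two = succ one

      one∊ : one ∊ w
      one∊ = ω-succ ω-zero
      two∊ : two ∊ w
      two∊ = ω-succ one∊

      ∅≢one : ∅ ≡ one → ⊥ {ℓ}
      ∅≢one e = ∅-e (subst (∅ ∊_) (sym e) succ-i)
      ∅≢two : ∅ ≡ two → ⊥ {ℓ}
      ∅≢two e = ∅-e (subst (one ∊_) (sym e) succ-i)
      one≢two : one ≡ two → ⊥ {ℓ}
      one≢two e = ∉-refl (subst (one ∊_) (sym e) succ-i)

      abstract
        π : ω₁ ⊗ ω₁ ≲ ω₁
        π = hessenberg isω o₁ w⊑ω₁
      module π = Injection π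

      ω₁-base : TermBase ω₁ π.f ∅ one two
      ω₁-base = record
        { Π-total = λ a b → let (k , m) = π.total (⊗-i a b) in k , π.cod m , m
        ; Π-functional = π.functional ; Π-injective = π.injective
        ; c₀∊ = w⊑ω₁ _ ω-zero ; c₁∊ = w⊑ω₁ _ one∊ ; c₂∊ = w⊑ω₁ _ two∊
        ; c₀≢c₁ = ∅≢one ; c₀≢c₂ = ∅≢two ; c₁≢c₂ = one≢two }

      record Hull (W G A X : V) : Set ℓ where
        field
          inside     : X ⊑ W
          contains   : A ⊑ X
          small      : X ≲ ω₁
          pairClosed : PairClosed X
          closed     : ClosedUnder G X

      -- The hull consists of the values of all terms with leaves in A. Terms are numbers below ω₁
      -- by way of the pairing function `π`, and a term has one value, which bounds the size of the
      -- hull.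
      hull : ∀ W G A → (∀ {x y} → x ∊ W → y ∊ W → pr x y ∊ W) → G ⊑ W ⊗ W → Functional G → A ⊑ W → A ≲ ω₁ → ∃ λ X → Hull W G A X
      hull W G A W-pair G⊑ G-fun A⊑ i = build (MakeEval.eval ω₁-base W-pair (Injection.injective i) G⊑ G-fun)
        where
        code : ∀ {a b} → a ∊ ω₁ → b ∊ ω₁ → ∃ λ k → k ∊ ω₁ × ∃ λ z → IsPair z a b × π.f ∋⟨ z , k ⟩
        code a b = let (k , m) = π.total (⊗-i a b) in k , π.cod m , _ , pr-spec , m
        build : (∃ λ K → Eval W ω₁ π.f (proj₁ i) G ∅ one two K) → ∃ λ X → Hull W G A X
        build (K , ev) = X , record
          { inside = sep-⊑ dX
          ; contains = λ a m → let (j , p) = Injection.total i m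
                                   (k , _ , c) = code (w⊑ω₁ _ ω-zero) (Injection.cod i p)
                               in sep-i dX (A⊑ a m) (k , leaf (A⊑ a m) (Injection.cod i p) p c)
          ; small = ≲-rel X ω₁ {λ x i → K ∋⟨ x , i ⟩} (def₁ K (S₁.PairIn 1 λ x i → 0 S.∋⟨ x , i ⟩))
              (λ m → let (k , p) = sep-P dX m in k , K-cod p , p) (λ _ _ _ p q → unique p q)
          ; pairClosed = λ x m y n z p →
              let (i , q) = sep-P dX m
                  (j , r) = sep-P dX n
                  (k , kω , c) = code (K-cod q) (K-cod r)
                  (l , _ , c') = code (w⊑ω₁ _ one∊) kω
              in subst (_∊ X) (sym (pr-unique p)) (sep-i dX (W-pair (sep-⊑ dX x m) (sep-⊑ dX y n)) (l , node q r c c'))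
          ; closed = λ x m y g →
              let (i , q) = sep-P dX m
                  (j , _ , c) = code (w⊑ω₁ _ two∊) (K-cod q)
              in sep-i dX (proj₂ (⊗-e₂ (G⊑ _ (∋-e g)))) (j , apply q g c) }
          where
          open Eval ev
          dX : Defn (λ x → ∃ λ i → K ∋⟨ x , i ⟩)
          dX = def₁ K (S.∃̇ λ i → 0 S.∋⟨ 1 , i ⟩)
          X : V
          X = sep W dX

    open Hulls

    -- The set U and the diagonal argument.

    module Selections where
      -- ω₁ levels cover U and all subsets of a level are elements of U, so a subset z of U is
      -- recovered from its ω₁ traces, which are elements of U. By `codes⊑U` the subsets of ω₁ × ω₁
      -- can index sections of z.
      record LevelledSet (U k : V) : Set ℓ where
        field
          k-total  : ∀ {i} → i ∊ ω₁ → ∃ λ Y → k ∋⟨ i , Y ⟩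
          k-fun    : ∀ {i Y Y'} → k ∋⟨ i , Y ⟩ → k ∋⟨ i , Y' ⟩ → Y ≡ Y'
          covers   : ∀ {x} → x ∊ U → ∃ λ i → ∃ λ Y → i ∊ ω₁ × k ∋⟨ i , Y ⟩ × x ∊ Y
          subset   : ∀ {i Y z} → i ∊ ω₁ → k ∋⟨ i , Y ⟩ → z ⊑ Y → z ∊ U
          U-pair   : ∀ {x y} → x ∊ U → y ∊ U → pr x y ∊ U
          ω₁⊑U     : ω₁ ⊑ U
          codes⊑U  : 𝒫 (ω₁ ⊗ ω₁) ⊑ U
          U-small  : SizeBelow U δ
          U-transitive : Transitive U

      -- Over a level B of V_δ that includes 𝒫(ω₁ × ω₁) the hierarchy is built up to index ω₁, and U
      -- is the level there. As ω₁ is a limit, each element of U already occurs at a smaller index.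
      levelledSet : ∃ λ U → ∃ λ k → LevelledSet U k
      levelledSet = base (W-e (W-∪ (W-𝒫 (W-⊗ (W-ordinal ω₁∈δ) (W-ordinal ω₁∈δ))) (W-ordinal ω₁∈δ)))
        where
        oS : Ordinal (succ ω₁)
        oS = succ-ord o₁
        finish : ∀ {B k U} → 𝒫 (ω₁ ⊗ ω₁) ∪ ω₁ ⊑ B → Transitive B → SizeBelow B δ → Hierarchy B (succ ω₁) k → k ∋⟨ ω₁ , U ⟩ → LevelledSet U k
        finish {B} {k} {U} s tB sB K top = record
          { k-total = λ i → total (∪-l i)
          ; k-fun = functional
          ; covers = covers
          ; subset = λ i p t → level-subset i p top t
          ; U-pair = λ x y → pair (covers x) (covers y)
          ; ω₁⊑U = λ i m → proj₂ (level top i) (inj₁ (s i (∪-r m)))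
          ; codes⊑U = λ i m → proj₂ (level top i) (inj₁ (s i (∪-l m)))
          ; U-small = level-small sB (λ i m → [ (λ k → ord-trans oδ k ω₁∈δ) , (λ e → subst (_∊ δ) (sym e) ω₁∈δ) ]′ (succ-e m)) top
          ; U-transitive = level-transitive tB top }
          where
          open Hierarchy K
          open HierarchyProperties oS K
          ω₁-limit : ∀ {i} → i ∊ ω₁ → succ i ∊ ω₁
          ω₁-limit = SuccessorOf.succ-closed succ₁ isω oω ⊑-refl
          covers : ∀ {x} → x ∊ U → ∃ λ i → ∃ λ Y → i ∊ ω₁ × k ∋⟨ i , Y ⟩ × x ∊ Y
          covers {x} m = [ bottom , above ]′ (proj₁ (level top x) m)
            where
            Covered : Set ℓ
            Covered = ∃ λ i → ∃ λ Y → i ∊ ω₁ × k ∋⟨ i , Y ⟩ × x ∊ Y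
            pack : ∀ {i} → i ∊ ω₁ → (∃ λ Y → k ∋⟨ i , Y ⟩) → (∀ {Y} → k ∋⟨ i , Y ⟩ → x ∊ Y) → Covered
            pack {i} iω (Y , p) h = i , Y , iω , p , h p
            bottom : x ∊ B → Covered
            bottom b = pack (w⊑ω₁ ∅ ω-zero) (total (∪-l (w⊑ω₁ ∅ ω-zero))) λ p → proj₂ (level p x) (inj₁ b)
            above : (∃∊ ω₁ λ β → ∃ λ X → k ∋⟨ β , X ⟩ × x ⊑ X) → Covered
            above (i , iω , X , p , t) = pack (ω₁-limit iω) (total (∪-l (ω₁-limit iω))) λ q → level-subset succ-i p q t
          pair : ∀ {x y} → (∃ λ i → ∃ λ Y → i ∊ ω₁ × k ∋⟨ i , Y ⟩ × x ∊ Y) → (∃ λ i → ∃ λ Y → i ∊ ω₁ × k ∋⟨ i , Y ⟩ × y ∊ Y) → pr x y ∊ U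
          pair {x} {y} (i , X , iω , p , m) (j , Y , jω , q , n) = go (total (∪-l mω)) (total (∪-l (ω₁-limit mω)))
            where
            mω : i ∪ j ∊ ω₁
            mω = max∊ o₁ iω jω
            go : (∃ λ Z → k ∋⟨ i ∪ j , Z ⟩) → (∃ λ Z → k ∋⟨ succ (i ∪ j) , Z ⟩) → pr x y ∊ U
            go (Z , r) (Z' , r') = level-subset (ω₁-limit mω) r' top λ u l →
              level-subset succ-i r r' λ v l' →
                [ (λ e → subst (_∊ Z) (sym (sing-e (subst (v ∊_) e l'))) xZ)
                , (λ e → [ (λ q → subst (_∊ Z) (sym q) xZ) , (λ q → subst (_∊ Z) (sym q) yZ) ]′ (upair-e (subst (v ∊_) e l'))) ]′ (upair-e l)
              where
              xZ : x ∊ Z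
              xZ = level-mono (λ _ → ∪-l) p r x m
              yZ : y ∊ Z
              yZ = level-mono (λ _ → ∪-r) q r y n
        top : ∀ {B k} → 𝒫 (ω₁ ⊗ ω₁) ∪ ω₁ ⊑ B → Transitive B → SizeBelow B δ → Hierarchy B (succ ω₁) k → ∃ λ U → ∃ λ k → LevelledSet U k
        top s t sB K = let (U , p) = Hierarchy.total K succ-i in U , _ , finish s t sB K p
        base : InSomeLevel h δ (𝒫 (ω₁ ⊗ ω₁) ∪ ω₁) → ∃ λ U → ∃ λ k → LevelledSet U k
        base (α , _ , B , p , s) = top s (HierarchyProperties.level-transitive oδ hier (λ x m → ∅-e m) p)
          (HierarchyProperties.level-small oδ hier (w , w∈δ , ⊑→≲ (λ x m → ∅-e m)) ⊑-refl p) (proj₂ (hierarchy B (succ ω₁) oS))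

      module Coding {U k : V} (L : LevelledSet U k) where
        open LevelledSet L public

        -- A König-type diagonal argument: fewer than |𝒫(U)| sets of size ω₁
        -- cannot contain the traces of every subset of U.
        module König {R : V} (R⊑ : R ⊑ 𝒫 U) (few : ¬̇ (𝒫 U ≲ R)) where
          abstract
            dR : Defn (λ X → X ≲ ω₁)
            dR = def₁ ω₁ (S₃.Inj 1 0)
            dê : RelDefn (InjectionInto ω₁)
            dê = def₁ ω₁ (S₁.PairIn 1 (S₇.InjectionInto 0))
            dG : ∀ R₀ ê → RelDefn (AvoidsSections U ê R₀)
            dG R₀ ê = def₃ U R₀ ê (S₁.PairIn 3 (S₇.AvoidsSections 0 2 1))
            dS : ∀ ê w → RelDefn (λ g X → SectionCode U ê X w g)
            dS ê w = def₃ U ê w (S₁.PairIn 3 λ g X → S₇.SectionCode 0 1 X 2 g)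
            dz : ∀ γ → Defn (λ z → PairIn z (Glue γ))
            dz γ = def₁ γ (S₁.PairIn 1 (S₇.Glue 0))
            dw : ∀ z ê X → RelDefn (TraceCode k z ê X)
            dw z ê X = def₄ k z ê X (S₁.PairIn 4 (S₇.TraceCode 0 1 2 3))
            d∩ : ∀ z → Defn (λ x → x ∊ z)
            d∩ z = def₁ z (1 S.∊ 0)

          R₀ : V
          R₀ = sep R dR

          Solved : Set ℓ
          Solved = ∃ λ z → z ⊑ U × (∀ X → X ∊ R → X ≲ ω₁ → ¬̇ Traces ω₁ k z X)

          injections : ∃ λ ê → Selection ê R₀ (𝒫 (U ⊗ ω₁)) (InjectionInto ω₁)
          injections = select R₀ (𝒫 (U ⊗ ω₁)) dê λ {X} m →
            let (XR , (e , p , q)) = sep-e dR m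
            in e , 𝒫-i (λ z l → let (a , b , c , d , r) = ⊗-e (fun-⊑ p z l)
                                in subst (_∊ U ⊗ ω₁) (sym r) (⊗-i (𝒫-e (R⊑ X XR) a c) d)) , p , q

          -- For fixed w, if every subset g of U were coded by some X in `R₀`, then sending g to
          -- such an X would inject 𝒫(U) into `R₀`, since X and w determine g.
          avoid : ∀ ê → ∃ λ γ → Selection γ (𝒫 (ω₁ ⊗ ω₁)) (𝒫 U) (AvoidsSections U ê R₀)
          avoid ê = select (𝒫 (ω₁ ⊗ ω₁)) (𝒫 U) (dG R₀ ê) λ {w} _ → dne λ n →
            few (≲-trans (≲-rel (𝒫 U) R₀ (dS ê w)
              (λ {g} gU → dne λ n' → n (g , gU , λ X m s → n' (X , m , s)))
              (λ p q _ s s' → ext (λ u m → proj₂ (s' u (𝒫-e p u m)) (proj₁ (s u (𝒫-e p u m)) m))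
                                  (λ u m → proj₂ (s u (𝒫-e q u m)) (proj₁ (s' u (𝒫-e q u m)) m))))
              (⊑→≲ (sep-⊑ dR)))

          -- z is glued from the sections γ(w). If X had all traces of z as elements, let w = `wc` X
          -- record which number X gives to the trace at each level. The union of these traces is z,
          -- so X and w code the section of z at w, which γ(w) was chosen to avoid.
          solve : ∀ {ê γ} → Selection ê R₀ (𝒫 (U ⊗ ω₁)) (InjectionInto ω₁) → Selection γ (𝒫 (ω₁ ⊗ ω₁)) (𝒫 U) (AvoidsSections U ê R₀) → Solved
          solve {ê} {γ} se sγ = z , sep-⊑ (dz γ) , λ X XR i T →
            let X₀ = sep-i dR XR i
                (e , p) = Selection.total se X₀
                (g , q) = Selection.total sγ (w∈ X)
            in Selection.holds sγ q X X₀ (coded X e g X₀ T p q)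
            where
            z : V
            z = sep U (dz γ)
            z-i : ∀ {w u g} → w ∊ U → u ∊ U → γ ∋⟨ w , g ⟩ → u ∊ g → pr w u ∊ z
            z-i a b p m = sep-i (dz γ) (U-pair a b) (_ , _ , pr-spec , _ , p , m)
            z-e : ∀ {w u g} → pr w u ∊ z → γ ∋⟨ w , g ⟩ → u ∊ g
            z-e {w} {u} {g} m q = read (sep-P (dz γ) m)
              where
              match : ∀ {w' u' g'} → w' ≡ w × u' ≡ u → γ ∋⟨ w' , g' ⟩ → u' ∊ g' → u ∊ g
              match (refl , refl) p l = subst (u ∊_) (Selection.functional sγ _ _ _ p q) l
              read : PairIn (pr w u) (Glue γ) → u ∊ g
              read (w' , u' , p , g' , q' , l) = match (pair-inj p pr-spec) q' l
            wc : V → V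
            wc X = rel ω₁ ω₁ (dw z ê X)
            w∈ : ∀ X → wc X ∊ 𝒫 (ω₁ ⊗ ω₁)
            w∈ X = 𝒫-i (sep-⊑ (dw z ê X))
            coded : ∀ X e g → X ∊ R₀ → Traces ω₁ k z X → ê ∋⟨ X , e ⟩ → γ ∋⟨ wc X , g ⟩ → SectionCode U ê X (wc X) g
            coded X e g X₀ T p q u uU = (λ m → fwd (covers (U-pair wU uU)) (z-i wU uU q m)) , bwd
              where
              wU : wc X ∊ U
              wU = codes⊑U _ (w∈ X)
              e-fun = proj₁ (Selection.holds se p)
              e-inj = proj₂ (Selection.holds se p)
              Target : Set ℓ
              Target = ∃ λ e → ∃ λ t → ∃ λ i → ∃ λ j → ê ∋⟨ X , e ⟩ × e ∋⟨ t , j ⟩ × wc X ∋⟨ i , j ⟩ × t ∋⟨ wc X , u ⟩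
              fwd : (∃ λ i → ∃ λ Y → i ∊ ω₁ × k ∋⟨ i , Y ⟩ × pr (wc X) u ∊ Y) → pr (wc X) u ∊ z → Target
              fwd (i , Y , iω , r , l) m =
                let t = sep z (d∩ Y)
                    inter = λ v → (λ b → sep-e (d∩ Y) b) , (λ (b , c) → sep-i (d∩ Y) b c)
                    (j , s) = proj₂ (proj₁ e-fun) t (T i iω Y r t inter)
                    jω = proj₂ e-fun t j s
                in e , t , i , j , p , s , rel-i (dw z ê X) iω jω (Y , t , e , r , inter , p , s) , ∋-i (sep-i (d∩ Y) m l)
              bwd : Target → u ∊ g
              bwd (e' , t , i , j , p' , s , c , m) = unpack (proj₂ (proj₂ (rel-e (dw z ê X) c)))
                where
                unpack : TraceCode k z ê X i j → u ∊ g
                unpack (Y , t' , e'' , r , inter , p'' , s') =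
                  let same = λ {e₁} (p₁ : ê ∋⟨ X , e₁ ⟩) → Selection.functional se _ _ _ p₁ p
                      t≡ = e-inj _ _ _ (subst (λ e → e ∋⟨ t , j ⟩) (same p') s) (subst (λ e → e ∋⟨ t' , j ⟩) (same p'') s')
                  in z-e (proj₁ (proj₁ (inter _) (subst (pr (wc X) u ∊_) t≡ (∋-e m)))) q

          solution : Solved
          solution = combine injections
            where
            combine : (∃ λ ê → Selection ê R₀ (𝒫 (U ⊗ ω₁)) (InjectionInto ω₁)) → Solved
            combine (ê , se) = solve se (proj₂ (avoid ê))

        -- The hull of ω₁ and the ω₁ traces of z under the partial function coded by x. For the
        -- size, elements of ω₁ and traces are numbered with different tags.
        good : ∀ {x z} → x ⊑ U → FunctionalCode ∅ x → z ⊑ U → ∃ λ X → Good U ω₁ ∅ x X × Traces ω₁ k z X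
        good {x} {z} xs fx zU = pack (hull U r A U-pair (sep-⊑ dr) r-fun A⊑ A-small)
          where
          dr : RelDefn (CodeRel ∅ x)
          dr = def₂ ∅ x (S₁.PairIn 2 (S₇.CodeRel 0 1))
          r : V
          r = rel U U dr
          r-fun : Functional r
          r-fun t u u' p q = fx t u u' (proj₂ (proj₂ (rel-e dr p))) (proj₂ (proj₂ (rel-e dr q)))
          dT : Defn (λ t → ∃∊ ω₁ λ i → ∃ λ Y → k ∋⟨ i , Y ⟩ × IsIntersection t z Y)
          dT = def₃ ω₁ k z (S.∃∊ 0 λ i → S.∃̇ λ Y → (1 S.∋⟨ i , Y ⟩) S.∧ S.IsIntersection 3 2 Y)
          A : V
          A = ω₁ ∪ sep U dT
          A⊑ : A ⊑ U
          A⊑ a m = [ ω₁⊑U a , sep-⊑ dT a ]′ (∪-e m)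
          Tag : V → V → Set ℓ
          Tag a j = (a ∊ ω₁ × ∃ λ q → IsPair q ∅ a × π.f ∋⟨ q , j ⟩) ⊎
                    (∃ λ i → ∃ λ Y → ∃ λ q → k ∋⟨ i , Y ⟩ × IsIntersection a z Y × IsPair q one i × π.f ∋⟨ q , j ⟩)
          dTag : RelDefn Tag
          dTag = def₆ ω₁ ∅ π.f k z one (S₁.PairIn 6 λ a j →
            (a S.∊ 0 S.∧ S.∃̇ λ q → S.IsPair q 1 a S.∧ (2 S.∋⟨ q , j ⟩)) S.∨
            (S.∃̇ λ i → S.∃̇ λ Y → S.∃̇ λ q → (3 S.∋⟨ i , Y ⟩) S.∧ S.IsIntersection a 4 Y S.∧ S.IsPair q 5 i S.∧ (2 S.∋⟨ q , j ⟩)))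
          tag-inj : ∀ {a a' j} → Tag a j → Tag a' j → a ≡ a'
          tag-inj (inj₁ (_ , q , p , m)) (inj₁ (_ , q' , p' , m')) = proj₂ (pair-inj p (subst (λ q → IsPair q _ _) (π.injective m' m) p'))
          tag-inj (inj₁ (_ , q , p , m)) (inj₂ (_ , _ , q' , _ , _ , p' , m')) = ⊥-elim′ (∅≢one (proj₁ (pair-inj p (subst (λ q → IsPair q _ _) (π.injective m' m) p'))))
          tag-inj (inj₂ (_ , _ , q' , _ , _ , p' , m')) (inj₁ (_ , q , p , m)) = ⊥-elim′ (∅≢one (proj₁ (pair-inj p (subst (λ q → IsPair q _ _) (π.injective m' m) p'))))
          tag-inj (inj₂ (i , Y , q , r , t , p , m)) (inj₂ (i' , Y' , q' , r' , t' , p' , m')) =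
            same (proj₂ (pair-inj p (subst (λ q → IsPair q _ _) (π.injective m' m) p'))) r r' t t'
            where
            same₁ : ∀ {Y Y' a a'} → Y ≡ Y' → IsIntersection a z Y → IsIntersection a' z Y' → a ≡ a'
            same₁ refl t t' = ext (λ v m → proj₂ (t' v) (proj₁ (t v) m)) (λ v m → proj₂ (t v) (proj₁ (t' v) m))
            same : ∀ {i i' Y Y' a a'} → i ≡ i' → k ∋⟨ i , Y ⟩ → k ∋⟨ i' , Y' ⟩ → IsIntersection a z Y → IsIntersection a' z Y' → a ≡ a'
            same refl r r' = same₁ (k-fun r r')
          A-small : A ≲ ω₁
          A-small = ≲-rel A ω₁ {Tag} dTag (λ m → [ low , (λ l → high (sep-P dT l)) ]′ (∪-e m)) (λ _ _ _ → tag-inj)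
            where
            low : ∀ {a} → a ∊ ω₁ → ∃ λ j → j ∊ ω₁ × Tag a j
            low {a} aω = number (π.total (⊗-i (w⊑ω₁ _ ω-zero) aω))
              where
              number : (∃ λ j → π.f ∋⟨ pr ∅ a , j ⟩) → ∃ λ j → j ∊ ω₁ × Tag a j
              number (j , p) = j , π.cod p , inj₁ (aω , pr ∅ a , pr-spec , p)
            high : ∀ {a} → (∃∊ ω₁ λ i → ∃ λ Y → k ∋⟨ i , Y ⟩ × IsIntersection a z Y) → ∃ λ j → j ∊ ω₁ × Tag a j
            high {a} (i , iω , Y , r , t) = number (π.total (⊗-i (w⊑ω₁ _ one∊) iω))
              where
              number : (∃ λ j → π.f ∋⟨ pr one i , j ⟩) → ∃ λ j → j ∊ ω₁ × Tag a j
              number (j , p) = j , π.cod p , inj₂ (i , Y , pr one i , r , t , pr-spec , p)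
          pack : (∃ λ X → Hull U r A X) → ∃ λ X → Good U ω₁ ∅ x X × Traces ω₁ k z X
          pack (X , H) = X , (inside , (λ i m → contains i (∪-l m)) , small , pairClosed
                             , (λ t m u c → closed t m u (rel-i dr (inside t m) (right c) c)))
                           , (λ i iω Y p t e → contains t (∪-r (sep-i dT (subset iω p (λ v m → proj₂ (proj₁ (e v) m))) (i , iω , Y , p , e))))
            where
            open Hull H
            right : ∀ {t u} → CodeRel ∅ x t u → u ∊ U
            right (q , q' , p , p' , m) = U-transitive _ (U-transitive _ (U-transitive _ (U-transitive _ (xU m) _ (second p')) _ (in-pr p')) _ (second p)) _ (in-pr p)
              where
              second : ∀ {z a b} → IsPair z a b → upair a b ∊ z
              second p = subst (_ ∊_) (sym (pr-unique p)) upair-r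
              in-pr : ∀ {z a b} → IsPair z a b → b ∊ upair a b
              in-pr p = upair-r
              xU : ∀ {q} → q ∊ x → q ∊ U
              xU = xs _

    open Selections

    -- The injective choice of X for each code x.

    module Representatives where
      module _ {U k : V} (L : LevelledSet U k) where
        open Coding L

        -- `sel-inj` is the point: X determines the code x, so an ordinal computed from x and X is a
        -- function of X.
        record Represents (sel : V) : Set ℓ where
          field
            sel-total : ∀ {x} → x ⊑ U → FunctionalCode ∅ x → ∃ λ X → sel ∋⟨ x , X ⟩
            sel-fun   : ∀ {x X X'} → sel ∋⟨ x , X ⟩ → sel ∋⟨ x , X' ⟩ → X ≡ X'
            sel-good  : ∀ {x X} → sel ∋⟨ x , X ⟩ → Good U ω₁ ∅ x X
            sel-inj   : ∀ {x x' X} → sel ∋⟨ x , X ⟩ → sel ∋⟨ x' , X ⟩ → x ≡ x'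

        private
          abstract
            dC : Defn (FunctionalCode ∅)
            dC = def₁ ∅ (S₇.FunctionalCode 0 1)
            dBefore : ∀ s → RelDefn (Before s)
            dBefore s = def₁ s (S₁.PairIn 1 (S₇.Before 0))
            dChoice : RelDefn ChoiceFrom
            dChoice = def₀ (S₁.PairIn 0 S₇.ChoiceFrom)
            dOutside : ∀ x R → Defn (GoodOutside (𝒫 U) U ω₁ ∅ x R)
            dOutside x R = def₆ (𝒫 U) U ω₁ ∅ x R (S₇.GoodOutside 0 1 2 3 4 5 6)

          𝒞 : V
          𝒞 = sep (𝒫 U) dC

          -- The least ordinal θ into which 𝒫(U) injects is used, so that at each stage of the
          -- recursion fewer than |𝒫(U)| sets have been chosen before.
          module WithRank {s θ : V} (oθ : Ordinal θ) (inj : IsFunction s (𝒫 U) θ × IsInjective s) (minimal-θ : ∀ ε → ε ∊ θ → ¬̇ (𝒫 U ≲ ε)) where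
            module s = Injection {𝒫 U} {θ} (s , inj)

            E : V
            E = rel 𝒞 𝒞 (dBefore s)

            E-i : ∀ {x y a b} → x ∊ 𝒞 → y ∊ 𝒞 → s ∋⟨ x , a ⟩ → s ∋⟨ y , b ⟩ → a ∊ b → E ∋⟨ x , y ⟩
            E-i p q m n l = rel-i (dBefore s) p q (_ , _ , m , n , l)

            E-e : ∀ {x y b} → E ∋⟨ x , y ⟩ → s ∋⟨ y , b ⟩ → ∃ λ a → s ∋⟨ x , a ⟩ × a ∊ b
            E-e e n = let (_ , _ , a , b' , m , n' , l) = rel-e (dBefore s) e
                      in a , m , subst (a ∊_) (s.functional n' n) l

            rank : ∀ {x} → x ∊ 𝒞 → ∃ λ a → s ∋⟨ x , a ⟩
            rank m = s.total (sep-⊑ dC _ m)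

            E-wf : WellFounded 𝒞 E
            E-wf = record
              { field⊑ = λ e → proj₁ (rel-e (dBefore s) e)
              ; wf = λ B sub (y , yB) → start B sub y yB (rank (sub y yB)) }
              where
              start : ∀ B → B ⊑ 𝒞 → ∀ y → y ∊ B → (∃ λ a → s ∋⟨ y , a ⟩) → ∃ λ m → m ∊ B × (∀ u → u ∊ B → ¬̇ (E ∋⟨ u , m ⟩))
              start B sub y yB (b , p) = finish (least {λ a → ∃∊ B λ x → s ∋⟨ x , a ⟩} (def₂ B s (S.∃∊ 0 λ x → 1 S.∋⟨ x , 2 ⟩)) (ord-elt oθ (s.cod p)) (y , yB , p))
                where
                finish : (∃ λ μ → Ordinal μ × (∃∊ B λ x → s ∋⟨ x , μ ⟩) × (∀ β → β ∊ μ → ¬̇ (∃∊ B λ x → s ∋⟨ x , β ⟩)) × μ ⊑ b) →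
                         ∃ λ m → m ∊ B × (∀ u → u ∊ B → ¬̇ (E ∋⟨ u , m ⟩))
                finish (μ , _ , (x , xB , q) , min , _) = x , xB , λ u uB e → let (a , r , l) = E-e e q in min a l (u , uB , r)

            module WithChoice {ch : V} (sc : Selection ch (𝒫 (𝒫 U)) (𝒫 U) ChoiceFrom) where
              module ch = Selection sc
              F : V → V → V → Set ℓ
              F = selectionStep (𝒫 U) U ω₁ ∅ ch

              outside : (x R : V) → V
              outside x R = sep (𝒫 U) (dOutside x R)

              outside-spec : ∀ x R X → X ∊ outside x R ⇔ GoodOutside (𝒫 U) U ω₁ ∅ x R X
              outside-spec x R X = (λ m → sep-P (dOutside x R) m) , (λ g → sep-i (dOutside x R) (proj₁ g) g)

              outside-unique : ∀ {x R A} → (∀ X → X ∊ A ⇔ GoodOutside (𝒫 U) U ω₁ ∅ x R X) → A ≡ outside x R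
              outside-unique {x} {R} h = ext (λ X m → proj₂ (outside-spec x R X) (proj₁ (h X) m)) (λ X m → proj₂ (h X) (proj₁ (outside-spec x R X) m))

              F-e : ∀ {x R v} → F x R v → ch ∋⟨ outside x R , v ⟩
              F-e (A , h , m) = subst (λ A → ch ∋⟨ A , _ ⟩) (outside-unique h) m

              F-total : ∀ x R → x ∊ 𝒞 → ∃ λ v → F x R v
              F-total x R _ = let (v , m) = ch.total (𝒫-i (sep-⊑ (dOutside x R))) in v , outside x R , outside-spec x R , m

              private
                module SR = S₂.Recursion (S₇.selectionStep 2 3 4 5 6) 0 1

              recursion : ∃ λ c → Solution F 𝒞 E c
              recursion = Recursion*.solution F 𝒞 E (SR.Value 8 7 9) (ch ∷ ∅ ∷ ω₁ ∷ U ∷ 𝒫 U ∷ E ∷ 𝒞 ∷ [])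
                (λ _ _ k → k) (λ _ _ k → k) (def₇ 𝒞 E (𝒫 U) U ω₁ ∅ ch (S.∃̇ λ v → SR.Value 7 v))
                (WellFounded.field⊑ E-wf) (WellFounded.wf E-wf) F-total
                (λ p q → ch.functional _ _ _ (F-e p) (F-e q))
                (def₇ 𝒞 E (𝒫 U) U ω₁ ∅ ch (S₁.PairIn 7 SR.Value))

              module WithSolution {c : V} (sol : Solution F 𝒞 E c) where
                open Solution sol
                open Recursion F 𝒞 E using (Values)

                fewValues : ∀ {x R} → x ∊ 𝒞 → Values c x R → ¬̇ (𝒫 U ≲ R)
                fewValues {x} {R} xC V i = go (rank xC)
                  where
                  dI : RelDefn (IndexBelow E x c s)
                  dI = def₄ E x c s (S₁.PairIn 4 (S₇.IndexBelow 0 1 2 3))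
                  go : (∃ λ b → s ∋⟨ x , b ⟩) → ⊥ {ℓ}
                  go (b , p) = minimal-θ b (s.cod p) (≲-trans i (≲-rel R b {IndexBelow E x c s} dI
                    (λ {X} m → let (x' , e , q) = proj₁ (V X) m
                                   (a , r , l) = E-e e p
                               in a , l , x' , e , q , r)
                    (λ _ _ _ → same)))
                    where
                    same : ∀ {X X' a} → IndexBelow E x c s X a → IndexBelow E x c s X' a → X ≡ X'
                    same (x₁ , e , q , r) (x₂ , e' , q' , r') = functional q (subst (λ x → c ∋⟨ x , _ ⟩) (s.injective r' r) q')

                values⊑ : ∀ {x R} → Values c x R → R ⊑ 𝒫 U
                values⊑ V X m = let (x' , e , q) = proj₁ (V X) m
                                    (R' , V' , f) = equation q
                                in ch.cod (F-e f)

                -- The diagonal argument provides a z whose traces no earlier value captures, while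
                -- some good X for x captures them. This X is new, so the choice function picks from
                -- a nonempty set.
                chosen : ∀ {x R v} → x ∊ 𝒞 → Values c x R → F x R v → GoodOutside (𝒫 U) U ω₁ ∅ x R v
                chosen {x} {R} {v} xC V f = proj₁ (outside-spec x R v) (ch.holds (F-e f) (exists (König.solution (values⊑ V) (fewValues xC V))))
                  where
                  exists : König.Solved (values⊑ V) (fewValues xC V) → ∃ λ Y → Y ∊ outside x R
                  exists (z , zU , avoid) = pack (good (𝒫-e (sep-⊑ dC x xC)) (sep-P dC xC) zU)
                    where
                    pack : (∃ λ X → Good U ω₁ ∅ x X × Traces ω₁ k z X) → ∃ λ Y → Y ∊ outside x R
                    pack (X , G , T) = X , proj₂ (outside-spec x R X) (𝒫-i (proj₁ G) , G , λ m → avoid X m (proj₁ (proj₂ (proj₂ G))) T)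

                chosen′ : ∀ {x v} → c ∋⟨ x , v ⟩ → ∃ λ R → Values c x R × GoodOutside (𝒫 U) U ω₁ ∅ x R v
                chosen′ m = let (R , V , f) = equation m in R , V , chosen (dom m) V f

                distinct : ∀ {x x' v} → c ∋⟨ x , v ⟩ → c ∋⟨ x' , v ⟩ → ¬̇ (E ∋⟨ x , x' ⟩)
                distinct m m' e = let (R , V , g) = chosen′ m' in proj₂ (proj₂ g) (proj₂ (V _) (_ , e , m))

                represents : Represents c
                represents = record
                  { sel-total = λ s f → total (sep-i dC (𝒫-i s) f)
                  ; sel-fun = functional
                  ; sel-good = λ m → let (R , V , g) = chosen′ m in proj₁ (proj₂ g)
                  ; sel-inj = λ m m' → compare m m' (rank (dom m)) (rank (dom m')) }
                  where
                  compare : ∀ {x x' X} → c ∋⟨ x , X ⟩ → c ∋⟨ x' , X ⟩ → (∃ λ a → s ∋⟨ x , a ⟩) → (∃ λ a → s ∋⟨ x' , a ⟩) → x ≡ x'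
                  compare m m' (a , p) (b , q) with comparable (ord-elt oθ (s.cod p)) (ord-elt oθ (s.cod q))
                  ... | inj₁ l = ⊥-elim′ (distinct m m' (E-i (dom m) (dom m') p q l))
                  ... | inj₂ (inj₁ refl) = s.injective p q
                  ... | inj₂ (inj₂ l) = ⊥-elim′ (distinct m' m (E-i (dom m') (dom m) q p l))

        representatives : ∃ Represents
        representatives = start (𝒫-small U-small)
          where
          withChoice : ∀ {s θ} → Ordinal θ → IsFunction s (𝒫 U) θ × IsInjective s → (∀ ε → ε ∊ θ → ¬̇ (𝒫 U ≲ ε)) →
                       (∃ λ ch → Selection ch (𝒫 (𝒫 U)) (𝒫 U) ChoiceFrom) → ∃ Represents
          withChoice oθ i m (ch , sc) = finish recursion
            where
            open WithRank oθ i m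
            open WithChoice sc
            finish : (∃ λ c → Solution F 𝒞 E c) → ∃ Represents
            finish (c , sol) = c , WithSolution.represents sol
          choiceFunction : ∃ λ ch → Selection ch (𝒫 (𝒫 U)) (𝒫 U) ChoiceFrom
          choiceFunction = select (𝒫 (𝒫 U)) (𝒫 U) dChoice λ {A} a →
            [ (λ (Y , m) → Y , 𝒫-e a Y m , λ _ → m) , (λ n → ∅ , 𝒫-i (λ _ → ∅-e) , λ k → ⊥-elim′ (n k)) ]′ (dec (∃ λ Y → Y ∊ A))
          withRank : (∃ λ θ → Ordinal θ × 𝒫 U ≲ θ × (∀ ε → ε ∊ θ → ¬̇ (𝒫 U ≲ ε))) → ∃ Represents
          withRank (θ , oθ , (s , i) , m) = withChoice oθ i m choiceFunction
          start : SizeBelow (𝒫 U) δ → ∃ Represents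
          start (β , b , i) = let (θ , oθ , j , m , _) = least {λ θ → 𝒫 U ≲ θ} (def₁ (𝒫 U) (S₃.Inj 0 1)) (ord-elt oδ b) i in withRank (θ , oθ , j , m)

    open Representatives

    open OrderTypes oδ

    -- The bounding function f and the stationarity of the sets it bounds.

    module Bounds where
      -- f is a function of N ∩ U which bounds the order type of N ∩ δ for
      -- stationarily many N.
      record BoundingFunction (lam₀ U f : V) : Set ℓ where
        field
          index₀     : IsIndex δ lam₀
          U⊑H        : U ⊑ H lam₀
          f-fun      : ∀ {X γ γ'} → f ∋⟨ X , γ ⟩ → f ∋⟨ X , γ' ⟩ → γ ≡ γ'
          f-cod      : ∀ {X γ} → f ∋⟨ X , γ ⟩ → γ ∊ ω₂
          stationary : ∀ G → G ⊑ W ⊗ W → Functional G → ∃ λ N → Admissible δ ω₁ W U f N × ClosedUnder G N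

      private
       module Build {U k : V} (L : LevelledSet U k) {sel : V} (rep : Represents L sel) (U⊑W : U ⊑ W) where
        open LevelledSet L
        open Represents rep

        abstract
          dΠ : RelDefn (λ x y → x ≡ y)
          dΠ = def₀ (S₁.PairIn 0 S._≐_)

          dBound : RelDefn (BoundOfCode sel one)
          dBound = def₂ sel one (S₁.PairIn 2 (S₈.BoundOfCode 0 1))

          dHas : Defn (HasBound sel one ω₂)
          dHas = def₃ sel one ω₂ (S₈.HasBound 0 1 2 3)

          dCode : ∀ K → Defn (CodeOf U δ ∅ one K)
          dCode K = def₅ U δ ∅ one K (S₈.CodeOf 0 1 2 3 4 5)

          dN : ∀ X K → Defn (λ a → ∃∊ X λ t → K ∋⟨ a , t ⟩)
          dN X K = def₂ X K (S.∃∊ 0 λ t → 1 S.∋⟨ 2 , t ⟩)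

          dρ : ∀ N c → Defn (λ v → ∃∊ N λ α → α ∊ δ × c ∋⟨ α , v ⟩)
          dρ N c = def₃ N c δ (S.∃∊ 0 λ α → α S.∊ 2 S.∧ (1 S.∋⟨ α , 3 ⟩))

          dRank : ∀ K c → RelDefn (RankOfTerm K δ c)
          dRank K c = def₃ K δ c (S₁.PairIn 3 (S₈.RankOfTerm 0 1 2))

        -- Terms are elements of U: a pair is its own code, and every u ∈ U is a leaf whose value is
        -- u.
        Π I : V
        Π = rel (U ⊗ U) U dΠ
        I = rel U U dΠ

        Π-e : ∀ {z k} → Π ∋⟨ z , k ⟩ → z ≡ k
        Π-e m = proj₂ (proj₂ (rel-e dΠ m))

        base : TermBase U Π ∅ one two
        base = record
          { Π-total = λ a b → _ , U-pair a b , rel-i dΠ (⊗-i a b) (U-pair a b) refl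
          ; Π-functional = λ m n → trans (sym (Π-e m)) (Π-e n)
          ; Π-injective = λ m n → trans (Π-e m) (sym (Π-e n))
          ; c₀∊ = ω₁⊑U _ (w⊑ω₁ _ ω-zero) ; c₁∊ = ω₁⊑U _ (w⊑ω₁ _ one∊) ; c₂∊ = ω₁⊑U _ (w⊑ω₁ _ two∊)
          ; c₀≢c₁ = ∅≢one ; c₀≢c₂ = ∅≢two ; c₁≢c₂ = one≢two }

        Af f : V
        Af = sep (𝒫 U) dHas
        -- f(X) is some bound below ω₂ for the relation coded by the x that X represents. It is
        -- chosen before any G is given.
        f-selection : ∃ λ f → Selection f Af ω₂ (BoundOfCode sel one)
        f-selection = select Af ω₂ dBound λ m → let (γ , g , b) = sep-P dHas m in γ , g , b
        f = proj₁ f-selection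
        module f = Selection (proj₂ f-selection)

        module _ {G K : V} (G⊑ : G ⊑ W ⊗ W) (ev : Eval W U Π I G ∅ one two K) where
          open Eval ev

          code : V
          code = sep U (dCode K)

          code-e₀ : ∀ {t u} → CodeRel ∅ code t u → K ∋⟨ u , t ⟩ × u ∊ U
          code-e₀ (z , z' , p , p' , m) = read p p' (sep-P (dCode K) m)
            where
            match : ∀ {t u t' u'} → t ≡ t' × u ≡ u' → K ∋⟨ u' , t' ⟩ → u' ∊ U → K ∋⟨ u , t ⟩ × u ∊ U
            match (refl , refl) m n = m , n
            read : ∀ {z z' t u} → IsPair z t u → IsPair z' ∅ z → CodeOf U δ ∅ one K z' → K ∋⟨ u , t ⟩ × u ∊ U
            read p p' (q , inj₁ (r , t' , u' , r' , m , n)) = match (pair-inj p (subst (λ q → IsPair q t' u') (sym (proj₂ (pair-inj p' r))) r')) m n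
            read p p' (q , inj₂ (r , _)) = ⊥-elim′ (∅≢one (proj₁ (pair-inj p' r)))

          code-e₁ : ∀ {t t'} → CodeRel one code t t' → ∃ λ α → ∃ λ β → K ∋⟨ α , t ⟩ × K ∋⟨ β , t' ⟩ × α ∊ β × β ∊ δ
          code-e₁ (z , z' , p , p' , m) = read p p' (sep-P (dCode K) m)
            where
            Res : V → V → Set ℓ
            Res t t' = ∃ λ α → ∃ λ β → K ∋⟨ α , t ⟩ × K ∋⟨ β , t' ⟩ × α ∊ β × β ∊ δ
            match : ∀ {t u t' u'} → t ≡ t' × u ≡ u' → Res t' u' → Res t u
            match (refl , refl) r = r
            read : ∀ {z z' t u} → IsPair z t u → IsPair z' one z → CodeOf U δ ∅ one K z' → Res t u
            read p p' (q , inj₁ (r , _)) = ⊥-elim′ (∅≢one (proj₁ (pair-inj r p')))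
            read p p' (q , inj₂ (r , t' , u' , r' , res)) = match (pair-inj p (subst (λ q → IsPair q t' u') (sym (proj₂ (pair-inj p' r))) r')) res

          code-i₀ : ∀ {t u} → K ∋⟨ u , t ⟩ → u ∊ U → CodeRel ∅ code t u
          code-i₀ {t} {u} m n = pr t u , pr ∅ (pr t u) , pr-spec , pr-spec ,
            sep-i (dCode K) (U-pair (ω₁⊑U _ (w⊑ω₁ _ ω-zero)) (U-pair (K-cod m) n)) (pr t u , inj₁ (pr-spec , t , u , pr-spec , m , n))

          code-i₁ : ∀ {t t' α β} → K ∋⟨ α , t ⟩ → K ∋⟨ β , t' ⟩ → α ∊ β → β ∊ δ → CodeRel one code t t'
          code-i₁ {t} {t'} {α} {β} m n l d = pr t t' , pr one (pr t t') , pr-spec , pr-spec ,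
            sep-i (dCode K) (U-pair (ω₁⊑U _ (w⊑ω₁ _ one∊)) (U-pair (K-cod m) (K-cod n)))
              (pr t t' , inj₂ (pr-spec , t , t' , pr-spec , α , β , m , n , l , d))

          functionalCode : FunctionalCode ∅ code
          functionalCode t u u' p q = unique (proj₁ (code-e₀ p)) (proj₁ (code-e₀ q))

          module _ {X : V} (selX : sel ∋⟨ code , X ⟩) where
            X⊑U : X ⊑ U
            X⊑U = proj₁ (sel-good selX)
            ω₁⊑X : ω₁ ⊑ X
            ω₁⊑X = proj₁ (proj₂ (sel-good selX))
            X-small : X ≲ ω₁
            X-small = proj₁ (proj₂ (proj₂ (sel-good selX)))
            X-pair : ∀ {x y} → x ∊ X → y ∊ X → pr x y ∊ X
            X-pair a b = proj₁ (proj₂ (proj₂ (proj₂ (sel-good selX)))) _ a _ b _ pr-spec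
            X-closed : ∀ {t u} → t ∊ X → K ∋⟨ u , t ⟩ → u ∊ U → u ∊ X
            X-closed a m n = proj₂ (proj₂ (proj₂ (proj₂ (sel-good selX)))) _ a _ (code-i₀ m n)

            -- The values of the terms in X. Leaves give X ⊆ N; conversely a value in U of a term in
            -- X lies in X, since X is closed under the part of the evaluation recorded in the code.
            -- Hence N ∩ U = X.
            N : V
            N = sep W (dN X K)

            N-i : ∀ {a t} → t ∊ X → K ∋⟨ a , t ⟩ → a ∊ N
            N-i m p = sep-i (dN X K) (K-dom p) (_ , m , p)

            N-e : ∀ {a} → a ∊ N → ∃∊ X λ t → K ∋⟨ a , t ⟩
            N-e = sep-P (dN X K)

            mkCode : ∀ {a b} → a ∊ X → b ∊ X → ∃ λ z → IsPair z a b × Π ∋⟨ z , pr a b ⟩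
            mkCode a b = _ , pr-spec , rel-i dΠ (⊗-i (X⊑U _ a) (X⊑U _ b)) (U-pair (X⊑U _ a) (X⊑U _ b)) refl

            n∊X : ∀ {n} → n ∊ w → n ∊ X
            n∊X m = ω₁⊑X _ (w⊑ω₁ _ m)

            X⊑N : X ⊑ N
            X⊑N u m = N-i (X-pair (n∊X ω-zero) m) (leaf (U⊑W u (X⊑U u m)) (X⊑U u m) (rel-i dΠ (X⊑U u m) (X⊑U u m) refl) (mkCode (n∊X ω-zero) m))

            N-small : N ≲ ω₁
            N-small = ≲-trans (≲-rel N X {λ a t → K ∋⟨ a , t ⟩} (def₁ K (S₁.PairIn 1 λ a t → 0 S.∋⟨ a , t ⟩)) (λ m → N-e m) (λ _ _ _ p q → unique p q)) X-small

            N-pair : PairClosed N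
            N-pair x m y n z p = go (N-e m) (N-e n)
              where
              go : (∃∊ X λ t → K ∋⟨ x , t ⟩) → (∃∊ X λ t → K ∋⟨ y , t ⟩) → z ∊ N
              go (t , a , q) (t' , b , r) = subst (_∊ N) (sym (pr-unique p))
                (N-i (X-pair (n∊X one∊) (X-pair a b)) (node q r (mkCode a b) (mkCode (n∊X one∊) (X-pair a b))))

            N-closed : ClosedUnder G N
            N-closed x m y g = let (t , a , q) = N-e m in N-i (X-pair (n∊X two∊) a) (apply q g (mkCode (n∊X two∊) a))

            N∩U : IsIntersection X N U
            N∩U u = (λ m → X⊑N u m , X⊑U u m) , λ (m , n) → let (t , a , q) = N-e m in X-closed a q n

            module WithCollapse {c : V} (C : CollapseOf δ N c) where
              otp : ∀ {α v} → c ∋⟨ α , v ⟩ → Otp δ N α v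
              otp m = c , C , m

              -- The order type of N ∩ δ. It is below ω₂ because N has size at most ω₁, and the
              -- order types of the values rank the coded relation below it, so f is defined at X.
              ρ : V
              ρ = sep (⋃ (⋃ c)) (dρ N c)

              ρ-i : ∀ {α v} → α ∊ N → α ∊ δ → c ∋⟨ α , v ⟩ → v ∊ ρ
              ρ-i {α} {v} a d m = sep-i (dρ N c) (⋃-i (upair-r {α} {v}) (⋃-i upair-r (∋-e m))) (α , a , d , m)

              value : ∀ {α} → α ∊ δ → ∃ λ v → c ∋⟨ α , v ⟩
              value = proj₁ (proj₂ C) _

              oρ : Ordinal ρ
              oρ = (λ v m x l → let (α , a , d , p) = sep-P (dρ N c) m
                                    (β , b , q , r) = proj₁ (proj₂ (proj₂ (proj₂ C) α v p) x) l
                                in ρ-i b (ord-trans oδ q d) r)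
                 , (λ v m → let (α , a , d , p) = sep-P (dρ N c) m in proj₁ (otp-ordinal (otp p)))

              ρ∈ω₂ : ρ ∊ ω₂
              ρ∈ω₂ = SuccessorOf.small→∊ succ₂ oρ (≲-trans
                (≲-rel ρ N {λ v α → c ∋⟨ α , v ⟩} (def₁ c (S₁.PairIn 1 λ v α → 0 S.∋⟨ α , v ⟩))
                  (λ m → let (α , a , d , p) = sep-P (dρ N c) m in α , a , p) (λ _ _ _ p q → proj₁ C _ _ _ p q)) N-small)

              e : V
              e = rel X ρ (dRank K c)

              bound : GoodBound one code X ρ
              bound = e , (λ t v m → proj₁ (proj₂ (rel-e (dRank K c) m))) , total , increasing
                where
                total : ∀ t → t ∊ X → ∃ λ v → e ∋⟨ t , v ⟩
                total t m = [ yes′ , no′ ]′ (dec (∃ λ α → K ∋⟨ α , t ⟩ × α ∊ δ))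
                  where
                  yes′ : (∃ λ α → K ∋⟨ α , t ⟩ × α ∊ δ) → ∃ λ v → e ∋⟨ t , v ⟩
                  yes′ (α , p , d) = let (v , q) = value d in v , rel-i (dRank K c) m (ρ-i (N-i m p) d q) (inj₁ (α , p , d , q))
                  no′ : ¬̇ (∃ λ α → K ∋⟨ α , t ⟩ × α ∊ δ) → ∃ λ v → e ∋⟨ t , v ⟩
                  -- Terms whose value is not an ordinal below δ get rank 0, which is in ρ because 0
                  -- ∈ N.
                  no′ n = let (v , q) = value zero∈δ
                              v≡∅ = otp-identity (λ x → ∅-e) (otp q)
                          in v , rel-i (dRank K c) m (ρ-i (X⊑N _ (n∊X ω-zero)) zero∈δ q) (inj₂ (n , subst IsEmpty (sym v≡∅) ∅-empty))
                rank : ∀ {t v α} → RankOfTerm K δ c t v → K ∋⟨ α , t ⟩ → α ∊ δ → c ∋⟨ α , v ⟩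
                rank (inj₁ (α' , p , _ , q)) p' d = subst (λ α → c ∋⟨ α , _ ⟩) (unique p p') q
                rank (inj₂ (n , _)) p' d = ⊥-elim′ (n (_ , p' , d))
                increasing : ∀ t → t ∊ X → ∀ t' → t' ∊ X → CodeRel one code t t' → ∀ v v' → e ∋⟨ t , v ⟩ → e ∋⟨ t' , v' ⟩ → v ∊ v'
                increasing t m t' m' r v v' a b = go (code-e₁ r)
                  where
                  go : (∃ λ α → ∃ λ β → K ∋⟨ α , t ⟩ × K ∋⟨ β , t' ⟩ × α ∊ β × β ∊ δ) → v ∊ v'
                  go (α , β , p , q , l , d) = otp-mono (otp (rank (proj₂ (proj₂ (rel-e (dRank K c) b))) q d)) (N-i m p) l
                    (otp (rank (proj₂ (proj₂ (rel-e (dRank K c) a))) p (ord-trans oδ l d)))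

              -- The chosen γ need not be ρ. By induction on α, any ranking of the coded relation
              -- dominates the order type of N ∩ α at each term of X with value α, so every bound
              -- for the code bounds the order types.
              below : ∀ {γ} → Ordinal γ → GoodBound one code X γ → ∀ {α v} → α ∊ N → α ∊ δ → c ∋⟨ α , v ⟩ → v ∊ γ
              below {γ} oγ (e' , cod , tot , inc) {α} {v} a d p = go (N-e a)
                where
                step : ∀ α → α ∊ δ → (∀ β → β ∊ α → β ∊ δ → RankBelow K X c e' β) → RankBelow K X c e' α
                step α d ih t m p v q v' r x l = inner (proj₁ (proj₂ (proj₂ (proj₂ C) α v q) x) l)
                  where
                  inner : (∃ λ β → β ∊ N × β ∊ α × c ∋⟨ β , x ⟩) → x ∊ v'
                  inner (β , b , s , q') = inner₂ (N-e b)
                    where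
                    inner₂ : (∃∊ X λ t → K ∋⟨ β , t ⟩) → x ∊ v'
                    inner₂ (t' , m' , p') = let (y , r') = tot t' m'
                                            in ⊑-∊-trans (otp-ordinal (otp q')) (ord-elt oγ (cod t v' r))
                                                 (ih β s (ord-trans oδ s d) t' m' p' x q' y r')
                                                 (inc t' m' t m (code-i₁ p' p s d) y v' r' r)
                go : (∃∊ X λ t → K ∋⟨ α , t ⟩) → v ∊ γ
                go (t , m , q) = let (v' , r) = tot t m
                                 in ⊑-∊-trans (otp-ordinal (otp p)) oγ
                                      (foundation-ind δ {RankBelow K X c e'} (def₄ K X c e' (S₈.RankBelow 0 1 2 3 4)) step d t m q v p v' r) (cod t v' r)

              X∊Af : X ∊ Af
              X∊Af = sep-i dHas (𝒫-i X⊑U) (ρ , ρ∈ω₂ , code , selX , bound)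

              admissible : Admissible δ ω₁ W U f N
              admissible = sep-⊑ (dN X K) , N-small , ⊑-trans ω₁⊑X X⊑N , N-pair , finish (f.total X∊Af)
                where
                finish : (∃ λ γ → f ∋⟨ X , γ ⟩) → ∃ λ X → ∃ λ γ → IsIntersection X N U × f ∋⟨ X , γ ⟩ × (∀∊ N λ α → α ∊ δ → ∀ v → Otp δ N α v → v ∊ γ)
                finish (γ , m) = X , γ , N∩U , m , λ α a d v o → inside (f.holds m) a d (value d) o
                  where
                  inside : BoundOfCode sel one X γ → ∀ {α v} → α ∊ N → α ∊ δ → (∃ λ v → c ∋⟨ α , v ⟩) → Otp δ N α v → v ∊ γ
                  -- The bound f(X) belongs to some x' represented by X; injectivity of the
                  -- representation makes x' the code of the present evaluation.
                  inside (x' , s , b) a d (v' , p) o = subst (_∊ γ) (otp-unique (otp p) o)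
                    (below (ord-elt o₂ (f.cod m)) (subst (λ x → GoodBound one x X γ) (sel-inj s selX) b) a d p)

        stationary : ∀ G → G ⊑ W ⊗ W → Functional G → ∃ λ N → Admissible δ ω₁ W U f N × ClosedUnder G N
        stationary G G⊑ G-fun = step₁ (MakeEval.eval base W-pr (λ m n → trans (I-e m) (sym (I-e n))) G⊑ G-fun)
          where
          I-e : ∀ {x y} → I ∋⟨ x , y ⟩ → x ≡ y
          I-e m = proj₂ (proj₂ (rel-e dΠ m))
          step₁ : (∃ λ K → Eval W U Π I G ∅ one two K) → ∃ λ N → Admissible δ ω₁ W U f N × ClosedUnder G N
          step₁ (K , ev) = step₂ (sel-total (sep-⊑ (dCode K)) (functionalCode G⊑ ev))
            where
            step₂ : (∃ λ X → sel ∋⟨ code G⊑ ev , X ⟩) → ∃ λ N → Admissible δ ω₁ W U f N × ClosedUnder G N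
            step₂ (X , s) = step₃ (collapse-exists (N G⊑ ev s))
              where
              step₃ : (∃ λ c → CollapseOf δ (N G⊑ ev s) c) → ∃ λ N → Admissible δ ω₁ W U f N × ClosedUnder G N
              step₃ (c , C) = N G⊑ ev s , WithCollapse.admissible G⊑ ev s C , N-closed G⊑ ev s

      boundingFunction : ∃ λ lam₀ → ∃ λ U → ∃ λ f → BoundingFunction lam₀ U f
      boundingFunction = start levelledSet
        where
        Result : Set ℓ
        Result = ∃ λ lam₀ → ∃ λ U → ∃ λ f → BoundingFunction lam₀ U f
        finish : ∀ {U k β lam} → (L : LevelledSet U k) → U ≲ β → IsIndex δ lam → β ∊ lam → ∃ (Represents L) → Result
        finish {U} {k} {β} {lam} L i ind m (sel , rep) = lam , U , B.f , record
          { index₀ = ind ; U⊑H = U⊑H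
          ; f-fun = B.f.functional _ _ _
          ; f-cod = B.f.cod
          ; stationary = B.stationary }
          where
          open LevelledSet L
          U⊑H : U ⊑ H lam
          U⊑H x k = H-i (proj₁ ind) (proj₁ (proj₂ ind)) (U , U-transitive , U-transitive x k , (β , m , i))
          module B = Build L rep (⊑-trans U⊑H H⊑W)
        choose : ∀ {U k β} → (L : LevelledSet U k) → U ≲ β → (∃ λ lam → IsIndex δ lam × β ∊ lam × SuccessorOf (β ∪ ω₂) lam) → Result
        choose L i (lam , ind , m , _) = finish L i ind m (representatives L)
        start : (∃ λ U → ∃ λ k → LevelledSet U k) → Result
        start (U , k , L) = let (β , b , i) = LevelledSet.U-small L in choose L i (index-above b)

    open Bounds

    -- The ideals and the tower.

    module _ {lam₀ U f : V} (bf : BoundingFunction lam₀ U f) where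
      module Tower where
        open BoundingFunction bf public
        open Ideal δ ω₁ W U f public

        Adm : V → Set ℓ
        Adm = Admissible δ ω₁ W U f

        module Adm {N : V} (a : Adm N) where
          ⊑W : N ⊑ W
          ⊑W = proj₁ a
          small : N ≲ ω₁
          small = proj₁ (proj₂ a)
          ω₁⊑ : ω₁ ⊑ N
          ω₁⊑ = proj₁ (proj₂ (proj₂ a))
          pair : ∀ {x y} → x ∊ N → y ∊ N → pr x y ∊ N
          pair p q = proj₁ (proj₂ (proj₂ (proj₂ a))) _ p _ q _ pr-spec
          ∩H : ∀ {lam} → N ∩ H lam ∊ Z lam
          ∩H = Z-i (λ x m → proj₂ (∩-e m)) (ω₁ , ω₁∈ω₂ , ≲-trans (⊑→≲ λ x m → proj₁ (∩-e m)) small)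

        kills⊑ : ∀ {Y G} → Kills Y G → G ⊑ W ⊗ W
        kills⊑ (s , _) z m = let (x , a , y , b , p) = s z m in subst (_∊ W ⊗ W) (sym (pr-unique p)) (⊗-i a b)

        toKills : ∀ {Y G} → G ⊑ W ⊗ W → Functional G → (∀ N → Adm N → ClosedUnder G N → ¬̇ Y N) → Kills Y G
        toKills s fn h = (λ z m → let (x , y , a , b , e) = ⊗-e (s z m) in x , a , y , b , subst (λ z → IsPair z x y) (sym e) pr-spec) , fn , h

        null-⊑ : ∀ {X Y : V → Set ℓ} → (∀ N → Adm N → X N → Y N) → Null Y → Null X
        null-⊑ h (G , s , fn , k) = G , s , fn , λ N a c x → k N a c (h N a x)

        null-empty : ∀ {X : V → Set ℓ} → (∀ N → Adm N → ¬̇ X N) → Null X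
        null-empty h = ∅ , (λ z m → ∅-e m) , (λ x y y' m → ∅-e (∋-e m)) , λ N a _ → h N a

        not-null : ∀ {X : V → Set ℓ} → (∀ N → Adm N → X N) → ¬̇ Null X
        not-null h k@(G , s , fn , r) = let (N , a , c) = stationary G (kills⊑ {G = G} (s , fn , r)) fn in r N a c (h N a)

        ∅∊W : ∅ ∊ W
        ∅∊W = W-ordinal zero∈δ
        n∊W : ∀ {n} → n ∊ w → n ∊ W
        n∊W m = W-ordinal (ord-trans oδ m w∈δ)

        -- One function acts as G on arguments (0, x) and as G' on arguments (1, x). An admissible N
        -- has these pairs as elements whenever x ∈ N.
        null-∪ : ∀ {X Y : V → Set ℓ} → Null X → Null Y → Null (λ N → X N ⊎ Y N)
        null-∪ {X} {Y} (G , k) (G' , k') = G* , toKills (sep-⊑ d) fn kill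
          where
          d : Defn (Tagged ∅ one G G')
          d = def₄ ∅ one G G' (S₁₀.Tagged 0 1 2 3 4)
          G* : V
          G* = sep (W ⊗ W) d
          Res : V → V → Set ℓ
          Res q y = (∃ λ x → IsPair q ∅ x × G ∋⟨ x , y ⟩) ⊎ (∃ λ x → IsPair q one x × G' ∋⟨ x , y ⟩)
          G*-e : ∀ {q y} → G* ∋⟨ q , y ⟩ → Res q y
          G*-e {q} {y} m = read (sep-P d (∋-e m))
            where
            match : ∀ {q' y'} → q' ≡ q × y' ≡ y → Res q' y' → Res q y
            match (refl , refl) r = r
            read : Tagged ∅ one G G' (pr q y) → Res q y
            read (q' , y' , p , r) = match (pair-inj p pr-spec) r
          fn : Functional G*
          fn q y y' m m' = compare (G*-e m) (G*-e m')
            where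
            compare : Res q y → Res q y' → y ≡ y'
            compare (inj₁ (x , p , a)) (inj₁ (x' , p' , a')) = proj₁ (proj₂ k) _ _ _ a (subst (λ x → G ∋⟨ x , y' ⟩) (proj₂ (pair-inj p' p)) a')
            compare (inj₁ (x , p , a)) (inj₂ (x' , p' , a')) = ⊥-elim′ (∅≢one (proj₁ (pair-inj p p')))
            compare (inj₂ (x , p , a)) (inj₁ (x' , p' , a')) = ⊥-elim′ (∅≢one (proj₁ (pair-inj p' p)))
            compare (inj₂ (x , p , a)) (inj₂ (x' , p' , a')) = proj₁ (proj₂ k') _ _ _ a (subst (λ x → G' ∋⟨ x , y' ⟩) (proj₂ (pair-inj p' p)) a')
          kill : ∀ N → Adm N → ClosedUnder G* N → ¬̇ (X N ⊎ Y N)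
          kill N a c = [ proj₂ (proj₂ k) N a (λ x m y g → c (pr ∅ x) (pair (tag ω-zero) m) y
                           (∋-i (sep-i d (⊗-i (W-pr ∅∊W (⊑W x m)) (proj₂ (⊗-e₂ (kills⊑ k _ (∋-e g))))) (_ , y , pr-spec , inj₁ (x , pr-spec , g)))))
                       , proj₂ (proj₂ k') N a (λ x m y g → c (pr one x) (pair (tag one∊) m) y
                           (∋-i (sep-i d (⊗-i (W-pr (n∊W one∊) (⊑W x m)) (proj₂ (⊗-e₂ (kills⊑ k' _ (∋-e g))))) (_ , y , pr-spec , inj₂ (x , pr-spec , g))))) ]′
            where
            open Adm a
            tag : ∀ {n} → n ∊ w → n ∊ N
            tag m = ω₁⊑ _ (w⊑ω₁ _ m)

        -- Normality: a diagonal union of null families is null.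
        nabla : ∀ B {Y : V → V → Set ℓ} → B ⊑ W → RelDefn (λ b G → Kills (Y b) G) → (∀ b → b ∊ B → Null (Y b)) →
                Null (λ N → ∃ λ b → b ∊ N × b ∊ B × Y b N)
        nabla B {Y} B⊑ d h = build (select B (𝒫 (W ⊗ W)) d λ {b} m → let (G , k) = h b m in G , 𝒫-i (kills⊑ {Y b} k) , k)
          where
          build : (∃ λ g → Selection g B (𝒫 (W ⊗ W)) (λ b G → Kills (Y b) G)) → Null (λ N → ∃ λ b → b ∊ N × b ∊ B × Y b N)
          build (g , sg) = G* , toKills (sep-⊑ d*) fn kill
            where
            open Selection sg
            d* : RelDefn (Diagonally g)
            d* = def₁ g (S₁.PairIn 1 (S₁₀.Diagonally 0))
            G* : V
            G* = rel W W d*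
            fn : Functional G*
            fn q y y' m m' = compare (proj₂ (proj₂ (rel-e d* m))) (proj₂ (proj₂ (rel-e d* m')))
              where
              same : ∀ {b b' x x' G G'} → b ≡ b' × x ≡ x' → g ∋⟨ b , G ⟩ → g ∋⟨ b' , G' ⟩ → G ∋⟨ x , y ⟩ → G' ∋⟨ x' , y' ⟩ → y ≡ y'
              same (refl , refl) p p' r r' = proj₁ (proj₂ (holds p)) _ _ _ r (subst (λ G → G ∋⟨ _ , y' ⟩) (functional _ _ _ p' p) r')
              compare : Diagonally g q y → Diagonally g q y' → y ≡ y'
              compare (b , x , G , e , p , r) (b' , x' , G' , e' , p' , r') = same (pair-inj e e') p p' r r'
            kill : ∀ N → Adm N → ClosedUnder G* N → ¬̇ (∃ λ b → b ∊ N × b ∊ B × Y b N)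
            kill N a c (b , bN , bB , y) = go (total bB)
              where
              open Adm a
              go : (∃ λ G → g ∋⟨ b , G ⟩) → ⊥ {ℓ}
              go (G , p) = proj₂ (proj₂ (holds p)) N a
                (λ x m y r → c (pr b x) (pair bN m) y (rel-i d* (W-pr (B⊑ b bB) (⊑W x m)) (proj₂ (⊗-e₂ (kills⊑ {Y b} (holds p) _ (∋-e r)))) (b , x , G , pr-spec , p , r))) y

        -- Closure under the constant function with value b puts b into N, since N has 0 as an
        -- element.
        null-omitting : ∀ {b} → b ∊ W → Null (λ N → ¬̇ (b ∊ N))
        null-omitting {b} bW = rel W W d , toKills (sep-⊑ d) (λ x y y' m m' → trans (proj₂ (proj₂ (rel-e d m))) (sym (proj₂ (proj₂ (rel-e d m')))))
          λ N a c n → n (c ∅ (Adm.ω₁⊑ a _ (w⊑ω₁ _ ω-zero)) b (rel-i d ∅∊W bW refl))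
          where
          d : RelDefn (λ x y → y ≡ b)
          d = def₁ b (S₁.PairIn 1 λ x y → y S.≐ 0)

        abstract
          dJ : ∀ lam → Defn (λ A → Null (Trace A (H lam)))
          dJ lam = def₆ δ ω₁ W U f (H lam) (S₁₀.Ideal.Null 0 1 2 3 4 (S₁₀.Trace 6 5))

          J : V → V
          J lam = sep (𝒫 (Z lam)) (dJ lam)

          J-i : ∀ {lam A} → A ⊑ Z lam → Null (Trace A (H lam)) → A ∊ J lam
          J-i s n = sep-i (dJ _) (𝒫-i s) n

          J-e : ∀ {lam A} → A ∊ J lam → A ⊑ Z lam × Null (Trace A (H lam))
          J-e m = let (a , b) = sep-e (dJ _) m in 𝒫-e a , b

        Z∉J : ∀ {lam} → ¬̇ (Z lam ∊ J lam)
        Z∉J m = not-null (λ N a → trace-i (Adm.∩H a)) (proj₂ (J-e m))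

        module _ {lam : V} (ind : IsIndex δ lam) where
          private
            lamδ : lam ∊ δ
            lamδ = proj₁ (proj₂ ind)

          ω₂⊑H : ω₂ ⊑ H lam
          ω₂⊑H α m = H-ordinal lamδ (index-ω₂ ind α m)

          -- An injection of α into ω₁ turns the union into one over ω₁, and since ω₁ ⊆ N this is a
          -- diagonal union.
          complete : ∀ {α F Q} → α ∊ ω₂ → IsFunction F α (J lam) → IsUnionOfRange Q F → Q ∊ J lam
          complete {α} {F} {Q} αω₂ hF hQ = J-i Q⊑ (use (SuccessorOf.below succ₂ αω₂))
            where
            F-fun : ∀ {ξ A A'} → F ∋⟨ ξ , A ⟩ → F ∋⟨ ξ , A' ⟩ → A ≡ A'
            F-fun p q = proj₂ (proj₁ (proj₁ hF)) _ _ _ p q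
            Q⊑ : Q ⊑ Z lam
            Q⊑ x m = let (ξ , A , p , q) = proj₁ (hQ x) m in proj₁ (J-e (proj₂ hF ξ A p)) x q
            use : α ≲ ω₁ → Null (Trace Q (H lam))
            use i = null-⊑ (λ N a (M , m , t) → index N a (proj₁ (hQ M) m) t)
              (nabla ω₁ {λ j → Member I.f F (H lam) j} (λ j m → W-ordinal (ord-trans oδ m ω₁∈δ)) d each)
              where
              module I = Injection i
              d : RelDefn (λ j G → Kills (Member I.f F (H lam) j) G)
              d = def₈ δ ω₁ W U f I.f F (H lam) (S₁.PairIn 8 λ j G → S₁₀.Ideal.Kills 0 1 2 3 4 (S₁₀.Member 5 6 7 j) G)
              each : ∀ j → j ∊ ω₁ → Null (Member I.f F (H lam) j)
              each j _ = [ hit , (λ n → null-empty λ { N a (ξ , A , M , p , q , _) → n (ξ , A , p , q) }) ]′ (dec (∃ λ ξ → ∃ λ A → I.f ∋⟨ ξ , j ⟩ × F ∋⟨ ξ , A ⟩))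
                where
                hit : (∃ λ ξ → ∃ λ A → I.f ∋⟨ ξ , j ⟩ × F ∋⟨ ξ , A ⟩) → Null (Member I.f F (H lam) j)
                hit (ξ , A , p , q) = null-⊑ (λ { N a (ξ' , A' , M , p' , q' , m , t) →
                  M , subst (M ∊_) (F-fun (subst (λ ξ → F ∋⟨ ξ , A' ⟩) (I.injective p' p) q') q) m , t }) (proj₂ (J-e (proj₂ hF ξ A q)))
              index : ∀ N {M} → Adm N → (∃ λ ξ → ∃ λ A → F ∋⟨ ξ , A ⟩ × M ∊ A) → IsIntersection M N (H lam) →
                      ∃ λ j → j ∊ N × j ∊ ω₁ × Member I.f F (H lam) j N
              index N {M} a (ξ , A , p , m) t = go (I.total (proj₁ (⊗-e₂ (fun-⊑ hF _ (∋-e p)))))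
                where
                go : (∃ λ j → I.f ∋⟨ ξ , j ⟩) → ∃ λ j → j ∊ N × j ∊ ω₁ × Member I.f F (H lam) j N
                go (j , q) = j , Adm.ω₁⊑ a j (I.cod q) , I.cod q , ξ , A , M , q , p , m , t

          -- If all fibres of g were in the ideal, the trace of S would lie in their diagonal union
          -- and be null.
          normal : ∀ S g → S ⊑ Z lam → ¬̇ (S ∊ J lam) → IsFunctionOn g S → (∀ N b → g ∋⟨ N , b ⟩ → b ∊ N) →
                   ∃ λ S' → ∃ λ b → S' ⊑ S × ¬̇ (S' ∊ J lam) × (∀∊ S' λ N → g ∋⟨ N , b ⟩)
          normal S g S⊑ S∉ g-fun reg = dne λ n → S∉ (J-i S⊑ (null-⊑ (λ N a (M , m , t) → regress N M m t (proj₂ g-fun M m))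
            (nabla (H lam) {Fibre S g (H lam)} H⊑W d λ b _ → null-⊑ (λ { N a (M , m , p , t) → M , sep-i (dS b) m p , t })
              (proj₂ (J-e (dne λ k → n (sep S (dS b) , b , sep-⊑ (dS b) , k , λ N m → sep-P (dS b) m)))))))
            where
            dS : ∀ b → Defn (λ N → g ∋⟨ N , b ⟩)
            dS b = def₂ g b (0 S.∋⟨ 2 , 1 ⟩)
            d : RelDefn (λ b G → Kills (Fibre S g (H lam) b) G)
            d = def₈ δ ω₁ W U f S g (H lam) (S₁.PairIn 8 λ b G → S₁₀.Ideal.Kills 0 1 2 3 4 (S₁₀.Fibre 5 6 7 b) G)
            regress : ∀ N M → M ∊ S → IsIntersection M N (H lam) → (∃ λ b → g ∋⟨ M , b ⟩) → ∃ λ b → b ∊ N × b ∊ H lam × Fibre S g (H lam) b N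
            regress N M m t (b , p) = let (bN , bH) = proj₁ (t b) (reg M b p) in b , bN , bH , M , m , p , t

          isIdeal : IsIdeal (J lam) (Z lam)
          isIdeal = record
            { onZ = λ A m → proj₁ (J-e m)
            ; empty = ∅ , J-i (λ x m → ∅-e m) (null-empty λ { N a (M , m , _) → ∅-e m }) , ∅-empty
            ; downwardClosed = λ A B m s → J-i (⊑-trans s (proj₁ (J-e m))) (null-⊑ (λ { N a (M , k , t) → M , s M k , t }) (proj₂ (J-e m)))
            ; proper = λ m → lower (Z∉J m)
            ; countablyComplete = λ w' F Q isw' hF hQ → complete (subst (_∊ ω₂) (ω-unique isω isw') (ord-trans o₂ w∈ω₁ ω₁∈ω₂)) hF hQ
            ; fine = λ b (N , m , bN) → let d = dF b in
                sep (Z lam) d , J-i (sep-⊑ d) (null-⊑ (λ { N a (M , k , t) bN' → sep-P d k (proj₂ (t b) (bN' , proj₁ (Z-e m) b bN)) })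
                  (null-omitting (H⊑W b (proj₁ (Z-e m) b bN)))) , λ N → sep-e d , λ (x , y) → sep-i d x y
            ; normal = λ S g s n fg r → let (S' , b , p , q , t) = normal S g s (λ m → lift (n m)) fg r in S' , b , p , (λ m → lower (q m)) , t }
            where
            dF : ∀ b → Defn (λ N → ¬̇ (b ∊ N))
            dF b = def₁ b (S.¬̇ (0 S.∊ 1))

          -- Closure under ω₂ unions fails for the sets of all M omitting b, with b ranging over ω₂.
          -- Each is in the ideal, and together they cover Z_λ, because no M of size at most ω₁
          -- includes ω₂.
          isCompleteness : IsCompleteness ω₂ (J lam)
          isCompleteness = SuccessorOf.cardinal succ₂ , (λ α m F Q → complete m) , last (select ω₂ (𝒫 (Z lam)) d λ {b} _ → sep (Z lam) (dO b) , 𝒫-i (sep-⊑ (dO b)) , omit b)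
            where
            dO : ∀ b → Defn (λ N → ¬̇ (b ∊ N))
            dO b = def₁ b (S.¬̇ (0 S.∊ 1))
            omit : ∀ b → Omitting (Z lam) b (sep (Z lam) (dO b))
            omit b N = sep-e (dO b) , λ (x , y) → sep-i (dO b) x y
            d : RelDefn (Omitting (Z lam))
            d = def₁ (Z lam) (S₁.PairIn 1 (S₁₀.Omitting 0))
            last : (∃ λ F → Selection F ω₂ (𝒫 (Z lam)) (Omitting (Z lam))) → ∃ λ F → ∃ λ Q → IsFunction F ω₂ (J lam) × IsUnionOfRange Q F × ¬ (Q ∊ J lam)
            last (F , sF) = F , Z lam , (isFunctionOn , λ b A p → J-i (λ M m → proj₁ (proj₁ (holds p M) m)) (small b A p)) , range , λ m → lower (Z∉J m)
              where
              open Selection sF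
              small : ∀ b A → F ∋⟨ b , A ⟩ → Null (Trace A (H lam))
              small b A p = null-⊑ (λ { N a (M , k , t) bN → proj₂ (proj₁ (holds p M) k) (proj₂ (t b) (bN , ω₂⊑H b (dom p))) }) (null-omitting (H⊑W b (ω₂⊑H b (dom p))))
              range : IsUnionOfRange (Z lam) F
              range M = (λ m → dne λ n → SuccessorOf.larger succ₂ (≲-trans (⊑→≲ (all-in m n)) (bounded (proj₂ (Z-e m)))))
                      , λ (b , A , p , k) → proj₁ (proj₁ (holds p M) k)
                where
                all-in : M ∊ Z lam → ¬̇ (∃ λ b → ∃ λ A → F ∋⟨ b , A ⟩ × M ∊ A) → ω₂ ⊑ M
                all-in m n b bω₂ = dne λ k → let (A , p) = total bω₂ in n (b , A , p , proj₂ (holds p M) (m , k))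
                bounded : SizeBelow M ω₂ → M ≲ ω₁
                bounded (α , a , i) = ≲-trans i (SuccessorOf.below succ₂ a)

        abstract
          dR : Defn (IsIndex δ)
          dR = def₁ δ (S₁₀.Index 0 1)

          dI : RelDefn IdealAt
          dI = def₅ δ ω₁ W U f (S₁.PairIn 5 (S₁₀.Ideal.IdealAt 0 1 2 3 4))

        R 𝓘 : V
        R = sep δ dR
        𝓘 = rel R (𝒫 (𝒫 (𝒫 W))) dI

        R-e : ∀ {lam} → lam ∊ R → IsIndex δ lam
        R-e = sep-P dR
        R-i : ∀ {lam} → IsIndex δ lam → lam ∊ R
        R-i ind = sep-i dR (proj₁ (proj₂ ind)) ind

        idealAt : ∀ {lam} → IsIndex δ lam → IdealAt lam (J lam)
        idealAt {lam} ind = H lam , Z lam , H-spec ind , (ω₂ , isω₂ , λ N → Z-e , λ (a , b) → Z-i a b) , λ A → J-e , λ (a , b) → J-i a b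

        idealAt-unique : ∀ {lam J'} → IsIndex δ lam → IdealAt lam J' → J' ≡ J lam
        idealAt-unique {lam} {J'} ind (H' , Z' , h , (ω₂' , i , z) , e) = go (H-unique ind h) (Z-unique ind (H' , ω₂' , h , i , z)) e
          where
          go : ∀ {H' Z'} → H' ≡ H lam → Z' ≡ Z lam → (∀ A → A ∊ J' ⇔ (A ⊑ Z' × Null (Trace A H'))) → J' ≡ J lam
          go refl refl e = ext (λ A m → let (a , b) = proj₁ (e A) m in J-i a b) (λ A m → proj₂ (e A) (J-e m))

        𝓘-i : ∀ {lam} → IsIndex δ lam → 𝓘 ∋⟨ lam , J lam ⟩
        𝓘-i ind = rel-i dI (R-i ind) (𝒫-i λ A m → 𝒫-i λ N k → 𝒫-i (⊑-trans (proj₁ (Z-e (proj₁ (J-e m) N k))) H⊑W)) (idealAt ind)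

        𝓘-e : ∀ {lam J'} → 𝓘 ∋⟨ lam , J' ⟩ → IsIndex δ lam × J' ≡ J lam
        𝓘-e m = let (r , _ , i) = rel-e dI m in R-e r , idealAt-unique (R-e r) i

        isTower : IsTower δ 𝓘
        isTower = record
          { indexedByRegulars = R , (λ lam → R-e , R-i) ,
              ((λ z m → let (lam , J' , e , r , _) = rel-pair dI m in lam , r , J' , subst (λ z → IsPair z lam J') (sym e) pr-spec) ,
               (λ lam J₁ J₂ m n → trans (proj₂ (𝓘-e m)) (sym (proj₂ (𝓘-e n))))) , λ lam r → J lam , 𝓘-i (R-e r)
          ; ideals = λ lam J' Z' m z → ideals (𝓘-e m) z
          ; projections = λ lam lam' J₁ J₂ Z₁ Z₂ m m' s z z' → projections (𝓘-e m) (𝓘-e m') s z z' }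
          where
          ideals : ∀ {lam J' Z'} → IsIndex δ lam × J' ≡ J lam → IsZ Z' lam → IsIdeal J' Z'
          ideals (ind , refl) z = subst (IsIdeal (J _)) (sym (Z-unique ind z)) (isIdeal ind)
          -- All the ideals are projections of one ideal on subsets of V_δ, so only the equality of
          -- (N ∩ H_λ') ∩ H_λ and N ∩ H_λ is at stake. That H_λ is the union of Z_λ is seen from
          -- singletons.
          projection : ∀ {lam lam'} → IsIndex δ lam → lam ⊑ lam' → IsProjection (J lam) (Z lam) (J lam') (Z lam')
          projection {lam} {lam'} ind s Q hQ A = go (ext
              (λ x m → let (N , n , k) = proj₁ (hQ x) m in proj₁ (Z-e n) x k)
              (λ x m → proj₂ (hQ x) (sing x , H-sing m , sing-i)))
            where
            dL : Defn (λ N' → ∃∊ A λ N → IsIntersection N N' (H lam))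
            dL = def₂ A (H lam) (S.∃∊ 0 λ N → S.IsIntersection N 2 1)
            Lift′ : V
            Lift′ = sep (Z lam') dL
            go : Q ≡ H lam → A ∊ J lam ⇔ (A ⊑ Z lam × ∃∊ (J lam') λ B → ∀ N' → N' ∊ B ⇔ (N' ∊ Z lam' × ∃∊ A λ N → IsIntersection N N' Q))
            go refl = (λ m → proj₁ (J-e m) , Lift′ , J-i (sep-⊑ dL) (null-⊑ (λ { N a (M , k , t) →
                          let l = trace-e {A} (sep-P dL k)
                          in trace-i (subst (_∊ A) (trans (cong (_∩ H lam) (∩-unique t)) (∩-absorb (H-mono s))) l) }) (proj₂ (J-e m)))
                        , λ N' → sep-e dL , λ (x , y) → sep-i dL x y)
                    , (λ (A⊑ , B , b , e) → J-i A⊑ (null-⊑ (λ { N a t → N ∩ H lam' , proj₂ (e _) (Adm.∩H a , N ∩ H lam , trace-e t ,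
                          subst (λ x → IsIntersection x (N ∩ H lam') (H lam)) (∩-absorb (H-mono s)) ∩-spec) , ∩-spec }) (proj₂ (J-e b))))
          projections : ∀ {lam lam' J₁ J₂ Z₁ Z₂} → IsIndex δ lam × J₁ ≡ J lam → IsIndex δ lam' × J₂ ≡ J lam' → lam ⊑ lam' → IsZ Z₁ lam → IsZ Z₂ lam' → IsProjection J₁ Z₁ J₂ Z₂
          projections {lam} {lam'} (ind , refl) (ind' , refl) s z z' = rewriteZ (Z-unique ind z) (Z-unique ind' z')
            where
            rewriteZ : ∀ {Z₁ Z₂} → Z₁ ≡ Z lam → Z₂ ≡ Z lam' → IsProjection (J lam) Z₁ (J lam') Z₂
            rewriteZ refl refl = projection ind s

        hasCriticalPoint : HasCriticalPoint 𝓘 ω₂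
        hasCriticalPoint lam J' m = go (𝓘-e m)
          where
          go : IsIndex δ lam × J' ≡ J lam → IsCompleteness ω₂ J'
          go (ind , refl) = isCompleteness ind

      open Tower

      -- The tower forcing and its forcing relation in terms of families of sets N.

      module TowerForcing where
        Cond : V → V → V → Set ℓ
        Cond c lam S = c ≡ pr lam S × IsIndex δ lam × S ⊑ Z lam × ¬̇ Null (Trace S (H lam))

        cond→ : ∀ {c lam S} → Condition 𝓘 c lam S → Cond c lam S
        cond→ {c} {lam} {S} (p , J' , Z' , m , z , s , n) = go (𝓘-e m) p
          where
          go : IsIndex δ lam × J' ≡ J lam → IsPair c lam S → Cond c lam S
          go (ind , e) p = pr-unique p , ind , sub , λ k → n (subst (S ∊_) (sym e) (J-i sub k))
            where
            sub : S ⊑ Z lam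
            sub = subst (S ⊑_) (Z-unique ind z) s

        →cond : ∀ {c lam S} → Cond c lam S → Condition 𝓘 c lam S
        →cond {c} {lam} {S} (e , ind , s , n) = subst (λ c → IsPair c lam S) (sym e) pr-spec , J lam , Z lam , 𝓘-i ind , Z-spec ind , s , λ m → n (proj₂ (J-e m))

        towerCond→ : ∀ {c lam S} → IsTowerCondition 𝓘 c lam S → Cond c lam S
        towerCond→ (p , J' , Z' , m , z , s , n) = cond→ (p , J' , Z' , m , z , s , λ k → lift (n k))

        →towerCond : ∀ {c lam S} → Cond c lam S → IsTowerCondition 𝓘 c lam S
        →towerCond c = let (p , J' , Z' , m , z , s , n) = →cond c in p , J' , Z' , m , z , s , λ k → lower (n k)

        towerPoset : ∃ λ P → ∃ λ Le → IsTowerPoset 𝓘 P Le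
        towerPoset = P , Le , record
          { carrier = λ c → (λ m → let (lam , S , k) = sep-P dP m in lam , S , →towerCond (cond→ k))
                          , (λ (lam , S , k) → P-i (towerCond→ k))
          ; order = λ z → (λ m → let (c' , c , lam' , S' , lam , S , Hs , p , k' , k , s , h , r) = sep-P dLe m
                                 in c' , c , lam' , S' , lam , S , Hs , p , →towerCond (cond→ k') , →towerCond (cond→ k) , s , h , r)
                        , (λ (c' , c , lam' , S' , lam , S , Hs , p , k' , k , s , h , r) →
                             sep-i dLe (subst (_∊ P ⊗ P) (sym (pr-unique p)) (⊗-i (P-i (towerCond→ k')) (P-i (towerCond→ k))))
                               (c' , c , lam' , S' , lam , S , Hs , p , →cond (towerCond→ k') , →cond (towerCond→ k) , s , h , r)) }
          where
          dP : Defn (λ c → ∃ λ lam → ∃ λ S → Condition 𝓘 c lam S)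
          dP = def₁ 𝓘 (S.∃̇ λ lam → S.∃̇ λ S' → S₁₃.Condition 0 1 lam S')
          P : V
          P = sep (R ⊗ 𝒫 (𝒫 W)) dP
          P-i : ∀ {c lam S} → Cond c lam S → c ∊ P
          P-i {c} {lam} {S} k@(e , ind , s , n) = sep-i dP (subst (_∊ R ⊗ 𝒫 (𝒫 W)) (sym e)
            (⊗-i (R-i ind) (𝒫-i λ N m → 𝒫-i (⊑-trans (proj₁ (Z-e (s N m))) H⊑W)))) (lam , S , →cond k)
          dLe : Defn (Order 𝓘)
          dLe = def₁ 𝓘 (S₁₃.Order 0 1)
          Le : V
          Le = sep (P ⊗ P) dLe

      open TowerForcing

      module _ {P Le : V} (tp : IsTowerPoset 𝓘 P Le) where
        module Poset where
          open IsTowerPoset tp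

          cond-e : ∀ {c} → c ∊ P → ∃ λ lam → ∃ λ S → Cond c lam S
          cond-e m = let (lam , S , k) = proj₁ (carrier _) m in lam , S , towerCond→ k

          cond-i : ∀ {c lam S} → Cond c lam S → c ∊ P
          cond-i k = proj₂ (carrier _) (_ , _ , →towerCond k)

          le-i : ∀ {c' c lam' S' lam S} → Cond c' lam' S' → Cond c lam S → lam ⊑ lam' → (∀ N → N ∊ S' → N ∩ H lam ∊ S) → Le ∋⟨ c' , c ⟩
          le-i {c'} {c} {lam = lam} k' k s h = ∋-i (proj₂ (order _) (c' , c , _ , _ , _ , _ , H lam , pr-spec , →towerCond k' , →towerCond k , s , H-spec (proj₁ (proj₂ k)) , λ N m → N ∩ H lam , h N m , ∩-spec))

          LeData : V → V → Set ℓ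
          LeData c' c = ∃ λ lam' → ∃ λ S' → ∃ λ lam → ∃ λ S → Cond c' lam' S' × Cond c lam S × lam ⊑ lam' × (∀ N → N ∊ S' → N ∩ H lam ∊ S)

          le-e : ∀ {c' c} → Le ∋⟨ c' , c ⟩ → LeData c' c
          le-e {c'} {c} m = go (proj₁ (order _) (∋-e m))
            where
            finish : ∀ {d' d lam' S' lam S Hs} → d' ≡ c' × d ≡ c → Cond d' lam' S' → Cond d lam S → lam ⊑ lam' → Hs ≡ H lam →
                     (∀∊ S' λ N' → ∃∊ S λ N → IsIntersection N N' Hs) → LeData c' c
            finish {S = S} (refl , refl) k' k s refl r = _ , _ , _ , _ , k' , k , s , λ N n → let (N' , a , b) = r N n in subst (_∊ S) (∩-unique b) a
            go : (∃ λ d' → ∃ λ d → ∃ λ lam' → ∃ λ S' → ∃ λ lam → ∃ λ S → ∃ λ Hs → IsPair (pr c' c) d' d ×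
                  IsTowerCondition 𝓘 d' lam' S' × IsTowerCondition 𝓘 d lam S × lam ⊑ lam' × IsH Hs lam ×
                  (∀∊ S' λ N' → ∃∊ S λ N → IsIntersection N N' Hs)) → LeData c' c
            go (d' , d , lam' , S' , lam , S , Hs , p , k' , k , s , h , r) =
              finish (pair-inj p pr-spec) (towerCond→ k') (towerCond→ k) s (H-unique (proj₁ (proj₂ (towerCond→ k))) h) r

          cond-unique : ∀ {c lam S lam' S'} → Cond c lam S → Cond c lam' S' → lam ≡ lam' × S ≡ S'
          cond-unique (e , _) (e' , _) = pr-inj (trans (sym e) e')

          Z-∩ : ∀ {lam N} → N ∊ Z lam → N ∩ H lam ≡ N
          Z-∩ m = ext (λ x k → proj₁ (∩-e k)) (λ x k → ∩-i k (proj₁ (Z-e m) x k))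

          le-refl : ∀ {c} → c ∊ P → Le ∋⟨ c , c ⟩
          le-refl m = let (lam , S , k) = cond-e m
                      in le-i k k ⊑-refl λ N n → subst (_∊ S) (sym (Z-∩ (proj₁ (proj₂ (proj₂ k)) N n))) n

          le-trans : ∀ {a b c} → Le ∋⟨ a , b ⟩ → Le ∋⟨ b , c ⟩ → Le ∋⟨ a , c ⟩
          le-trans m n = go (le-e m) (le-e n)
            where
            go₂ : ∀ {a c l₁ S₁ l₂ S₂ l₃ S₃ l₄ S₄} → l₂ ≡ l₃ × S₂ ≡ S₃ → Cond a l₁ S₁ → Cond c l₄ S₄ → l₂ ⊑ l₁ → (∀ N → N ∊ S₁ → N ∩ H l₂ ∊ S₂) →
                  l₄ ⊑ l₃ → (∀ N → N ∊ S₃ → N ∩ H l₄ ∊ S₄) → Le ∋⟨ a , c ⟩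
            go₂ {S₄ = S₄} (refl , refl) k₁ k₄ s h s' h' = le-i k₁ k₄ (⊑-trans s' s) λ N n → subst (_∊ S₄) (∩-absorb (H-mono s')) (h' _ (h N n))
            go : ∀ {a b c} → LeData a b → LeData b c → Le ∋⟨ a , c ⟩
            go (_ , _ , _ , _ , k₁ , k₂ , s , h) (_ , _ , _ , _ , k₃ , k₄ , s' , h') = go₂ (cond-unique k₂ k₃) k₁ k₄ s h s' h'

          le-dom : ∀ {a b} → Le ∋⟨ a , b ⟩ → a ∊ P
          le-dom m = let (_ , _ , _ , _ , k , _) = le-e m in cond-i k

          le-cod : ∀ {a b} → Le ∋⟨ a , b ⟩ → b ∊ P
          le-cod m = let (_ , _ , _ , _ , _ , k , _) = le-e m in cond-i k

          open Check isω P Le le-refl le-trans le-dom le-cod public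

          -- A condition (λ, S) is read as the family of all N with N ∩ H_λ ∈ S. Conditions with
          -- different indices become comparable this way, and compatibility becomes a question
          -- about intersections modulo null families.
          In : V → V → Set ℓ
          In c N = ∃ λ lam → ∃ λ S → Cond c lam S × N ∩ H lam ∊ S

          in-cond : ∀ {c lam S N} → Cond c lam S → In c N → N ∩ H lam ∊ S
          in-cond k (lam' , S' , k' , m) = go (cond-unique k' k) m
            where
            go : ∀ {lam S lam' S' N} → lam' ≡ lam × S' ≡ S → N ∩ H lam' ∊ S' → N ∩ H lam ∊ S
            go (refl , refl) m = m

          in-mono : ∀ {c c' N} → c' ≼ c → In c' N → In c N
          in-mono {N = N} l i = go (le-e l) i
            where
            go : ∀ {c c'} → LeData c' c → In c' N → In c N
            go (lam' , S' , lam , S , k' , k , s , h) i = lam , S , k , subst (_∊ S) (∩-absorb (H-mono s)) (h _ (in-cond k' i))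

          in-not-null : ∀ {c} → c ∊ P → ¬̇ Null (In c)
          in-not-null m n = go (cond-e m) n
            where
            go : ∀ {c} → (∃ λ lam → ∃ λ S → Cond c lam S) → ¬̇ Null (In c)
            go {c} (lam , S , k) n = proj₂ (proj₂ (proj₂ k)) (null-⊑ {Trace S (H lam)} {In c} (λ N a t → lam , S , k , trace-e t) n)

          inN→ : ∀ {s N} → s ∊ P → InN s N → In s N
          inN→ {s} {N} m i = go (cond-e m) i
            where
            go : (∃ λ lam → ∃ λ S → Cond s lam S) → InN s N → In s N
            go (lam , S , k) (lam' , S' , H' , p , hH , t) = lam , S , k , match (pr-inj (trans (sym (pr-unique p)) (proj₁ k))) hH t
              where
              match : ∀ {lam' S' H'} → lam' ≡ lam × S' ≡ S → IsH H' lam' → Trace S' H' N → N ∩ H lam ∊ S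
              match (refl , refl) hH t = trace-e (subst (λ H' → Trace S H' N) (H-unique (proj₁ (proj₂ k)) hH) t)

          →inN : ∀ {s N} → In s N → InN s N
          →inN {s} (lam , S , k , m) = lam , S , H lam , subst (λ s → IsPair s lam S) (sym (proj₁ k)) pr-spec , H-spec (proj₁ (proj₂ k)) , trace-i m

          condition : ∃ λ p → p ∊ P
          condition = _ , cond-i {lam = lam₀} {Z lam₀} (refl , index₀ , ⊑-refl , λ nl → not-null (λ N a → trace-i (Adm.∩H a)) nl)

          private
            compat-≤ : ∀ {c₁ c₂ l₁ S₁ l₂ S₂} → Cond c₁ l₁ S₁ → Cond c₂ l₂ S₂ → l₁ ⊑ l₂ → ¬̇ Null (λ N → In c₁ N × In c₂ N) → ∃ λ c → c ≼ c₁ × c ≼ c₂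
            compat-≤ {c₁} {c₂} {l₁} {S₁} {l₂} {S₂} k₁ k₂ s n = pr l₂ S' ,
              le-i k' k₁ s (λ N m → trace-e (sep-P d m)) ,
              le-i k' k₂ ⊑-refl (λ N m → subst (_∊ S₂) (sym (Z-∩ (proj₁ (proj₂ (proj₂ k₂)) N (sep-⊑ d N m)))) (sep-⊑ d N m))
              where
              d : Defn (Trace S₁ (H l₁))
              d = def₂ S₁ (H l₁) (S₁₀.Trace 0 1 2)
              S' : V
              S' = sep S₂ d
              k' : Cond (pr l₂ S') l₂ S'
              k' = refl , proj₁ (proj₂ k₂) , ⊑-trans (sep-⊑ d) (proj₁ (proj₂ (proj₂ k₂))) , λ nl →
                n (null-⊑ (λ N a (i₁ , i₂) → trace-i (sep-i d (in-cond k₂ i₂) (trace-i (subst (_∊ S₁) (sym (∩-absorb (H-mono s))) (in-cond k₁ i₁))))) nl)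

          -- At the larger of the two indices, the members of one set whose traces lie in the other
          -- set form a condition below both.
          compat : ∀ {c₁ c₂} → c₁ ∊ P → c₂ ∊ P → ¬̇ Null (λ N → In c₁ N × In c₂ N) → ∃ λ c → c ≼ c₁ × c ≼ c₂
          compat m₁ m₂ n = go (cond-e m₁) (cond-e m₂) n
            where
            go : ∀ {c₁ c₂} → (∃ λ lam → ∃ λ S → Cond c₁ lam S) → (∃ λ lam → ∃ λ S → Cond c₂ lam S) → ¬̇ Null (λ N → In c₁ N × In c₂ N) → ∃ λ c → c ≼ c₁ × c ≼ c₂
            go (l₁ , S₁ , k₁) (l₂ , S₂ , k₂) n =
              [ (λ s → compat-≤ k₁ k₂ s n)
              , (λ m → let (c , a , b) = compat-≤ k₂ k₁ (proj₁ (ord-elt oδ (proj₁ (proj₂ (proj₁ (proj₂ k₁))))) _ m) (λ nl → n (null-⊑ (λ N _ (x , y) → y , x) nl)) in c , b , a)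
              ]′ (ord-cases (ord-elt oδ (proj₁ (proj₂ (proj₁ (proj₂ k₁))))) (ord-elt oδ (proj₁ (proj₂ (proj₁ (proj₂ k₂))))))

          Sure : V → V → (V → Set ℓ) → Set ℓ
          Sure lam c X = ∀ N → Adm N → In c N → X (N ∩ H lam)

          extend : ∀ {c lam} {X : V → Set ℓ} → c ∊ P → IsIndex δ lam → Defn X → ¬̇ Null (λ N → In c N × X (N ∩ H lam)) → ∃ λ c' → c' ≼ c × Sure lam c' X
          extend {c} {lam} {X} m ind d n = go (compat m (cond-i k) (λ nl → n (null-⊑ (λ N a (i , x) → i , lam , S , k , sep-i d (Adm.∩H a) x) nl)))
            where
            S : V
            S = sep (Z lam) d
            k : Cond (pr lam S) lam S
            k = refl , ind , sep-⊑ d , λ nl → n (null-⊑ (λ N a (_ , x) → trace-i (sep-i d (Adm.∩H a) x)) nl)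
            go : (∃ λ c' → c' ≼ c × c' ≼ pr lam S) → ∃ λ c' → c' ≼ c × Sure lam c' X
            go (c' , l , l') = c' , l , λ N a i → sep-P d (in-cond k (in-mono l' i))

          decide : ∀ {c lam} {X : V → Set ℓ} → c ∊ P → IsIndex δ lam → Defn X → ∃ λ c' → c' ≼ c × (Sure lam c' X ⊎ Sure lam c' (λ M → ¬̇ X M))
          decide {c} {lam} {X} m ind d = [ no′ , yes′ ]′ (dec (Null (λ N → In c N × X (N ∩ H lam))))
            where
            yes′ : ¬̇ Null (λ N → In c N × X (N ∩ H lam)) → ∃ λ c' → c' ≼ c × (Sure lam c' X ⊎ Sure lam c' (λ M → ¬̇ X M))
            yes′ n = let (c' , l , s) = extend m ind d n in c' , l , inj₁ s
            no′ : Null (λ N → In c N × X (N ∩ H lam)) → ∃ λ c' → c' ≼ c × (Sure lam c' X ⊎ Sure lam c' (λ M → ¬̇ X M))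
            no′ nl = let (c' , l , s) = extend m ind (def-¬ d) (λ nl' → in-not-null m (null-⊑
                           (λ N a i → [ (λ x → inj₁ (i , x)) , (λ x → inj₂ (i , x)) ]′ (dec (X (N ∩ H lam)))) (null-∪ nl nl')))
                     in c' , l , inj₂ s

          witness : ∀ {c} → c ∊ P → ¬̇ (∀ N → Adm N → ¬̇ In c N)
          witness m h = in-not-null m (null-empty h)

          -- Dense lam X is the assertion "X holds almost everywhere" of the forcing language.
          Dense : V → (V → Set ℓ) → Forced
          Dense lam X p = ∀ q → q ≼ p → ∃ λ r → r ≼ q × Sure lam r X

          -- Normality for conditions. If each part of p on which Y b holds were null, their
          -- diagonal union would be null, and it includes p; so one fixed b works on a stronger
          -- condition.
          pressDown : ∀ {p} (B : V) {Y : V → V → Set ℓ} (lam : V → V) → p ∊ P → B ⊑ W →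
            (∀ {lam' S} → Cond p lam' S → RelDefn (λ b G → Kills (λ N → Trace S (H lam') N × Y b (N ∩ H (lam b))) G)) →
            (∀ b → b ∊ B → Defn (Y b)) → (∀ b → b ∊ B → IsIndex δ (lam b)) →
            (∀ N → Adm N → In p N → ∃ λ b → b ∊ N × b ∊ B × Y b (N ∩ H (lam b))) →
            ∃ λ b → b ∊ B × ∃ λ q → q ≼ p × Sure (lam b) q (Y b)
          pressDown {p} B {Y} lam m B⊑ d dY ind h = go (cond-e m)
            where
            Res : Set ℓ
            Res = ∃ λ b → b ∊ B × ∃ λ q → q ≼ p × Sure (lam b) q (Y b)
            go : (∃ λ lam' → ∃ λ S → Cond p lam' S) → Res
            go (lam' , S , k) = dne λ n → in-not-null m (null-⊑ (λ N a i → let (b , bN , bB , y) = h N a i in b , bN , bB , trace-i (in-cond k i) , y)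
              (nabla B {λ b N → Trace S (H lam') N × Y b (N ∩ H (lam b))} B⊑ (d k) λ b bB → dne λ nn →
                n (b , bB , extend m (ind b bB) (dY b bB) (λ nl → nn (null-⊑ (λ N a (t , y) → (lam' , S , k , trace-e t) , y) nl)))))

          private
            dΓ : Defn (GenericPair P Le)
            dΓ = def₂ P Le (S₁₃.GenericPair 0 1 2)

          abstract
            Γ : V
            Γ = sep (ˇ P) dΓ

            Γ-spec : IsGenericName Γ
            Γ-spec z = (λ m → sep-P dΓ m) , λ (p , pP , τ , h , e) →
              sep-i dΓ (subst (_∊ ˇ P) (sym (trans (pr-unique e) (cong (λ τ → pr τ p) (ˇ-unique h)))) (∋-e (ˇ-member pP pP))) (p , pP , τ , h , e)

            Γ-name : IsName Γ
            Γ-name = subset-name (sep-⊑ dΓ) (ˇ-name P)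

          Γ-unique : ∀ {Γ'} → IsGenericName Γ' → Γ' ≡ Γ
          Γ-unique h = ext (λ z m → proj₂ (Γ-spec z) (proj₁ (h z) m)) (λ z m → proj₂ (h z) (proj₁ (Γ-spec z) m))

          -- An element of the canonical name is a check name with its own condition attached. As
          -- check names are injective, forcing c into the generic filter means density of the
          -- conditions below c.
          ∊G-e : ∀ {c p} → (c ∊G) p → ∀ q → q ≼ p → ∃ λ r → r ≼ q × r ≼ c
          ∊G-e {c} {p} (Γ' , h , ch) q l = go (∈-elim (subst (λ Γ → p ⊩ ˇ c ∈ Γ) (Γ-unique h) (check→ {φ = λ τ → τ Ext.∊ Γ'} ch)) q l)
            where
            go₂ : ∀ {r ρ s} → r ≼ q → r ≼ s → r ⊩ ˇ c ≈ ρ → (∃∊ P λ p → ∃ λ τ → IsCheckName τ p × IsPair (pr ρ s) τ p) → ∃ λ r → r ≼ q × r ≼ c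
            go₂ {r} {ρ} {s} k k' e (p , pP , τ , h , e') =
              let (a , b) = pr-inj (pr-unique e')
                  same = ˇ-injective (subst (r ⊩ ˇ c ≈_) (trans a (ˇ-unique h)) e)
              in r , k , subst (r ≼_) (trans b (sym same)) k'
            go : (∃ λ r → r ≼ q × ∃ λ ρ → ∃ λ s → Γ ∋⟨ ρ , s ⟩ × r ≼ s × r ⊩ ˇ c ≈ ρ) → ∃ λ r → r ≼ q × r ≼ c
            go (r , k , ρ , s , m , k' , e) = go₂ k k' e (proj₁ (Γ-spec _) (∋-e m))

          ∊G-i : ∀ {c p} → c ∊ P → (∀ q → q ≼ p → ∃ λ r → r ≼ q × r ≼ c) → (c ∊G) p
          ∊G-i {c} {p} cP h = Γ , Γ-spec , check← {φ = λ τ → τ Ext.∊ Γ} (∈-local λ q l →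
            let (r , k , k') = h q l
            in r , k , ∈-intro Γ-name (∋-i (proj₂ (Γ-spec _) (c , cP , ˇ c , ˇ-spec c , pr-spec))) k')

          open GenericUltrapower δ P Le public

          private
            index-above₂ : ∀ {a lam} → a ∊ δ → IsIndex δ lam → ∃ λ lam' → IsIndex δ lam' × a ⊑ lam' × lam ⊑ lam'
            index-above₂ a ind =
              let (lam' , ind' , m , _) = index-above (max∊ oδ a (proj₁ (proj₂ ind)))
                  s = proj₁ (ord-elt oδ (proj₁ (proj₂ ind'))) _ m
              in lam' , ind' , (λ x k → s x (∪-l k)) , λ x k → s x (∪-r k)

          -- For such Q, the quantifier over all large indices in `AlmostAll` reduces to the single
          -- index `lam`.
          Stable : V → (V → Set ℓ) → Set ℓ
          Stable lam Q = ∀ {lam' N} → IsIndex δ lam' → lam ⊑ lam' → N ⊑ W → Q (N ∩ H lam) ⇔ Q (N ∩ H lam')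

          almost→dense : ∀ {lam Q p} → IsIndex δ lam → Stable lam Q → AlmostAll Q p → Dense lam Q p
          almost→dense {lam} {Q} {p} ind st h q l = step₁ (h q l)
            where
            Res : Set ℓ
            Res = ∃ λ r → r ≼ q × Sure lam r Q
            step₃ : ∀ {lam' r Z' S c} → IsIndex δ lam' → lam ⊑ lam' → r ≼ q → (IsZ Z' lam' × (∀ N → N ∊ S ⇔ (N ∊ Z' × Q N)) × IsPair c lam' S) → (∃ λ r' → r' ≼ r × r' ≼ c) → Res
            step₃ {S = S} ind' s k (_ , sp , e) (r' , k' , k'') = r' , le-trans k' k , λ N a i →
              let (c∈ , lam'' , S'' , kc) = le-cod k'' , cond-e (le-cod k'')
                  inS = read (pr-inj (trans (sym (pr-unique e)) (proj₁ kc))) (in-cond kc (in-mono k'' i))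
              in proj₂ (st ind' s (Adm.⊑W a)) (proj₂ (proj₁ (sp _) inS))
              where
              read : ∀ {lam' S lam'' S'' N} → lam' ≡ lam'' × S ≡ S'' → N ∩ H lam'' ∊ S'' → N ∩ H lam' ∊ S
              read (refl , refl) m = m
            step₂ : ∀ {lam' r} → IsIndex δ lam' → lam ⊑ lam' → r ≼ q →
                    (∃ᵛ λ Z → ∃ᵛ λ S → ∃ᵛ λ c → ⌜ IsZ Z lam' × (∀ N → N ∊ S ⇔ (N ∊ Z × Q N)) × IsPair c lam' S ⌝ Ext.∧ (c ∊G)) r → Res
            step₂ ind' s k hz =
              let (r₁ , k₁ , Z' , hs) = hz _ (≼r k)
                  (r₂ , k₂ , S , hc) = hs r₁ (≼r k₁)
                  (r₃ , k₃ , c , (sp , g)) = hc r₂ (≼r k₂)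
              in step₃ ind' s (le-trans k₃ (le-trans k₂ (le-trans k₁ k))) sp (∊G-e g r₃ (≼r k₃))
            step₁ : (∃ λ r → r ≼ q × ∃ λ lam₀ → (lam₀ ∊ δ) × (∀ lam' → ∀ r' → r' ≼ r → (IsIndex δ lam' × lam₀ ⊑ lam') →
                    (∃ᵛ λ Z → ∃ᵛ λ S → ∃ᵛ λ c → ⌜ IsZ Z lam' × (∀ N → N ∊ S ⇔ (N ∊ Z × Q N)) × IsPair c lam' S ⌝ Ext.∧ (c ∊G)) r')) → Res
            step₁ (r , k , lam₀ , d , hl) = let (lam' , ind' , a , b) = index-above₂ d ind in step₂ ind' b k (hl lam' r (≼r k) (ind' , a))

          -- Below a condition r deciding Q, every condition meets the set of all M ∈ Z_λ' with Q in
          -- a non-null family. This set is therefore a condition, and it is forced into the generic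
          -- filter.
          dense→almost : ∀ {lam Q p} → IsIndex δ lam → Stable lam Q → Defn Q → Dense lam Q p → AlmostAll Q p
          dense→almost {lam} {Q} {p} ind st dQ h q l = go (h q l)
            where
            go : (∃ λ r → r ≼ q × Sure lam r Q) → ∃ λ r → r ≼ q × ∃ λ lam₀ → (lam₀ ∊ δ) × (∀ lam' → ∀ r' → r' ≼ r → (IsIndex δ lam' × lam₀ ⊑ lam') →
                    (∃ᵛ λ Z → ∃ᵛ λ S → ∃ᵛ λ c → ⌜ IsZ Z lam' × (∀ N → N ∊ S ⇔ (N ∊ Z × Q N)) × IsPair c lam' S ⌝ Ext.∧ (c ∊G)) r')
            go (r , k , s) = r , k , lam , proj₁ (proj₂ ind) , λ lam' r' k' (ind' , sub) →
                λ q₁ l₁ → q₁ , ≼r l₁ , Z lam' , λ q₂ l₂ → q₂ , ≼r l₂ , S lam' , λ q₃ l₃ → q₃ , ≼r l₃ , pr lam' (S lam') ,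
                  (Z-spec ind' , (λ N → sep-e dQ , λ (a , b) → sep-i dQ a b) , pr-spec) ,
                  generic ind' sub (le-trans l₃ (le-trans l₂ (le-trans l₁ k')))
              where
              S : V → V
              S lam' = sep (Z lam') dQ
              inS : ∀ {lam' c N} → IsIndex δ lam' → lam ⊑ lam' → c ≼ r → Adm N → In c N → N ∩ H lam' ∊ S lam'
              inS ind' sub k' a i = sep-i dQ (Adm.∩H a) (proj₁ (st ind' sub (Adm.⊑W a)) (s _ a (in-mono k' i)))
              cond : ∀ {lam' c} → IsIndex δ lam' → lam ⊑ lam' → c ≼ r → Cond (pr lam' (S lam')) lam' (S lam')
              cond ind' sub k' = refl , ind' , sep-⊑ dQ , λ nl → in-not-null (le-dom k') (null-⊑ (λ N a i → trace-i (inS ind' sub k' a i)) nl)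
              generic : ∀ {lam' c} → IsIndex δ lam' → lam ⊑ lam' → c ≼ r → (pr lam' (S lam') ∊G) c
              generic {lam'} ind' sub k' = ∊G-i (cond-i (cond ind' sub k')) λ q' l' →
                compat (le-dom l') (cond-i (cond ind' sub k')) λ nl → in-not-null (le-dom l')
                  (null-⊑ (λ N a i → i , lam' , S lam' , cond ind' sub k' , inS ind' sub (le-trans l' k') a i) nl)

        open Poset

        -- Failure of presaturation: the name of an injection of δ into ω₁.

        module Presat where
          injections : ∃ λ ê → Selection ê ω₂ (𝒫 (ω₂ ⊗ ω₁)) (InjectionInto ω₁)
          injections = select ω₂ (𝒫 (ω₂ ⊗ ω₁)) (def₁ ω₁ (S₁.PairIn 1 (S₇.InjectionInto 0))) λ {γ} m →
            let (e , p , q) = SuccessorOf.below succ₂ m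
            in e , 𝒫-i (λ z l → let (a , b , c , d , r) = ⊗-e (fun-⊑ p z l)
                                in subst (_∊ ω₂ ⊗ ω₁) (sym r) (⊗-i (ord-trans o₂ c m) d)) , p , q

          module Positions {ê : V} (sê : Selection ê ω₂ (𝒫 (ω₂ ⊗ ω₁)) (InjectionInto ω₁)) where
            private
              module ê = Selection sê

            Pos : V → V → V → Set ℓ
            Pos = Position δ U f ê

            pos-agree : ∀ {α i i' N} → Pos α i N → Pos α i' N → i ≡ i'
            pos-agree (_ , v , X , γ , e , o , t , p , q , r) (_ , v' , X' , γ' , e' , o' , t' , p' , q' , r') =
              go (otp-unique o o') (trans (∩-unique t) (sym (∩-unique t'))) p p' q q' r r'
              where
              go₂ : ∀ {γ γ' e e' v i i'} → γ ≡ γ' → ê ∋⟨ γ , e ⟩ → ê ∋⟨ γ' , e' ⟩ → e ∋⟨ v , i ⟩ → e' ∋⟨ v , i' ⟩ → i ≡ i'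
              go₂ refl q q' r r' = proj₂ (proj₁ (proj₁ (proj₁ (ê.holds q)))) _ _ _ r (subst (λ e → e ∋⟨ _ , _ ⟩) (ê.functional _ _ _ q' q) r')
              go : ∀ {v v' X X' γ γ' e e' i i'} → v ≡ v' → X ≡ X' → f ∋⟨ X , γ ⟩ → f ∋⟨ X' , γ' ⟩ → ê ∋⟨ γ , e ⟩ → ê ∋⟨ γ' , e' ⟩ → e ∋⟨ v , i ⟩ → e' ∋⟨ v' , i' ⟩ → i ≡ i'
              go refl refl p p' = go₂ (f-fun p p')

            pos-injective : ∀ {α α' i N} → Pos α i N → Pos α' i N → α ≡ α'
            pos-injective {α} {α'} (m , v , X , γ , e , o , t , p , q , r) (m' , v' , X' , γ' , e' , o' , t' , p' , q' , r') =
              compare (go (trans (∩-unique t) (sym (∩-unique t'))) p p' q q' r r')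
              where
              go₂ : ∀ {γ γ' e e' v v' i} → γ ≡ γ' → ê ∋⟨ γ , e ⟩ → ê ∋⟨ γ' , e' ⟩ → e ∋⟨ v , i ⟩ → e' ∋⟨ v' , i ⟩ → v ≡ v'
              go₂ refl q q' r r' = proj₂ (ê.holds q) _ _ _ r (subst (λ e → e ∋⟨ _ , _ ⟩) (ê.functional _ _ _ q' q) r')
              go : ∀ {v v' X X' γ γ' e e' i} → X ≡ X' → f ∋⟨ X , γ ⟩ → f ∋⟨ X' , γ' ⟩ → ê ∋⟨ γ , e ⟩ → ê ∋⟨ γ' , e' ⟩ → e ∋⟨ v , i ⟩ → e' ∋⟨ v' , i ⟩ → v ≡ v'
              go refl p p' = go₂ (f-fun p p')
              compare : v ≡ v' → α ≡ α'
              compare e = [ (λ l → ⊥-elim′ (∉-refl (subst (v ∊_) (sym e) (otp-mono o' m l o))))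
                          , [ (λ q → q) , (λ l → ⊥-elim′ (∉-refl (subst (v' ∊_) e (otp-mono o m' l o')))) ]′
                          ]′ (comparable (ord-elt oδ (otp-dom o)) (ord-elt oδ (otp-dom o')))

            pos-exists : ∀ {α N} → Adm N → α ∊ δ → α ∊ N → ∃ λ i → i ∊ ω₁ × Pos α i N
            pos-exists {α} {N} (_ , _ , _ , _ , X , γ , t , p , b) αδ m = go (otp-exists N αδ) (ê.total (f-cod p))
              where
              go₂ : ∀ {v e} → Otp δ N α v → ê ∋⟨ γ , e ⟩ → (∃ λ i → e ∋⟨ v , i ⟩) → ∃ λ i → i ∊ ω₁ × Pos α i N
              go₂ o q (i , r) = i , proj₂ (proj₁ (ê.holds q)) _ _ r , m , _ , X , γ , _ , o , t , p , q , r
              go : (∃ λ v → Otp δ N α v) → (∃ λ e → ê ∋⟨ γ , e ⟩) → ∃ λ i → i ∊ ω₁ × Pos α i N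
              go (v , o) (e , q) = go₂ o q (proj₂ (proj₁ (proj₁ (ê.holds q))) v (b α m αδ v o))

            pos-trace : ∀ {lam α i N} → IsIndex δ lam → α ∊ lam → lam₀ ⊑ lam → Pos α i (N ∩ H lam) ⇔ Pos α i N
            pos-trace {lam} {α} {i} {N} ind αl s =
              (λ (m , v , X , γ , e , o , t , r) → proj₁ (∩-e m) , v , X , γ , e , otp-transfer (λ β b → (λ k → proj₁ (∩-e k)) , (λ k → ∩-i k (inH b))) o
                 , (λ x → (λ k → let (a , b) = proj₁ (t x) k in proj₁ (∩-e a) , b) , (λ (a , b) → proj₂ (t x) (∩-i a (H-mono s x (U⊑H x b)) , b))) , r)
              , (λ (m , v , X , γ , e , o , t , r) → ∩-i m (H-ordinal (proj₁ (proj₂ ind)) αl) , v , X , γ , e , otp-transfer (λ β b → (λ k → ∩-i k (inH b)) , (λ k → proj₁ (∩-e k))) o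
                 , (λ x → (λ k → let (a , b) = proj₁ (t x) k in ∩-i a (H-mono s x (U⊑H x b)) , b) , (λ (a , b) → proj₂ (t x) (proj₁ (∩-e a) , b))) , r)
              where
              inH : ∀ {β} → β ∊ α → β ∊ H lam
              inH b = H-ordinal (proj₁ (proj₂ ind)) (ord-trans (ord-elt oδ (proj₁ (proj₂ ind))) b αl)

            module Collapsing where
              abstract
                dPos : ∀ α i → Defn (Pos α i)
                dPos α i = def₆ δ U f ê α i (S₁₄.Position 0 1 2 3 4 5 6)

                dKill : ∀ S Hs Hl α → RelDefn (λ i G → Kills (λ N → Trace S Hs N × (∃ λ M → IsIntersection M N Hl × Pos α i M)) G)
                dKill S Hs Hl α = def (S₁.PairIn 10 (λ i G → S₁₀.Ideal.Kills 0 1 2 3 4 (λ N → S₁₀.Trace 5 6 N S.∧ S.∃̇ λ M → S.IsIntersection M N 7 S.∧ S₁₄.Position 0 3 4 9 8 i M) G) 11)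
                  (ê ∷ α ∷ Hl ∷ Hs ∷ S ∷ f ∷ U ∷ W ∷ ω₁ ∷ δ ∷ [])

                dColour : RelDefn (Colour δ ω₁ W U f ê)
                dColour = def₆ δ ω₁ W U f ê (S₁.PairIn 6 (S₁₄.Colour 0 1 2 3 4 5))

                dName : ∀ C → Defn (NameOfRelation P Le C)
                dName C = def₃ P Le C (S₁₄.NameOfRelation 0 1 2 3)

              -- `_∩_` is not a term of the formulas, so the formula of `dKill` quantifies over an M
              -- that is this intersection; soundness and completeness absorb the difference.
              dKill′ : ∀ S Hs lam α → RelDefn (λ i G → Kills (λ N → Trace S Hs N × Pos α i (N ∩ H lam)) G)
              dKill′ S Hs lam α = record { Defn (dKill S Hs (H lam) α)
                ; sound = λ z c → let (i , G , p , k) = Defn.sound (dKill S Hs (H lam) α) z c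
                                  in i , G , p , proj₁ k , proj₁ (proj₂ k) , λ N a cl (t , x) → proj₂ (proj₂ k) N a cl (t , N ∩ H lam , ∩-spec , x)
                ; complete = λ z (i , G , p , k) → Defn.complete (dKill S Hs (H lam) α) z
                    (i , G , p , proj₁ k , proj₁ (proj₂ k) , λ N a cl (t , M' , e , x) → proj₂ (proj₂ k) N a cl (t , subst (Pos α i) (∩-unique e) x)) }

              -- Almost every N contains α. Its position is an element of ω₁ and so of N; normality
              -- makes it constant on a stronger condition. The index is above α and `lam₀`, so that
              -- N ∩ H_λ knows both N ∩ α and N ∩ U.
              decidePosition : ∀ {α q} → α ∊ δ → q ∊ P → ∃ λ r → r ≼ q × ∃ λ i → i ∊ ω₁ × (∀ N → Adm N → In r N → Pos α i N)
              decidePosition {α} {q} αδ qP = go (index-above (max∊ oδ αδ (proj₁ (proj₂ index₀))))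
                where
                Res : Set ℓ
                Res = ∃ λ r → r ≼ q × ∃ λ i → i ∊ ω₁ × (∀ N → Adm N → In r N → Pos α i N)
                go : (∃ λ lam → IsIndex δ lam × α ∪ lam₀ ∊ lam × SuccessorOf (α ∪ lam₀ ∪ ω₂) lam) → Res
                go (lam , ind , m , _) = start (extend qP ind (def₁ α (0 S.∊ 1)) λ nl → in-not-null qP (null-⊑
                    (λ N a i → [ (λ k → inj₁ (i , ∩-i k αH)) , inj₂ ]′ (dec (α ∊ N))) (null-∪ nl (null-omitting (W-ordinal αδ)))))
                  where
                  olam : Ordinal lam
                  olam = ord-elt oδ (proj₁ (proj₂ ind))
                  s : lam₀ ⊑ lam
                  s x k = proj₁ olam _ m x (∪-r k)
                  αl : α ∊ lam
                  αl = ⊑-∊-trans (ord-elt oδ αδ) olam (λ x → ∪-l) m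
                  αH : α ∊ H lam
                  αH = H-ordinal (proj₁ (proj₂ ind)) αl
                  finish : ∀ {r} → r ≼ q → (∃ λ i → i ∊ ω₁ × ∃ λ r' → r' ≼ r × Sure lam r' (Pos α i)) → Res
                  finish k (i , iω , r' , k' , su) = r' , le-trans k' k , i , iω , λ N a j → proj₁ (pos-trace ind αl s) (su N a j)
                  start : (∃ λ r → r ≼ q × Sure lam r (λ M → α ∊ M)) → Res
                  start (r , k , su) = finish k (pressDown ω₁ {λ i → Pos α i} (λ _ → lam) (le-dom k) (λ i m → W-ordinal (ord-trans oδ m ω₁∈δ))
                    (λ {lam'} {S} _ → dKill′ S (H lam') lam α) (λ i _ → dPos α i) (λ _ _ → ind)
                    λ N a j → let (i , iω , x) = pos-exists a αδ (proj₁ (∩-e (su N a j)))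
                              in i , Adm.ω₁⊑ a i iω , iω , proj₂ (pos-trace ind αl s) x)

              -- `C` relates the pair (α, i) to the conditions that decide i as the position of α.
              -- `hn` attaches these conditions to the check names of the pairs and thus names the
              -- injection of δ into ω₁.
              C hn : V
              C = rel (δ ⊗ ω₁) P dColour
              hn = sep (ˇ (δ ⊗ ω₁)) (dName C)

              C-i : ∀ {α i s} → α ∊ δ → i ∊ ω₁ → s ∊ P → (∀ N → Adm N → In s N → Pos α i N) → C ∋⟨ pr α i , s ⟩
              C-i a b c g = rel-i dColour (⊗-i a b) c (_ , _ , pr-spec , λ N x y → g N x (inN→ c y))

              C-e : ∀ {α i s} → C ∋⟨ pr α i , s ⟩ → α ∊ δ × i ∊ ω₁ × (∀ N → Adm N → In s N → Pos α i N)
              C-e {α} {i} {s} m = let (a , _ , c) = rel-e dColour m in proj₁ (⊗-e₂ a) , proj₂ (⊗-e₂ a) , read c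
                where
                match : ∀ {α' i'} → α' ≡ α × i' ≡ i → (∀ N → Adm N → InN s N → Pos α' i' N) → ∀ N → Adm N → In s N → Pos α i N
                match (refl , refl) g N x y = g N x (→inN y)
                read : Colour δ ω₁ W U f ê (pr α i) s → ∀ N → Adm N → In s N → Pos α i N
                read (α' , i' , p , g) = match (pair-inj p pr-spec) g

              h-name : IsName hn
              h-name = subset-name (sep-⊑ (dName C)) (ˇ-name (δ ⊗ ω₁))

              h-i : ∀ {α i s} → C ∋⟨ pr α i , s ⟩ → hn ∋⟨ pn (ˇ α) (ˇ i) , s ⟩
              h-i {α} {i} {s} m = ∋-i (sep-i (dName C) (subst (λ n → pr n s ∊ ˇ (δ ⊗ ω₁)) (ˇ-pair α i) (∋-e (ˇ-member (proj₁ (rel-e dColour m)) (proj₁ (proj₂ (rel-e dColour m))))))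
                (pr α i , s , m , pn (ˇ α) (ˇ i) , subst (λ n → IsCheckName n (pr α i)) (ˇ-pair α i) (ˇ-spec _) , pr-spec))

              h-e : ∀ {ρ s} → hn ∋⟨ ρ , s ⟩ → ∃ λ α → ∃ λ i → ρ ≡ pn (ˇ α) (ˇ i) × C ∋⟨ pr α i , s ⟩
              h-e {ρ} {s} m = go (sep-P (dName C) (∋-e m))
                where
                go₂ : ∀ {a s' τ} → (∃ λ α → ∃ λ i → α ∊ δ × i ∊ ω₁ × a ≡ pr α i) → s' ≡ s → τ ≡ ˇ a → ρ ≡ τ → C ∋⟨ a , s' ⟩ → ∃ λ α → ∃ λ i → ρ ≡ pn (ˇ α) (ˇ i) × C ∋⟨ pr α i , s ⟩
                go₂ (α , i , _ , _ , refl) refl e e' c = α , i , trans e' (trans e (ˇ-pair α i)) , c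
                go : NameOfRelation P Le C (pr ρ s) → ∃ λ α → ∃ λ i → ρ ≡ pn (ˇ α) (ˇ i) × C ∋⟨ pr α i , s ⟩
                go (a , s' , c , τ , hτ , p) = let (e , e') = pr-inj (pr-unique p) in go₂ (⊗-e (proj₁ (rel-e dColour c))) (sym e') (ˇ-unique hτ) e c

              Graph : V → V → V → Set ℓ
              Graph r x y = ∃ λ α → ∃ λ i → α ∊ δ × i ∊ ω₁ × (∀ N → Adm N → In r N → Pos α i N) × r ⊩ x ≈ ˇ α × r ⊩ y ≈ ˇ i

              graph : ∀ {q x y} → IsName x → IsName y → (hn Ext.∋⟨ x , y ⟩) q → ∀ q' → q' ≼ q → ∃ λ r → r ≼ q' × Graph r x y
              graph {q} {x} {y} nx ny m q' l = go (∈-elim (∋→pn nx ny m) q' l)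
                where
                go₂ : ∀ {r ρ s} → r ≼ q' → r ≼ s → r ⊩ pn x y ≈ ρ → (∃ λ α → ∃ λ i → ρ ≡ pn (ˇ α) (ˇ i) × C ∋⟨ pr α i , s ⟩) → ∃ λ r → r ≼ q' × Graph r x y
                go₂ {r} k k' e (α , i , refl , c) = let (a , b , g) = C-e c
                                                        (e₁ , e₂) = pn-injective (le-dom k) nx ny (ˇ-name α) (ˇ-name i) e
                                                    in r , k , α , i , a , b , (λ N x y → g N x (in-mono k' y)) , e₁ , e₂
                go : (∃ λ r → r ≼ q' × ∃ λ ρ → ∃ λ s → hn ∋⟨ ρ , s ⟩ × r ≼ s × r ⊩ pn x y ≈ ρ) → ∃ λ r → r ≼ q' × Graph r x y
                go (r , k , ρ , s , m , k' , e) = go₂ k k' e (h-e m)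

              graph-≼ : ∀ {r r' x y} → r' ≼ r → Graph r x y → Graph r' x y
              graph-≼ l (α , i , a , b , g , e , e') = α , i , a , b , (λ N x y → g N x (in-mono l y)) , ≈-mono l e , ≈-mono l e'

              graph-functional : ∀ {r x y y'} → Graph r x y → Graph r x y' → r ⊩ y ≈ y'
              graph-functional {r} (α , i , _ , _ , g , e , e') (α₂ , i₂ , _ , _ , g₂ , e₂ , e₂') = go (ˇ-injective (≈-trans (≈-sym e) e₂)) g₂
                where
                go : α ≡ α₂ → (∀ N → Adm N → In r N → Pos α₂ i₂ N) → r ⊩ _ ≈ _
                go refl g₂ = ≈-trans e' (≈-trans (subst (λ j → r ⊩ ˇ i ≈ ˇ j) same (≈-refl (proj₁ (≈-names e)) (ˇ-name i))) (≈-sym e₂'))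
                  where
                  same : i ≡ i₂
                  same = dne λ n → witness (proj₁ (≈-names e)) λ N a j → n (pos-agree (g N a j) (g₂ N a j))

              graph-injective : ∀ {r x x' y} → Graph r x y → Graph r x' y → r ⊩ x ≈ x'
              graph-injective {r} (α , i , _ , _ , g , e , e') (α₂ , i₂ , _ , _ , g₂ , e₂ , e₂') = go (ˇ-injective (≈-trans (≈-sym e') e₂')) g₂
                where
                go : i ≡ i₂ → (∀ N → Adm N → In r N → Pos α₂ i₂ N) → r ⊩ _ ≈ _
                go refl g₂ = ≈-trans e (≈-trans (subst (λ j → r ⊩ ˇ α ≈ ˇ j) same (≈-refl (proj₁ (≈-names e)) (ˇ-name α))) (≈-sym e₂))
                  where
                  same : α ≡ α₂
                  same = dne λ n → witness (proj₁ (≈-names e)) λ N a j → n (pos-injective (g N a j) (g₂ N a j))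

              both : ∀ {q x y x' y'} → IsName x → IsName y → IsName x' → IsName y' → (hn Ext.∋⟨ x , y ⟩) q → (hn Ext.∋⟨ x' , y' ⟩) q →
                     ∀ q' → q' ≼ q → ∃ λ r → r ≼ q' × Graph r x y × Graph r x' y'
              both {x = x} {y} {x'} {y'} nx ny nx' ny' m m' q' l = go (graph nx ny m q' l)
                where
                go₂ : ∀ {r} → r ≼ q' → Graph r x y → (∃ λ r' → r' ≼ r × Graph r' x' y') → ∃ λ r → r ≼ q' × Graph r x y × Graph r x' y'
                go₂ k g (r' , k' , g') = r' , le-trans k' k , graph-≼ k' g , g'
                go : (∃ λ r → r ≼ q' × Graph r x y) → ∃ λ r → r ≼ q' × Graph r x y × Graph r x' y'
                go (r , k , g) = go₂ k g (graph nx' ny' m' r (le-trans k l))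

              ∋-≼ : ∀ {F x y q q'} → q' ≼ q → (F Ext.∋⟨ x , y ⟩) q → (F Ext.∋⟨ x , y ⟩) q'
              ∋-≼ l m r k = m r (le-trans k l)

              isPartial : ∀ p → Ext.IsPartialFunction hn (ˇ δ) p
              isPartial p =
                (λ z nz q l m q' l' → let (r , k , ρ , s , m' , k' , e) = ∈-elim m q' l'
                                          (α , i , e' , c) = h-e m'
                                          (a , _ , _) = C-e c
                                      in r , k , ˇ α , ˇ-name α , ˇ∈-i (le-dom k) a , λ q₁ l₁ → q₁ , ≼r l₁ , ˇ i , ˇ-name i ,
                                         pn→pair (ˇ-name α) (ˇ-name i) (≈-mono l₁ (subst (r ⊩ z ≈_) e' e))) ,
                (λ x nx y ny y' ny' q l m q' l' m' → ≈→≐ (≈-local (le-dom l') ny ny' λ q₁ l₁ →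
                  let (r , k , g , g') = both nx ny nx ny' (∋-≼ l' m) m' q₁ l₁ in r , k , graph-functional g g'))

              isTotal : ∀ p → (Ext.∀∊ (ˇ δ) λ x → Ext.∃̇ λ y → hn Ext.∋⟨ x , y ⟩) p
              isTotal p x nx q l m q' l' = go (∈ˇ-e m q' l')
                where
                Res : Set ℓ
                Res = ∃ λ r → r ≼ q' × ∃ λ y → IsName y × (hn Ext.∋⟨ x , y ⟩) r
                go₂ : ∀ {r α} → r ≼ q' → α ∊ δ → r ⊩ x ≈ ˇ α → (∃ λ r' → r' ≼ r × ∃ λ i → i ∊ ω₁ × (∀ N → Adm N → In r' N → Pos α i N)) → Res
                go₂ {α = α} k a e (r' , k' , i , b , g) = r' , le-trans k' k , ˇ i , ˇ-name i ,
                  pn→∋ nx (ˇ-name i) (∈-congˡ (pn-cong (≈-sym (≈-mono k' e)) (≈-refl (le-dom k') (ˇ-name i))) (∈-intro h-name (h-i (C-i a b (le-dom k') g)) (le-refl (le-dom k'))))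
                go : (∃ λ r → r ≼ q' × ∃ λ α → α ∊ δ × r ⊩ x ≈ ˇ α) → Res
                go (r , k , α , a , e) = go₂ k a e (decidePosition a (le-dom k))

              isFunctionExt : ∀ p → (Ext.IsFunction hn (ˇ δ) (ˇ ω₁)) p
              isFunctionExt p = (isPartial p , isTotal p) , λ x nx y ny q l m → ∈-local λ q' l' →
                let (r , k , α , i , a , b , g , e , e') = graph nx ny m q' l' in r , k , ∈-congˡ (≈-sym e') (ˇ∈-i (le-dom k) b)

              isInjectiveExt : ∀ p → Ext.IsInjective hn p
              isInjectiveExt p x nx x' nx' y ny q l m q' l' m' = ≈→≐ (≈-local (le-dom l') nx nx' λ q₁ l₁ →
                let (r , k , g , g') = both nx ny nx' ny (∋-≼ l' m) m' q₁ l₁ in r , k , graph-injective g g')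

              collapsed : ∀ {p} → p ∊ P → ¬̇ (check δ (λ δ̌ → Ext.Regular δ̌) p)
              -- Of regularity, only the clause that δ is a cardinal is refuted, with ω₁ ∈ δ and
              -- `hn` as the injection.
              collapsed {p} pP c = proj₂ (proj₁ (check→ {φ = λ δ̌ → Ext.Regular δ̌} c)) p (le-refl pP)
                λ q l → q , ≼r l , ˇ ω₁ , ˇ-name ω₁ , ˇ∈-i (le-dom l) ω₁∈δ , λ q' l' → q' , ≼r l' , hn , h-name , isFunctionExt q' , isInjectiveExt q'

          regularity-fails : ¬̇ (⊩ check δ λ δ̌ → Ext.Regular δ̌)
          regularity-fails pre = go injections condition
            where
            go : (∃ λ ê → Selection ê ω₂ (𝒫 (ω₂ ⊗ ω₁)) (InjectionInto ω₁)) → (∃ λ p → p ∊ P) → ⊥ {ℓ}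
            go (ê , sê) (p , m) = collapsed m (pre p m)
              where
              open Positions.Collapsing sê

        open Presat

        -- The generic ultrapower: values, choice of functions, pairs and applications.

        module Ultra where
          record Supp (lam g : V) : Set ℓ where
            field
              index      : IsIndex δ lam
              pairs      : ∀ {z} → z ∊ g → ∃ λ x → ∃ λ v → x ∊ W × z ≡ pr x v
              functional : Functional g
              local      : ∀ {x y v} → x ∊ W → y ∊ W → (∀ u → u ∊ H lam → u ∊ x ⇔ u ∊ y) → g ∋⟨ x , v ⟩ → g ∋⟨ y , v ⟩

          Fn : V → Set ℓ
          Fn g = ∃ λ lam → Supp lam g

          raise : ∀ {lam lam' g} → IsIndex δ lam' → lam ⊑ lam' → Supp lam g → Supp lam' g
          raise ind s S = record { index = ind ; pairs = pairs ; functional = functional ; local = λ a b h → local a b λ u m → h u (H-mono s u m) }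
            where
            open Supp S

          trace∊W : ∀ {lam N} → IsIndex δ lam → N ∩ H lam ∊ W
          trace∊W ind = W-⊑ (H-∈W ind) λ x m → proj₂ (∩-e m)

          supp-trace : ∀ {lam lam' g N v} → Supp lam g → IsIndex δ lam' → lam ⊑ lam' → g ∋⟨ N ∩ H lam , v ⟩ ⇔ g ∋⟨ N ∩ H lam' , v ⟩
          supp-trace {lam} {lam'} {g} {N} S ind s = local (trace∊W index) (trace∊W ind) (λ u m → up′ , down m) , local (trace∊W ind) (trace∊W index) (λ u m → down m , up′)
            where
            open Supp S
            up′ : ∀ {u} → u ∊ N ∩ H lam → u ∊ N ∩ H lam'
            up′ k = ∩-i (proj₁ (∩-e k)) (H-mono s _ (proj₂ (∩-e k)))
            down : ∀ {u} → u ∊ H lam → u ∊ N ∩ H lam' → u ∊ N ∩ H lam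
            down m k = ∩-i (proj₁ (∩-e k)) m

          hbs→fn : ∀ {g} → HasBoundedSupport g → Fn g
          hbs→fn {g} (W' , v , (h , fn) , lam , H' , ind , hH , loc) = lam , go (VAt-unique v) (H-unique ind hH) h loc
            where
            go : ∀ {W' H'} → W' ≡ W → H' ≡ H lam → (∀∊ g λ z → ∃∊ W' λ x → ∃ λ y → IsPair z x y) →
                 (∀ x y → x ∊ W' → y ∊ W' → (∀∊ H' λ u → u ∊ x ⇔ u ∊ y) → ∀ v → g ∋⟨ x , v ⟩ ⇔ g ∋⟨ y , v ⟩) → Supp lam g
            go refl refl h loc = record
              { index = ind ; pairs = λ m → let (x , a , y , p) = h _ m in x , y , a , pr-unique p
              ; functional = fn ; local = λ a b e m → proj₁ (loc _ _ a b e _) m }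

          fn→hbs : ∀ {g} → Fn g → HasBoundedSupport g
          fn→hbs {g} (lam , S) = W , isVAt , ((λ z m → let (x , v , a , e) = pairs m in x , a , v , subst (λ z → IsPair z x v) (sym e) pr-spec) , functional) ,
            lam , H lam , index , H-spec index , λ x y a b e v → local a b e , local b a (λ u m → proj₂ (e u m) , proj₁ (e u m))
            where
            open Supp S

          -- The value of g at N, computed at any index that supports g; by `val-at` the choice does
          -- not matter. Functions of bounded support thereby act on the sets N themselves.
          val : V → V → V → Set ℓ
          val g N a = ∃ λ lam → Supp lam g × g ∋⟨ N ∩ H lam , a ⟩

          ordIndex : ∀ {lam} → IsIndex δ lam → Ordinal lam
          ordIndex ind = ord-elt oδ (proj₁ (proj₂ ind))

          private
            index-⊑ : ∀ {lam lam'} → IsIndex δ lam → IsIndex δ lam' → lam ⊑ lam' ⊎ lam' ⊑ lam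
            index-⊑ i j = [ inj₁ , (λ m → inj₂ (proj₁ (ordIndex i) _ m)) ]′ (ord-cases (ordIndex i) (ordIndex j))

          val-at : ∀ {lam g N a} → Supp lam g → val g N a → g ∋⟨ N ∩ H lam , a ⟩
          val-at S (lam' , S' , m) = [ (λ s → proj₂ (supp-trace S (Supp.index S') s) m) , (λ s → proj₁ (supp-trace S' (Supp.index S) s) m) ]′ (index-⊑ (Supp.index S) (Supp.index S'))

          at-val : ∀ {lam g N a} → Supp lam g → g ∋⟨ N ∩ H lam , a ⟩ → val g N a
          at-val S m = _ , S , m

          val-unique : ∀ {g N a b} → val g N a → val g N b → a ≡ b
          val-unique (lam , S , m) v = Supp.functional S _ _ _ m (val-at S v)

          common : ∀ {g k} → Fn g → Fn k → ∃ λ lam → Supp lam g × Supp lam k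
          common (lam , S) (lam' , S') = [ (λ s → lam' , raise (Supp.index S') s S , S') , (λ s → lam , S , raise (Supp.index S) s S') ]′ (index-⊑ (Supp.index S) (Supp.index S'))

          common₃ : ∀ {g k l} → Fn g → Fn k → Fn l → ∃ λ lam → Supp lam g × Supp lam k × Supp lam l
          common₃ a b c = go (common a b) c
            where
            go : ∀ {g k l} → (∃ λ lam → Supp lam g × Supp lam k) → Fn l → ∃ λ lam → Supp lam g × Supp lam k × Supp lam l
            go (lam , S , T) (lam' , Q) = [ (λ s → lam' , raise (Supp.index Q) s S , raise (Supp.index Q) s T , Q) , (λ s → lam , S , T , raise (Supp.index S) s Q) ]′ (index-⊑ (Supp.index S) (Supp.index Q))

          Sure* : (V → Set ℓ) → Forced
          Sure* X r = ∀ N → Adm N → In r N → X N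

          -- X holds almost everywhere, with X a predicate of N and not of its trace at some index.
          -- This frees the computations in the ultrapower from comparing indices.
          D* : (V → Set ℓ) → Forced
          D* X p = ∀ q → q ≼ p → ∃ λ r → r ≼ q × Sure* X r

          sure*-≼ : ∀ {X r r'} → r' ≼ r → Sure* X r → Sure* X r'
          sure*-≼ l s N a i = s N a (in-mono l i)

          sure→D : ∀ {X r} → Sure* X r → D* X r
          sure→D {X} s q l = q , ≼r l , sure*-≼ {X} l s

          D-≼ : ∀ {X p q} → q ≼ p → D* X p → D* X q
          D-≼ l h r k = h r (le-trans k l)

          D-local : ∀ {X p} → (∀ q → q ≼ p → ∃ λ r → r ≼ q × D* X r) → D* X p
          D-local {X} {p} h q l = go (h q l)
            where
            go : (∃ λ r → r ≼ q × D* X r) → ∃ λ r → r ≼ q × Sure* X r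
            go (r , k , d) = let (r' , k' , s) = d r (≼r k) in r' , le-trans k' k , s

          D-map : ∀ {X Y p} → (∀ N → Adm N → In p N → X N → Y N) → D* X p → D* Y p
          D-map h d q l = let (r , k , s) = d q l in r , k , λ N a i → h N a (in-mono (le-trans k l) i) (s N a i)

          D-map₂ : ∀ {X Y Q p} → (∀ N → Adm N → In p N → X N → Y N → Q N) → D* X p → D* Y p → D* Q p
          D-map₂ {X} {Y} {Q} {p} h d e q l = go (d q l)
            where
            go₂ : ∀ {r} → r ≼ q → Sure* X r → (∃ λ r' → r' ≼ r × Sure* Y r') → ∃ λ r → r ≼ q × Sure* Q r
            go₂ k s (r' , k' , s') = r' , le-trans k' k , λ N a i → h N a (in-mono (le-trans k' (le-trans k l)) i) (s N a (in-mono k' i)) (s' N a i)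
            go : (∃ λ r → r ≼ q × Sure* X r) → ∃ λ r → r ≼ q × Sure* Q r
            go (r , k , s) = go₂ k s (e r (le-trans k l))

          D-contra : ∀ {X p} {Q : Set ℓ} → p ∊ P → D* X p → (∀ N → Adm N → In p N → ¬̇ X N) → Q
          D-contra {X} {p} m d h = go (d p (le-refl m))
            where
            go : ∀ {Q : Set ℓ} → (∃ λ r → r ≼ p × Sure* X r) → Q
            go (r , k , s) = ⊥-elim′ (witness (le-dom k) λ N a i → h N a (in-mono k i) (s N a i))

          Decides : (V → Set ℓ) → V → Set ℓ
          Decides X q = ∃ λ r → r ≼ q × (Sure* X r ⊎ Sure* (λ N → ¬̇ X N) r)

          decide* : ∀ {lam X q} → q ∊ P → IsIndex δ lam → Defn X → Decides (λ N → X (N ∩ H lam)) q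
          decide* m ind d = decide m ind d

          D-member : ∀ {lam b p} → IsIndex δ lam → b ∊ H lam → D* (λ N → b ∊ N) p
          D-member {lam} {b} ind bH q l = go (extend {X = λ M → b ∊ M} (le-dom l) ind (def₁ b (0 S.∊ 1)) λ nl → in-not-null (le-dom l) (null-⊑
              (λ N a i → [ (λ k → inj₁ (i , ∩-i k bH)) , inj₂ ]′ (dec (b ∊ N))) (null-∪ nl (null-omitting (H⊑W b bH)))))
            where
            go : (∃ λ r → r ≼ q × Sure lam r (λ M → b ∊ M)) → ∃ λ r → r ≼ q × Sure* (λ N → b ∊ N) r
            go (r , k , s) = r , k , λ N a i → proj₁ (∩-e (s N a i))

          private
            dHas : ∀ g k → Defn (HasValue g k)
            dHas g k = def₂ g k (S₁₅.HasValue 0 1 2)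
            dMem : ∀ g k → Defn (MemberValue g k)
            dMem g k = def₂ g k (S₁₅.MemberValue 0 1 2)

            stable-has : ∀ {lam g k} → Supp lam g → Supp lam k → Stable lam (HasValue g k)
            stable-has S T ind s _ = (λ (v , m , n) → v , proj₁ (supp-trace S ind s) m , proj₁ (supp-trace T ind s) n)
                                   , (λ (v , m , n) → v , proj₂ (supp-trace S ind s) m , proj₂ (supp-trace T ind s) n)
            stable-mem : ∀ {lam g k} → Supp lam g → Supp lam k → Stable lam (MemberValue g k)
            stable-mem S T ind s _ = (λ (v , w , m , n , e) → v , w , proj₁ (supp-trace S ind s) m , proj₁ (supp-trace T ind s) n , e)
                                   , (λ (v , w , m , n , e) → v , w , proj₂ (supp-trace S ind s) m , proj₂ (supp-trace T ind s) n , e)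

          Eq* Mem* : V → V → V → Set ℓ
          Eq* g k N = ∃ λ v → val g N v × val k N v
          Mem* g k N = ∃ λ v → ∃ λ w → val g N v × val k N w × v ∊ w

          ≐-e : ∀ {g k p} → Fn g → Fn k → (g ≐ᵤ k) p → D* (Eq* g k) p
          ≐-e {g} {k} {p} a b h = go (common a b)
            where
            go : (∃ λ lam → Supp lam g × Supp lam k) → D* (Eq* g k) p
            go (lam , S , T) = D-map {λ N → HasValue g k (N ∩ H lam)} {Eq* g k} (λ N _ _ (v , m , n) → v , at-val S m , at-val T n) (almost→dense {lam} {HasValue g k} (Supp.index S) (stable-has S T) h)

          ≐-i : ∀ {g k p} → Fn g → Fn k → D* (Eq* g k) p → (g ≐ᵤ k) p
          ≐-i {g} {k} {p} a b h = go (common a b)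
            where
            go : (∃ λ lam → Supp lam g × Supp lam k) → (g ≐ᵤ k) p
            go (lam , S , T) = dense→almost {lam} {HasValue g k} (Supp.index S) (stable-has S T) (dHas g k) (D-map {Eq* g k} {λ N → HasValue g k (N ∩ H lam)} (λ N _ _ (v , m , n) → v , val-at S m , val-at T n) h)

          ∊-e : ∀ {g k p} → Fn g → Fn k → (g ∊ᵤ k) p → D* (Mem* g k) p
          ∊-e {g} {k} {p} a b h = go (common a b)
            where
            go : (∃ λ lam → Supp lam g × Supp lam k) → D* (Mem* g k) p
            go (lam , S , T) = D-map {λ N → MemberValue g k (N ∩ H lam)} {Mem* g k} (λ N _ _ (v , w , m , n , e) → v , w , at-val S m , at-val T n , e) (almost→dense {lam} {MemberValue g k} (Supp.index S) (stable-mem S T) h)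

          ∊-i : ∀ {g k p} → Fn g → Fn k → D* (Mem* g k) p → (g ∊ᵤ k) p
          ∊-i {g} {k} {p} a b h = go (common a b)
            where
            go : (∃ λ lam → Supp lam g × Supp lam k) → (g ∊ᵤ k) p
            go (lam , S , T) = dense→almost {lam} {MemberValue g k} (Supp.index S) (stable-mem S T) (dMem g k) (D-map {Mem* g k} {λ N → MemberValue g k (N ∩ H lam)} (λ N _ _ (v , w , m , n , e) → v , w , val-at S m , val-at T n , e) h)

          Defined : V → V → Set ℓ
          Defined g N = ∃ λ v → val g N v

          inUlt-fn : ∀ {g p} → InUlt g p → Fn g
          inUlt-fn (h , _) = hbs→fn h

          inUlt-def : ∀ {g p} → InUlt g p → D* (Defined g) p
          inUlt-def u@(h , e) = D-map (λ { N _ _ (v , m , _) → v , m }) (≐-e (inUlt-fn u) (inUlt-fn u) e)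

          inUlt-i : ∀ {g p} → Fn g → D* (Defined g) p → InUlt g p
          inUlt-i fn d = fn→hbs fn , ≐-i fn fn (D-map (λ { N _ _ (v , m) → v , m , m }) d)

          inUlt-≼ : ∀ {g p q} → q ≼ p → InUlt g p → InUlt g q
          inUlt-≼ l u = inUlt-i (inUlt-fn u) (D-≼ l (inUlt-def u))

          record Choice (lam r : V) (Q : V → V → Set ℓ) (k : V) : Set ℓ where
            field
              supp    : Supp lam k
              defined : Sure* (Defined k) r
              correct : ∀ {N v} → Adm N → val k N v → Q (N ∩ H lam) v

            fn : Fn k
            fn = lam , supp

            inUlt : InUlt k r
            inUlt = inUlt-i fn (sure→D {Defined k} defined)

          -- The existential step of Łoś's theorem. A value is chosen for each trace in Z_λ and
          -- carried over to all x ∈ V_δ with that trace, so the function is supported by λ.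
          choose : ∀ {lam r} {Q : V → V → Set ℓ} B → IsIndex δ lam → RelDefn Q →
                   (∀ N → Adm N → In r N → ∃ λ v → v ∊ B × Q (N ∩ H lam) v) → Defn (λ M → ∃ λ v → v ∊ B × Q M v) → ∃ λ k → Choice lam r Q k
          choose {lam} {r} {Q} B ind d h dA = build (select A B d λ m → sep-P dA m)
            where
            A : V
            A = sep (Z lam) dA
            build : (∃ λ s → Selection s A B Q) → ∃ λ k → Choice lam r Q k
            build (s , sel) = k , record
              { supp = supp
              ; defined = λ N a i → let (v , m) = Selection.total sel (sep-i dA (Adm.∩H a) (h N a i))
                                    in v , at-val supp (rel-i dK (trace∊W ind) (Selection.cod sel m) (N ∩ H lam , self , m))
              ; correct = λ {N} {v} a x → let (M' , t , m) = proj₂ (proj₂ (rel-e dK (val-at supp x)))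
                                          in subst (λ M → Q M v) (trans (∩-unique t) (sym (∩-unique self))) (Selection.holds sel m) }
              where
              dK : RelDefn (Chosen s (H lam))
              dK = def₂ s (H lam) (S₁.PairIn 2 (S₁₅.Chosen 0 1))
              k : V
              k = rel W B dK
              self : ∀ {N} → IsIntersection (N ∩ H lam) (N ∩ H lam) (H lam)
              self x = (λ m → m , proj₂ (∩-e m)) , proj₁
              supp : Supp lam k
              supp = record
                { index = ind
                ; pairs = λ m → let (x , v , e , a , _) = rel-pair dK m in x , v , a , e
                ; functional = λ x v v' m m' → let (M₁ , t , n) = proj₂ (proj₂ (rel-e dK m))
                                                   (M₂ , t' , n') = proj₂ (proj₂ (rel-e dK m'))
                                               in Selection.functional sel _ _ _ n (subst (λ M → s ∋⟨ M , v' ⟩) (trans (∩-unique t') (sym (∩-unique t))) n')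
                ; local = λ a b e m → let (_ , vB , M' , t , n) = rel-e dK m
                                      in rel-i dK b vB (M' , (λ u → (λ l → let (p , q) = proj₁ (t u) l in proj₁ (e u q) p , q)
                                                                           , (λ (p , q) → proj₂ (t u) (proj₂ (e u q) p , q))) , n) }

          ran : V → V
          ran g = ⋃ (⋃ g)

          ran-i : ∀ {g M v} → g ∋⟨ M , v ⟩ → v ∊ ran g
          ran-i {M = M} {v} m = ⋃-i (upair-r {M} {v}) (⋃-i upair-r (∋-e m))

          Upair* Pair* App* : V → V → V → V → Set ℓ
          Upair* z x y N = ∃ λ c → ∃ λ a → ∃ λ b → val z N c × val x N a × val y N b × c ≡ upair a b
          Pair* z x y N = ∃ λ c → ∃ λ a → ∃ λ b → val z N c × val x N a × val y N b × c ≡ pr a b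
          App* k x y N = ∃ λ e → ∃ λ a → ∃ λ b → val k N e × val x N a × val y N b × e ∋⟨ a , b ⟩

          -- If, on some stronger condition, z(N) had elements other than x(N) and y(N), choosing
          -- them would give an element of [z] different from [x] and [y].
          upair→ : ∀ {z x y p} → InUlt z p → InUlt x p → InUlt y p → Ult.IsUnorderedPair z x y p → D* (Upair* z x y) p
          upair→ {z} {x} {y} {p} uz ux uy h = go (common₃ (inUlt-fn uz) (inUlt-fn ux) (inUlt-fn uy))
            where
            fz = inUlt-fn uz
            fx = inUlt-fn ux
            fy = inUlt-fn uy
            reflᵤ : ∀ {g q} → q ≼ p → InUlt g p → (g ≐ᵤ g) q
            reflᵤ l u = proj₂ (inUlt-≼ l u)
            x∊z : ∀ q → q ≼ p → D* (Mem* x z) q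
            x∊z q l = ∊-e fx fz (proj₂ (h x q l (inUlt-≼ l ux)) q (≼r l) λ q' l' → q' , ≼r l' , inj₁ (reflᵤ (le-trans l' l) ux))
            y∊z : ∀ q → q ≼ p → D* (Mem* y z) q
            y∊z q l = ∊-e fy fz (proj₂ (h y q l (inUlt-≼ l uy)) q (≼r l) λ q' l' → q' , ≼r l' , inj₂ (reflᵤ (le-trans l' l) uy))
            module _ {lam} (Sz : Supp lam z) (Sx : Supp lam x) (Sy : Supp lam y) where
              Other : V → V → Set ℓ
              Other = OtherElement z x y
              dO : Defn (λ M → ∃ λ w → Other M w)
              dO = def₃ z x y (S.∃̇ λ w → S₁₅.OtherElement 0 1 2 3 w)
              B : V
              B = ⋃ (ran z)
              absurd′ : ∀ {r} → r ≼ p → Sure* (λ N → ∃ λ w → Other (N ∩ H lam) w) r → ⊥ {ℓ}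
              absurd′ {r} l s = withChoice (choose {lam} {r} {Other} B (Supp.index Sz) (def₃ z x y (S₁.PairIn 3 (S₁₅.OtherElement 0 1 2)))
                  (λ N a i → let (w , c , a' , b , m , r) = s N a i in w , ⋃-i (proj₁ (proj₂ (proj₂ r))) (ran-i m) , c , a' , b , m , r)
                  (def₄ z x y B (S.∃̇ λ w → (w S.∊ 3) S.∧ S₁₅.OtherElement 0 1 2 4 w)))
                where
                withChoice : (∃ λ k → Choice lam r Other k) → ⊥ {ℓ}
                withChoice (k , ch) = finish (proj₁ (h k r l inUlt) r (≼r l) (∊-i fn fz (sure→D {Mem* k z} member)) r (≼r l))
                  where
                  open Choice ch
                  member : Sure* (Mem* k z) r
                  member N a i = go₂ (defined N a i)
                    where
                    go₂ : Defined k N → Mem* k z N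
                    go₂ (v , m) = let (c , _ , _ , mc , _ , _ , vc , _) = correct a m in v , c , m , at-val Sz mc , vc
                  differs : ∀ {g q} → q ≼ r → Supp lam g → (∀ {N v a} → Other (N ∩ H lam) v → val g N a → v ≡ a → ⊥ {ℓ}) → (k ≐ᵤ g) q → ⊥ {ℓ}
                  differs l' Sg no-eq e = D-contra (le-dom l') (≐-e fn (_ , Sg) e) λ N a i (v , m , n) → no-eq (correct a m) n refl
                  finish : (∃ λ r' → r' ≼ r × ((k ≐ᵤ x) r' ⊎ (k ≐ᵤ y) r')) → ⊥ {ℓ}
                  finish (r' , l' , inj₁ e) = differs l' Sx (λ (_ , a , _ , _ , ma , _ , _ , ne , _) n q → ne (trans q (val-unique n (at-val Sx ma)))) e
                  finish (r' , l' , inj₂ e) = differs l' Sy (λ (_ , _ , b , _ , _ , mb , _ , _ , ne) n q → ne (trans q (val-unique n (at-val Sy mb)))) e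
              equal : ∀ {N} → ¬̇ (∃ λ w → Other (N ∩ H lam) w) → Mem* x z N → Mem* y z N → Upair* z x y N
              equal n (a , c , ma , mc , i) (b , c' , mb , mc' , j) = c , a , b , mc , ma , mb , ext
                (λ w k → dne λ ne → n (w , c , a , b , val-at Sz mc , val-at Sx ma , val-at Sy mb , k
                  , (λ e → ne (subst (_∊ upair a b) (sym e) upair-l)) , λ e → ne (subst (_∊ upair a b) (sym e) upair-r)))
                (λ w k → [ (λ e → subst (_∊ c) (sym e) i) , (λ e → subst (_∊ c) (sym e) (subst (b ∊_) (val-unique mc' mc) j)) ]′ (upair-e k))
              decided : ∀ q → q ≼ p → Decides (λ N → ∃ λ w → Other (N ∩ H lam) w) q → ∃ λ r → r ≼ q × D* (Upair* z x y) r
              decided q l (r , k , inj₁ s) = ⊥-elim′ (absurd′ (le-trans k l) s)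
              decided q l (r , k , inj₂ s) = r , k , D-map₂ (λ N a i m m' → equal (s N a i) m m') (x∊z r (le-trans k l)) (y∊z r (le-trans k l))
            go : (∃ λ lam → Supp lam z × Supp lam x × Supp lam y) → D* (Upair* z x y) p
            go (lam , Sz , Sx , Sy) = D-local {Upair* z x y} λ q l → decided Sz Sx Sy q l (decide* (le-dom l) (Supp.index Sz) (dO Sz Sx Sy))

          upair← : ∀ {z x y p} → Fn z → Fn x → Fn y → D* (Upair* z x y) p → Ult.IsUnorderedPair z x y p
          upair← {z} {x} {y} {p} fz fx fy d w q l uw = fwd , bwd
            where
            fw = inUlt-fn uw
            fwd : ∀ q' → q' ≼ q → (w ∊ᵤ z) q' → ∀ q₁ → q₁ ≼ q' → ∃ λ r → r ≼ q₁ × ((w ≐ᵤ x) r ⊎ (w ≐ᵤ y) r)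
            fwd q' l' m q₁ l₁ = go (common fw fx)
              where
              l₂ : q₁ ≼ p
              l₂ = le-trans l₁ (le-trans l' l)
              go : (∃ λ lam → Supp lam w × Supp lam x) → ∃ λ r → r ≼ q₁ × ((w ≐ᵤ x) r ⊎ (w ≐ᵤ y) r)
              go (lam , Sw , Sx) = decided (decide* (le-dom l₁) (Supp.index Sw) (dHas w x))
                where
                decided : Decides (λ N → HasValue w x (N ∩ H lam)) q₁ → ∃ λ r → r ≼ q₁ × ((w ≐ᵤ x) r ⊎ (w ≐ᵤ y) r)
                decided (r , k , inj₁ s) = r , k , inj₁ (≐-i fw fx (sure→D {Eq* w x} λ N a i → let (v , m , n) = s N a i in v , at-val Sw m , at-val Sx n))
                decided (r , k , inj₂ s) = r , k , inj₂ (≐-i fw fy (D-map₂ pick (D-≼ (le-trans k l₁) (∊-e fw fz m)) (D-≼ (le-trans k l₂) d)))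
                  where
                  pick : ∀ N → Adm N → In r N → Mem* w z N → Upair* z x y N → Eq* w y N
                  pick N a i (v , c , mv , mc , e) (c' , a' , b , mc' , ma , mb , q) =
                    [ (λ e' → ⊥-elim′ (s N a i (v , val-at Sw mv , subst (λ v → x ∋⟨ N ∩ H lam , v ⟩) (sym e') (val-at Sx ma))))
                    , (λ e' → v , mv , subst (val y N) (sym e') mb) ]′ (upair-e (subst (v ∊_) (trans (val-unique mc mc') q) e))
            bwd : ∀ q' → q' ≼ q → ((w ≐ᵤ x) Ext.∨ (w ≐ᵤ y)) q' → (w ∊ᵤ z) q'
            bwd q' l' h = ∊-i fw fz (D-local {Mem* w z} λ q₁ l₁ → go q₁ l₁ (h q₁ l₁))
              where
              go : ∀ q₁ → q₁ ≼ q' → (∃ λ r → r ≼ q₁ × ((w ≐ᵤ x) r ⊎ (w ≐ᵤ y) r)) → ∃ λ r → r ≼ q₁ × D* (Mem* w z) r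
              go q₁ l₁ (r , k , inj₁ e) = r , k , D-map₂ (λ N a i (v , mv , mx) (c , a' , b , mc , ma , mb , q) →
                v , c , mv , mc , subst (v ∊_) (sym q) (subst (λ t → v ∊ upair t b) (val-unique mx ma) upair-l)) (≐-e fw fx e) (D-≼ (le-trans k (le-trans l₁ (le-trans l' l))) d)
              go q₁ l₁ (r , k , inj₂ e) = r , k , D-map₂ (λ N a i (v , mv , mx) (c , a' , b , mc , ma , mb , q) →
                v , c , mv , mc , subst (v ∊_) (sym q) (subst (λ t → v ∊ upair a' t) (val-unique mx mb) upair-r)) (≐-e fw fy e) (D-≼ (le-trans k (le-trans l₁ (le-trans l' l))) d)

          pair→ : ∀ {z x y p} → InUlt z p → InUlt x p → InUlt y p → Ult.IsPair z x y p → D* (Pair* z x y) p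
          pair→ {z} {x} {y} {p} uz ux uy h = D-local {Pair* z x y} λ q l → go q l (h q l)
            where
            go₂ : ∀ {q r a} → q ≼ p → r ≼ q → InUlt a r →
                  (∃ λ r' → r' ≼ r × ∃ λ b → InUlt b r' × (Ult.IsUnorderedPair a x x r' × Ult.IsUnorderedPair b x y r' × Ult.IsUnorderedPair z a b r')) →
                  ∃ λ r → r ≼ q × D* (Pair* z x y) r
            go₂ l k ua (r' , k' , b , ub , h₁ , h₂ , h₃) = r' , le-trans k' k ,
              D-map₂ (λ { N _ _ (A , a₁ , a₂ , mA , m₁ , m₂ , e) (B , a₃ , b₁ , mB , m₃ , m₄ , e' , (c , A' , B' , mc , mA' , mB' , e'')) →
                        c , a₃ , b₁ , mc , m₃ , m₄ , trans e'' (cong₂-upair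
                          (trans (val-unique mA' mA) (trans e (cong₂-upair (val-unique m₁ m₃) (val-unique m₂ m₃))))
                          (trans (val-unique mB' mB) e')) })
                (upair→ (inUlt-≼ k' ua) (inUlt-≼ l' ux) (inUlt-≼ l' ux) h₁)
                (D-map₂ (λ { N _ _ (B , a₃ , b₁ , mB , m₃ , m₄ , e') r → B , a₃ , b₁ , mB , m₃ , m₄ , e' , r })
                  (upair→ ub (inUlt-≼ l' ux) (inUlt-≼ l' uy) h₂) (upair→ (inUlt-≼ l' uz) (inUlt-≼ k' ua) ub h₃))
              where
              l' = le-trans k' (le-trans k l)
              cong₂-upair : ∀ {a a' b b'} → a ≡ a' → b ≡ b' → upair a b ≡ upair a' b'
              cong₂-upair refl refl = refl
            go : ∀ q → q ≼ p → (∃ λ r → r ≼ q × ∃ λ a → InUlt a r × (Ult.∃̇ λ b → Ult.IsUnorderedPair a x x Ult.∧ Ult.IsUnorderedPair b x y Ult.∧ Ult.IsUnorderedPair z a b) r) →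
                 ∃ λ r → r ≼ q × D* (Pair* z x y) r
            go q l (r , k , a , ua , h') = go₂ l k ua (h' r (≼r k))

          upairName : ∀ {x y r} → Fn x → Fn y → Sure* (Defined x) r → Sure* (Defined y) r → ∃ λ k → InUlt k r × Sure* (Upair* k x y) r
          upairName {x} {y} {r} fx fy dx dy = go (common fx fy)
            where
            go : (∃ λ lam → Supp lam x × Supp lam y) → ∃ λ k → InUlt k r × Sure* (Upair* k x y) r
            go (lam , Sx , Sy) = finish (choose {lam} {r} {UpairValue x y} B (Supp.index Sx) (def₂ x y (S₁.PairIn 2 (S₁₅.UpairValue 0 1)))
                (λ N a i → let (u , m) = dx N a i
                               (v , n) = dy N a i
                           in upair u v , 𝒫-i (λ w k → [ (λ e → subst (_∊ _) (sym e) (∪-l (ran-i (val-at Sx m)))) , (λ e → subst (_∊ _) (sym e) (∪-r (ran-i (val-at Sy n)))) ]′ (upair-e k))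
                              , u , v , val-at Sx m , val-at Sy n , upair-spec u v)
                (def₃ x y B (S.∃̇ λ w → (w S.∊ 2) S.∧ S₁₅.UpairValue 0 1 3 w)))
              where
              B : V
              B = 𝒫 (ran x ∪ ran y)
              finish : (∃ λ k → Choice lam r (UpairValue x y) k) → ∃ λ k → InUlt k r × Sure* (Upair* k x y) r
              finish (k , ch) = k , Choice.inUlt ch , λ N a i → let (c , m) = Choice.defined ch N a i
                                                                    (u , v , m₁ , m₂ , e) = Choice.correct ch a m
                                                                in c , u , v , m , at-val Sx m₁ , at-val Sy m₂ , upair-unique e

          pair← : ∀ {z x y p} → Fn z → Fn x → Fn y → D* (Pair* z x y) p → Ult.IsPair z x y p
          pair← {z} {x} {y} {p} fz fx fy d q l = step₀ (d q l)
            where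
            Res : Set ℓ
            Res = ∃ λ r → r ≼ q × ∃ λ a → InUlt a r × (Ult.∃̇ λ b → Ult.IsUnorderedPair a x x Ult.∧ Ult.IsUnorderedPair b x y Ult.∧ Ult.IsUnorderedPair z a b) r
            step₂ : ∀ {r a b} → r ≼ q → Sure* (Pair* z x y) r → InUlt a r → Sure* (Upair* a x x) r → InUlt b r → Sure* (Upair* b x y) r → Res
            step₂ {r} {a} {b} k s ua sa ub sb = r , k , a , ua , λ q' l' → q' , ≼r l' , b , inUlt-≼ l' ub ,
              upair← fa fx fx (sure→D {Upair* a x x} (sure*-≼ {Upair* a x x} l' sa)) , upair← fb fx fy (sure→D {Upair* b x y} (sure*-≼ {Upair* b x y} l' sb)) ,
              upair← fz fa fb (sure→D {Upair* z a b} (sure*-≼ {Upair* z a b} l' λ N aN i → combine (s N aN i) (sa N aN i) (sb N aN i)))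
              where
              fa = inUlt-fn ua
              fb = inUlt-fn ub
              combine : ∀ {N} → Pair* z x y N → Upair* a x x N → Upair* b x y N → Upair* z a b N
              combine (c , u , v , mc , mu , mv , e) (A , a₁ , a₂ , mA , m₁ , m₂ , e₁) (B , a₃ , b₁ , mB , m₃ , m₄ , e₂) =
                c , A , B , mc , mA , mB , eq₃ (val-unique m₁ mu) (val-unique m₂ mu) (val-unique m₃ mu) (val-unique m₄ mv) e e₁ e₂
                where
                eq₃ : ∀ {c A B u v a₁ a₂ a₃ b₁} → a₁ ≡ u → a₂ ≡ u → a₃ ≡ u → b₁ ≡ v → c ≡ pr u v → A ≡ upair a₁ a₂ → B ≡ upair a₃ b₁ → c ≡ upair A B
                eq₃ refl refl refl refl refl refl refl = refl
            step₁ : ∀ {r} → r ≼ q → Sure* (Pair* z x y) r → Res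
            step₁ {r} k s = go (upairName fx fx dx dx) (upairName fx fy dx dy)
              where
              dx : Sure* (Defined x) r
              dx N a i = let (_ , u , _ , _ , m , _) = s N a i in u , m
              dy : Sure* (Defined y) r
              dy N a i = let (_ , _ , v , _ , _ , m , _) = s N a i in v , m
              go : (∃ λ a → InUlt a r × Sure* (Upair* a x x) r) → (∃ λ b → InUlt b r × Sure* (Upair* b x y) r) → Res
              go (a , ua , sa) (b , ub , sb) = step₂ k s ua sa ub sb
            step₀ : (∃ λ r → r ≼ q × Sure* (Pair* z x y) r) → Res
            step₀ (r , k , s) = step₁ k s

          app→ : ∀ {k x y p} → InUlt k p → InUlt x p → InUlt y p → (k Ult.∋⟨ x , y ⟩) p → D* (App* k x y) p
          app→ {k} {x} {y} {p} uk ux uy h = D-local {App* k x y} λ q l → go q l (h q l)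
            where
            go : ∀ q → q ≼ p → (∃ λ r → r ≼ q × ∃ λ z → InUlt z r × ((z ∊ᵤ k) r × Ult.IsPair z x y r)) → ∃ λ r → r ≼ q × D* (App* k x y) r
            go q l (r , l' , z , uz , m , e) = r , l' , D-map₂ (λ N _ _ (v , w , mv , mw , i) (c , a , b , mc , ma , mb , e) →
                w , a , b , mw , ma , mb , ∋-i (subst (_∊ w) (trans (val-unique mv mc) e) i))
              (∊-e (inUlt-fn uz) (inUlt-fn uk) m) (pair→ uz (inUlt-≼ l'' ux) (inUlt-≼ l'' uy) e)
              where l'' = le-trans l' l

          app← : ∀ {k x y p} → Fn k → Fn x → Fn y → D* (App* k x y) p → (k Ult.∋⟨ x , y ⟩) p
          app← {k} {x} {y} {p} fk fx fy d q l = step₀ (d q l) (common fx fy)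
            where
            Res : Set ℓ
            Res = ∃ λ r → r ≼ q × ∃ λ z → InUlt z r × ((z ∊ᵤ k) r × Ult.IsPair z x y r)
            step₀ : (∃ λ r → r ≼ q × Sure* (App* k x y) r) → (∃ λ lam → Supp lam x × Supp lam y) → Res
            step₀ (r , l' , s) (lam , Sx , Sy) = finish (choose {lam} {r} {PairValue x y} B (Supp.index Sx) (def₂ x y (S₁.PairIn 2 (S₁₅.PairValue 0 1)))
                (λ N aN i → let (e , a , b , me , ma , mb , m) = s N aN i
                            in pr a b , ⋃-i (∋-e m) (ran-i (proj₂ (proj₂ me))) , a , b , val-at Sx ma , val-at Sy mb , pr-spec)
                (def₃ x y B (S.∃̇ λ w → (w S.∊ 2) S.∧ S₁₅.PairValue 0 1 3 w)))
              where
              B : V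
              B = ⋃ (ran k)
              finish : (∃ λ z → Choice lam r (PairValue x y) z) → Res
              finish (z , ch) = r , l' , z , Choice.inUlt ch ,
                ∊-i (Choice.fn ch) fk (sure→D {Mem* z k} λ N aN i → member (s N aN i) (Choice.defined ch N aN i) aN) ,
                pair← (Choice.fn ch) fx fy (sure→D {Pair* z x y} λ N aN i → paired (Choice.defined ch N aN i) aN)
                where
                paired : ∀ {N} → Defined z N → Adm N → Pair* z x y N
                paired (c , m) aN = let (a , b , ma , mb , e) = Choice.correct ch aN m in c , a , b , m , at-val Sx ma , at-val Sy mb , pr-unique e
                member : ∀ {N} → App* k x y N → Defined z N → Adm N → Mem* z k N
                member {N} (e , a , b , me , ma , mb , m) dz aN = go (paired dz aN)
                  where
                  go : Pair* z x y N → Mem* z k N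
                  go (c , a' , b' , mc , ma' , mb' , q) = c , e , mc , me , subst (_∊ e) (trans (cong₂-pr (val-unique ma ma') (val-unique mb mb')) (sym q)) (∋-e m)
                    where
                    cong₂-pr : ∀ {a a' b b'} → a ≡ a' → b ≡ b' → pr a b ≡ pr a' b'
                    cong₂-pr refl refl = refl

        open Ultra

        -- The functions g_ξ and F in the ultrapower.

        module Ranks where
          otp-below : ∀ {N α v} → Otp δ N α v → v ⊑ α
          otp-below {N} o = foundation-ind δ {OtpBelow δ N} (def₂ δ N (S₁₆.OtpBelow 0 1 2)) step (otp-dom o) _ o
            where
            step : ∀ α → α ∊ δ → (∀ β → β ∊ α → β ∊ δ → OtpBelow δ N β) → OtpBelow δ N α
            step α a ih v o x m = let (β , _ , q , r) = otp-members o m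
                                  in ⊑-∊-trans (otp-ordinal r) (ord-elt oδ a) (ih β q (ord-trans oδ q a) x r) q

          abstract
            dG : ∀ ξ → RelDefn (λ x v → Otp δ x ξ v)
            dG ξ = def₂ δ ξ (S₁.PairIn 2 λ x v → S₈.Otp 0 x 1 v)

            dF : RelDefn (BoundAt U f)
            dF = def₂ U f (S₁.PairIn 2 (S₁₆.BoundAt 0 1))

          -- The function g_ξ. An order type of a subset of ξ is at most ξ, so 𝒫(δ) is large enough
          -- to hold all its values.
          G : V → V
          G ξ = rel W (𝒫 δ) (dG ξ)

          G-i : ∀ {x ξ v} → x ∊ W → Otp δ x ξ v → G ξ ∋⟨ x , v ⟩
          G-i a o = rel-i (dG _) a (𝒫-i (⊑-trans (otp-below o) (proj₁ oδ _ (otp-dom o)))) o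

          G-e : ∀ {x ξ v} → G ξ ∋⟨ x , v ⟩ → Otp δ x ξ v
          G-e m = proj₂ (proj₂ (rel-e (dG _) m))

          G-supp : ∀ {lam ξ} → IsIndex δ lam → ξ ⊑ lam → Supp lam (G ξ)
          G-supp {lam} {ξ} ind s = record
            { index = ind
            ; pairs = λ m → let (x , v , e , a , _) = rel-pair (dG ξ) m in x , v , a , e
            ; functional = λ x v v' m m' → otp-unique (G-e m) (G-e m')
            ; local = λ a b h m → G-i b (otp-transfer (λ β l → h β (H-ordinal (proj₁ (proj₂ ind)) (s β l))) (G-e m)) }

          indexFor : ∀ {ξ} → ξ ∊ δ → ∃ λ lam → IsIndex δ lam × ξ ⊑ lam
          indexFor m = let (lam , ind , l , _) = index-above m in lam , ind , proj₁ (ordIndex ind) _ l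

          G-fn : ∀ {ξ} → ξ ∊ δ → Fn (G ξ)
          G-fn m = let (lam , ind , s) = indexFor m in lam , G-supp ind s

          otp-trace : ∀ {lam N ξ v} → IsIndex δ lam → ξ ⊑ lam → Otp δ (N ∩ H lam) ξ v ⇔ Otp δ N ξ v
          otp-trace ind s = otp-transfer (λ β l → (λ k → proj₁ (∩-e k)) , λ k → ∩-i k (H-ordinal (proj₁ (proj₂ ind)) (s β l)))
                          , otp-transfer (λ β l → (λ k → ∩-i k (H-ordinal (proj₁ (proj₂ ind)) (s β l))) , λ k → proj₁ (∩-e k))

          G-val : ∀ {N ξ v} → ξ ∊ δ → val (G ξ) N v ⇔ Otp δ N ξ v
          G-val {N} {ξ} {v} m = go (indexFor m)
            where
            go : (∃ λ lam → IsIndex δ lam × ξ ⊑ lam) → val (G ξ) N v ⇔ Otp δ N ξ v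
            go (lam , ind , s) = (λ x → proj₁ (otp-trace ind s) (G-e (val-at (G-supp ind s) x)))
                               , (λ o → at-val (G-supp ind s) (G-i (trace∊W ind) (proj₂ (otp-trace ind s) o)))

          G-def : ∀ {ξ r} → ξ ∊ δ → Sure* (Defined (G ξ)) r
          G-def m N _ _ = let (v , o) = otp-exists N m in v , proj₂ (G-val m) o

          G-inUlt : ∀ {ξ r} → ξ ∊ δ → InUlt (G ξ) r
          G-inUlt {ξ} m = inUlt-i (G-fn m) (sure→D {Defined (G ξ)} (G-def m))

          F : V
          F = rel W ω₂ dF

          F-supp : Supp lam₀ F
          F-supp = record
            { index = index₀
            ; pairs = λ m → let (x , v , e , a , _) = rel-pair dF m in x , v , a , e
            ; functional = λ x v v' m m' → let (X , t , p) = proj₂ (proj₂ (rel-e dF m))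
                                               (X' , t' , p') = proj₂ (proj₂ (rel-e dF m'))
                                           in f-fun p (subst (λ X → f ∋⟨ X , v' ⟩) (trans (∩-unique t') (sym (∩-unique t))) p')
            ; local = λ a b h m → let (_ , vω , X , t , p) = rel-e dF m
                                  in rel-i dF b vω (X , (λ u → (λ k → let (l , n) = proj₁ (t u) k in proj₁ (h u (U⊑H u n)) l , n)
                                                             , (λ (l , n) → proj₂ (t u) (proj₂ (h u (U⊑H u n)) l , n))) , p) }

          -- The last clause of admissibility, read as a statement on the ultrapower: [F] exceeds
          -- [g_ξ] on all N with ξ ∈ N, and for fixed ξ almost every N is of this kind.
          F-value : ∀ {N} → Adm N → ∃ λ γ → γ ∊ ω₂ × val F N γ × (∀ {ξ v} → ξ ∊ δ → ξ ∊ N → Otp δ N ξ v → v ∊ γ)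
          F-value {N} (_ , _ , _ , _ , X , γ , t , p , b) = γ , f-cod p
            , at-val F-supp (rel-i dF (trace∊W index₀) (f-cod p) (X , (λ u → (λ k → let (l , n) = proj₁ (t u) k in ∩-i l (U⊑H u n) , n)
                                                                          , (λ (l , n) → proj₂ (t u) (proj₁ (∩-e l) , n))) , p))
            , λ d m o → b _ m d _ o

          F-inUlt : ∀ {r} → InUlt F r
          F-inUlt = inUlt-i (_ , F-supp) (sure→D {Defined F} λ N a _ → let (γ , _ , m , _) = F-value a in γ , m)

          member* : ∀ {b p} → b ∊ δ → D* (λ N → b ∊ N) p
          member* b = let (lam , ind , m , _) = index-above b in D-member ind (H-ordinal (proj₁ (proj₂ ind)) m)

          EqG : V → V → V → Set ℓ
          EqG u ζ N = ∃ λ v → val u N v × Otp δ N ζ v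

          ≐G→ : ∀ {u ζ r} → Fn u → ζ ∊ δ → (u ≐ᵤ G ζ) r → D* (EqG u ζ) r
          ≐G→ {u} {ζ} fu m e = D-map {Eq* u (G ζ)} {EqG u ζ} (λ N _ _ (v , a , b) → v , a , proj₁ (G-val m) b) (≐-e fu (G-fn m) e)

          -- Normality: an element of [G ξ] is some [G ζ] with ζ < ξ.
          regress : ∀ {u ξ r} → Fn u → ξ ∊ δ → r ∊ P → Sure* (λ N → ∃ λ v → ∃ λ w → val u N v × Otp δ N ξ w × v ∊ w) r →
                    ∃ λ ζ → ζ ∊ ξ × ∃ λ r' → r' ≼ r × Sure* (EqG u ζ) r'
          regress {u} {ξ} {r} fu ξδ rP s = go (common fu (G-fn ξδ)) (indexFor ξδ)
            where
            Res : Set ℓ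
            Res = ∃ λ ζ → ζ ∊ ξ × ∃ λ r' → r' ≼ r × Sure* (EqG u ζ) r'
            at : ∀ {lam} → Supp lam u → ξ ⊑ lam → Res
            at {lam} Su sub = finish (pressDown ξ {λ ζ → OtpValue δ u ζ} (λ _ → lam) rP (λ ζ m → W-ordinal (ord-trans oδ m ξδ))
                (λ {lam'} {S} _ → dKill S (H lam')) (λ ζ _ → def₃ δ u ζ (S₁₆.OtpValue 0 1 2 3)) (λ _ _ → ind) start)
              where
              ind = Supp.index Su
              sub′ : ∀ {ζ} → ζ ∊ ξ → ζ ⊑ lam
              sub′ m x k = sub x (ord-trans (ord-elt oδ ξδ) k m)
              dKill₀ : ∀ S Hs → RelDefn (λ ζ G → Kills (λ N → Trace S Hs N × (∃ λ M → IsIntersection M N (H lam) × OtpValue δ u ζ M)) G)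
              dKill₀ S Hs = def (S₁.PairIn 9 (λ ζ G → S₁₀.Ideal.Kills 0 1 2 3 4 (λ N → S₁₀.Trace 5 6 N S.∧ S.∃̇ λ M → S.IsIntersection M N 7 S.∧ S₁₆.OtpValue 0 8 ζ M) G) 10)
                (u ∷ H lam ∷ Hs ∷ S ∷ f ∷ U ∷ W ∷ ω₁ ∷ δ ∷ [])
              dKill : ∀ S Hs → RelDefn (λ ζ G → Kills (λ N → Trace S Hs N × OtpValue δ u ζ (N ∩ H lam)) G)
              dKill S Hs = record { Defn (dKill₀ S Hs)
                ; sound = λ z c → let (i , G , p , k) = Defn.sound (dKill₀ S Hs) z c
                                  in i , G , p , proj₁ k , proj₁ (proj₂ k) , λ N a cl (t , x) → proj₂ (proj₂ k) N a cl (t , N ∩ H lam , ∩-spec , x)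
                ; complete = λ z (i , G , p , k) → Defn.complete (dKill₀ S Hs) z
                    (i , G , p , proj₁ k , proj₁ (proj₂ k) , λ N a cl (t , M' , e , x) → proj₂ (proj₂ k) N a cl (t , subst (OtpValue δ u i) (∩-unique e) x)) }
              start : ∀ N → Adm N → In r N → ∃ λ ζ → ζ ∊ N × ζ ∊ ξ × OtpValue δ u ζ (N ∩ H lam)
              start N a i = let (v , w , m , o , e) = s N a i
                                (ζ , ζN , ζξ , o') = otp-members o e
                            in ζ , ζN , ζξ , v , val-at Su m , proj₂ (otp-trace ind (sub′ ζξ)) o'
              finish : (∃ λ ζ → ζ ∊ ξ × ∃ λ q → q ≼ r × Sure lam q (OtpValue δ u ζ)) → Res
              finish (ζ , m , q , k , su) = ζ , m , q , k , λ N a i → let (v , x , o) = su N a i in v , at-val Su x , proj₁ (otp-trace ind (sub′ m)) o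
            go : (∃ λ lam → Supp lam u × Supp lam (G ξ)) → (∃ λ lam → IsIndex δ lam × ξ ⊑ lam) → Res
            go (lam , Su , _) (lam' , ind , sub) = [ (λ s → at (raise ind s Su) sub) , (λ m → at Su (⊑-trans sub (proj₁ (ordIndex (Supp.index Su)) _ m))) ]′
              (ord-cases (ordIndex (Supp.index Su)) (ordIndex ind))

        open Ranks

        -- Łoś's theorem for ordinals and for injections into ω₁.

        module UltraOrdinals where
          Subset* : V → V → V → Set ℓ
          Subset* k g N = ∃ λ y → ∃ λ v → val k N y × val g N v × y ⊑ v

          Valued : (V → Set ℓ) → V → V → Set ℓ
          Valued X g N = ∃ λ v → val g N v × X v

          -- The common pattern of what follows: X says that a counterexample exists at N. If X held
          -- throughout a condition, chosen counterexamples would form a function contradicting the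
          -- hypothesis in the ultrapower, so densely often X fails.
          decided : ∀ {lam X Y p} → IsIndex δ lam → Defn X → (∀ r → r ≼ p → Sure* (λ N → X (N ∩ H lam)) r → ⊥ {ℓ}) →
                    (∀ r → r ≼ p → Sure* (λ N → ¬̇ X (N ∩ H lam)) r → D* Y r) → D* Y p
          decided {lam} {X} {Y} {p} ind d no′ yes′ = D-local {Y} λ q l → go q l (decide* {lam} {X} (le-dom l) ind d)
            where
            go : ∀ q → q ≼ p → Decides (λ N → X (N ∩ H lam)) q → ∃ λ r → r ≼ q × D* Y r
            go q l (r , k , inj₁ s) = ⊥-elim′ (no′ r (le-trans k l) s)
            go q l (r , k , inj₂ s) = r , k , yes′ r (le-trans k l) s

          subset→ : ∀ {k g p} → InUlt k p → InUlt g p → (k Ult.⊑ g) p → D* (Subset* k g) p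
          subset→ {k} {g} {p} uk ug h = go (common (inUlt-fn uk) (inUlt-fn ug))
            where
            go : (∃ λ lam → Supp lam k × Supp lam g) → D* (Subset* k g) p
            go (lam , Sk , Sg) = decided {lam} {λ M → ∃ λ z → Escapes k g M z} {Subset* k g} ind (def₂ k g (S.∃̇ λ z → S₁₆.Escapes 0 1 2 z)) no′ yes′
              where
              ind = Supp.index Sk
              B : V
              B = ⋃ (ran k)
              no′ : ∀ r → r ≼ p → Sure* (λ N → ∃ λ z → Escapes k g (N ∩ H lam) z) r → ⊥ {ℓ}
              no′ r l s = build (choose {lam} {r} {Escapes k g} B ind (def₂ k g (S₁.PairIn 2 (S₁₆.Escapes 0 1)))
                  (λ N a i → let (z , y , v , my , mv , zy , n) = s N a i in z , ⋃-i zy (ran-i my) , y , v , my , mv , zy , n)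
                  (def₃ k g B (S.∃̇ λ z → (z S.∊ 2) S.∧ S₁₆.Escapes 0 1 3 z)))
                where
                build : (∃ λ z → Choice lam r (Escapes k g) z) → ⊥ {ℓ}
                build (z , ch) = D-contra {Mem* z g} (le-dom l)
                    (∊-e fn (_ , Sg) (h z r l inUlt r (≼r l) (∊-i fn (_ , Sk) (sure→D {Mem* z k} λ N a i → member a (defined N a i)))))
                    λ N a i (x , v , mx , mv , e) → outside (correct a mx) mv e
                  where
                  open Choice ch
                  member : ∀ {N} → Adm N → Defined z N → Mem* z k N
                  member a (x , m) = let (y , v , my , mv , zy , n) = correct a m in x , y , m , at-val Sk my , zy
                  outside : ∀ {N x v} → Escapes k g (N ∩ H lam) x → val g N v → x ∊ v → ⊥ {ℓ}
                  outside {x = x} (y , v , my , mv , zy , n) m e = n (subst (x ∊_) (val-unique m (at-val Sg mv)) e)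
              yes′ : ∀ r → r ≼ p → Sure* (λ N → ¬̇ (∃ λ z → Escapes k g (N ∩ H lam) z)) r → D* (Subset* k g) r
              yes′ r l s = D-map₂ {Defined k} {Defined g} {Subset* k g}
                (λ N a i (y , my) (v , mv) → y , v , my , mv , λ z zy → dne λ n → s N a i (z , y , v , val-at Sk my , val-at Sg mv , zy , n))
                (D-≼ {Defined k} l (inUlt-def uk)) (D-≼ {Defined g} l (inUlt-def ug))

          transitive→ : ∀ {g p} → InUlt g p → Ult.Transitive g p → D* (Valued Transitive g) p
          transitive→ {g} {p} ug h = go (inUlt-fn ug)
            where
            go : Fn g → D* (Valued Transitive g) p
            go (lam , S) = decided {lam} {λ M → ∃ λ y → NonTransitive g M y} {Valued Transitive g} ind (def₁ g (S.∃̇ λ y → S₁₆.NonTransitive 0 1 y)) no′ yes′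
              where
              ind = Supp.index S
              B : V
              B = ⋃ (ran g)
              no′ : ∀ r → r ≼ p → Sure* (λ N → ∃ λ y → NonTransitive g (N ∩ H lam) y) r → ⊥ {ℓ}
              no′ r l s = build (choose {lam} {r} {NonTransitive g} B ind (def₁ g (S₁.PairIn 1 (S₁₆.NonTransitive 0)))
                  (λ N a i → let (y , v , mv , yv , x) = s N a i in y , ⋃-i yv (ran-i mv) , v , mv , yv , x)
                  (def₂ g B (S.∃̇ λ y → (y S.∊ 1) S.∧ S₁₆.NonTransitive 0 2 y)))
                where
                build : (∃ λ y → Choice lam r (NonTransitive g) y) → ⊥ {ℓ}
                build (k , ch) = D-contra {Subset* k g} (le-dom l)
                    (subset→ inUlt (inUlt-≼ l ug) (h k r l inUlt r (≼r l) (∊-i fn (_ , S) (sure→D {Mem* k g} λ N a i → member a (defined N a i)))))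
                    λ N a i (y , v , my , mv , s) → outside (correct a my) mv s
                  where
                  open Choice ch
                  member : ∀ {N} → Adm N → Defined k N → Mem* k g N
                  member a (y , m) = let (v , mv , yv , _) = correct a m in y , v , m , at-val S mv , yv
                  outside : ∀ {N y v} → NonTransitive g (N ∩ H lam) y → val g N v → y ⊑ v → ⊥ {ℓ}
                  outside (v , mv , yv , z , zy , n) m s = n (subst (z ∊_) (val-unique m (at-val S mv)) (s z zy))
              yes′ : ∀ r → r ≼ p → Sure* (λ N → ¬̇ (∃ λ y → NonTransitive g (N ∩ H lam) y)) r → D* (Valued Transitive g) r
              yes′ r l s = D-map {Defined g} {Valued Transitive g}
                (λ N a i (v , mv) → v , mv , λ y yv z zy → dne λ n → s N a i (y , v , val-at S mv , yv , z , zy , n))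
                (D-≼ {Defined g} l (inUlt-def ug))

          ordinal→ : ∀ {g p} → InUlt g p → Ult.Ordinal g p → D* (Valued Ordinal g) p
          ordinal→ {g} {p} ug (tr , h) = go (inUlt-fn ug)
            where
            go : Fn g → D* (Valued Ordinal g) p
            go (lam , S) = decided {lam} {λ M → ∃ λ y → NonTransitiveElement g M y} {Valued Ordinal g} ind (def₁ g (S.∃̇ λ y → S₁₆.NonTransitiveElement 0 1 y)) no′ yes′
              where
              ind = Supp.index S
              B : V
              B = ⋃ (ran g)
              no′ : ∀ r → r ≼ p → Sure* (λ N → ∃ λ y → NonTransitiveElement g (N ∩ H lam) y) r → ⊥ {ℓ}
              no′ r l s = build (choose {lam} {r} {NonTransitiveElement g} B ind (def₁ g (S₁.PairIn 1 (S₁₆.NonTransitiveElement 0)))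
                  (λ N a i → let (y , v , mv , yv , x) = s N a i in y , ⋃-i yv (ran-i mv) , v , mv , yv , x)
                  (def₂ g B (S.∃̇ λ y → (y S.∊ 1) S.∧ S₁₆.NonTransitiveElement 0 2 y)))
                where
                build : (∃ λ y → Choice lam r (NonTransitiveElement g) y) → ⊥ {ℓ}
                build (k , ch) = D-contra {Valued Transitive k} (le-dom l)
                    (transitive→ inUlt (h k r l inUlt r (≼r l) (∊-i fn (_ , S) (sure→D {Mem* k g} λ N a i → member a (defined N a i)))))
                    λ N a i (y , my , t) → outside t (correct a my)
                  where
                  open Choice ch
                  member : ∀ {N} → Adm N → Defined k N → Mem* k g N
                  member a (y , m) = let (v , mv , yv , _) = correct a m in y , v , m , at-val S mv , yv
                  outside : ∀ {N y} → Transitive y → NonTransitiveElement g (N ∩ H lam) y → ⊥ {ℓ}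
                  outside t (v , mv , yv , z , zy , w , wz , n) = n (t z zy w wz)
              yes′ : ∀ r → r ≼ p → Sure* (λ N → ¬̇ (∃ λ y → NonTransitiveElement g (N ∩ H lam) y)) r → D* (Valued Ordinal g) r
              yes′ r l s = D-map {Valued Transitive g} {Valued Ordinal g}
                (λ N a i (v , mv , t) → v , mv , t , λ y yv z zy w wz → dne λ n → s N a i (y , v , val-at S mv , yv , z , zy , w , wz , n))
                (D-≼ {Valued Transitive g} l (transitive→ ug tr))

          Injects : V → V → V → Set ℓ
          Injects g e N = ∃ λ x → ∃ λ v → val e N x × val g N v × IsFunction x v ω₁ × IsInjective x

          -- Łoś's theorem for the statement that e is an injection of g into ω₁, where [G ω₁] represents ω₁.
          module _ {g e r₀ : V} (ug : InUlt g r₀) (ue : InUlt e r₀) (s₀ : Sure* (Injects g e) r₀) where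
            private
              at : ∀ {q N} → q ≼ r₀ → Adm N → In q N → Injects g e N
              at l a i = s₀ _ a (in-mono l i)

              Pairs : V → V → V → Set ℓ
              Pairs x y N = ∃ λ a → ∃ λ b → val x N a × val y N b × ∃ λ i → ∃ λ v → val e N i × val g N v × IsFunction i v ω₁ × IsInjective i × i ∋⟨ a , b ⟩

              pairs→ : ∀ {x y q} → q ≼ r₀ → InUlt x q → InUlt y q → (e Ult.∋⟨ x , y ⟩) q → D* (Pairs x y) q
              pairs→ {x} {y} {q} l ux uy m = D-map {App* e x y} {Pairs x y} (λ N aN j → join (at l aN j)) (app→ (inUlt-≼ l ue) ux uy m)
                where
                join : ∀ {N} → Injects g e N → App* e x y N → Pairs x y N
                join (i , v , me , mv , fn , inj) (i' , a , b , me' , ma , mb , p) =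
                  a , b , ma , mb , i , v , me , mv , fn , inj , subst (λ i → i ∋⟨ a , b ⟩) (val-unique me' me) p

              value∈ω₁ : ∀ {x y q} → q ≼ r₀ → InUlt x q → InUlt y q → (e Ult.∋⟨ x , y ⟩) q → (y ∊ᵤ G ω₁) q
              value∈ω₁ {x} {y} l ux uy m = ∊-i (inUlt-fn uy) (G-fn ω₁∈δ) (D-map {Pairs x y} {Mem* y (G ω₁)}
                (λ N a j (x , y , mx , my , i , v , me , mv , fn , inj , p) → y , ω₁ , my , Gω₁ a , proj₂ fn _ _ p) (pairs→ l ux uy m))
                where
                Gω₁ : ∀ {N} → Adm N → val (G ω₁) N ω₁
                -- Since ω₁ ⊆ N, the order type of N ∩ ω₁ is ω₁ itself.
                Gω₁ {N} a = let (v , o) = otp-exists N ω₁∈δ in subst (val (G ω₁) N) (otp-identity (Adm.ω₁⊑ a) o) (proj₂ (G-val ω₁∈δ) o)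

              functional : ∀ {x y y' q} → q ≼ r₀ → InUlt x q → InUlt y q → InUlt y' q → (e Ult.∋⟨ x , y ⟩) q → (e Ult.∋⟨ x , y' ⟩) q → (y ≐ᵤ y') q
              functional {x} {y} {y'} l ux uy uy' m m' = ≐-i (inUlt-fn uy) (inUlt-fn uy') (D-map₂ {Pairs x y} {Pairs x y'} {Eq* y y'}
                (λ { N _ _ (a , b , ma , mb , i , v , me , mv , fn , inj , p) (a' , b' , ma' , mb' , i' , _ , me' , _ , _ , _ , p') →
                  b , mb , subst (val y' N) (proj₂ (proj₁ (proj₁ fn)) a b' b (subst (λ a → i ∋⟨ a , b' ⟩) (val-unique ma' ma) (subst (λ i → i ∋⟨ a' , b' ⟩) (val-unique me' me) p')) p) mb' })
                (pairs→ l ux uy m) (pairs→ l ux uy' m'))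

              injective : ∀ {x x' y q} → q ≼ r₀ → InUlt x q → InUlt x' q → InUlt y q → (e Ult.∋⟨ x , y ⟩) q → (e Ult.∋⟨ x' , y ⟩) q → (x ≐ᵤ x') q
              injective {x} {x'} {y} l ux ux' uy m m' = ≐-i (inUlt-fn ux) (inUlt-fn ux') (D-map₂ {Pairs x y} {Pairs x' y} {Eq* x x'}
                (λ { N _ _ (a , b , ma , mb , i , v , me , mv , fn , inj , p) (a' , b' , ma' , mb' , i' , _ , me' , _ , _ , _ , p') →
                  a , ma , subst (val x' N) (inj a' a b (subst (λ b → i ∋⟨ a' , b ⟩) (val-unique mb' mb) (subst (λ i → i ∋⟨ a' , b' ⟩) (val-unique me' me) p')) p) ma' })
                (pairs→ l ux uy m) (pairs→ l ux' uy m'))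

              -- At almost every N the value of z is a pair in the graph of an injection; its two
              -- coordinates are chosen as functions of N.
              decompose : ∀ {z q} → q ≼ r₀ → InUlt z q → (z ∊ᵤ e) q →
                ∃ λ r → r ≼ q × ∃ λ x → InUlt x r × ((x ∊ᵤ g) r × (Ult.∃̇ λ y → Ult.IsPair z x y) r)
              decompose {z} {q} l uz m = start (∊-e (inUlt-fn uz) (inUlt-fn ue) m q (≼r l)) (inUlt-fn uz)
                where
                Res : Set ℓ
                Res = ∃ λ r → r ≼ q × ∃ λ x → InUlt x r × ((x ∊ᵤ g) r × (Ult.∃̇ λ y → Ult.IsPair z x y) r)
                Split : V → Set ℓ
                Split N = ∃ λ a → ∃ λ b → ∃ λ v → val z N (pr a b) × val g N v × a ∊ v × b ∊ ω₁
                split : ∀ {N} → Mem* z e N → Injects g e N → Split N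
                split {N} (w , i , mw , mi , wi) (i' , v , me , mv , fn , _) = go (val-unique me mi) fn
                  where
                  go : i' ≡ i → IsFunction i' v ω₁ → Split N
                  go refl fn = let (a , av , b , p) = proj₁ (proj₁ (proj₁ fn)) w wi
                                   e = pr-unique p
                               in a , b , v , subst (val z N) e mw , mv , av , proj₂ fn a b (∋-i (subst (_∊ i) e wi))
                build : ∀ {r lam} → r ≼ q → Supp lam z → Sure* Split r → (∃ λ x → Choice lam r (FirstValue z) x) → (∃ λ y → Choice lam r (SecondValue z) y) → Res
                build {r} {lam} k S s (x , cx) (y , cy) = r , k , x , Choice.inUlt cx ,
                    ∊-i (Choice.fn cx) (inUlt-fn ug) (sure→D {Mem* x g} λ N a i → member a (s N a i) (Choice.defined cx N a i)) ,
                    λ q' l' → q' , ≼r l' , y , inUlt-≼ l' (Choice.inUlt cy) ,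
                      pair← (_ , S) (Choice.fn cx) (Choice.fn cy) (sure→D {Pair* z x y} (sure*-≼ {Pair* z x y} l' λ N a i → paired a (s N a i) (Choice.defined cx N a i) (Choice.defined cy N a i)))
                  where
                  first : ∀ {N a b x'} → Adm N → val z N (pr a b) → val x N x' → x' ≡ a
                  first a m mx = let (c , mc , b' , p) = Choice.correct cx a mx in proj₁ (pr-inj (trans (sym (pr-unique p)) (val-unique (at-val S mc) m)))
                  second : ∀ {N a b y'} → Adm N → val z N (pr a b) → val y N y' → y' ≡ b
                  second a m my = let (c , mc , a' , p) = Choice.correct cy a my in proj₂ (pr-inj (trans (sym (pr-unique p)) (val-unique (at-val S mc) m)))
                  member : ∀ {N} → Adm N → Split N → Defined x N → Mem* x g N
                  member aN (a , b , v , m , mv , av , _) (x' , mx) = x' , v , mx , mv , subst (_∊ v) (sym (first aN m mx)) av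
                  paired : ∀ {N} → Adm N → Split N → Defined x N → Defined y N → Pair* z x y N
                  paired {N} aN (a , b , v , m , _) (x' , mx) (y' , my) = pr a b , a , b , m , subst (val x N) (first aN m mx) mx , subst (val y N) (second aN m my) my , refl
                start : (∃ λ r → r ≼ q × Sure* (Mem* z e) r) → Fn z → Res
                start (r , k , s) (lam , S) = build k S s' (choose {lam} {r} {FirstValue z} (⋃ (ran g)) (Supp.index S) (def₁ z (S₁.PairIn 1 (S₁₆.FirstValue 0)))
                    (λ N a i → first (s' N a i)) (def₂ z (⋃ (ran g)) (S.∃̇ λ w → (w S.∊ 1) S.∧ S₁₆.FirstValue 0 2 w)))
                    (choose {lam} {r} {SecondValue z} ω₁ (Supp.index S) (def₁ z (S₁.PairIn 1 (S₁₆.SecondValue 0)))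
                    (λ N a i → second (s' N a i)) (def₂ z ω₁ (S.∃̇ λ w → (w S.∊ 1) S.∧ S₁₆.SecondValue 0 2 w)))
                  where
                  s' : Sure* Split r
                  s' N a i = split (s N a i) (at (le-trans k l) a i)
                  first : ∀ {N} → Split N → ∃ λ a → a ∊ ⋃ (ran g) × FirstValue z (N ∩ H lam) a
                  first (a , b , v , m , mv , av , _) = a , ⋃-i av (ran-i (proj₂ (proj₂ mv))) , pr a b , val-at S m , b , pr-spec
                  second : ∀ {N} → Split N → ∃ λ b → b ∊ ω₁ × SecondValue z (N ∩ H lam) b
                  second (a , b , v , m , mv , _ , bω) = b , bω , pr a b , val-at S m , a , pr-spec

              total : ∀ {x q} → q ≼ r₀ → InUlt x q → (x ∊ᵤ g) q → (Ult.∃̇ λ y → e Ult.∋⟨ x , y ⟩) q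
              total {x} {q} l ux m q' l' = start (∊-e (inUlt-fn ux) (inUlt-fn ug) m q' l') (common (inUlt-fn ue) (inUlt-fn ux))
                where
                Res : Set ℓ
                Res = ∃ λ r → r ≼ q' × ∃ λ y → InUlt y r × (e Ult.∋⟨ x , y ⟩) r
                start : (∃ λ r → r ≼ q' × Sure* (Mem* x g) r) → (∃ λ lam → Supp lam e × Supp lam x) → Res
                start (r , k , s) (lam , Se , Sx) = build (choose {lam} {r} {AppValue e x} ω₁ (Supp.index Se) (def₂ e x (S₁.PairIn 2 (S₁₆.AppValue 0 1)))
                    (λ N a i → value (at (le-trans k (le-trans l' l)) a i) (s N a i)) (def₃ e x ω₁ (S.∃̇ λ w → (w S.∊ 2) S.∧ S₁₆.AppValue 0 1 3 w)))
                  where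
                  value : ∀ {N} → Injects g e N → Mem* x g N → ∃ λ b → b ∊ ω₁ × AppValue e x (N ∩ H lam) b
                  value (i , v , me , mv , fn , _) (a , v' , ma , mv' , av) =
                    let (b , p) = proj₂ (proj₁ fn) a (subst (a ∊_) (val-unique mv' mv) av)
                    in b , proj₂ fn a b p , i , a , val-at Se me , val-at Sx ma , p
                  build : (∃ λ y → Choice lam r (AppValue e x) y) → Res
                  build (y , ch) = r , k , y , Choice.inUlt ch , app← (_ , Se) (_ , Sx) (Choice.fn ch) (sure→D {App* e x y} λ N a i → app a (Choice.defined ch N a i))
                    where
                    app : ∀ {N} → Adm N → Defined y N → App* e x y N
                    app a (b , m) = let (i , a' , mi , ma , p) = Choice.correct ch a m in i , a' , b , at-val Se mi , at-val Sx ma , m , p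

            isFunction : Ult.IsFunction e g (G ω₁) r₀
            isFunction =
              ( ( (λ z q l uz q' l' m q'' l'' → decompose (le-trans l'' (le-trans l' l)) (inUlt-≼ (le-trans l'' l') uz) (λ t n → m t (le-trans n l'')))
                , (λ x q l ux y q₁ l₁ uy y' q₂ l₂ uy' q₃ l₃ m q₄ l₄ m' →
                    functional (le-trans l₄ (le-trans l₃ (le-trans l₂ (le-trans l₁ l)))) (inUlt-≼ (le-trans l₄ (le-trans l₃ (le-trans l₂ l₁))) ux)
                      (inUlt-≼ (le-trans l₄ (le-trans l₃ l₂)) uy) (inUlt-≼ (le-trans l₄ l₃) uy') (λ t n → m t (le-trans n l₄)) m') )
              , (λ x q l ux q' l' m → total (le-trans l' l) (inUlt-≼ l' ux) m) )
              , (λ x q l ux y q₁ l₁ uy q₂ l₂ m → value∈ω₁ (le-trans l₂ (le-trans l₁ l)) (inUlt-≼ (le-trans l₂ l₁) ux) (inUlt-≼ l₂ uy) m)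

            isInjective : Ult.IsInjective e r₀
            isInjective x q l ux x' q₁ l₁ ux' y q₂ l₂ uy q₃ l₃ m q₄ l₄ m' =
              injective (le-trans l₄ (le-trans l₃ (le-trans l₂ (le-trans l₁ l)))) (inUlt-≼ (le-trans l₄ (le-trans l₃ (le-trans l₂ l₁))) ux)
                (inUlt-≼ (le-trans l₄ (le-trans l₃ l₂)) ux') (inUlt-≼ (le-trans l₄ l₃) uy) (λ t n → m t (le-trans n l₄)) m'

        open UltraOrdinals

        -- Partial collapses and the failure of the weak Chang property.

        module PartialCollapse {c p₀ : V} (pc : IsPartialCollapse c p₀) where
          Val : V → V → Forced
          Val g x = c Ext.∋⟨ ˇ g , x ⟩

          val-≼ : ∀ {g x p q} → q ≼ p → Val g x p → Val g x q
          val-≼ l h q' l' = h q' (le-trans l' l)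

          ∊ᵤ-≼ : ∀ {g k p q} → q ≼ p → (g ∊ᵤ k) p → (g ∊ᵤ k) q
          ∊ᵤ-≼ l h q' l' = h q' (le-trans l' l)

          val-cong : ∀ {g x y p} → IsName x → IsName y → p ⊩ x ≈ y → Val g x p → Val g y p
          val-cong {g} {p = p} nx ny e h = pn→∋ (ˇ-name g) ny (∈-congˡ (pn-cong (≈-refl (proj₁ (≈-names e)) (ˇ-name g)) e) (∋→pn (ˇ-name g) nx h))

          ElementsCollapse Values : V → V → V → Forced
          ElementsCollapse g ǧ x = Ult.∀̇ λ k → (k ∊ᵤ g) Ext.⇒ (Ult.∃̇ λ k' → (k' ≐ᵤ k) Ext.∧ (check k' λ ǩ' → Ext.∃̇ λ y → c Ext.∋⟨ ǩ' , y ⟩))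
          Values g ǧ x = Ext.∀̇ λ y → (y Ext.∊ x) Ext.⇔ (Ult.∃̇ λ k → (k ∊ᵤ g) Ext.∧ (check k λ ǩ → c Ext.∋⟨ ǩ , y ⟩))

          at : ∀ {g x q} → q ≼ p₀ → InUlt g q → IsName x → Val g x q → (ElementsCollapse g (ˇ g) x Ext.∧ Values g (ˇ g) x) q
          at {g} {x} {q} l u nx h =
            check→ {φ = λ ǧ → Ext.∀̇ λ x → c Ext.∋⟨ ǧ , x ⟩ Ext.⇒ (ElementsCollapse g ǧ x Ext.∧ Values g ǧ x)} (pc g q l u) x nx q (≼r l) h

          element-collapses : ∀ {g x k q} → q ≼ p₀ → InUlt g q → IsName x → Val g x q → InUlt k q → (k ∊ᵤ g) q →
            ∃ λ r → r ≼ q × ∃ λ k' → ∃ λ y → InUlt k' r × (k' ≐ᵤ k) r × IsName y × Val k' y r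
          element-collapses {g} {x} {k} {q} l u nx h uk m = go (proj₁ (at l u nx h) k q (≼r l) uk q (≼r l) m q (≼r l))
            where
            Res : Set ℓ
            Res = ∃ λ r → r ≼ q × ∃ λ k' → ∃ λ y → InUlt k' r × (k' ≐ᵤ k) r × IsName y × Val k' y r
            go₂ : ∀ {r k'} → r ≼ q → InUlt k' r → (k' ≐ᵤ k) r → (∃ λ r' → r' ≼ r × ∃ λ y → IsName y × Val k' y r') → Res
            go₂ n u' e (r' , n' , y , ny , v) = r' , le-trans n' n , _ , y , inUlt-≼ n' u' , (λ q' l' → e q' (le-trans l' n')) , ny , v
            go : (∃ λ r → r ≼ q × ∃ λ k' → InUlt k' r × ((k' ≐ᵤ k) r × check k' (λ ǩ' → Ext.∃̇ λ y → c Ext.∋⟨ ǩ' , y ⟩) r)) → Res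
            go (r , n , k' , u' , e , ch) = go₂ n u' e (check→ {φ = λ ǩ' → Ext.∃̇ λ y → c Ext.∋⟨ ǩ' , y ⟩} ch r (≼r n))

          value-attained : ∀ {g x y q} → q ≼ p₀ → InUlt g q → IsName x → Val g x q → IsName y → q ⊩ y ∈ x →
            ∃ λ r → r ≼ q × ∃ λ k → InUlt k r × (k ∊ᵤ g) r × Val k y r
          value-attained {g} {x} {y} {q} l u nx h ny m = go (proj₁ (proj₂ (at l u nx h) y ny) q (≼r l) m q (≼r l))
            where
            go : (∃ λ r → r ≼ q × ∃ λ k → InUlt k r × ((k ∊ᵤ g) r × check k (λ ǩ → c Ext.∋⟨ ǩ , y ⟩) r)) →
                 ∃ λ r → r ≼ q × ∃ λ k → InUlt k r × (k ∊ᵤ g) r × Val k y r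
            go (r , n , k , uk , m , ch) = r , n , k , uk , m , check→ {φ = λ ǩ → c Ext.∋⟨ ǩ , y ⟩} ch

          value-member : ∀ {g x k y q} → q ≼ p₀ → InUlt g q → IsName x → Val g x q → InUlt k q → (k ∊ᵤ g) q → IsName y → Val k y q → q ⊩ y ∈ x
          value-member {g} {x} {k} {y} {q} l u nx h uk m ny v = proj₂ (proj₂ (at l u nx h) y ny) q (≼r l) λ q' l' →
            q' , ≼r l' , k , inUlt-≼ l' uk , ∊ᵤ-≼ {k} {g} l' m , check← {φ = λ ǩ → c Ext.∋⟨ ǩ , y ⟩} (val-≼ {k} {y} l' v)

          -- The collapse need only be defined at some representative k' of [k]. Its value is forced
          -- into the check name of β, and a stronger condition decides it to be some γ < β.
          descend : ∀ {g β k q} → q ≼ p₀ → InUlt g q → Val g (ˇ β) q → InUlt k q → (k ∊ᵤ g) q →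
            ∃ λ r → r ≼ q × ∃ λ k' → ∃ λ γ → γ ∊ β × InUlt k' r × (k' ≐ᵤ k) r × Val k' (ˇ γ) r
          descend {g} {β} {k} {q} l u h uk m = go (element-collapses l u (ˇ-name β) h uk m)
            where
            Res : Set ℓ
            Res = ∃ λ r → r ≼ q × ∃ λ k' → ∃ λ γ → γ ∊ β × InUlt k' r × (k' ≐ᵤ k) r × Val k' (ˇ γ) r
            go₂ : ∀ {r k' y} → r ≼ q → InUlt k' r → (k' ≐ᵤ k) r → IsName y → Val k' y r → (∃ λ r' → r' ≼ r × ∃ λ γ → γ ∊ β × r' ⊩ y ≈ ˇ γ) → Res
            go₂ {k' = k'} n u' e ny v (r' , n' , γ , b , s) =
              r' , le-trans n' n , k' , γ , b , inUlt-≼ n' u' , (λ q' l' → e q' (le-trans l' n')) , val-cong ny (ˇ-name γ) s (val-≼ {k'} n' v)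
            go : (∃ λ r → r ≼ q × ∃ λ k' → ∃ λ y → InUlt k' r × (k' ≐ᵤ k) r × IsName y × Val k' y r) → Res
            go (r , n , k' , y , u' , e , ny , v) = go₂ n u' e ny v (∈ˇ-e (value-member (le-trans n l) (inUlt-≼ n u) (ˇ-name β) (val-≼ {g} n h) u' k'∊g ny v) r (≼r n))
              where
              k'∊g : (k' ∊ᵤ g) r
              k'∊g = ∊-i (inUlt-fn u') (inUlt-fn u) (D-map₂ {Eq* k' k} {Mem* k g} {Mem* k' g}
                (λ N _ _ (v , a , b) (v' , w , a' , b' , i) → v , w , a , b' , subst (_∊ w) (val-unique a' b) i)
                (≐-e (inUlt-fn u') (inUlt-fn uk) e) (D-≼ {Mem* k g} n (∊-e (inUlt-fn uk) (inUlt-fn u) m)))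

          ascend : ∀ {g β γ q} → q ≼ p₀ → InUlt g q → Val g (ˇ β) q → γ ∊ β → ∃ λ r → r ≼ q × ∃ λ k → InUlt k r × (k ∊ᵤ g) r × Val k (ˇ γ) r
          ascend {β = β} {γ} l u h m = value-attained l u (ˇ-name β) h (ˇ-name γ) (ˇ∈-i (le-dom l) m)

          -- Stated for every k that agrees with g_η on r, because `descend` and `regress` return
          -- other representatives than the ones they are given.
          Rank : V → Set ℓ
          Rank η = ∀ r k β → r ≼ p₀ → Fn k → Sure* (EqG k η) r → Val k (ˇ β) r → β ∊ δ → β ≡ η

          private
            supp→ : ∀ {lam g} → Supp lam g → Supported W (H lam) g
            supp→ S = (λ z m → let (x , v , a , e) = pairs m in x , a , v , subst (λ z → IsPair z x v) (sym e) pr-spec) , functional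
                    , λ x a y b e v m → local a b e m
              where
              open Supp S

            →supp : ∀ {lam Hl g} → IsIndex δ lam → IsH Hl lam → Supported W Hl g → Supp lam g
            →supp {lam} {Hl} {g} ind h s = go (H-unique ind h) s
              where
              go : ∀ {Hl} → Hl ≡ H lam → Supported W Hl g → Supp lam g
              go refl (ps , fn , loc) = record
                { index = ind ; pairs = λ m → let (x , a , v , p) = ps _ m in x , v , a , pr-unique p
                ; functional = fn ; local = λ a b e m → loc _ a _ b e _ m }

            valueOf→ : ∀ {g N v} → ValueOf δ W g N v → val g N v
            valueOf→ {g} {N} {v} (lam , Hl , ind , h , s , M' , t , m) =
              lam , →supp ind h s , subst (λ M → g ∋⟨ M , v ⟩) (trans (∩-unique t) (cong (N ∩_) (H-unique ind h))) m

            →valueOf : ∀ {g N v} → val g N v → ValueOf δ W g N v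
            →valueOf {N = N} (lam , S , m) = lam , H lam , Supp.index S , H-spec (Supp.index S) , supp→ S , N ∩ H lam , ∩-spec , m

            rank→ : ∀ {η} → RankUnique δ ω₁ W U f P Le p₀ c η → Rank η
            rank→ h r k β l (lam , S) s v b = h r k β l (lam , H lam , Supp.index S , H-spec (Supp.index S) , supp→ S)
              (λ N a i → let (w , x , o) = s N a (inN→ (le-dom l) i) in w , →valueOf x , o)
              (λ z τ p ch → ∈-elim (subst (r ⊩_∈ c) (trans (sym (trans (cong ˇ_ (pr-unique p)) (ˇ-pair k β))) (sym (ˇ-unique ch))) (∋→pn (ˇ-name k) (ˇ-name β) v))) b

            →rank : ∀ {η} → Rank η → RankUnique δ ω₁ W U f P Le p₀ c η
            →rank h r k β l (lam , Hl , ind , hH , s) e m b = h r k β l (lam , →supp ind hH s)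
              (λ N a i → let (w , x , o) = e N a (→inN i) in w , valueOf→ x , o)
              (pn→∋ (ˇ-name k) (ˇ-name β) (subst (r ⊩_∈ c) (ˇ-pair k β) (∈-from (m (pr k β) (ˇ pr k β) pr-spec (ˇ-spec (pr k β)))))) b

            abstract
              dRank : Defn (RankUnique δ ω₁ W U f P Le p₀ c)
              dRank = def (S₁₆.RankUnique 0 1 2 3 4 5 6 7 8 9 10) (c ∷ p₀ ∷ Le ∷ P ∷ f ∷ U ∷ W ∷ ω₁ ∷ δ ∷ [])

          inUlt-sure : ∀ {u ζ r} → Fn u → Sure* (EqG u ζ) r → InUlt u r
          inUlt-sure {u} fu s = inUlt-i fu (sure→D {Defined u} λ N a i → let (v , m , _) = s N a i in v , m)

          rank-unique : ∀ {η} → η ∊ δ → Rank η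
          rank-unique m = rank→ (foundation-ind δ {RankUnique δ ω₁ W U f P Le p₀ c} dRank (λ η d ih → →rank (step η d λ ζ a → rank→ (ih ζ a (ord-trans oδ a d)))) m)
            where
            -- If β < η, then [g_β] ∈ [k] collapses to some γ < β, against the hypothesis at β. If η
            -- < β, then η is the image of some [u] ∈ [k]; by normality [u] is some [g_ζ] with ζ <
            -- η, whose image is ζ by hypothesis.
            step : ∀ η → η ∊ δ → (∀ ζ → ζ ∊ η → Rank ζ) → Rank η
            step η d ih r k β l fk s v b = [ below , [ (λ e → e) , above ]′ ]′ (comparable (ord-elt oδ b) (ord-elt oδ d))
              where
              uk : InUlt k r
              uk = inUlt-sure fk s
              rP : r ∊ P
              rP = le-dom l
              below : β ∊ η → β ≡ η
              below m = go (descend l uk v (G-inUlt b) (∊-i (G-fn b) fk (D-map {λ N → β ∊ N} {Mem* (G β) k} (λ N a i n → gβ a i n (otp-exists N b)) (member* b))))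
                where
                gβ : ∀ {N} → Adm N → In r N → β ∊ N → (∃ λ x → Otp δ N β x) → Mem* (G β) k N
                gβ a i n (x , o) = let (w , y , o') = s _ a i in x , w , proj₂ (G-val b) o , y , otp-mono o' n m o
                go₂ : ∀ {r' k' γ} → r' ≼ r → InUlt k' r' → Val k' (ˇ γ) r' → γ ∊ β → (∃ λ r'' → r'' ≼ r' × Sure* (EqG k' β) r'') → β ≡ η
                go₂ {r'} {k'} {γ} n u' v' g (r'' , n' , s') =
                  ⊥-elim′ (∉-refl (subst (_∊ β) (ih β m r'' k' γ (le-trans n' (le-trans n l)) (inUlt-fn u') s' (val-≼ {k'} n' v') (ord-trans oδ g b)) g))
                go : (∃ λ r' → r' ≼ r × ∃ λ k' → ∃ λ γ → γ ∊ β × InUlt k' r' × (k' ≐ᵤ G β) r' × Val k' (ˇ γ) r') → β ≡ η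
                go (r' , n , k' , γ , g , u' , e , v') = go₂ n u' v' g (≐G→ (inUlt-fn u') b e r' (≼r n))
              above : η ∊ β → β ≡ η
              above m = go (ascend l uk v m)
                where
                go₃ : ∀ {r' u} → r' ≼ r → Fn u → Val u (ˇ η) r' → (∃ λ ζ → ζ ∊ η × ∃ λ r'' → r'' ≼ r' × Sure* (EqG u ζ) r'') → β ≡ η
                go₃ {r'} {u} n fu v' (ζ , z , r'' , n' , s') =
                  ⊥-elim′ (∉-refl (subst (_∊ η) (sym (ih ζ z r'' u η (le-trans n' (le-trans n l)) fu s' (val-≼ {u} n' v') d)) z))
                go₂ : ∀ {r' u} → r' ≼ r → InUlt u r' → Val u (ˇ η) r' → (∃ λ r'' → r'' ≼ r' × Sure* (Mem* u k) r'') → β ≡ η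
                go₂ {r'} {u} n uu v' (r'' , n' , s') = go₃ (le-trans n' n) (inUlt-fn uu) (val-≼ {u} n' v') (regress (inUlt-fn uu) d (le-dom n')
                  λ N a i → join (s' N a i) (s N a (in-mono (le-trans n' n) i)))
                  where
                  join : ∀ {N} → Mem* u k N → EqG k η N → ∃ λ v → ∃ λ w → val u N v × Otp δ N η w × v ∊ w
                  join (x , w , a , y , i) (w' , y' , o) = x , w' , a , o , subst (x ∊_) (val-unique y y') i
                go : (∃ λ r' → r' ≼ r × ∃ λ u → InUlt u r' × (u ∊ᵤ k) r' × Val u (ˇ η) r') → β ≡ η
                go (r' , n , u , uu , m' , v') = go₂ n uu v' (∊-e (inUlt-fn uu) fk m' r' (≼r n))

          module _ {κ : V} where
            -- [F] is not an element of [κ]: its rank γ would be the rank of [G γ] ∈ [F].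
            F∉κ : ∀ {q} → q ≼ p₀ → InUlt κ q → Val κ (ˇ δ) q → ¬̇ (F ∊ᵤ κ) q
            F∉κ {q} l uh vh m = go (descend l uh vh F-inUlt m)
              where
              go₃ : ∀ {r k γ γ'} → r ≼ p₀ → γ ∊ δ → γ' ∊ γ → InUlt k r → Val k (ˇ γ') r → (∃ λ r' → r' ≼ r × Sure* (EqG k γ) r') → ⊥ {ℓ}
              go₃ {k = k} {γ} {γ'} n d g uk v (r' , n' , s) =
                ∉-refl (subst (_∊ γ) (rank-unique d r' k γ' (le-trans n' n) (inUlt-fn uk) s (val-≼ {k} n' v) (ord-trans oδ g d)) g)
              go₂ : ∀ {r F' γ} → r ≼ p₀ → γ ∊ δ → InUlt F' r → (F' ≐ᵤ F) r → Val F' (ˇ γ) r → ⊥ {ℓ}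
              go₂ {r} {F'} {γ} n d uF e v = next (descend n uF v (G-inUlt d) (∊-i (G-fn d) (inUlt-fn uF)
                  (D-map₂ {λ N → γ ∊ N} {Eq* F' F} {Mem* (G γ) F'} (λ N a i k q → member k q (F-value a) (otp-exists N d)) (member* d) (≐-e (inUlt-fn uF) (_ , F-supp) e))))
                where
                member : ∀ {N} → γ ∊ N → Eq* F' F N → (∃ λ θ → θ ∊ ω₂ × val F N θ × (∀ {ξ v} → ξ ∊ δ → ξ ∊ N → Otp δ N ξ v → v ∊ θ)) → (∃ λ v → Otp δ N γ v) → Mem* (G γ) F' N
                member k (x , a , b) (θ , _ , t , bound) (v , o) = v , x , proj₂ (G-val d) o , a , subst (v ∊_) (val-unique t b) (bound d k o)
                next : (∃ λ r' → r' ≼ r × ∃ λ k → ∃ λ γ' → γ' ∊ γ × InUlt k r' × (k ≐ᵤ G γ) r' × Val k (ˇ γ') r') → ⊥ {ℓ}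
                next (r' , n' , k , γ' , g , uk , e' , v') = go₃ (le-trans n' n) d g uk v' (≐G→ (inUlt-fn uk) d e' r' (≼r n'))
              go : (∃ λ r → r ≼ q × ∃ λ F' → ∃ λ γ → γ ∊ δ × InUlt F' r × (F' ≐ᵤ F) r × Val F' (ˇ γ) r) → ⊥ {ℓ}
              go (r , n , F' , γ , d , uF , e , v) = go₂ (le-trans n l) d uF e v

            Below : V → Set ℓ
            Below N = ∃ λ v → val κ N v × Ordinal v × v ∊ ω₂

            below : ∀ {q} → q ≼ p₀ → InUlt κ q → Val κ (ˇ δ) q → Ult.Ordinal κ q → D* Below q
            below {q} l uh vh o = go (common (_ , F-supp) (inUlt-fn uh))
              where
              go : (∃ λ lam → Supp lam F × Supp lam κ) → D* Below q
              go (lam , SF , Sh) = decided {lam} {MemberValue F κ} {Below} (Supp.index SF) (def₂ F κ (S₁₅.MemberValue 0 1 2))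
                (λ r k s → F∉κ (le-trans k l) (inUlt-≼ k uh) (val-≼ {κ} k vh) (∊-i (_ , SF) (_ , Sh)
                  (sure→D {Mem* F κ} λ N a i → let (v , w , m , n , e) = s N a i in v , w , at-val SF m , at-val Sh n , e)))
                λ r k s → D-map {Valued Ordinal κ} {Below} (λ N a i (v , m , ov) → place (s N a i) (F-value a) m ov) (D-≼ {Valued Ordinal κ} k (ordinal→ uh o))
                where
                place : ∀ {N v} → ¬̇ MemberValue F κ (N ∩ H lam) → (∃ λ θ → θ ∊ ω₂ × val F N θ × (∀ {ξ v} → ξ ∊ δ → ξ ∊ N → Otp δ N ξ v → v ∊ θ)) → val κ N v → Ordinal v → Below N
                place {N} {v} n (θ , t , m , _) mv ov = v , mv , ov ,
                  [ (λ s → ⊑-∊-trans ov o₂ s t) , (λ e → ⊥-elim′ (n (θ , v , val-at SF m , val-at Sh mv , e))) ]′ (ord-cases ov (ord-elt o₂ t))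

            -- A collapse of [κ] below ω₁ gives ω₁ a rank below ω₁.
            κ⋢ω₁ : ∀ {q} → q ≼ p₀ → InUlt κ q → Val κ (ˇ δ) q → ¬̇ Sure* (λ N → ∃ λ v → val κ N v × v ⊑ ω₁) q
            κ⋢ω₁ {q} l uh vh s = go (ascend l uh vh ω₁∈δ)
              where
              go₃ : ∀ {r u} → r ≼ p₀ → InUlt u r → Val u (ˇ ω₁) r → (∃ λ ζ → ζ ∊ ω₁ × ∃ λ r' → r' ≼ r × Sure* (EqG u ζ) r') → ⊥ {ℓ}
              go₃ {u = u} n uu v (ζ , z , r' , n' , s') =
                ∉-refl (subst (_∊ ω₁) (sym (rank-unique (ord-trans oδ z ω₁∈δ) r' u ω₁ (le-trans n' n) (inUlt-fn uu) s' (val-≼ {u} n' v) ω₁∈δ)) z)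
              go₂ : ∀ {r u} → r ≼ q → InUlt u r → Val u (ˇ ω₁) r → (∃ λ r' → r' ≼ r × Sure* (Mem* u κ) r') → ⊥ {ℓ}
              go₂ {r} {u} n uu v (r' , n' , s') = go₃ (le-trans n' (le-trans n l)) (inUlt-≼ n' uu) (val-≼ {u} n' v)
                  (regress (inUlt-fn uu) ω₁∈δ (le-dom n') λ N a i → bounded a (s' N a i) (s N a (in-mono (le-trans n' n) i)) (otp-exists N ω₁∈δ))
                where
                bounded : ∀ {N} → Adm N → Mem* u κ N → (∃ λ v → val κ N v × v ⊑ ω₁) → (∃ λ w → Otp δ N ω₁ w) → ∃ λ v → ∃ λ w → val u N v × Otp δ N ω₁ w × v ∊ w
                bounded a (x , y , mx , my , e) (v , mv , sub) (w , o) =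
                  x , w , mx , o , subst (x ∊_) (sym (otp-identity (Adm.ω₁⊑ a) o)) (sub x (subst (x ∊_) (val-unique my mv) e))
              go : (∃ λ r → r ≼ q × ∃ λ u → InUlt u r × (u ∊ᵤ κ) r × Val u (ˇ ω₁) r) → ⊥ {ℓ}
              go (r , n , u , uu , m , v) = go₂ n uu v (∊-e (inUlt-fn uu) (inUlt-fn uh) m r (≼r n))

            -- From ω₁ ∈ κ(N) the class [g_ω₁] is an element of [κ]; this is the ordinal required by
            -- `SizeBelow`. The injection is chosen tracewise among injections of κ(N) < ω₂ into ω₁.
            small : ∀ {q} → InUlt κ q → Sure* Below q → Sure* (λ N → ∃ λ v → val κ N v × ω₁ ∊ v) q → Ult.SizeBelow κ κ q
            small {q} uh s big = go (inUlt-fn uh)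
              where
              go : Fn κ → Ult.SizeBelow κ κ q
              go (lam , Sh) = build (choose {lam} {q} {InjectionValue ω₁ κ} (𝒫 (ω₂ ⊗ ω₁)) (Supp.index Sh) (def₂ ω₁ κ (S₁.PairIn 2 (S₁₆.InjectionValue 0 1)))
                  (λ N a i → inj (s N a i)) (def₃ ω₁ κ (𝒫 (ω₂ ⊗ ω₁)) (S.∃̇ λ e → (e S.∊ 2) S.∧ S₁₆.InjectionValue 0 1 3 e)))
                where
                inj : ∀ {N} → Below N → ∃ λ e → e ∊ 𝒫 (ω₂ ⊗ ω₁) × InjectionValue ω₁ κ (N ∩ H lam) e
                inj (v , m , _ , b) = let (e , p , i) = SuccessorOf.below succ₂ b
                                      in e , 𝒫-i (λ z l → let (x , y , k , n , r) = ⊗-e (fun-⊑ p z l)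
                                                          in subst (_∊ ω₂ ⊗ ω₁) (sym r) (⊗-i (ord-trans o₂ k b) n)) , v , val-at Sh m , p , i
                build : (∃ λ e → Choice lam q (InjectionValue ω₁ κ) e) → Ult.SizeBelow κ κ q
                build (e , ch) q' l' = q' , ≼r l' , G ω₁ , G-inUlt ω₁∈δ ,
                    ∊-i (G-fn ω₁∈δ) (_ , Sh) (sure→D {Mem* (G ω₁) κ} λ N a i → member a (big N a (in-mono l' i)) (otp-exists N ω₁∈δ)) ,
                    λ q₁ l₁ → q₁ , ≼r l₁ , e , inUlt-≼ (le-trans l₁ l') (Choice.inUlt ch) , injection (le-trans l₁ l')
                  where
                  member : ∀ {N} → Adm N → (∃ λ v → val κ N v × ω₁ ∊ v) → (∃ λ w → Otp δ N ω₁ w) → Mem* (G ω₁) κ N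
                  member a (v , m , e) (w , o) = w , v , proj₂ (G-val ω₁∈δ) o , m , subst (_∊ v) (sym (otp-identity (Adm.ω₁⊑ a) o)) e
                  injects : Sure* (Injects κ e) q
                  injects N a i = read (Choice.defined ch N a i)
                    where
                    read : Defined e N → Injects κ e N
                    read (x , m) = let (v , mv , p , i) = Choice.correct ch a m in x , v , m , at-val Sh mv , p , i
                  injection : ∀ {r} → r ≼ q → (Ult.IsFunction e κ (G ω₁) Ext.∧ Ult.IsInjective e) r
                  injection k = isFunction (inUlt-≼ k uh) (inUlt-≼ k (Choice.inUlt ch)) (sure*-≼ {Injects κ e} k injects)
                              , isInjective (inUlt-≼ k uh) (inUlt-≼ k (Choice.inUlt ch)) (sure*-≼ {Injects κ e} k injects)

            contradiction : ∀ {q} → q ≼ p₀ → InUlt κ q → Val κ (ˇ δ) q → Ult.Ordinal κ q → (∀ r → r ≼ q → ¬̇ Ult.SizeBelow κ κ r) → ⊥ {ℓ}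
            contradiction {q} l uh vh o big = start (below l uh vh o q (≼r l)) (inUlt-fn uh)
              where
              cases : ∀ {r lam} → r ≼ q → Supp lam κ → Sure* Below r → Decides (λ N → ContainsValue ω₁ κ (N ∩ H lam)) r → ⊥ {ℓ}
              cases n S s (r' , n' , inj₁ t) = big r' (le-trans n' n) (small (inUlt-≼ (le-trans n' n) uh) (sure*-≼ {Below} n' s)
                λ N a i → let (v , m , e) = t N a i in v , at-val S m , e)
              cases n S s (r' , n' , inj₂ t) = κ⋢ω₁ (le-trans n' (le-trans n l)) (inUlt-≼ (le-trans n' n) uh) (val-≼ {κ} (le-trans n' n) vh)
                λ N a i → read (s N a (in-mono n' i)) (t N a i)
                where
                read : ∀ {N} → Below N → ¬̇ ContainsValue ω₁ κ (N ∩ H _) → ∃ λ v → val κ N v × v ⊑ ω₁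
                read (v , m , ov , _) n = v , m , [ (λ k → k) , (λ e → ⊥-elim′ (n (v , val-at S m , e))) ]′ (ord-cases ov o₁)
              start : (∃ λ r → r ≼ q × Sure* Below r) → Fn κ → ⊥ {ℓ}
              start (r , n , s) (lam , S) = cases n S s (decide* {lam} {ContainsValue ω₁ κ} (le-dom n) (Supp.index S) (def₂ ω₁ κ (S₁₆.ContainsValue 0 1 2)))

        weakChang-fails : ¬̇ (⊩ Ult.∃̇ λ κ → CollapsesTo κ δ Ext.∧ Ult.Regular κ)
        weakChang-fails w = start condition
          where
          collapsed : ∀ {r κ} → r ≼ r → InUlt κ r → CollapsesTo κ δ r → Ult.Regular κ r → ⊥ {ℓ}
          collapsed {r} {κ} rr uκ ch ((oκ , big) , _) = go (check→ {φ = Attained (ˇ κ)} (check→ {φ = λ ȟ → check δ (Attained ȟ)} ch) r rr)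
            where
            Attained : V → V → Forced
            Attained ȟ δ̌ = Ext.∃̇ λ c → IsPartialCollapse c Ext.∧ c Ext.∋⟨ ȟ , δ̌ ⟩
            go : (∃ λ r' → r' ≼ r × ∃ λ c → IsName c × (IsPartialCollapse c r' × (c Ext.∋⟨ ˇ κ , ˇ δ ⟩) r')) → ⊥ {ℓ}
            go (r' , n , c , nc , pc , v) = PartialCollapse.contradiction pc (≼r n) (inUlt-≼ n uκ) v
              ((λ k q l → proj₁ oκ k q (le-trans l n)) , λ k q l → proj₂ oκ k q (le-trans l n)) λ q l → big q (le-trans l n)
          start : (∃ λ p → p ∊ P) → ⊥ {ℓ}
          start (p , m) = go (w p m p (le-refl m))
            where
            go : (∃ λ r → r ≼ p × ∃ λ κ → InUlt κ r × (CollapsesTo κ δ r × Ult.Regular κ r)) → ⊥ {ℓ}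
            go (r , k , κ , uκ , ch , reg) = collapsed (≼r k) uκ ch reg

      boundingTower : ∃ λ 𝓘 → IsTower δ 𝓘 × (∃ λ ω₂ → Isω₂ ω₂ × HasCriticalPoint 𝓘 ω₂) × ¬ Presaturated δ 𝓘 × ¬ WeakChang δ 𝓘
      boundingTower = 𝓘 , isTower , (ω₂ , isω₂ , hasCriticalPoint) ,
          (λ pre → refute towerPoset λ {P} {Le} tp → Presat.regularity-fails tp (pre P Le tp)) ,
          (λ wc → refute towerPoset λ {P} {Le} tp → weakChang-fails tp (wc P Le tp))
        where
        -- Both properties quantify over all representations of the tower forcing as a set, so
        -- refuting them requires one to exist.
        refute : (∃ λ P → ∃ λ Le → IsTowerPoset 𝓘 P Le) → (∀ {P Le} → IsTowerPoset 𝓘 P Le → ⊥ {ℓ}) → _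
        refute (P , Le , tp) k = lower (k tp)

    nonpresaturatedTower : ∃ λ 𝓘 → IsTower δ 𝓘 × (∃ λ ω₂ → Isω₂ ω₂ × HasCriticalPoint 𝓘 ω₂) × ¬ Presaturated δ 𝓘 × ¬ WeakChang δ 𝓘
    nonpresaturatedTower = let (_ , _ , _ , bf) = boundingFunction in boundingTower bf

theorem2 : ∀ {ℓ} → ExcludedMiddle ℓ → (M : ZFCModel ℓ) →
    let open SetTheory M in
    (PFA⁺ ⊎ MM) → ∀ δ → Inaccessible δ →
    ∃ λ 𝓘 → IsTower δ 𝓘 ×
    (∃ λ ω₂ → Isω₂ ω₂ × HasCriticalPoint 𝓘 ω₂) ×
    ¬ Presaturated δ 𝓘 ×
    ¬ WeakChang δ 𝓘
theorem2 em M _ δ inaccessible = nonpresaturatedTower em M (Levels.frame em M inaccessible)
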